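{- Let $\ell\geq4$ be an even integer and let $r,m$ be integers with $2\leq r\leq \ell-2$ and $m\geq\ell+1$. Let $\mathcal{F}=\{F_1,F_2,F_3\}$, where $F_1=(P_\ell\cup\overline{K_m})\bigotimes T(m(r-1),r-1)$, $F_2=(K_{1,2}\cup mK_2)\bigotimes mK_2\bigotimes T(m(r-2),r-2)$, $F_3=(K_{\ell/2}\cup K_{\ell-1}\cup\overline{K_m})\bigotimes T(m(r-1),r-1)$. Then for sufficiently large $n$: (i) if $2\leq r\leq\ell-3$, then ${\rm EX}(n,\mathcal{F})=\{K_{\frac{\ell-2}{2}}\bigotimes T(n-\frac{\ell-2}{2},r)\}$; (ii) if $2\leq r=\ell-2$, then ${\rm EX}(n,\mathcal{F})\subseteq\{K_{\frac{r}{2}}\bigotimes T(n-\frac{r}{2},r)\}\cup\mathcal{G}_{n,r}$.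
   Context: All graphs are finite and simple; $\mathcal{F}$-free means containing no member of $\mathcal{F}$ as a subgraph, and ${\rm EX}(n,\mathcal{F})$ is the set of $\mathcal{F}$-free $n$-vertex graphs with maximum number of edges (graphs considered up to isomorphism). $\cup$ is disjoint union, $tH$ is $t$ disjoint copies of $H$, $\bigotimes$ is the join (disjoint union plus all edges between different factors). $P_\ell$ is the path on $\ell$ vertices, $K_s$ the complete graph, $\overline{K_m}$ the edgeless graph on $m$ vertices, $K_{1,2}$ the path with 3 vertices. $T(n,r)$ is the Turán graph (complete $r$-partite graph on $n$ vertices with parts of sizes $\lfloor n/r\rfloor$ or $\lceil n/r\rceil$), $T(n,1)=\overline{K_n}$, and $T(n,0)$ is the empty graph. For integers $n_1,\dots,n_r$ with $\sum n_i=n$ and $|n_i-n_j|\leq2$ for all $i,j$, $K^{+}_{n_1,\dots,n_r}$ is the graph obtained from the complete $r$-partite graph $K_{n_1,\dots,n_r}$ by adding a perfect matching (or a near perfect matching if the part has odd size) inside each of its $r$ parts; $\mathcal{G}_{n,r}$ is the set of all such graphs. -}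

module Defs where

open import Data.Bool using (Bool; true; false; _∧_; _∨_; not)
open import Data.Bool.Properties using (∨-comm)
open import Data.Nat using (ℕ; zero; suc; _+_; _*_; _∸_; _≤_; _≡ᵇ_; _<ᵇ_)
open import Data.Nat.DivMod using (_/_; _%_)
open import Data.Fin using (Fin; toℕ; splitAt; _≟_)
open import Data.Sum using (_⊎_; inj₁; inj₂)
open import Data.Product using (Σ; _×_; _,_; proj₁; proj₂)
open import Data.List using (List; []; _∷_; length; map; allFin)
open import Data.Nat.ListAction using (sum)
open import Data.List.Membership.Propositional using (_∈_)
open import Data.List.Relation.Unary.All using (All)
open import Relation.Nullary using (¬_; yes; no)
open import Relation.Nullary.Decidable using (⌊_⌋)
open import Relation.Binary.PropositionalEquality using (_≡_; refl; sym; cong₂)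
open import Data.Empty using (⊥-elim)

record Graph (n : ℕ) : Set where
  field
    adj     : Fin n → Fin n → Bool
    adj-sym : ∀ i j → adj i j ≡ adj j i
    adj-irr : ∀ i → adj i i ≡ false
open Graph public

private
  neq : ∀ {n} → Fin n → Fin n → Bool
  neq i j = not ⌊ i ≟ j ⌋

  neq-sym : ∀ {n} (i j : Fin n) → neq i j ≡ neq j i
  neq-sym i j with i ≟ j | j ≟ i
  ... | yes _ | yes _ = refl
  ... | no _  | no _  = refl
  ... | yes p | no q  = ⊥-elim (q (sym p))
  ... | no p  | yes q = ⊥-elim (p (sym q))

  neq-irr : ∀ {n} (i : Fin n) → neq i i ≡ false
  neq-irr i with i ≟ i
  ... | yes _ = refl
  ... | no p  = ⊥-elim (p refl)

fromRel : ∀ {n} → (Fin n → Fin n → Bool) → Graph n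
adj (fromRel R) i j = neq i j ∧ (R i j ∨ R j i)
adj-sym (fromRel R) i j = cong₂ _∧_ (neq-sym i j) (∨-comm (R i j) (R j i))
adj-irr (fromRel R) i rewrite neq-irr i = refl

edgeCount : ∀ {n} → Graph n → ℕ
edgeCount {n} G =
  sum (map (λ i → sum (map (λ j → indicator (adj G i j ∧ (toℕ i <ᵇ toℕ j))) (allFin n))) (allFin n))
  where
  indicator : Bool → ℕ
  indicator true  = 1
  indicator false = 0

edgeless : (m : ℕ) → Graph m
edgeless m = fromRel (λ _ _ → false)

complete : (s : ℕ) → Graph s
complete s = fromRel (λ _ _ → true)

path : (ℓ : ℕ) → Graph ℓ
path ℓ = fromRel (λ i j → toℕ j ≡ᵇ suc (toℕ i))

private
  blockRel : ∀ {a b} → Bool → (Fin a → Fin a → Bool) → (Fin b → Fin b → Bool)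
           → Fin (a + b) → Fin (a + b) → Bool
  blockRel {a} c R S x y with splitAt a x | splitAt a y
  ... | inj₁ u | inj₁ v = R u v
  ... | inj₂ u | inj₂ v = S u v
  ... | inj₁ _ | inj₂ _ = c
  ... | inj₂ _ | inj₁ _ = c

_∪ᴳ_ : ∀ {a b} → Graph a → Graph b → Graph (a + b)
G ∪ᴳ H = fromRel (blockRel false (adj G) (adj H))

_⊗ᴳ_ : ∀ {a b} → Graph a → Graph b → Graph (a + b)
G ⊗ᴳ H = fromRel (blockRel true (adj G) (adj H))

infixr 6 _⊗ᴳ_
infixr 7 _∪ᴳ_

copies : ∀ {k} (t : ℕ) → Graph k → Graph (t * k)
copies zero    H = edgeless 0
copies (suc t) H = H ∪ᴳ copies t H

-- Turán graph T(n,r): vertex i lies in part (i mod r); T(n,0) is edgeless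
-- (it is only used with n = 0, i.e. the empty graph)
turan : (n r : ℕ) → Graph n
turan n zero    = edgeless n
turan n (suc k) = fromRel (λ i j → not (toℕ i % suc k ≡ᵇ toℕ j % suc k))

matchingOn : (s : ℕ) → Graph s
matchingOn s = fromRel (λ i j → toℕ i / 2 ≡ᵇ toℕ j / 2)

Kplus : (ss : List ℕ) → Graph (sum ss)
Kplus []       = edgeless 0
Kplus (s ∷ ss) = matchingOn s ⊗ᴳ Kplus ss

record _≅_ {a b : ℕ} (G : Graph a) (H : Graph b) : Set where
  field
    to        : Fin a → Fin b
    from      : Fin b → Fin a
    from-to   : ∀ x → from (to x) ≡ x
    to-from   : ∀ y → to (from y) ≡ y
    preserves : ∀ x y → adj H (to x) (to y) ≡ adj G x y

_⊆ᴳ_ : ∀ {k n} → Graph k → Graph n → Set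
_⊆ᴳ_ {k} {n} F G =
  Σ (Fin k → Fin n) λ f →
    (∀ x y → f x ≡ f y → x ≡ y) ×
    (∀ u v → adj F u v ≡ true → adj G (f u) (f v) ≡ true)

Family : Set
Family = List (Σ ℕ Graph)

Free : ∀ {n} → Family → Graph n → Set
Free 𝓕 G = All (λ F → ¬ (proj₂ F ⊆ᴳ G)) 𝓕

IsExtremal : ∀ {n} → Family → Graph n → Set
IsExtremal {n} 𝓕 G = Free 𝓕 G × ((H : Graph n) → Free 𝓕 H → edgeCount H ≤ edgeCount G)

InGnr : ∀ {n} → (r : ℕ) → Graph n → Set
InGnr {n} r G =
  Σ (List ℕ) λ ss →
    length ss ≡ r × sum ss ≡ n ×
    (∀ {x y} → x ∈ ss → y ∈ ss → x ≤ y + 2) ×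
    (G ≅ Kplus ss)

F₁ : (ℓ r m : ℕ) → Σ ℕ Graph
F₁ ℓ r m = _ , ((path ℓ ∪ᴳ edgeless m) ⊗ᴳ turan (m * (r ∸ 1)) (r ∸ 1))

F₂ : (ℓ r m : ℕ) → Σ ℕ Graph
F₂ ℓ r m = _ , ((path 3 ∪ᴳ copies m (complete 2)) ⊗ᴳ copies m (complete 2)
                 ⊗ᴳ turan (m * (r ∸ 2)) (r ∸ 2))

F₃ : (ℓ r m : ℕ) → Σ ℕ Graph
F₃ ℓ r m = _ , ((complete (ℓ / 2) ∪ᴳ complete (ℓ ∸ 1) ∪ᴳ edgeless m)
                 ⊗ᴳ turan (m * (r ∸ 1)) (r ∸ 1))

forbidden : (ℓ r m : ℕ) → Family
forbidden ℓ r m = F₁ ℓ r m ∷ F₂ ℓ r m ∷ F₃ ℓ r m ∷ []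

cliqueJoinTuran : (a n r : ℕ) → Graph (a + (n ∸ a))
cliqueJoinTuran a n r = complete a ⊗ᴳ turan (n ∸ a) r

{-# OPTIONS --safe #-}
module Submission where

open import Defs
open import Data.Bool using (Bool; true; false; _∧_; _∨_; not; if_then_else_)
open import Data.Bool.Properties using () renaming (_≟_ to _≟ᵇ_)
open import Data.Nat using (ℕ; zero; suc; _+_; _*_; _∸_; _^_; _≤_; _<_; z≤n; s≤s; _≡ᵇ_; _<ᵇ_; _⊔_; NonZero; _≤?_; _<?_; s≤s⁻¹) renaming (_≟_ to _≟ℕ_)
open import Data.Nat.Base using (>-nonZero)
open import Data.Nat.Properties hiding (suc-injective; _≟_; _≤?_; _<?_)
open import Data.Nat.DivMod
open import Data.Nat.Tactic.RingSolver using (solve-∀)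
open import Data.Nat.Induction using (<-rec)
open import Data.Fin using (Fin; zero; suc; toℕ; fromℕ<; punchIn; punchOut; splitAt; join; _↑ˡ_; _↑ʳ_; combine; remQuot; inject≤; cast) renaming (_≟_ to _≟ᶠ_)
open import Data.Fin.Properties using (any?; all?; pigeonhole; injective⇒≤; suc-injective; toℕ-injective; toℕ<n; toℕ-fromℕ<; punchInᵢ≢i; punchIn-injective; punchOut-injective; punchIn-punchOut; combine-remQuot; remQuot-combine; inject≤-injective; toℕ-cast; toℕ-inject≤; splitAt-↑ˡ; splitAt-↑ʳ; join-splitAt; toℕ-↑ʳ; ↑ˡ-injective; ↑ʳ-injective; fromℕ<-injective; toℕ-combine; splitAt⁻¹-↑ˡ; splitAt⁻¹-↑ʳ)
open import Data.Product using (Σ; ∃; _×_; _,_) renaming (proj₁ to fst; proj₂ to snd)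
open import Data.Sum using (_⊎_; [_,_]′) renaming (inj₁ to inl; inj₂ to inr)
open import Data.Maybe using (Maybe; just; nothing)
open import Data.Maybe.Properties using (just-injective)
open import Data.Empty using (⊥; ⊥-elim)
open import Data.Unit using (⊤; tt)
open import Data.List using (List; []; _∷_; _++_; length; map; concat; reverse; take; lookup; tabulate; allFin; filter)
open import Data.List.Properties using (length-++; length-map; length-tabulate; length-reverse; ++-assoc; ++-identityʳ; unfold-reverse)
open import Data.List.Membership.Propositional using (_∈_; _∉_; find; lose)
open import Data.List.Membership.Propositional.Properties using (∈-++⁺ˡ; ∈-++⁺ʳ; ∈-++⁻; ∈-map⁺; ∈-map⁻; ∈-concat⁺′; ∈-concat⁻′; ∈-lookup; ∈-allFin; ∈-tabulate⁻; ∈-tabulate⁺; ∈-∃++; ∈-filter⁺; ∈-filter⁻)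
open import Data.List.Relation.Unary.Any using (here; there)
open import Data.List.Relation.Unary.All using (All; []; _∷_)
open import Data.List.Relation.Unary.AllPairs using ([]; _∷_)
open import Data.List.Relation.Unary.Unique.Propositional using (Unique)
open import Relation.Nullary using (¬_; Dec; yes; no; does)
open import Relation.Nullary.Decidable using (¬?; _×-dec_; _⊎-dec_; _→-dec_; dec-true; dec-false; ⌊_⌋; isYes≗does)
open import Relation.Binary.PropositionalEquality using (_≡_; _≢_; refl; sym; trans; cong; cong₂; subst; subst₂)
open import Function using (_∘_; id; case_of_)
import Algebra.Properties.CommutativeMonoid.Sum +-0-commutativeMonoid as Sum
import Algebra.Properties.Semiring.Sum +-*-semiring as SemiringSum
open import Data.List.Relation.Binary.Permutation.Propositional using (_↭_; ↭-trans; ↭-sym; ↭-refl; ↭⇒↭ₛ; ↭-prep)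
import Data.List.Relation.Binary.Permutation.Propositional.Properties as Perm
import Data.List.Relation.Binary.Permutation.Setoid.Properties as PermS
import Data.List.Membership.DecPropositional as DecMem
import Data.List.Relation.Unary.All as All
import Relation.Binary.PropositionalEquality as ≡
import Data.Bool as Booleans
import Data.List.Relation.Unary.Unique.Propositional.Properties as Uniqueₚ
import Data.List.Relation.Unary.Any as Any
open import Data.List.Relation.Unary.Any.Properties using (lookup-index)
import Data.List.Relation.Binary.Permutation.Propositional as ↭
import Data.List.Relation.Unary.All.Properties as Allₚ
import Data.List.Relation.Unary.AllPairs.Properties as AllPairsₚ
open import Data.Nat.Divisibility using (divides)
open import Data.Nat.ListAction using (sum)
open import Data.Fin.Subset using (Subset)
open import Data.Fin.Subset.Properties using (anySubset?)
import Data.Vec as Vec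
import Data.Vec.Properties as Vecₚ

-- Write `ℓ = 2 + 2 * q` and `r = 2 + ρ`, and count every edge twice. There are two candidates: `q`
-- dominating vertices (apexes) joined to a balanced complete `r`-partite graph, and a nearly
-- balanced complete `r`-partite graph with a maximum matching in each part. Adding `2 * u` vertices
-- to each part raises the first count by a common quadratic term plus `2 * q * (2 * u)`, the second
-- by the same term plus `r * (2 * u)`. As `r ≤ 2 * q`, the second competes only when `r = 2 * q`.
-- The benchmark `h n` is the better of the competing counts.
--
-- Reduction to robust graphs. A graph is `Robust` if deleting a bounded vertex set never increases
-- its surplus over `h`. A graph that is not robust passes to a smaller one with larger surplus. The
-- surplus grows by at least one for boundedly many lost vertices, and it cannot exceed the square
-- of the order. So, starting from a huge graph with positive surplus, the descent would have to
-- stop at a robust graph that is still large and still has positive surplus. It remains to treat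
-- large robust graphs. Deleting one vertex from such a graph gives minimum degree about
-- `(1 - 1/r) n`; deleting `r * (2 * u)` vertices gives the sharp weighted inequality `Deletion`.
--
-- Rough structure. The minimum degree produces `r` large, mutually joined rows. A vertex that
-- misses few cells of every row but one is put into the class of that row. Without `F₁` a class has
-- no path on `ℓ` vertices, so Erdős-Gallai makes it sparse, and repeatedly rechoosing the rows
-- among vertices of low inner degree leaves only boundedly many vertices unclassified.
--
-- Symmetric copies. A depth-first forest of a class has bounded height, so many bounded pieces hang
-- off a bounded separator. By pigeonhole many of them are copies of one graph, attached in the same
-- way to a bounded set `Z`, and copies from different classes can be taken completely joined. This
-- is `Config`.
--
-- Dichotomy. If at most one class has edges in its copies, `Deletion` is applied to two copies of a
-- set closed under adjacency. Without vertices of `Z` attached to the copy and to all other rows,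
-- Erdős-Gallai would be tight, giving two disjoint cliques on `ℓ - 1` vertices and hence `F₃`.
-- Otherwise `F₁` forbids long alternating walks through such vertices, and a count along a
-- depth-first tree finds `q` vertices joined to a whole complete `r`-partite graph. If at least two
-- classes have edges, excluding `F₂` leaves copies of maximum degree one, and `Deletion` shows that
-- at least `2 * q` classes have an edge; hence `r = 2 * q` and every class does.
--
-- Endgames. Applied to the structure just found, `Deletion` holds with equality, so every vertex of
-- `G` is attached exactly as in the corresponding construction and the whole vertex set is
-- partitioned. Counting edges, with tangent-line inequalities for the class sizes, gives the bound
-- `h n`. In case of equality the sizes are balanced, and the equality case of Erdős-Gallai together
-- with `F₃` (or excluding `F₂`) controls the edges inside the classes. A spanning injection into
-- the construction is then an isomorphism, because the edge numbers agree.

infixr 6 _∙_ _&_ _=&_ _&=_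

_∙_ : ∀ {A : Set} {x y z : A} → x ≡ y → y ≡ z → x ≡ z
_∙_ = trans

_&_ : ∀ {x y z : ℕ} → x ≤ y → y ≤ z → x ≤ z
_&_ = ≤-trans

_=&_ : ∀ {x y z : ℕ} → x ≡ y → y ≤ z → x ≤ z
e =& p = ≤-trans (≤-reflexive e) p

_&=_ : ∀ {x y z : ℕ} → x ≤ y → y ≡ z → x ≤ z
p &= e = ≤-trans p (≤-reflexive e)

-- Linear arithmetic by certificate: `s ≤ t` is the sum of the hypotheses with their multipliers,
-- `k` is the slack, and the remaining identity is left to the ring solver.
lin : ∀ {x y s t} k → s ≤ t → x + t + k ≡ y + s → x ≤ y
lin {x} {y} {s} {t} k s≤t eq =
  +-cancelʳ-≤ t x y ((m≤m+n (x + t) k &= eq) & +-monoʳ-≤ y s≤t)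

𝟙 : Bool → ℕ
𝟙 true  = 1
𝟙 false = 0

𝟙≤1 : ∀ b → 𝟙 b ≤ 1
𝟙≤1 true  = ≤-refl
𝟙≤1 false = z≤n

bool : (b : Bool) → b ≡ true ⊎ b ≡ false
bool true  = inl refl
bool false = inr refl

true≢false : ∀ {b : Bool} → b ≡ true → b ≡ false → ⊥
true≢false refl ()

¬true⇒false : ∀ {b : Bool} → ¬ b ≡ true → b ≡ false
¬true⇒false {true}  h = ⊥-elim (h refl)
¬true⇒false {false} h = refl

∧-intro : ∀ {a b : Bool} → a ≡ true → b ≡ true → a ∧ b ≡ true
∧-intro refl refl = refl

∧-elimˡ : ∀ {a b : Bool} → a ∧ b ≡ true → a ≡ true
∧-elimˡ {true} _ = refl

∧-elimʳ : ∀ {a b : Bool} → a ∧ b ≡ true → b ≡ true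
∧-elimʳ {true} h = h

∨-elim : ∀ {a b : Bool} → a ∨ b ≡ true → a ≡ true ⊎ b ≡ true
∨-elim {true}  _ = inl refl
∨-elim {false} h = inr h

∨-introˡ : ∀ {a b : Bool} → a ≡ true → a ∨ b ≡ true
∨-introˡ refl = refl

∨-introʳ : ∀ {a b : Bool} → b ≡ true → a ∨ b ≡ true
∨-introʳ {true}  _ = refl
∨-introʳ {false} h = h

not-true : ∀ {b : Bool} → not b ≡ true → b ≡ false
not-true {false} _ = refl

not-false : ∀ {b : Bool} → b ≡ false → not b ≡ true
not-false refl = refl

from-does : ∀ {a} {A : Set a} (d : Dec A) → does d ≡ true → A
from-does (yes a) _ = a

from-¬does : ∀ {a} {A : Set a} (d : Dec A) → does d ≡ false → ¬ A
from-¬does (no ¬a) _ = ¬a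

-- Finite sums and counting of vertex sets.

opaque
  ∑ : ∀ {n} → (Fin n → ℕ) → ℕ
  ∑ = Sum.sum

  ∑-empty : (f : Fin 0 → ℕ) → ∑ f ≡ 0
  ∑-empty f = refl

  ∑-suc : ∀ {n} (f : Fin (suc n) → ℕ) → ∑ f ≡ f zero + ∑ (λ i → f (suc i))
  ∑-suc f = refl

  ∑-cong : ∀ {n} {f g : Fin n → ℕ} → (∀ i → f i ≡ g i) → ∑ f ≡ ∑ g
  ∑-cong h = Sum.sum-cong-≗ h

  ∑-distrib-+ : ∀ {n} (f g : Fin n → ℕ) → ∑ (λ i → f i + g i) ≡ ∑ f + ∑ g
  ∑-distrib-+ = Sum.∑-distrib-+

  ∑-const : ∀ n c → ∑ {n} (λ _ → c) ≡ n * c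
  ∑-const zero    c = refl
  ∑-const (suc n) c = cong (c +_) (∑-const n c)

  ∑-comm : ∀ {m n} (f : Fin m → Fin n → ℕ) → ∑ (λ i → ∑ (f i)) ≡ ∑ (λ j → ∑ (λ i → f i j))
  ∑-comm = Sum.∑-comm

  ∑-*ˡ : ∀ {n} c (f : Fin n → ℕ) → ∑ (λ i → c * f i) ≡ c * ∑ f
  ∑-*ˡ c f = sym (SemiringSum.*-distribˡ-sum c f)

  ∑-mono : ∀ {n} {f g : Fin n → ℕ} → (∀ i → f i ≤ g i) → ∑ f ≤ ∑ g
  ∑-mono {zero}  h = z≤n
  ∑-mono {suc n} h = +-mono-≤ (h zero) (∑-mono λ i → h (suc i))

opaque
  set : ∀ {A : Set} {P : A → Set} → (∀ v → Dec (P v)) → A → Bool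
  set P? v = does (P? v)

  set⁻ : ∀ {A : Set} {P : A → Set} (P? : ∀ v → Dec (P v)) {v} → set P? v ≡ true → P v
  set⁻ P? {v} = from-does (P? v)

  set⁺ : ∀ {A : Set} {P : A → Set} (P? : ∀ v → Dec (P v)) {v} → P v → set P? v ≡ true
  set⁺ P? {v} p = dec-true (P? v) p

  set-false : ∀ {A : Set} {P : A → Set} (P? : ∀ v → Dec (P v)) {v} → set P? v ≡ false → ¬ P v
  set-false P? {v} = from-¬does (P? v)

infixr 6 _∩_
_∩_ : ∀ {A : Set} → (A → Bool) → (A → Bool) → A → Bool
(P ∩ Q) v = P v ∧ Q v

∁ : ∀ {A : Set} → (A → Bool) → A → Bool
∁ P v = not (P v)

full : ∀ {A : Set} → A → Bool
full _ = true

opaque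
  # : ∀ {n} → (Fin n → Bool) → ℕ
  # P = ∑ (λ v → 𝟙 (P v))

  #-∑ : ∀ {n} (P : Fin n → Bool) → # P ≡ ∑ (λ v → 𝟙 (P v))
  #-∑ P = refl

record Many {A : Set} (k : ℕ) (P : A → Set) : Set where
  constructor many
  field
    at     : Fin k → A
    at-inj : ∀ {i j} → at i ≡ at j → i ≡ j
    at-sat : ∀ i → P (at i)

Many-map : ∀ {A : Set} {P Q : A → Set} {k} → (∀ {v} → P v → Q v) → Many k P → Many k Q
Many-map f (many σ inj p) = many σ inj λ i → f (p i)

Many-image : ∀ {A B : Set} {P : A → Set} {Q : B → Set} {k} (f : A → B) → (∀ {x y} → f x ≡ f y → x ≡ y) →
  (∀ {v} → P v → Q (f v)) → Many k P → Many k Q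
Many-image f f-inj g (many σ inj p) = many (f ∘ σ) (inj ∘ f-inj) λ i → g (p i)

Many-≤ : ∀ {A : Set} {P : A → Set} {k k'} → k' ≤ k → Many k P → Many k' P
Many-≤ le (many σ inj p) =
  many (λ i → σ (inject≤ i le)) (λ eq → inject≤-injective le le _ _ (inj eq)) λ i → p (inject≤ i le)

Many-all : ∀ {k} → Many k (λ (_ : Fin k) → ⊤)
Many-all = many id id λ _ → tt

module _ {n : ℕ} where
  private V = Fin n

  avoid₁ : ∀ {k} {P : V → Set} (x : V) → Many (suc k) P → Many k (λ v → P v × v ≢ x)
  avoid₁ {k} x (many σ inj p) with any? (λ i → σ i ≟ᶠ x)
  ... | yes (i , refl) = many (λ j → σ (punchIn i j)) (λ eq → punchIn-injective i _ _ (inj eq))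
                        λ j → p _ , λ eq → punchInᵢ≢i i j (inj eq)
  ... | no ¬e = many (λ j → σ (suc j)) (λ eq → suc-injective (inj eq)) λ j → p _ , λ eq → ¬e (suc j , eq)

  avoid : ∀ {k} {P : V → Set} (xs : List V) → Many (length xs + k) P → Many k (λ v → P v × v ∉ xs)
  avoid [] m = Many-map (λ p → p , λ ()) m
  avoid (x ∷ xs) m = Many-map (λ { ((p , ≢x) , ∉xs) → p , λ { (here eq) → ≢x eq ; (there h) → ∉xs h } })
                              (avoid xs (avoid₁ x m))

  fresh : ∀ {k} {P : V → Set} (xs : List V) → length xs < k → Many k P → ∃ λ v → P v × v ∉ xs
  fresh xs le m with avoid {k = 1} xs (Many-≤ (+-comm (length xs) 1 =& le) m)
  ... | many σ _ p = σ zero , p zero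

∑-zero : ∀ {n} {f : Fin n → ℕ} → (∀ i → f i ≡ 0) → ∑ f ≡ 0
∑-zero {n} h = ∑-cong h ∙ ∑-const n 0 ∙ *-zeroʳ n

opaque
  unfolding ∑

  ∑-term : ∀ {n} (f : Fin n → ℕ) i → f i ≤ ∑ f
  ∑-term f zero    = m≤m+n _ _
  ∑-term f (suc i) = ∑-term (f ∘ suc) i & m≤n+m _ _

  ∑-remove : ∀ {n} (f : Fin n → ℕ) x → ∑ f ≡ f x + ∑ (λ v → 𝟙 (not (does (v ≟ᶠ x))) * f v)
  ∑-remove {suc n} f zero = cong (f zero +_) (∑-cong {n} λ i → sym (+-identityʳ _))
  ∑-remove {suc n} f (suc x) = cong (f zero +_) (∑-remove (f ∘ suc) x) ∙
    lem (f zero) (f (suc x)) (∑ (λ v → 𝟙 (not (does (v ≟ᶠ x))) * f (suc v))) where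
    lem : ∀ a b s → a + (b + s) ≡ b + (1 * a + s)
    lem = solve-∀

  -- The source of the equality cases below: a termwise bound that loses nothing in total loses
  -- nothing anywhere.
  ∑-equal : ∀ {n} {f g : Fin n → ℕ} → (∀ i → f i ≤ g i) → ∑ g ≤ ∑ f → ∀ i → f i ≡ g i
  ∑-equal {suc n} {f} {g} h le zero =
    ≤-antisym (h zero) (+-cancelʳ-≤ (∑ (g ∘ suc)) _ _ (le & +-monoʳ-≤ (f zero) (∑-mono (h ∘ suc))))
  ∑-equal {suc n} {f} {g} h le (suc i) =
    ∑-equal (h ∘ suc) (+-cancelˡ-≤ (g zero) _ _ (le & +-monoˡ-≤ _ (h zero))) i

#-mono : ∀ {n} {P Q : Fin n → Bool} → (∀ v → P v ≡ true → Q v ≡ true) → # P ≤ # Q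
#-mono {P = P} {Q} h = subst₂ _≤_ (sym (#-∑ P)) (sym (#-∑ Q)) (∑-mono le) where
  le : ∀ v → 𝟙 (P v) ≤ 𝟙 (Q v)
  le v with P v in eq
  ... | false = z≤n
  ... | true rewrite h v eq = ≤-refl

#≤n : ∀ {n} (P : Fin n → Bool) → # P ≤ n
#≤n {n} P = (#-∑ P) =& ∑-mono (λ v → 𝟙≤1 (P v)) &= (∑-const n 1 ∙ *-identityʳ n)

#-full : ∀ n → # (full {Fin n}) ≡ n
#-full n = (#-∑ {n} full) ∙ ∑-const n 1 ∙ *-identityʳ n

𝟙-split : ∀ a b → 𝟙 a ≡ 𝟙 (a ∧ b) + 𝟙 (a ∧ not b)
𝟙-split true  true  = refl
𝟙-split true  false = refl
𝟙-split false _     = refl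

#-split : ∀ {n} (P Q : Fin n → Bool) → # P ≡ # (P ∩ Q) + # (P ∩ ∁ Q)
#-split P Q = (#-∑ P) ∙ ∑-cong (λ v → 𝟙-split (P v) (Q v)) ∙
  ∑-distrib-+ (λ v → 𝟙 (P v ∧ Q v)) (λ v → 𝟙 (P v ∧ not (Q v))) ∙ sym (cong₂ _+_ (#-∑ (P ∩ Q)) (#-∑ (P ∩ ∁ Q)))

#-∁ : ∀ {n} (P : Fin n → Bool) → # P + # (∁ P) ≡ n
#-∁ {n} P = sym (#-split full P) ∙ #-full n

opaque
 unfolding ∑ #

 pick : ∀ {n} k (P : Fin n → Bool) → k ≤ # P → Many k (λ v → P v ≡ true)
 pick zero P h = many (λ ()) (λ { {()} }) λ ()
 pick {zero} (suc k) P ()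
 pick {suc n} (suc k) P h with P zero in eq
 ... | true with pick k (P ∘ suc) (s≤s⁻¹ h)
 ...   | many σ inj p = many τ τ-inj τ-p where
   τ : Fin (suc k) → Fin (suc n)
   τ zero    = zero
   τ (suc i) = suc (σ i)
   τ-inj : ∀ {i j} → τ i ≡ τ j → i ≡ j
   τ-inj {zero}  {zero}  _ = refl
   τ-inj {suc i} {suc j} e = cong suc (inj (suc-injective e))
   τ-p : ∀ i → P (τ i) ≡ true
   τ-p zero    = eq
   τ-p (suc i) = p i
 pick {suc n} (suc k) P h | false with pick (suc k) (P ∘ suc) h
 ... | many σ inj p = many (suc ∘ σ) (inj ∘ suc-injective) p

∑-inj : ∀ {k n} (σ : Fin k → Fin n) → (∀ {i j} → σ i ≡ σ j → i ≡ j) → (f : Fin n → ℕ) →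
  ∑ (λ i → f (σ i)) ≤ ∑ f
∑-inj {zero}  σ inj f = ∑-empty _ =& z≤n
∑-inj {suc k} σ inj f = ∑-suc (λ i → f (σ i)) =& ≤-trans
  (+-monoʳ-≤ (f (σ zero)) (∑-mono le & ∑-inj (σ ∘ suc) (suc-injective ∘ inj) f'))
  (≤-reflexive (sym (∑-remove f (σ zero)))) where
  f' : _ → ℕ
  f' v = 𝟙 (not (does (v ≟ᶠ σ zero))) * f v
  le : ∀ i → f (σ (suc i)) ≤ f' (σ (suc i))
  le i with σ (suc i) ≟ᶠ σ zero
  ... | yes e = case inj e of λ ()
  ... | no _  = ≤-reflexive (sym (+-identityʳ _))

Many⇒≤# : ∀ {n k} (P : Fin n → Bool) → Many k (λ v → P v ≡ true) → k ≤ # P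
Many⇒≤# {k = k} P (many σ inj p) = ≤-trans
  (≤-reflexive (sym (∑-cong {k} (λ i → cong 𝟙 (p i)) ∙ ∑-const k 1 ∙ *-identityʳ k)))
  (∑-inj σ inj (λ v → 𝟙 (P v)) &= sym (#-∑ P))

#≤-code : ∀ {n} b (P : Fin n → Bool) (f : Fin n → ℕ) → (∀ v → P v ≡ true → f v < b) →
  (∀ v w → P v ≡ true → P w ≡ true → f v ≡ f w → v ≡ w) → # P ≤ b
#≤-code b P f f< f-inj with pick (# P) P ≤-refl
... | many σ inj p = injective⇒≤ {f = λ i → fromℕ< (f< (σ i) (p i))}
  λ {i} {j} eq → inj (f-inj _ _ (p i) (p j) (fromℕ<-injective _ _ _ _ eq))

-- Keep the larger side of each test in turn; every test costs a factor of two.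
homog : ∀ {n} k (t : Fin k → Fin n → Bool) M (X : Fin n → Bool) → 2 ^ k * M ≤ # X →
  ∃ λ X' → (∀ v → X' v ≡ true → X v ≡ true) × M ≤ # X' ×
           (∀ j x y → X' x ≡ true → X' y ≡ true → t j x ≡ t j y)
homog zero t M X h = X , (λ _ → id) , sym (+-identityʳ M) =& h , λ ()
homog (suc k) t M X h with 2 ^ k * M ≤? # (X ∩ t zero) | 2 ^ k * M ≤? # (X ∩ ∁ (t zero))
... | yes p | _ with homog k (t ∘ suc) M (X ∩ t zero) p
...   | X' , sub , big , hom = X' , (λ v e → ∧-elimˡ (sub v e)) , big ,
        λ { zero x y ex ey → ∧-elimʳ (sub x ex) ∙ sym (∧-elimʳ (sub y ey)) ; (suc j) → hom j }
homog (suc k) t M X h | no _ | yes p with homog k (t ∘ suc) M (X ∩ ∁ (t zero)) p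
...   | X' , sub , big , hom = X' , (λ v e → ∧-elimˡ (sub v e)) , big ,
        λ { zero x y ex ey → not-true (∧-elimʳ {X x} (sub x ex)) ∙ sym (not-true (∧-elimʳ {X y} (sub y ey))) ; (suc j) → hom j }
homog (suc k) t M X h | no p | no q = ⊥-elim (<-irrefl refl (≤-trans
  (≤-<-trans (lem (2 ^ k) M =& h &= #-split X (t zero)) (+-monoˡ-< _ (≰⇒> p)))
  (+-monoʳ-≤ (2 ^ k * M) (<⇒≤ (≰⇒> q))))) where
  lem : ∀ a m → a * m + a * m ≡ 2 * a * m
  lem = solve-∀

Unique-resp-↭ : ∀ {A : Set} {xs ys : List A} → xs ↭ ys → Unique xs → Unique ys
Unique-resp-↭ {A} p u = PermS.Unique-resp-↭ (≡.setoid A) (↭⇒↭ₛ p) u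

lcount : ∀ {A : Set} → (A → Bool) → List A → ℕ
lcount P []       = 0
lcount P (x ∷ xs) = 𝟙 (P x) + lcount P xs

infix 4 _∈ᶠ?_
_∈ᶠ?_ : ∀ {n} (x : Fin n) (xs : List (Fin n)) → Dec (x ∈ xs)
_∈ᶠ?_ = DecMem._∈?_ _≟ᶠ_

memᵇ : ∀ {n} → List (Fin n) → Fin n → Bool
memᵇ xs v = does (v ∈ᶠ? xs)

isᵇ : ∀ {n} → Fin n → Fin n → Bool
isᵇ x v = does (v ≟ᶠ x)

#-remove : ∀ {n} (P : Fin n → Bool) x → # P ≡ 𝟙 (P x) + # (P ∩ ∁ (isᵇ x))
#-remove P x = (#-∑ P) ∙ ∑-remove (λ v → 𝟙 (P v)) x ∙ cong (𝟙 (P x) +_)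
  (∑-cong (λ v → lem (P v) (isᵇ x v)) ∙ sym (#-∑ (P ∩ ∁ (isᵇ x)))) where
  lem : ∀ p b → 𝟙 (not b) * 𝟙 p ≡ 𝟙 (p ∧ not b)
  lem true  true  = refl
  lem true  false = refl
  lem false true  = refl
  lem false false = refl

#≤lcount : ∀ {n} (P Q : Fin n → Bool) xs → (∀ v → P v ≡ true → v ∈ xs) → (∀ v → P v ≡ true → Q v ≡ true) →
  # P ≤ lcount Q xs
#≤lcount {n} P Q [] sub imp = ≤-reflexive ((#-∑ P) ∙ (∑-zero λ v → cong 𝟙 (¬true⇒false λ e → case sub v e of λ ())))
#≤lcount P Q (x ∷ xs) sub imp = #-remove P x =& +-mono-≤ le
  (#≤lcount (P ∩ ∁ (isᵇ x)) Q xs sub' λ v e → imp v (∧-elimˡ e)) where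
  le : 𝟙 (P x) ≤ 𝟙 (Q x)
  le with P x in eq
  ... | false = z≤n
  ... | true rewrite imp x eq = ≤-refl
  sub' : ∀ v → (P ∩ ∁ (isᵇ x)) v ≡ true → v ∈ xs
  sub' v e with sub v (∧-elimˡ e)
  ... | here v≡x = ⊥-elim (from-¬does (v ≟ᶠ x) (not-true (∧-elimʳ {P v} e)) v≡x)
  ... | there h  = h

lcount≤length : ∀ {A : Set} (Q : A → Bool) xs → lcount Q xs ≤ length xs
lcount≤length Q [] = z≤n
lcount≤length Q (x ∷ xs) = +-mono-≤ (𝟙≤1 (Q x)) (lcount≤length Q xs)

#-memᵇ≤ : ∀ {n} (xs : List (Fin n)) → # (memᵇ xs) ≤ length xs
#-memᵇ≤ xs = #≤lcount (memᵇ xs) full xs (λ v e → from-does (v ∈ᶠ? xs) e) (λ _ _ → refl) & lcount≤length full xs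

#-equal : ∀ {n} (P Q : Fin n → Bool) → (∀ v → P v ≡ true → Q v ≡ true) → # Q ≤ # P → ∀ v → Q v ≡ true → P v ≡ true
#-equal P Q sub le v qv with bool (P v)
... | inl p = p
... | inr p = ⊥-elim (<-irrefl (sym (cong 𝟙 p) ∙ eq ∙ cong 𝟙 qv) ≤-refl) where
  𝟙-mono : ∀ w → 𝟙 (P w) ≤ 𝟙 (Q w)
  𝟙-mono w with P w in e
  ... | false = z≤n
  ... | true rewrite sub w e = ≤-refl
  eq : 𝟙 (P v) ≡ 𝟙 (Q v)
  eq = ∑-equal 𝟙-mono (subst₂ _≤_ (#-∑ Q) (#-∑ P) le) v

#-pos : ∀ {n} (P : Fin n → Bool) {v} → P v ≡ true → 0 < # P
#-pos P {v} e = cong 𝟙 (sym e) =& ∑-term (λ w → 𝟙 (P w)) v &= sym (#-∑ P)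

#-zero : ∀ {n} (P : Fin n → Bool) → (∀ v → P v ≡ false) → # P ≡ 0
#-zero P h = (#-∑ P) ∙ (∑-zero λ v → cong 𝟙 (h v))

#-witness : ∀ {n} (P : Fin n → Bool) → 0 < # P → ∃ λ v → P v ≡ true
#-witness P h with pick 1 P h
... | many σ _ p = σ zero , p zero

∈-∷-∉ : ∀ {A : Set} {x y : A} {ys} → x ≢ y → x ∉ ys → x ∉ y ∷ ys
∈-∷-∉ a b (here e)  = a e
∈-∷-∉ a b (there h) = b h

∉⇒All≢ : ∀ {A : Set} {x : A} {ys} → x ∉ ys → All (x ≢_) ys
∉⇒All≢ {ys = []} h = []
∉⇒All≢ {ys = y ∷ ys} h = (λ e → h (here e)) ∷ ∉⇒All≢ (λ m → h (there m))

Unique-∷⁻ : ∀ {A : Set} {x : A} {xs} → Unique (x ∷ xs) → x ∉ xs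
Unique-∷⁻ (a ∷ _) m = All.lookup a m refl

-- Degrees, edge counts and paths inside vertex sets.

module Graphs {n : ℕ} (G : Graph n) where
  V : Set
  V = Fin n

  Adj : V → V → Set
  Adj x y = adj G x y ≡ true

  Adj-sym : ∀ {x y} → Adj x y → Adj y x
  Adj-sym {x} {y} h = adj-sym G y x ∙ h

  Adj-≢ : ∀ {x y} → Adj x y → x ≢ y
  Adj-≢ {x} h refl = true≢false h (adj-irr G x)

  d : V → (V → Bool) → ℕ
  d v Q = # (adj G v ∩ Q)

  -- Counts ordered adjacent pairs, so `E X X` is twice the number of edges inside `X`. Edge counts
  -- stay in this doubled form to avoid halves.
  E : (V → Bool) → (V → Bool) → ℕ
  E P Q = ∑ (λ v → 𝟙 (P v) * d v Q)

  private
    E-expand : ∀ P Q → E P Q ≡ ∑ (λ v → ∑ (λ w → 𝟙 (P v) * 𝟙 (adj G v w ∧ Q w)))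
    E-expand P Q = ∑-cong λ v → cong (𝟙 (P v) *_) (#-∑ (adj G v ∩ Q)) ∙ sym (∑-*ˡ (𝟙 (P v)) (λ w → 𝟙 (adj G v w ∧ Q w)))

  E-sym : ∀ P Q → E P Q ≡ E Q P
  E-sym P Q = E-expand P Q ∙ ∑-comm (λ v w → 𝟙 (P v) * 𝟙 (adj G v w ∧ Q w)) ∙
    (∑-cong λ w → ∑-cong λ v → cong (λ b → 𝟙 (P v) * 𝟙 (b ∧ Q w)) (adj-sym G v w) ∙ lem (P v) (adj G w v) (Q w)) ∙
      sym (E-expand Q P) where
    lem : ∀ p a b → 𝟙 p * 𝟙 (a ∧ b) ≡ 𝟙 b * 𝟙 (a ∧ p)
    lem true  true  true  = refl
    lem true  true  false = refl
    lem true  false true  = refl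
    lem true  false false = refl
    lem false true  true  = refl
    lem false true  false = refl
    lem false false true  = refl
    lem false false false = refl

  E-splitˡ : ∀ P Q R → E P Q ≡ E (P ∩ R) Q + E (P ∩ ∁ R) Q
  E-splitˡ P Q R = (∑-cong λ v → cong (_* d v Q) (𝟙-split (P v) (R v)) ∙ *-distribʳ-+ (d v Q) (𝟙 (P v ∧ R v)) _) ∙
    ∑-distrib-+ (λ v → 𝟙 (P v ∧ R v) * d v Q) (λ v → 𝟙 (P v ∧ not (R v)) * d v Q)

  E-splitʳ : ∀ P Q R → E P Q ≡ E P (Q ∩ R) + E P (Q ∩ ∁ R)
  E-splitʳ P Q R = E-sym P Q ∙ E-splitˡ Q P R ∙ (cong₂ _+_ (E-sym (Q ∩ R) P) (E-sym (Q ∩ ∁ R) P))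

  E-split : ∀ X R → E X X ≡ E (X ∩ R) (X ∩ R) + 2 * E (X ∩ R) (X ∩ ∁ R) + E (X ∩ ∁ R) (X ∩ ∁ R)
  E-split X R = E-splitˡ X X R ∙ (cong₂ _+_ (E-splitʳ (X ∩ R) X R) (E-splitʳ (X ∩ ∁ R) X R)) ∙
    cong (λ z → E (X ∩ R) (X ∩ R) + E (X ∩ R) (X ∩ ∁ R) + (z + E (X ∩ ∁ R) (X ∩ ∁ R))) (E-sym (X ∩ ∁ R) (X ∩ R)) ∙
      lem (E (X ∩ R) (X ∩ R)) (E (X ∩ R) (X ∩ ∁ R)) _ where
    lem : ∀ a b c → a + b + (b + c) ≡ a + 2 * b + c
    lem = solve-∀

  E-const : ∀ P Q k → (∀ v → P v ≡ true → d v Q ≤ k) → E P Q ≤ k * # P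
  E-const P Q k h = ∑-mono le &= (∑-*ˡ k (λ v → 𝟙 (P v)) ∙ cong (k *_) (sym (#-∑ P))) where
    le : ∀ v → 𝟙 (P v) * d v Q ≤ k * 𝟙 (P v)
    le v with P v in e
    ... | false = z≤n
    ... | true  = subst₂ _≤_ (sym (+-identityʳ _)) (sym (*-identityʳ k)) (h v e)

  E-zero : ∀ P Q → (∀ v w → P v ≡ true → Q w ≡ true → ¬ Adj v w) → E P Q ≡ 0
  E-zero P Q h = n≤0⇒n≡0 (E-const P Q 0 λ v pv → ≤-reflexive (#-zero (adj G v ∩ Q)
    λ w → ¬true⇒false λ e → h v w pv (∧-elimʳ {adj G v w} e) (∧-elimˡ e)))

  E-mono : ∀ {P P' Q Q' : V → Bool} → (∀ v → P v ≡ true → P' v ≡ true) → (∀ v → Q v ≡ true → Q' v ≡ true) → E P Q ≤ E P' Q'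
  E-mono {P} {P'} {Q} {Q'} p q = ∑-mono λ v → *-mono-≤ (le v)
    (#-mono {P = adj G v ∩ Q} {Q = adj G v ∩ Q'} λ w e → ∧-intro (∧-elimˡ e) (q w (∧-elimʳ {adj G v w} e))) where
    le : ∀ v → 𝟙 (P v) ≤ 𝟙 (P' v)
    le v with P v in e
    ... | false = z≤n
    ... | true rewrite p v e = ≤-refl

  d-self : ∀ {v} X → X v ≡ true → suc (d v X) ≤ # X
  d-self {v} X xv = s≤s (#-mono {P = adj G v ∩ X} {Q = X ∩ ∁ (isᵇ v)} λ w e → ∧-intro (∧-elimʳ {adj G v w} e)
      (not-false (dec-false (w ≟ᶠ v) λ w≡v → Adj-≢ (∧-elimˡ e) (sym w≡v)))) &=
    sym (#-remove X v ∙ cong (λ b → 𝟙 b + # (X ∩ ∁ (isᵇ v))) xv)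

  E-remove : ∀ X v → X v ≡ true → E X X ≡ E (X ∩ ∁ (isᵇ v)) (X ∩ ∁ (isᵇ v)) + 2 * d v X
  E-remove X v xv = E-split X (isᵇ v) ∙ cong₂ (λ a b → a + 2 * b + E X' X') e0 e1 ∙ +-comm (2 * d v X) _ where
    X' = X ∩ ∁ (isᵇ v)
    isv : ∀ {w} → (X ∩ isᵇ v) w ≡ true → w ≡ v
    isv {w} e = from-does (w ≟ᶠ v) (∧-elimʳ {X w} e)
    e0 : E (X ∩ isᵇ v) (X ∩ isᵇ v) ≡ 0
    e0 = E-zero _ _ λ a b ea eb h → Adj-≢ h (isv ea ∙ sym (isv eb))
    dX : d v X' ≡ d v X
    dX = (#-∑ _) ∙ ∑-cong eqv ∙ sym (#-∑ _) where
      eqv : ∀ w → 𝟙 ((adj G v ∩ X') w) ≡ 𝟙 ((adj G v ∩ X) w)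
      eqv w with w ≟ᶠ v
      ... | no _ with X w
      ...   | true = refl
      ...   | false = refl
      eqv w | yes refl rewrite adj-irr G v = refl
    e1 : E (X ∩ isᵇ v) X' ≡ d v X
    e1 = ∑-remove _ v ∙ (cong₂ _+_ head (∑-zero tail)) ∙ +-identityʳ _ where
      head : 𝟙 (X v ∧ isᵇ v v) * d v X' ≡ d v X
      head rewrite xv | dec-true (v ≟ᶠ v) refl = +-identityʳ _ ∙ dX
      tail : ∀ w → 𝟙 (not (does (w ≟ᶠ v))) * (𝟙 (X w ∧ isᵇ v w) * d w X') ≡ 0
      tail w with w ≟ᶠ v
      ... | yes _ = refl
      ... | no _ with X w
      ...   | true  = refl
      ...   | false = refl

  -- Path x xs y: xs is a walk from x to y, with both ends included in xs.
  data Path : V → List V → V → Set where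
    [_] : ∀ x → Path x (x ∷ []) x
    _∷_ : ∀ {x y z ys} → Adj x y → Path y ys z → Path x (x ∷ ys) z

  infixr 5 _++⟨_⟩_
  _++⟨_⟩_ : ∀ {x xs y z zs w} → Path x xs y → Adj y z → Path z zs w → Path x (xs ++ zs) w
  [ x ]   ++⟨ a ⟩ q = a ∷ q
  (b ∷ p) ++⟨ a ⟩ q = b ∷ (p ++⟨ a ⟩ q)

  Path-reverse : ∀ {x xs y} → Path x xs y → Path y (reverse xs) x
  Path-reverse [ x ] = [ x ]
  Path-reverse (_∷_ {x} {y} {z} {ys} a p) =
    subst (λ l → Path z l x) (sym (unfold-reverse x ys)) (Path-reverse p ++⟨ Adj-sym a ⟩ [ x ])

  PathFree : ℕ → (V → Bool) → Set
  PathFree k X = ∀ {x y xs} → Path x xs y → Unique xs → (∀ {v} → v ∈ xs → X v ≡ true) → length xs ≤ k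

  PathFree-⊆ : ∀ {k X X'} → (∀ v → X' v ≡ true → X v ≡ true) → PathFree k X → PathFree k X'
  PathFree-⊆ sub pf p u a = pf p u (λ m → sub _ (a m))

  record Clique (k : ℕ) (X : V → Bool) : Set where
    field
      cl     : Fin k → V
      cl-inj : ∀ {i j} → cl i ≡ cl j → i ≡ j
      cl-sat : ∀ i → X (cl i) ≡ true
      cl-adj : ∀ {i j} → i ≢ j → Adj (cl i) (cl j)

  Path-head∈ : ∀ {x xs y} → Path x xs y → x ∈ xs
  Path-head∈ [ x ] = here refl
  Path-head∈ (a ∷ p) = here refl

  Path-last∈ : ∀ {x xs y} → Path x xs y → y ∈ xs
  Path-last∈ [ x ] = here refl
  Path-last∈ (a ∷ p) = there (Path-last∈ p)

  Path-split : ∀ {x xs y v} → Path x xs y → v ∈ xs →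
    v ≡ x ⊎ ∃ λ ps → ∃ λ p → ∃ λ vs → Path x ps p × Adj p v × Path v vs y × xs ≡ ps ++ vs
  Path-split [ x ] (here e) = inl e
  Path-split (a ∷ p) (here e) = inl e
  Path-split (_∷_ {x} {y} {z} {ys} a p) (there m) with Path-split p m
  ... | inl refl = inr (x ∷ [] , x , ys , [ x ] , a , p , refl)
  ... | inr (ps , p' , vs , P₁ , b , P₂ , eq) = inr (x ∷ ps , p' , vs , a ∷ P₁ , b , P₂ , cong (x ∷_) eq)

  Path-rotate : ∀ {x xs y v} → Path x xs y → Adj y x → v ∈ xs → ∃ λ ys → ∃ λ w → Path v ys w × xs ↭ ys
  Path-rotate {xs = xs} p a m with Path-split p m
  ... | inl refl = xs , _ , p , ↭-refl
  ... | inr (ps , w , vs , P₁ , b , P₂ , refl) = vs ++ ps , w , P₂ ++⟨ a ⟩ P₁ , Perm.++-comm ps vs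

  -- A pair of consecutive vertices u, w with z ~ u and a ~ w exists once the two
  -- neighbourhoods together outnumber the gaps of the walk.
  Crossing : V → V → List V → V → V → Set
  Crossing x y xs a z = ∃ λ us → ∃ λ u → ∃ λ w → ∃ λ ws →
    Path x us u × Path w ws y × xs ≡ us ++ ws × Adj z u × Adj a w

  crossing : ∀ {x xs y} → Path x xs y → ∀ a z →
    Crossing x y xs a z ⊎
    suc (lcount (adj G z) xs + lcount (adj G a) xs) ≤ length xs + 𝟙 (adj G z y) + 𝟙 (adj G a x)
  crossing [ x ] a z = inr (≤-reflexive (cong suc (lem (𝟙 (adj G z x)) (𝟙 (adj G a x))))) where
    lem : ∀ a b → a + 0 + (b + 0) ≡ a + b
    lem = solve-∀
  crossing (_∷_ {x} {y} {e} {ys} b p) a z with crossing p a z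
  ... | inl (us , u , w , ws , P₁ , P₂ , eq , h₁ , h₂) =
    inl (x ∷ us , u , w , ws , b ∷ P₁ , P₂ , cong (x ∷_) eq , h₁ , h₂)
  ... | inr le with adj G z x in ez | adj G a y in ea
  ...   | true  | true  = inl (x ∷ [] , x , y , ys , [ x ] , p , refl , ez , ea)
  ...   | true  | false = inr (lin 0 le (lem (lcount (adj G z) ys) (lcount (adj G a) ys) (length ys) (𝟙 (adj G z e)) (𝟙 (adj G a x)))) where
    lem : ∀ p q l u v → suc (suc (p + (v + q))) + (l + u + 0) + 0 ≡ suc (l + u + v) + suc (p + q)
    lem = solve-∀
  ...   | false | true  = inr (lin 0 le (lem (lcount (adj G z) ys) (lcount (adj G a) ys) (length ys) (𝟙 (adj G z e)) (𝟙 (adj G a x)))) where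
    lem : ∀ p q l u v → suc (p + (v + q)) + (l + u + 1) + 0 ≡ suc (l + u + v) + suc (p + q)
    lem = solve-∀
  ...   | false | false = inr (lin 1 le (lem (lcount (adj G z) ys) (lcount (adj G a) ys) (length ys) (𝟙 (adj G z e)) (𝟙 (adj G a x)))) where
    lem : ∀ p q l u v → suc (p + (v + q)) + (l + u + 0) + 1 ≡ suc (l + u + v) + suc (p + q)
    lem = solve-∀

  outside? : ∀ x (X : V → Bool) (xs : List V) → (∃ λ o → X o ≡ true × o ∉ xs × Adj x o) ⊎ (∀ o → X o ≡ true → Adj x o → o ∈ xs)
  outside? x X xs with any? (λ o → (X o ≟ᵇ true) ×-dec (¬? (o ∈ᶠ? xs)) ×-dec (adj G x o ≟ᵇ true))
  ... | yes p = inl p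
  ... | no ¬p = inr λ o xo a → case (o ∈ᶠ? xs) of λ { (yes m) → m ; (no o∉) → ⊥-elim (¬p (o , xo , o∉ , a)) }

  -- Pósa rotation: a longest path whose ends both have degree above q closes up to a
  -- cycle, and a cycle with an edge leaving it extends to a longer path.
  low-or-closed : ∀ q X → PathFree (suc (2 * q)) X → ∀ f {x y xs} → Path x xs y → Unique xs →
    (∀ {v} → v ∈ xs → X v ≡ true) → length xs + f ≡ suc (suc (2 * q)) →
    (∃ λ v → X v ≡ true × d v X ≤ q) ⊎
    (∃ λ ys → Unique ys × length ys ≤ suc (2 * q) × (∃ λ y → y ∈ ys) × (∀ {v} → v ∈ ys → X v ≡ true) ×
      (∀ v w → v ∈ ys → X w ≡ true → Adj v w → w ∈ ys))
  -- `f` is the room left for lengthening the path: at `zero` it already has `2 + 2 * q` vertices.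
  low-or-closed q X pf zero {xs = xs} p u sat len =
    ⊥-elim (<-irrefl refl (sym (sym (+-identityʳ (length xs)) ∙ len) =& pf p u sat))
  low-or-closed q X pf (suc f) {x} {y} {xs} p u sat len with outside? x X xs | outside? y X xs
  ... | inl (o , xo , o∉ , a) | _ = low-or-closed q X pf f (Adj-sym a ∷ p) (∉⇒All≢ o∉ ∷ u)
      (λ { (here refl) → xo ; (there m) → sat m }) (sym (+-suc (length xs) f) ∙ len)
  ... | inr _ | inl (o , xo , o∉ , a) = low-or-closed q X pf f (Adj-sym a ∷ Path-reverse p)
      (∉⇒All≢ (λ m → o∉ (Perm.∈-resp-↭ (Perm.↭-reverse xs) m)) ∷ Unique-resp-↭ (↭-sym (Perm.↭-reverse xs)) u)
      (λ { (here refl) → xo ; (there m) → sat (Perm.∈-resp-↭ (Perm.↭-reverse xs) m) })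
      (cong (λ l → suc l + f) (length-reverse xs) ∙ sym (+-suc (length xs) f) ∙ len)
  ... | inr nx | inr ny with any? (λ v → (v ∈ᶠ? xs) ×-dec any? λ o → (X o ≟ᵇ true) ×-dec (¬? (o ∈ᶠ? xs)) ×-dec (adj G v o ≟ᵇ true))
  ...   | no ¬e = inr (xs , u , pf p u sat , (x , Path-head∈ p) , sat , λ v w v∈ xw a →
            case (w ∈ᶠ? xs) of λ { (yes m) → m ; (no w∉) → ⊥-elim (¬e (v , v∈ , w , xw , w∉ , a)) })
  ...   | yes (v , v∈ , o , xo , o∉ , ao) with d x X ≤? q | d y X ≤? q
  ...     | yes le | _ = inl (x , sat (Path-head∈ p) , le)
  ...     | no _ | yes le = inl (y , sat (Path-last∈ p) , le)
  ...     | no gx | no gy with crossing p x y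
  ...       | inr le = ⊥-elim (<-irrefl refl (lin 1 (+-mono-≤ (+-mono-≤ dx dy) (pf p u sat)) (lem q (lcount (adj G x) xs) (lcount (adj G y) xs) (length xs)) & le')) where
    dx : suc q ≤ lcount (adj G x) xs
    dx = (≰⇒> gx) & (#≤lcount (adj G x ∩ X) (adj G x) xs (λ w e → nx w (∧-elimʳ {adj G x w} e) (∧-elimˡ e)) λ w → ∧-elimˡ)
    dy : suc q ≤ lcount (adj G y) xs
    dy = (≰⇒> gy) & (#≤lcount (adj G y ∩ X) (adj G y) xs (λ w e → ny w (∧-elimʳ {adj G y w} e) (∧-elimˡ e)) λ w → ∧-elimˡ)
    le' : suc (lcount (adj G y) xs + lcount (adj G x) xs) ≤ length xs
    le' = le &= (cong₂ (λ a b → length xs + 𝟙 a + 𝟙 b) (adj-irr G y) (adj-irr G x) ∙ +-identityʳ _ ∙ +-identityʳ _)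
    lem : ∀ q a b l → suc l + (a + b + suc (2 * q)) + 1 ≡ suc (b + a) + (suc q + suc q + l)
    lem = solve-∀
  -- The crossing edges close the path into the cycle from `w₁` to `y`, over to `u₁` and back to
  -- `x`. It is reopened at `v`, whose outside neighbour `o` then lengthens the path.
  ...       | inl (us , u₁ , w₁ , ws , P₁ , P₂ , refl , h₁ , h₂)
              with Path-rotate (P₂ ++⟨ h₁ ⟩ Path-reverse P₁) h₂ (Perm.∈-resp-↭ (↭-trans (Perm.++-comm us ws) (Perm.++⁺ˡ ws (↭-sym (Perm.↭-reverse us)))) v∈)
  ...         | ys , e , P₃ , perm = low-or-closed q X pf f (Adj-sym ao ∷ P₃)
      (∉⇒All≢ (λ m → o∉ (Perm.∈-resp-↭ (↭-sym π) m)) ∷ Unique-resp-↭ π u)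
      (λ { (here refl) → xo ; (there m) → sat (Perm.∈-resp-↭ (↭-sym π) m) })
      (cong (λ l → suc l + f) (sym (Perm.↭-length π)) ∙ sym (+-suc _ f) ∙ len) where
      π : us ++ ws ↭ ys
      π = ↭-trans (Perm.++-comm us ws) (↭-trans (Perm.++⁺ˡ ws (↭-sym (Perm.↭-reverse us))) perm)

-- The Erdős-Gallai theorem with a tight case.

module ErdosGallai {n : ℕ} (G : Graph n) where
  open Graphs G

  -- Erdős-Gallai for paths on `2 + 2 * q` vertices, in doubled form. Of the equality case only the
  -- presence of one clique on `ℓ - 1` vertices is recorded; that is what `F₃` is played against.
  EGBound : ℕ → (V → Bool) → Set
  EGBound q X = E X X ≤ 2 * q * # X × (0 < # X → 2 * q * # X ≤ E X X → Clique (suc (2 * q)) X)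

  EG-small : ∀ q X → # X ≤ suc (2 * q) → EGBound q X
  EG-small q X small = bound , tight where
    d≤ : ∀ v → X v ≡ true → d v X ≤ 2 * q
    d≤ v xv = s≤s⁻¹ (d-self X xv & small)
    bound : E X X ≤ 2 * q * # X
    bound = E-const X X (2 * q) d≤
    tight : 0 < # X → 2 * q * # X ≤ E X X → Clique (suc (2 * q)) X
    tight pos eq = record { cl = σ ; cl-inj = inj ; cl-sat = sat ; cl-adj = λ i≢j → adjacent _ _ (sat _) (sat _) (i≢j ∘ inj) } where
      pw : ∀ v → 𝟙 (X v) * d v X ≤ 2 * q * 𝟙 (X v)
      pw v with X v in e
      ... | false = z≤n
      ... | true  = subst₂ _≤_ (sym (+-identityʳ _)) (sym (*-identityʳ (2 * q))) (d≤ v e)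
      all= : ∀ v → 𝟙 (X v) * d v X ≡ 2 * q * 𝟙 (X v)
      all= = ∑-equal pw ((∑-*ˡ (2 * q) (λ v → 𝟙 (X v)) ∙ cong (2 * q *_) (sym (#-∑ X))) =& eq)
      d= : ∀ v → X v ≡ true → d v X ≡ 2 * q
      d= v xv = subst (λ b → 𝟙 b * d v X ≡ 2 * q * 𝟙 b → d v X ≡ 2 * q) (sym xv)
        (λ e → sym (+-identityʳ _) ∙ e ∙ *-identityʳ (2 * q)) (all= v)
      x₀ = #-witness X pos
      size : suc (2 * q) ≤ # X
      size = cong suc (sym (d= _ (snd x₀))) =& d-self X (snd x₀)
      adjacent : ∀ v w → X v ≡ true → X w ≡ true → v ≢ w → Adj v w
      adjacent v w xv xw v≢w = ∧-elimˡ (#-equal (adj G v ∩ X) (X ∩ ∁ (isᵇ v))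
        (λ u e → ∧-intro (∧-elimʳ {adj G v u} e) (not-false (dec-false (u ≟ᶠ v) λ u≡v → Adj-≢ (∧-elimˡ e) (sym u≡v))))
        (s≤s⁻¹ ((cong (λ b → 𝟙 b + # (X ∩ ∁ (isᵇ v))) (sym xv) ∙ sym (#-remove X v)) =&
          small &= cong suc (sym (d= v xv))))
        w (∧-intro xw (not-false (dec-false (w ≟ᶠ v) (v≢w ∘ sym)))))
      open Many (pick (suc (2 * q)) X size) renaming (at to σ; at-inj to inj; at-sat to sat)

  Clique-⊆ : ∀ {k X X'} → (∀ v → X v ≡ true → X' v ≡ true) → Clique k X → Clique k X'
  Clique-⊆ sub c = record { cl = cl ; cl-inj = cl-inj ; cl-sat = λ i → sub _ (cl-sat i) ; cl-adj = cl-adj }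
    where open Clique c

  -- Induction on the size of `X`. Either a vertex of degree at most `q` is removed, or
  -- `low-or-closed` yields at most `2 * q + 1` vertices with no edge to the rest of `X`. These are
  -- split off and bounded trivially. Tightness is inherited by the part that contains the clique.
  EG : ∀ q X → PathFree (suc (2 * q)) X → EGBound q X
  EG q X = go (# X) X ≤-refl where
    go : ∀ k X → # X ≤ k → PathFree (suc (2 * q)) X → EGBound q X
    go k X le pf with # X ≤? suc (2 * q)
    ... | yes small = EG-small q X small
    go zero X le pf | no big = ⊥-elim (big (le & z≤n))
    go (suc k) X le pf | no big with #-witness X (s≤s z≤n & (≰⇒> big))
    ... | x , xx with low-or-closed q X pf (suc (2 * q)) [ x ] ([] ∷ []) (λ { (here refl) → xx }) refl
    ...   | inl (v , xv , dv≤q) = bound , tight where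
      X' = X ∩ ∁ (isᵇ v)
      size : # X ≡ suc (# X')
      size = #-remove X v ∙ cong (λ b → 𝟙 b + # X') xv
      ih : EGBound q X'
      ih = go k X' (s≤s⁻¹ (sym size =& le)) (PathFree-⊆ (λ w → ∧-elimˡ) pf)
      grow' : ∀ q a → 2 * q * suc a ≡ 2 * q * a + 2 * q
      grow' = solve-∀
      grow : ∀ a → 2 * q * suc a ≡ 2 * q * a + 2 * q
      grow = grow' q
      bound : E X X ≤ 2 * q * # X
      bound = subst₂ _≤_ (sym (E-remove X v xv)) (sym (grow (# X')) ∙ cong (2 * q *_) (sym size))
        (+-mono-≤ (fst ih) (*-monoʳ-≤ 2 dv≤q))
      tight : 0 < # X → 2 * q * # X ≤ E X X → Clique (suc (2 * q)) X
      tight _ eq = Clique-⊆ (λ w → ∧-elimˡ) (snd ih (s≤s z≤n & s≤s⁻¹ ((≰⇒> big) &= size))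
        (+-cancelʳ-≤ (2 * q) _ _ ((sym (grow (# X')) ∙ cong (2 * q *_) (sym size)) =&
          eq & E-remove X v xv =& +-monoʳ-≤ (E X' X') (*-monoʳ-≤ 2 dv≤q))))
    ...   | inr (ys , uys , len , (y , y∈) , sat , closed) = bound , tight where
      Y X₁ X₂ : V → Bool
      Y = memᵇ ys
      X₁ = X ∩ Y
      X₂ = X ∩ ∁ Y
      Y-sat : ∀ v → Y v ≡ true → v ∈ ys
      Y-sat v e = from-does (v ∈ᶠ? ys) e
      size : # X ≡ # X₁ + # X₂
      size = #-split X Y
      pos₁ : 0 < # X₁
      pos₁ = #-pos X₁ {y} (∧-intro (sat y∈) (dec-true (y ∈ᶠ? ys) y∈))
      b₁ : EGBound q X₁
      b₁ = EG-small q X₁ (#-mono {P = X₁} {Q = Y} (λ v → ∧-elimʳ {X v}) & #-memᵇ≤ ys & len)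
      b₂ : EGBound q X₂
      b₂ = go k X₂ (s≤s⁻¹ ((+-monoˡ-≤ (# X₂) pos₁ &= sym size) & le)) (PathFree-⊆ (λ w → ∧-elimˡ) pf)
      eqn : E X X ≡ E X₁ X₁ + E X₂ X₂
      eqn = E-split X Y ∙ cong (_+ E X₂ X₂) (cong (λ z → E X₁ X₁ + 2 * z)
        (E-zero X₁ X₂ λ v w ev ew a → from-¬does (w ∈ᶠ? ys) (not-true (∧-elimʳ {X w} ew))
          (closed v w (Y-sat v (∧-elimʳ {X v} ev)) (∧-elimˡ ew) a)) ∙ +-identityʳ _)
      dist : 2 * q * # X ≡ 2 * q * # X₁ + 2 * q * # X₂
      dist = cong (2 * q *_) size ∙ *-distribˡ-+ (2 * q) (# X₁) (# X₂)
      bound : E X X ≤ 2 * q * # X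
      bound = subst₂ _≤_ (sym eqn) (sym dist) (+-mono-≤ (fst b₁) (fst b₂))
      tight : 0 < # X → 2 * q * # X ≤ E X X → Clique (suc (2 * q)) X
      tight _ eq = Clique-⊆ (λ w → ∧-elimˡ) (snd b₁ pos₁ (+-cancelʳ-≤ (2 * q * # X₂) _ _
        ((subst₂ _≤_ dist eqn eq) & +-monoʳ-≤ (E X₁ X₁) (fst b₂))))

-- Embedding joins, unions, paths, matchings and Turán graphs.

fromRel-elim : ∀ {n} (R : Fin n → Fin n → Bool) {x y} → adj (fromRel R) x y ≡ true →
  x ≢ y × (R x y ≡ true ⊎ R y x ≡ true)
fromRel-elim R {x} {y} h = from-¬does (x ≟ᶠ y) (sym (isYes≗does (x ≟ᶠ y)) ∙ not-true (∧-elimˡ h)) , ∨-elim (∧-elimʳ {not ⌊ x ≟ᶠ y ⌋} h)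

fromRel-intro : ∀ {n} (R : Fin n → Fin n → Bool) {x y} → x ≢ y → (R x y ≡ true ⊎ R y x ≡ true) →
  adj (fromRel R) x y ≡ true
fromRel-intro R {x} {y} ne (inl h) = ∧-intro (not-false (isYes≗does (x ≟ᶠ y) ∙ dec-false (x ≟ᶠ y) ne)) (∨-introˡ h)
fromRel-intro R {x} {y} ne (inr h) = ∧-intro (not-false (isYes≗does (x ≟ᶠ y) ∙ dec-false (x ≟ᶠ y) ne)) (∨-introʳ {R x y} h)

-- Adjacency as seen after `splitAt`; `C` decides the cross pairs, `⊤` for a join and `⊥` for a
-- disjoint union.
Block : ∀ {a b} → Set → Graph a → Graph b → Fin a ⊎ Fin b → Fin a ⊎ Fin b → Set
Block C A B (inl u) (inl v) = adj A u v ≡ true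
Block C A B (inr u) (inr v) = adj B u v ≡ true
Block C A B (inl _) (inr _) = C
Block C A B (inr _) (inl _) = C

⊗-elim : ∀ {a b} (A : Graph a) (B : Graph b) x y → adj (A ⊗ᴳ B) x y ≡ true → Block ⊤ A B (splitAt a x) (splitAt a y)
⊗-elim {a} A B x y h with splitAt a x | splitAt a y | ∧-elimʳ {not ⌊ x ≟ᶠ y ⌋} h
... | inl _ | inr _ | _ = tt
... | inr _ | inl _ | _ = tt
... | inl u | inl v | e = [ id , trans (adj-sym A u v) ]′ (∨-elim e)
... | inr u | inr v | e = [ id , trans (adj-sym B u v) ]′ (∨-elim e)

∪-elim : ∀ {a b} (A : Graph a) (B : Graph b) x y → adj (A ∪ᴳ B) x y ≡ true → Block ⊥ A B (splitAt a x) (splitAt a y)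
∪-elim {a} A B x y h with splitAt a x | splitAt a y | ∧-elimʳ {not ⌊ x ≟ᶠ y ⌋} h
... | inl _ | inr _ | ()
... | inr _ | inl _ | ()
... | inl u | inl v | e = [ id , trans (adj-sym A u v) ]′ (∨-elim e)
... | inr u | inr v | e = [ id , trans (adj-sym B u v) ]′ (∨-elim e)

≡ᵇ-true : ∀ {a b} → (a ≡ᵇ b) ≡ true → a ≡ b
≡ᵇ-true {a} {b} h = ≡ᵇ⇒≡ a b (subst Booleans.T (sym h) tt)

≡⇒≡ᵇ-true : ∀ {a b} → a ≡ b → (a ≡ᵇ b) ≡ true
≡⇒≡ᵇ-true {zero}  refl = refl
≡⇒≡ᵇ-true {suc a} refl = ≡⇒≡ᵇ-true {a} refl

lookup-injective : ∀ {A : Set} {xs : List A} → Unique xs → ∀ {i j} → lookup xs i ≡ lookup xs j → i ≡ j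
lookup-injective {xs = x ∷ xs} u {zero}  {zero}  e = refl
lookup-injective {xs = x ∷ xs} u {zero}  {suc j} e = ⊥-elim (Unique-∷⁻ u (subst (_∈ xs) (sym e) (∈-lookup j)))
lookup-injective {xs = x ∷ xs} u {suc i} {zero}  e = ⊥-elim (Unique-∷⁻ u (subst (_∈ xs) e (∈-lookup i)))
lookup-injective {xs = x ∷ xs} (_ ∷ u) {suc i} {suc j} e = cong suc (lookup-injective u e)

module Embeddings {n : ℕ} (G : Graph n) where
  open Graphs G

  join-⊆ : ∀ {a b} (A : Graph a) (B : Graph b) (f : A ⊆ᴳ G) (g : B ⊆ᴳ G) →
    (∀ i j → Adj (fst f i) (fst g j)) → (A ⊗ᴳ B) ⊆ᴳ G
  join-⊆ {a} {b} A B (f , f-inj , f-pres) (g , g-inj , g-pres) cross = h , h-inj , h-pres where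
    h : Fin (a + b) → V
    h x = [ f , g ]′ (splitAt a x)
    h-inj : ∀ x y → h x ≡ h y → x ≡ y
    h-inj x y e = sym (join-splitAt a b x) ∙ cong (join a b) (lem (splitAt a x) (splitAt a y) e) ∙ join-splitAt a b y where
      lem : ∀ s t → [ f , g ]′ s ≡ [ f , g ]′ t → s ≡ t
      lem (inl u) (inl v) e = cong inl (f-inj u v e)
      lem (inr u) (inr v) e = cong inr (g-inj u v e)
      lem (inl u) (inr v) e = ⊥-elim (Adj-≢ (cross u v) e)
      lem (inr u) (inl v) e = ⊥-elim (Adj-≢ (cross v u) (sym e))
    h-pres : ∀ x y → adj (A ⊗ᴳ B) x y ≡ true → Adj (h x) (h y)
    h-pres x y e with splitAt a x | splitAt a y | ⊗-elim A B x y e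
    ... | inl u | inl v | k = f-pres u v k
    ... | inr u | inr v | k = g-pres u v k
    ... | inl u | inr v | _ = cross u v
    ... | inr u | inl v | _ = Adj-sym (cross v u)

  union-⊆ : ∀ {a b} (A : Graph a) (B : Graph b) (f : A ⊆ᴳ G) (g : B ⊆ᴳ G) →
    (∀ i j → fst f i ≢ fst g j) → (A ∪ᴳ B) ⊆ᴳ G
  union-⊆ {a} {b} A B (f , f-inj , f-pres) (g , g-inj , g-pres) disj = h , h-inj , h-pres where
    h : Fin (a + b) → V
    h x = [ f , g ]′ (splitAt a x)
    h-inj : ∀ x y → h x ≡ h y → x ≡ y
    h-inj x y e = sym (join-splitAt a b x) ∙ cong (join a b) (lem (splitAt a x) (splitAt a y) e) ∙ join-splitAt a b y where
      lem : ∀ s t → [ f , g ]′ s ≡ [ f , g ]′ t → s ≡ t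
      lem (inl u) (inl v) e = cong inl (f-inj u v e)
      lem (inr u) (inr v) e = cong inr (g-inj u v e)
      lem (inl u) (inr v) e = ⊥-elim (disj u v e)
      lem (inr u) (inl v) e = ⊥-elim (disj v u (sym e))
    h-pres : ∀ x y → adj (A ∪ᴳ B) x y ≡ true → Adj (h x) (h y)
    h-pres x y e with splitAt a x | splitAt a y | ∪-elim A B x y e
    ... | inl u | inl v | k = f-pres u v k
    ... | inr u | inr v | k = g-pres u v k

  edgeless-⊆ : ∀ {k P} → Many k P → edgeless k ⊆ᴳ G
  edgeless-⊆ {k} (many σ inj p) = σ , (λ x y → inj) , λ x y e → ⊥-elim (none (snd (fromRel-elim {k} (λ _ _ → false) {x} {y} e))) where
    none : false ≡ true ⊎ false ≡ true → ⊥
    none (inl ())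
    none (inr ())

  complete-⊆ : ∀ {k} (c : Fin k → V) → (∀ {i j} → i ≢ j → Adj (c i) (c j)) → complete k ⊆ᴳ G
  complete-⊆ {k} c a = c , inj , λ x y e → a (fst (fromRel-elim {k} (λ _ _ → true) {x} {y} e)) where
    inj : ∀ x y → c x ≡ c y → x ≡ y
    inj x y e with x ≟ᶠ y
    ... | yes p = p
    ... | no ¬p = ⊥-elim (Adj-≢ (a ¬p) e)

  Path-lookup : ∀ {x xs y} → Path x xs y → ∀ i j → toℕ j ≡ suc (toℕ i) → Adj (lookup xs i) (lookup xs j)
  Path-lookup (a ∷ p) zero (suc j) e = subst (Adj _) (sym (first p j (cong pred e))) a where
    open import Data.Nat using (pred)
    first : ∀ {x xs y} → Path x xs y → ∀ j → toℕ j ≡ 0 → lookup xs j ≡ x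
    first [ x ]   zero _ = refl
    first (a ∷ p) zero _ = refl
  Path-lookup (a ∷ p) (suc i) (suc j) e = Path-lookup p i j (cong pred e)
    where open import Data.Nat using (pred)
  Path-lookup [ x ] zero zero ()
  Path-lookup (a ∷ p) zero zero ()
  Path-lookup (a ∷ p) (suc i) zero ()

  path-⊆ : ∀ {x xs y} k → length xs ≡ k → Path x xs y → Unique xs → Σ (path k ⊆ᴳ G) λ f → ∀ i → fst f i ∈ xs
  path-⊆ {xs = xs} k refl p u = (lookup xs , (λ i j → lookup-injective u) , pres) , ∈-lookup where
    pres : ∀ i j → adj (path (length xs)) i j ≡ true → Adj (lookup xs i) (lookup xs j)
    pres i j e with snd (fromRel-elim (λ i j → toℕ j ≡ᵇ suc (toℕ i)) {i} {j} e)
    ... | inl h = Path-lookup p i j (≡ᵇ-true h)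
    ... | inr h = Adj-sym (Path-lookup p j i (≡ᵇ-true h))

  Path-take : ∀ {x xs y} → Path x xs y → ∀ k → suc k ≤ length xs →
    ∃ λ ys → ∃ λ z → Path x ys z × length ys ≡ suc k × (∀ {v} → v ∈ ys → v ∈ xs) × (Unique xs → Unique ys)
  Path-take {x} p zero le = x ∷ [] , x , [ x ] , refl , (λ { (here refl) → Path-head∈ p }) , λ _ → [] ∷ []
  Path-take [ x ] (suc k) (s≤s ())
  Path-take (_∷_ {x} a p) (suc k) (s≤s le) with Path-take p k le
  ... | ys , z , p' , len , sub , uniq = x ∷ ys , z , a ∷ p' , cong suc len ,
        (λ { (here e) → here e ; (there m) → there (sub m) }) ,
        λ { u@(_ ∷ u') → ∉⇒All≢ (λ m → Unique-∷⁻ u (sub m)) ∷ uniq u' }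

  record Matching (k : ℕ) (P : V → Set) : Set where
    field
      mx my  : Fin k → V
      mx-inj : ∀ {i j} → mx i ≡ mx j → i ≡ j
      my-inj : ∀ {i j} → my i ≡ my j → i ≡ j
      mxy    : ∀ i j → mx i ≢ my j
      mx-sat : ∀ i → P (mx i)
      my-sat : ∀ i → P (my i)
      m-adj  : ∀ i → Adj (mx i) (my i)

  Matching-sub : ∀ {k k' P} (σ : Fin k' → Fin k) → (∀ {i j} → σ i ≡ σ j → i ≡ j) → Matching k P → Matching k' P
  Matching-sub σ σ-inj M = record
    { mx = λ i → mx (σ i) ; my = λ i → my (σ i)
    ; mx-inj = λ e → σ-inj (mx-inj e) ; my-inj = λ e → σ-inj (my-inj e) ; mxy = λ i j → mxy _ _
    ; mx-sat = λ i → mx-sat _ ; my-sat = λ i → my-sat _ ; m-adj = λ i → m-adj _ }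
    where open Matching M

  Matching-≤ : ∀ {k k' P} → k' ≤ k → Matching k P → Matching k' P
  Matching-≤ le = Matching-sub (λ i → inject≤ i le) (λ e → inject≤-injective le le _ _ e)

  Matching-map : ∀ {k} {P Q : V → Set} → (∀ {v} → P v → Q v) → Matching k P → Matching k Q
  Matching-map f M = record { mx = mx ; my = my ; mx-inj = mx-inj ; my-inj = my-inj ; mxy = mxy
    ; mx-sat = λ i → f (mx-sat i) ; my-sat = λ i → f (my-sat i) ; m-adj = m-adj }
    where open Matching M

  Matching-avoid : ∀ {k P} x → Matching (suc k) P → Matching k (λ v → P v × v ≢ x)
  Matching-avoid {k} {P} x M with any? (λ i → (mx i ≟ᶠ x) ⊎-dec (my i ≟ᶠ x))
    where open Matching M
  ... | no ¬e = record { Matching (Matching-sub {k' = k} suc suc-injective M)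
      ; mx-sat = λ i → mx-sat (suc i) , λ e → ¬e (suc i , inl e)
      ; my-sat = λ i → my-sat (suc i) , λ e → ¬e (suc i , inr e) }
    where open Matching M
  ... | yes (i₀ , h) = record { Matching (Matching-sub (punchIn i₀) (λ {i} {j} → punchIn-injective i₀ i j) M)
      ; mx-sat = λ i → mx-sat (punchIn i₀ i) , λ e → nx i e h
      ; my-sat = λ i → my-sat (punchIn i₀ i) , λ e → ny i e h } where
    open Matching M
    nx : ∀ i → mx (punchIn i₀ i) ≡ x → (mx i₀ ≡ x ⊎ my i₀ ≡ x) → ⊥
    nx i e (inl h) = punchInᵢ≢i i₀ i (mx-inj (e ∙ sym h))
    nx i e (inr h) = mxy _ _ (e ∙ sym h)
    ny : ∀ i → my (punchIn i₀ i) ≡ x → (mx i₀ ≡ x ⊎ my i₀ ≡ x) → ⊥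
    ny i e (inl h) = mxy _ _ (h ∙ sym e)
    ny i e (inr h) = punchInᵢ≢i i₀ i (my-inj (e ∙ sym h))

  copies-⊆ : ∀ {k P} → Matching k P →
    Σ (copies k (complete 2) ⊆ᴳ G) λ f → ∀ i → P (fst f i)
  copies-⊆ {zero} M = ((λ ()) , (λ ()) , λ ()) , λ ()
  copies-⊆ {suc k} {P} M = union-⊆ (complete 2) (copies k (complete 2)) K₂ (fst rest) disj , sat where
    open Matching M
    K₂ : complete 2 ⊆ᴳ G
    K₂ = complete-⊆ (λ { zero → mx zero ; (suc zero) → my zero })
      λ { {zero} {zero} ne → ⊥-elim (ne refl) ; {zero} {suc zero} _ → m-adj zero
        ; {suc zero} {zero} _ → Adj-sym (m-adj zero) ; {suc zero} {suc zero} ne → ⊥-elim (ne refl) }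
    rest : Σ (copies k (complete 2) ⊆ᴳ G) λ f → ∀ i → P (fst f i) × fst f i ≢ mx zero × fst f i ≢ my zero
    rest = copies-⊆ {P = λ v → P v × v ≢ mx zero × v ≢ my zero} record { Matching (Matching-sub suc suc-injective M)
      ; mx-sat = λ i → mx-sat (suc i) , (λ e → case mx-inj e of λ ()) , λ e → mxy _ _ e
      ; my-sat = λ i → my-sat (suc i) , (λ e → mxy _ _ (sym e)) , λ e → case my-inj e of λ () }
    disj : ∀ i j → fst K₂ i ≢ fst (fst rest) j
    disj zero       j e = fst (snd (snd rest j)) (sym e)
    disj (suc zero) j e = snd (snd (snd rest j)) (sym e)
    sat : ∀ i → P ([ fst K₂ , fst (fst rest) ]′ (splitAt 2 i))
    sat i with splitAt 2 i
    ... | inl zero       = mx-sat zero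
    ... | inl (suc zero) = my-sat zero
    ... | inr j          = fst (snd rest j)

  -- The part of a vertex `x` is `x % k`, which is the second component of `remQuot`; the first
  -- component numbers the vertices of that part.
  turan-⊆ : ∀ {m} k (B : Fin k → Fin m → V) → (∀ j {a b} → B j a ≡ B j b → a ≡ b) →
    (∀ {i j} a b → i ≢ j → Adj (B i a) (B j b)) → turan (m * k) k ⊆ᴳ G
  turan-⊆ {m} k B B-inj B-adj = f , f-inj , f-pres k f-adj where
    dec : Fin (m * k) → Fin m × Fin k
    dec = remQuot {m} k
    f : Fin (m * k) → V
    f x = B (snd (dec x)) (fst (dec x))
    f-inj : ∀ x y → f x ≡ f y → x ≡ y
    f-inj x y e with snd (dec x) ≟ᶠ snd (dec y)
    ... | no ne = ⊥-elim (Adj-≢ (B-adj (fst (dec x)) (fst (dec y)) ne) e)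
    ... | yes eq = sym (combine-remQuot {m} k x) ∙ trans
          (cong₂ combine (B-inj (snd (dec y)) (cong (λ j → B j (fst (dec x))) (sym eq) ∙ e)) eq)
          (combine-remQuot {m} k y)
    f-adj : ∀ x y → snd (dec x) ≢ snd (dec y) → Adj (f x) (f y)
    f-adj x y ne = B-adj _ _ ne
    f-pres : ∀ k → {f : Fin (m * k) → V} → (∀ x y → snd (remQuot {m} k x) ≢ snd (remQuot {m} k y) → Adj (f x) (f y)) →
      ∀ x y → adj (turan (m * k) k) x y ≡ true → Adj (f x) (f y)
    f-pres zero f-adj x y e = case snd (remQuot {m} zero x) of λ ()
    f-pres (suc k) {f} f-adj x y e = f-adj x y λ eq → diff (snd (fromRel-elim R {x} {y} e))
        (res x ∙ cong (λ z → toℕ z % suc k) eq ∙ sym (res y)) where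
      R : Fin (m * suc k) → Fin (m * suc k) → Bool
      R i j = not (toℕ i % suc k ≡ᵇ toℕ j % suc k)
      res : ∀ x → toℕ x % suc k ≡ toℕ (snd (remQuot {m} (suc k) x)) % suc k
      res x = cong (λ z → toℕ z % suc k) (sym (combine-remQuot {m} (suc k) x)) ∙
        cong (_% suc k) (toℕ-combine (fst p) (snd p) ∙ +-comm _ (toℕ (snd p)) ∙ cong (toℕ (snd p) +_) (*-comm (suc k) _)) ∙
          [m+kn]%n≡m%n (toℕ (snd p)) (toℕ (fst p)) (suc k)
        where p = remQuot {m} (suc k) x
      absurd : ∀ a b → a ≡ b → not (a ≡ᵇ b) ≡ true → ⊥
      absurd a b eq h = true≢false (≡⇒≡ᵇ-true eq) (not-true h)
      diff : R x y ≡ true ⊎ R y x ≡ true → toℕ x % suc k ≡ toℕ y % suc k → ⊥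
      diff (inl h) eq = absurd _ _ eq h
      diff (inr h) eq = absurd _ _ (sym eq) h

-- The forbidden graphs inside a complete r-partite frame.

Complete : ∀ {n} (G : Graph n) {r : ℕ} → (Fin r → Fin n → Set) → Set
Complete G In = ∀ {i j x y} → i ≢ j → In i x → In j y → adj G x y ≡ true

-- The parameters `ℓ = 2 + 2 * q` and `r = 2 + ρ` turn `ℓ / 2`, `ℓ ∸ 1`, `r ∸ 1` and `r ∸ 2` into
-- expressions without division or truncated subtraction.
record ForbiddenFree {n} (q ρ m : ℕ) (G : Graph n) : Set where
  field
    noF₁ : ¬ (((path (2 + 2 * q) ∪ᴳ edgeless m) ⊗ᴳ turan (m * suc ρ) (suc ρ)) ⊆ᴳ G)
    noF₂ : ¬ (((path 3 ∪ᴳ copies m (complete 2)) ⊗ᴳ copies m (complete 2) ⊗ᴳ turan (m * ρ) ρ) ⊆ᴳ G)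
    noF₃ : ¬ (((complete (suc q) ∪ᴳ complete (suc (2 * q)) ∪ᴳ edgeless m) ⊗ᴳ turan (m * suc ρ) (suc ρ)) ⊆ᴳ G)

module Widths (q m : ℕ) where
  opaque
    -- A part size that suffices for all embeddings: `3 * ℓ + m`. The inequalities that follow list
    -- the demands made on it.
    width : ℕ
    width = 3 * (2 + 2 * q) + m

    m≤width : m ≤ width
    m≤width = m≤n+m m (3 * (2 + 2 * q))

    path-width : 2 + 2 * q + m ≤ width
    path-width = +-monoˡ-≤ m (m≤m+n (2 + 2 * q) _)

    clique-width : suc q + suc (2 * q) + m ≤ width
    clique-width = +-monoˡ-≤ m (lin {t = 0} (3 * q + 4) ≤-refl (lem q)) where
      lem : ∀ q → suc q + suc (2 * q) + 0 + (3 * q + 4) ≡ 3 * (2 + 2 * q) + 0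
      lem = solve-∀

    zigzag-width : suc (2 * suc q) ≤ width
    zigzag-width = lin {t = 0} (4 * q + 3 + m) ≤-refl (lem q m) where
      lem : ∀ q m → suc (2 * suc q) + 0 + (4 * q + 3 + m) ≡ 3 * (2 + 2 * q) + m + 0
      lem = solve-∀

    arms-width : 5 + 4 * q ≤ width
    arms-width = lin {t = 0} (2 * q + 1 + m) ≤-refl (lem q m) where
      lem : ∀ q m → 5 + 4 * q + 0 + (2 * q + 1 + m) ≡ 3 * (2 + 2 * q) + m + 0
      lem = solve-∀

    matching-width : 3 + m ≤ width
    matching-width = +-monoˡ-≤ m (lin {t = 0} (6 * q + 3) ≤-refl (lem q)) where
      lem : ∀ q → 3 + 0 + (6 * q + 3) ≡ 3 * (2 + 2 * q) + 0
      lem = solve-∀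

module Blobs {n : ℕ} (q ρ m : ℕ) (G : Graph n) (free : ForbiddenFree q ρ m G) where
  open Graphs G
  open Embeddings G
  open ForbiddenFree free
  open Widths q m renaming (width to w)

  private
    r ℓ : ℕ
    r = suc (suc ρ)
    ℓ = 2 + 2 * q

  -- A frame of `r` mutually joined parts in which part `i` is a special set and the others are
  -- ordinary rows. Most of the forbidden graphs below are located in such a frame.
  module Centred (i : Fin r) (Core : V → Set) (Row : Fin r → V → Set)
      (core-row : ∀ {j x y} → j ≢ i → Core x → Row j y → Adj x y) (row-row : ∀ {j j' x y} → j ≢ j' → Row j x → Row j' y → Adj x y)
      (core-many : Many w Core) (row-many : ∀ j → j ≢ i → Many w (Row j)) where
    In : Fin r → V → Set
    In j x = (j ≡ i × Core x) ⊎ (j ≢ i × Row j x)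

    complete-In : Complete G In
    complete-In ne (inl (refl , _)) (inl (refl , _)) = ⊥-elim (ne refl)
    complete-In ne (inl (refl , c)) (inr (ne' , p)) = core-row ne' c p
    complete-In ne (inr (ne' , p)) (inl (refl , c)) = Adj-sym (core-row ne' c p)
    complete-In ne (inr (_ , p)) (inr (_ , p')) = row-row ne p p'

    rich : ∀ j → Many w (In j)
    rich j = go (j ≟ᶠ i) where
      go : Dec (j ≡ i) → Many w (In j)
      go (yes refl) = Many-map (λ c → inl (refl , c)) core-many
      go (no ne)    = Many-map (λ p → inr (ne , p)) (row-many j ne)

  module _ (In : Fin r → V → Set) (complete-In : Complete G In) (rich : ∀ j → Many w (In j)) where

    private
      rows : (i₀ : Fin r) → Σ (turan (m * suc ρ) (suc ρ) ⊆ᴳ G) λ f → ∀ {x} j → In i₀ x → Adj x (fst f j)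
      rows i₀ = turan-⊆ (suc ρ) (λ j → Many.at (row j)) (λ j → Many.at-inj (row j))
          (λ a b ne → complete-In (λ e → ne (punchIn-injective i₀ _ _ e)) (Many.at-sat (row _) a) (Many.at-sat (row _) b)) ,
        λ j h → complete-In (λ e → punchInᵢ≢i i₀ _ (sym e)) h (Many.at-sat (row _) _) where
        row : (j : Fin (suc ρ)) → Many m (In (punchIn i₀ j))
        row j = Many-≤ m≤width (rich (punchIn i₀ j))

    -- The first `ℓ` vertices of the path and `m` further vertices of the same part form the left
    -- factor of `F₁`; the other `r - 1` parts supply the Turán factor.
    F₁-blob : ∀ i₀ {x xs y} → Path x xs y → Unique xs → (∀ {v} → v ∈ xs → In i₀ v) → ℓ ≤ length xs → ⊥
    F₁-blob i₀ {x} {xs} p u sat len with Path-take p (suc (2 * q)) len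
    ... | ys , z , p' , len' , sub , uniq = noF₁ (join-⊆ (path ℓ ∪ᴳ edgeless m) (turan (m * suc ρ) (suc ρ))
        (union-⊆ (path ℓ) (edgeless m) P (edgeless-⊆ K̄) λ i j e → snd (Many.at-sat K̄ j) (subst (_∈ ys) e (snd Pℓ i)))
        (fst (rows i₀)) λ i j → snd (rows i₀) j (left i)) where
      K̄ : Many m (λ v → In i₀ v × v ∉ ys)
      K̄ = avoid ys (Many-≤ (cong (_+ m) len' =& path-width) (rich i₀))
      Pℓ = path-⊆ ℓ len' p' (uniq u)
      P : path ℓ ⊆ᴳ G
      P = fst Pℓ
      left : ∀ i → In i₀ ([ fst P , Many.at K̄ ]′ (splitAt ℓ i))
      left i with splitAt ℓ i
      ... | inl j = sat (sub (snd Pℓ j))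
      ... | inr j = fst (Many.at-sat K̄ j)

    private
      F₂-assemble : (P₃ : path 3 ⊆ᴳ G) (C₀ C₁ : copies m (complete 2) ⊆ᴳ G) (Tρ : turan (m * ρ) ρ ⊆ᴳ G) →
        (∀ i j → fst P₃ i ≢ fst C₀ j) → (∀ i j → Adj (fst C₁ i) (fst Tρ j)) →
        (∀ i j → Adj (fst P₃ i) (fst C₁ j)) → (∀ i j → Adj (fst P₃ i) (fst Tρ j)) →
        (∀ i j → Adj (fst C₀ i) (fst C₁ j)) → (∀ i j → Adj (fst C₀ i) (fst Tρ j)) → ⊥
      F₂-assemble P₃ C₀ C₁ Tρ disj c₁t pc₁ pt c₀c₁ c₀t = noF₂
        (join-⊆ (path 3 ∪ᴳ copies m (complete 2)) (copies m (complete 2) ⊗ᴳ turan (m * ρ) ρ)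
          (union-⊆ (path 3) (copies m (complete 2)) P₃ C₀ disj)
          (join-⊆ (copies m (complete 2)) (turan (m * ρ) ρ) C₁ Tρ c₁t) cross) where
        cross : ∀ i j → Adj ([ fst P₃ , fst C₀ ]′ (splitAt 3 i)) ([ fst C₁ , fst Tρ ]′ (splitAt (m * 2) j))
        cross i j with splitAt 3 i | splitAt (m * 2) j
        ... | inl a | inl b = pc₁ a b
        ... | inl a | inr b = pt a b
        ... | inr a | inl b = c₀c₁ a b
        ... | inr a | inr b = c₀t a b

    -- A cherry meets at most three edges of a matching, so `3 + m` matching edges leave `m`
    -- disjoint from it.
    F₂-blob : ∀ {i₀ i₁} → i₀ ≢ i₁ → ∀ {a b c} → Adj a b → Adj b c → a ≢ c → In i₀ a → In i₀ b → In i₀ c →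
      Matching (3 + m) (In i₀) → Matching m (In i₁) → ⊥
    F₂-blob {i₀} {i₁} ne {a} {b} {c} ab bc a≢c ha hb hc M₀ M₁ = go
      (path-⊆ 3 refl (ab ∷ (bc ∷ [ c ])) ((Adj-≢ ab ∷ a≢c ∷ []) ∷ (Adj-≢ bc ∷ []) ∷ [] ∷ []))
      (copies-⊆ (Matching-map {Q = λ v → In i₀ v × v ∉ a ∷ b ∷ c ∷ []} (λ { (((h , a≢) , b≢) , c≢) → h , λ { (here e) → a≢ e ; (there (here e)) → b≢ e ; (there (there (here e))) → c≢ e } })
        (Matching-avoid c (Matching-avoid b (Matching-avoid a M₀)))))
      (copies-⊆ M₁)
      (turan-⊆ ρ (λ j → Many.at (row j)) (λ j → Many.at-inj (row j))
          (λ a b ne' → complete-In (λ e → ne' (punchIn-injective _ _ _ (punchIn-injective i₀ _ _ e))) (Many.at-sat (row _) a) (Many.at-sat (row _) b)) ,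
       λ j → snd (remQuot {m} ρ j) , Many.at-sat (row _) _) where
      idx : Fin ρ → Fin r
      idx j = punchIn i₀ (punchIn (punchOut ne) j)
      idx≢₀ : ∀ j → i₀ ≢ idx j
      idx≢₀ j e = punchInᵢ≢i i₀ _ (sym e)
      idx≢₁ : ∀ j → i₁ ≢ idx j
      idx≢₁ j e = punchInᵢ≢i (punchOut ne) j (punchIn-injective i₀ _ _ (sym e ∙ sym (punchIn-punchOut ne)))
      row : (j : Fin ρ) → Many m (In (idx j))
      row j = Many-≤ m≤width (rich (idx j))
      abc : ∀ {v} → v ∈ a ∷ b ∷ c ∷ [] → In i₀ v
      abc (here refl) = ha
      abc (there (here refl)) = hb
      abc (there (there (here refl))) = hc
      go : (Σ (path 3 ⊆ᴳ G) λ f → ∀ i → fst f i ∈ a ∷ b ∷ c ∷ []) →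
           (Σ (copies m (complete 2) ⊆ᴳ G) λ f → ∀ i → In i₀ (fst f i) × fst f i ∉ a ∷ b ∷ c ∷ []) →
           (Σ (copies m (complete 2) ⊆ᴳ G) λ f → ∀ i → In i₁ (fst f i)) →
           (Σ (turan (m * ρ) ρ ⊆ᴳ G) λ f → ∀ i → ∃ λ j → In (idx j) (fst f i)) → ⊥
      go (P₃ , p) (C₀ , c₀) (C₁ , c₁) (Tρ , t) = F₂-assemble P₃ C₀ C₁ Tρ
        (λ i j e → snd (c₀ j) (subst (_∈ a ∷ b ∷ c ∷ []) e (p i)))
        (λ i j → complete-In (idx≢₁ _) (c₁ i) (snd (t j)))
        (λ i j → complete-In ne (abc (p i)) (c₁ j))
        (λ i j → complete-In (idx≢₀ _) (abc (p i)) (snd (t j)))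
        (λ i j → complete-In ne (fst (c₀ i)) (c₁ j))
        (λ i j → complete-In (idx≢₀ _) (fst (c₀ i)) (snd (t j)))

    private
      F₃-assemble : (A : complete (suc q) ⊆ᴳ G) (B : complete (suc (2 * q)) ⊆ᴳ G) (C : edgeless m ⊆ᴳ G)
        (Tρ : turan (m * suc ρ) (suc ρ) ⊆ᴳ G) →
        (∀ i j → fst A i ≢ fst B j) → (∀ i j → fst A i ≢ fst C j) → (∀ i j → fst B i ≢ fst C j) →
        (∀ i j → Adj (fst A i) (fst Tρ j)) → (∀ i j → Adj (fst B i) (fst Tρ j)) →
        (∀ i j → Adj (fst C i) (fst Tρ j)) → ⊥
      F₃-assemble A B C Tρ ab ac bc at bt ct = noF₃
        (join-⊆ (complete (suc q) ∪ᴳ complete (suc (2 * q)) ∪ᴳ edgeless m) (turan (m * suc ρ) (suc ρ))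
          (union-⊆ (complete (suc q)) (complete (suc (2 * q)) ∪ᴳ edgeless m) A
            (union-⊆ (complete (suc (2 * q))) (edgeless m) B C bc) disj) Tρ cross) where
        disj : ∀ i j → fst A i ≢ [ fst B , fst C ]′ (splitAt (suc (2 * q)) j)
        disj i j with splitAt (suc (2 * q)) j
        ... | inl k = ab i k
        ... | inr k = ac i k
        cross : ∀ i j → Adj ([ fst A , (λ k → [ fst B , fst C ]′ (splitAt (suc (2 * q)) k)) ]′ (splitAt (suc q) i)) (fst Tρ j)
        cross i j with splitAt (suc q) i
        ... | inl k = at k j
        ... | inr k with splitAt (suc (2 * q)) k
        ...   | inl k' = bt k' j
        ...   | inr k' = ct k' j

    -- The two cliques have the sizes `ℓ / 2` and `ℓ ∸ 1`; the rest of the left factor is taken from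
    -- the same part, away from both.
    F₃-blob : ∀ i₀ (c : Fin (suc q) → V) (e : Fin (suc (2 * q)) → V) →
      (∀ {i j} → i ≢ j → Adj (c i) (c j)) → (∀ {i j} → i ≢ j → Adj (e i) (e j)) → (∀ i j → c i ≢ e j) →
      (∀ i → In i₀ (c i)) → (∀ i → In i₀ (e i)) → ⊥
    F₃-blob i₀ c e c-adj e-adj c≢e c-in e-in = F₃-assemble (complete-⊆ c c-adj) (complete-⊆ e e-adj) (edgeless-⊆ K̄) (fst (rows i₀))
      c≢e
      (λ i j eq → snd (Many.at-sat K̄ j) (subst (_∈ _) eq (∈-++⁺ˡ (∈-tabulate⁺ {f = c} i))))
      (λ i j eq → snd (Many.at-sat K̄ j) (subst (_∈ _) eq (∈-++⁺ʳ (tabulate c) (∈-tabulate⁺ {f = e} i))))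
      (λ i j → snd (rows i₀) j (c-in i)) (λ i j → snd (rows i₀) j (e-in i))
      (λ i j → snd (rows i₀) j (fst (Many.at-sat K̄ i))) where
      K̄ : Many m (λ v → In i₀ v × v ∉ tabulate c ++ tabulate e)
      K̄ = avoid (tabulate c ++ tabulate e) (Many-≤ (cong (_+ m) (length-++ (tabulate c) ∙
        (cong₂ _+_ (length-tabulate c) (length-tabulate e))) =& clique-width) (rich i₀))

-- A complete `k`-partite graph with parts of size `M`, as a subgraph: edges inside a row are
-- permitted.
record Rows {n} (G : Graph n) (k M : ℕ) : Set where
  field
    cell     : Fin k → Fin M → Fin n
    cell-inj : ∀ j {a b} → cell j a ≡ cell j b → a ≡ b
    cell-adj : ∀ {i j} a b → i ≢ j → adj G (cell i a) (cell j b) ≡ true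

∑-swap₃ : ∀ {n k M} (f : Fin n → Fin k → Fin M → ℕ) →
  ∑ (λ v → ∑ (λ i → ∑ (f v i))) ≡ ∑ (λ i → ∑ (λ a → ∑ (λ v → f v i a)))
∑-swap₃ f = ∑-comm (λ v i → ∑ (f v i)) ∙ (∑-cong λ i → ∑-comm λ v a → f v i a)

∑-≤const : ∀ {n} {f : Fin n → ℕ} c → (∀ i → f i ≤ c) → ∑ f ≤ n * c
∑-≤const {n} c h = ∑-mono h &= ∑-const n c

𝟙-∧ : ∀ a b → 𝟙 (a ∧ b) ≡ 𝟙 a * 𝟙 b
𝟙-∧ true  b = sym (+-identityʳ _)
𝟙-∧ false b = refl

≤-𝟙* : ∀ b {x y} → (b ≡ true → x ≤ y) → 𝟙 b * x ≤ 𝟙 b * y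
≤-𝟙* true  h = +-monoˡ-≤ 0 (h refl)
≤-𝟙* false h = z≤n

#-∑* : ∀ {n} c (P : Fin n → Bool) → ∑ (λ v → 𝟙 (P v) * c) ≡ # P * c
#-∑* c P = (∑-cong λ v → *-comm (𝟙 (P v)) c) ∙ ∑-*ˡ c (λ v → 𝟙 (P v)) ∙ cong (c *_) (sym (#-∑ P)) ∙ *-comm c (# P)

-- Large complete r-partite subgraphs from high minimum degree.

module TuranConst (ρ : ℕ) where
  private
    r : ℕ
    r = suc (suc ρ)

  opaque
    R R' : ℕ
    R  = 2 * (r * r)
    R' = 2 * r + 1

    R-def : R ≡ 2 * (r * r)
    R-def = refl

    R'-def : R' ≡ 2 * r + 1
    R'-def = refl

    1≤R : 1 ≤ R
    1≤R = s≤s z≤n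

    R-ineq : ∀ g b → g + b + (suc ρ * (R' * (g + b)) + b) ≤ R * g + R * b
    R-ineq g b = lin {t = 0} (suc ρ * (g + b) + g) ≤-refl (lem ρ g b) where
      lem : ∀ ρ g b → g + b + (suc ρ * ((2 * suc (suc ρ) + 1) * (g + b)) + b) + 0 + (suc ρ * (g + b) + g)
                    ≡ 2 * (suc (suc ρ) * suc (suc ρ)) * g + 2 * (suc (suc ρ) * suc (suc ρ)) * b + 0
      lem = solve-∀

  -- The recursion mirrors `rows-in`: `s` rows of length `R * M` are found first, then enough good
  -- vertices for one more row.
  ks-bound : ℕ → ℕ → ℕ
  ks-bound zero    M = 0
  ks-bound (suc s) M = ks-bound s (R * M) ⊔ (R * (2 ^ (s * (R * M)) * M))


open Rows public

module Cells {n : ℕ} (G : Graph n) where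
  open Graphs G
  open Embeddings G

  dR : ∀ {k M} → Rows G k M → V → Fin k → ℕ
  dR A v i = # (λ a → adj G v (cell A i a))

  nR : ∀ {k M} → Rows G k M → V → Fin k → ℕ
  nR A v i = # (λ a → not (adj G v (cell A i a)))

  dR+nR : ∀ {k M} (A : Rows G k M) v i → dR A v i + nR A v i ≡ M
  dR+nR A v i = #-∁ (λ a → adj G v (cell A i a))

  ∑-dR : ∀ {k M} (A : Rows G k M) (X : V → Bool) →
    ∑ (λ v → 𝟙 (X v) * ∑ (dR A v)) ≡ ∑ (λ i → ∑ (λ a → d (cell A i a) X))
  ∑-dR A X = (∑-cong λ v → sym (∑-*ˡ (𝟙 (X v)) (dR A v)) ∙ (∑-cong λ i →
      cong (𝟙 (X v) *_) (#-∑ (λ a → adj G v (cell A i a))) ∙ sym (∑-*ˡ (𝟙 (X v)) (λ a → 𝟙 (adj G v (cell A i a)))))) ∙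
    ∑-swap₃ (λ v i a → 𝟙 (X v) * 𝟙 (adj G v (cell A i a))) ∙ (∑-cong λ i → ∑-cong λ a →
      (∑-cong λ v → cong (λ b → 𝟙 (X v) * 𝟙 b) (adj-sym G v (cell A i a)) ∙ *-comm (𝟙 (X v)) _ ∙ sym (𝟙-∧ (adj G (cell A i a) v) (X v))) ∙
        sym (#-∑ (adj G (cell A i a) ∩ X)))

  nd : V → (V → Bool) → ℕ
  nd v X = # (X ∩ ∁ (adj G v))

  ∑-nR : ∀ {k M} (A : Rows G k M) (X : V → Bool) →
    ∑ (λ v → 𝟙 (X v) * ∑ (nR A v)) ≡ ∑ (λ i → ∑ (λ a → nd (cell A i a) X))
  ∑-nR A X = (∑-cong λ v → sym (∑-*ˡ (𝟙 (X v)) (nR A v)) ∙ (∑-cong λ i →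
      cong (𝟙 (X v) *_) (#-∑ (λ a → not (adj G v (cell A i a)))) ∙ sym (∑-*ˡ (𝟙 (X v)) (λ a → 𝟙 (not (adj G v (cell A i a))))))) ∙
    ∑-swap₃ (λ v i a → 𝟙 (X v) * 𝟙 (not (adj G v (cell A i a)))) ∙ (∑-cong λ i → ∑-cong λ a →
      (∑-cong λ v → cong (λ b → 𝟙 (X v) * 𝟙 (not b)) (adj-sym G v (cell A i a)) ∙ sym (𝟙-∧ (X v) (not (adj G (cell A i a) v)))) ∙
        sym (#-∑ (X ∩ ∁ (adj G (cell A i a)))))

  subRows : ∀ {k M M'} (A : Rows G k M) (P : Fin k → Fin M → Bool) → (∀ i → M' ≤ # (P i)) →
    Σ (Rows G k M') λ B → ∀ i a → ∃ λ b → cell B i a ≡ cell A i b × P i b ≡ true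
  subRows {M' = M'} A P h = record
    { cell = λ i a → cell A i (Many.at (σ i) a)
    ; cell-inj = λ i e → Many.at-inj (σ i) (cell-inj A i e)
    ; cell-adj = λ a b ne → cell-adj A _ _ ne } , λ i a → Many.at (σ i) a , refl , Many.at-sat (σ i) a where
    σ : ∀ i → Many M' (λ a → P i a ≡ true)
    σ i = pick M' (P i) (h i)

  -- Among many vertices with large neighbourhoods in every row, sufficiently many have
  -- the same neighbourhood; they form the new row.
  extend : ∀ {s M'} M → 1 ≤ M → (A : Rows G s M') (X : V → Bool) → (∀ v → X v ≡ true → ∀ i → M ≤ dR A v i) →
    2 ^ (s * M') * M ≤ # X →
    Σ (Rows G (suc s) M) λ B → (∀ a → X (cell B zero a) ≡ true) × (∀ i a → ∃ λ b → cell B (suc i) a ≡ cell A i b)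
  extend {s} {M'} M M≥1 A X deg big with homog (s * M') (λ k v → adj G v (cell A (fst (remQuot M' k)) (snd (remQuot {s} M' k)))) M X big
  ... | X' , sub , big' , hom = record { cell = cell' ; cell-inj = inj' ; cell-adj = adj' } , (λ a → sub _ (sat a)) , λ i a → fst (snd old i a) , fst (snd (snd old i a)) where
    open Many (pick M X' big') renaming (at to σ; at-inj to σ-inj; at-sat to sat)
    v₀ : V
    v₀ = σ (fromℕ< M≥1)
    old = subRows {M' = M} A (λ i a → adj G v₀ (cell A i a)) (λ i → deg v₀ (sub _ (sat (fromℕ< M≥1))) i)
    same : ∀ v → X' v ≡ true → ∀ i a → adj G v (cell A i a) ≡ adj G v₀ (cell A i a)
    same v xv i a = subst (λ p → adj G v (cell A (fst p) (snd p)) ≡ adj G v₀ (cell A (fst p) (snd p)))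
      (remQuot-combine i a) (hom (combine i a) v v₀ xv (sat _))
    cell' : Fin (suc s) → Fin M → V
    cell' zero    = σ
    cell' (suc i) = cell (fst old) i
    inj' : ∀ j {a b} → cell' j a ≡ cell' j b → a ≡ b
    inj' zero    = σ-inj
    inj' (suc j) = cell-inj (fst old) j
    new-old : ∀ a j b → Adj (σ a) (cell (fst old) j b)
    new-old a j b with snd old j b
    ... | b' , eq , h = subst (Adj (σ a)) (sym eq) (same (σ a) (sat a) j b' ∙ h)
    adj' : ∀ {i j} a b → i ≢ j → Adj (cell' i a) (cell' j b)
    adj' {zero}  {zero}  a b ne = ⊥-elim (ne refl)
    adj' {zero}  {suc j} a b ne = new-old a j b
    adj' {suc i} {zero}  a b ne = Adj-sym (new-old b i a)
    adj' {suc i} {suc j} a b ne = cell-adj (fst old) a b (ne ∘ cong suc)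

  module Turan (ρ : ℕ) where
    r : ℕ
    r = suc (suc ρ)

    open TuranConst ρ

    -- The permitted proportion of non-neighbours is `(2r + 1) / (2r²)`, slightly above `1/r` and
    -- below `1/(r - 1)`. This still forces `r` mutually joined rows, and it leaves slack for
    -- discarding some vertices.
    Dense : (V → Bool) → Set
    Dense X = ∀ v → X v ≡ true → R * nd v X ≤ R' * # X

    -- Count non-adjacent pairs between `X` and the rows. A vertex that is not good misses all but
    -- fewer than `M` of the `R * M` cells of some row, whereas each cell misses only the proportion
    -- allowed by `Dense`; with at most `r - 1` rows this cannot account for nearly all of `X`.
    good-many : ∀ {s} M → 1 ≤ M → s ≤ suc ρ → (X : V → Bool) → Dense X → (A : Rows G s (R * M)) →
      (∀ i a → X (cell A i a) ≡ true) →
      # X ≤ R * # (X ∩ set λ v → all? λ i → M ≤? dR A v i)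
    good-many {s} M M≥1 s≤ X dense A inX = final where
      Good : V → Bool
      Good = set λ v → all? (λ i → M ≤? dR A v i)
      g b x : ℕ
      g = # (X ∩ Good)
      b = # (X ∩ ∁ Good)
      x = # X
      x≡ : x ≡ g + b
      x≡ = #-split X Good
      S : ℕ
      S = ∑ (λ v → 𝟙 (X v) * ∑ (nR A v))
      pointwise : ∀ v → 𝟙 ((X ∩ ∁ Good) v) * (R * M) ≤ 𝟙 (X v) * ∑ (nR A v) + 𝟙 ((X ∩ ∁ Good) v) * M
      pointwise v with X v | Good v in eg
      ... | false | _ = z≤n
      ... | true | true = z≤n
      ... | true | false with any? (λ i → ¬? (M ≤? dR A v i))
      ...   | no ¬any = ⊥-elim (set-false (λ v → all? λ i → M ≤? dR A v i) eg λ i →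
              case M ≤? dR A v i of λ { (yes p) → p ; (no ¬p) → ⊥-elim (¬any (i , ¬p)) })
      ...   | yes (i , small) = +-identityʳ (R * M) =& sym (dR+nR A v i) =&
              +-mono-≤ (<⇒≤ (≰⇒> small)) (∑-term (nR A v) i) &= lem M (∑ (nR A v)) where
        lem : ∀ m s → m + s ≡ s + 0 + (m + 0)
        lem = solve-∀
      count : b * (R * M) ≤ S + b * M
      count = subst₂ _≤_ (#-∑* (R * M) (X ∩ ∁ Good))
        (∑-distrib-+ (λ v → 𝟙 (X v) * ∑ (nR A v)) (λ v → 𝟙 ((X ∩ ∁ Good) v) * M) ∙ cong (S +_) (#-∑* M (X ∩ ∁ Good)))
        (∑-mono pointwise)
      S≤ : R * S ≤ s * (R * M * (R' * x))
      S≤ = (cong (R *_) (∑-nR A X) ∙ sym (∑-*ˡ R λ i → ∑ (λ a → nd (cell A i a) X)) ∙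
          (∑-cong λ i → sym (∑-*ˡ R λ a → nd (cell A i a) X))) =&
        (∑-≤const _ λ i → ∑-≤const _ λ a → dense _ (inX i a))
      step : R * b ≤ s * (R' * x) + b
      step = *-cancelˡ-≤ (R * M) {{m*n≢0 R M {{>-nonZero 1≤R}} {{>-nonZero M≥1}}}} (lem₁ R M b =&
        *-monoʳ-≤ R count & *-distribˡ-+ R S (b * M) =&
        +-monoˡ-≤ _ S≤ &= lem₂ R M b s (R' * x)) where
        lem₁ : ∀ R M b → R * M * (R * b) ≡ R * (b * (R * M))
        lem₁ = solve-∀
        lem₂ : ∀ R M b s y → s * (R * M * y) + R * (b * M) ≡ R * M * (s * y + b)
        lem₂ = solve-∀
      final : x ≤ R * g
      final = subst (_≤ R * g) (sym x≡) (+-cancelʳ-≤ (R * b) _ _ (≤-trans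
        (+-monoʳ-≤ (g + b) (step & +-monoˡ-≤ b (*-monoˡ-≤ (R' * x) s≤ &= cong (λ y → suc ρ * (R' * y)) x≡)))
        (R-ineq g b)))

    -- The inductive proof of the Erdős-Stone theorem: the rows found first are longer by the factor
    -- `R`, so that each good vertex retains `M` neighbours in every one of them.
    rows-in : ∀ s M → 1 ≤ M → s ≤ r → (X : V → Bool) → Dense X → ks-bound s M ≤ # X →
      Σ (Rows G s M) λ A → ∀ i a → X (cell A i a) ≡ true
    rows-in zero M _ _ X dense _ = record { cell = λ () ; cell-inj = λ () ; cell-adj = λ { {()} } } , λ ()
    rows-in (suc s) M M≥1 s<r X dense big = step (rows-in s (R * M) RM≥1 (<⇒≤ s<r) X dense (m≤m⊔n _ _ & big)) where
      RM≥1 : 1 ≤ R * M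
      RM≥1 = *-mono-≤ {1} {R} {1} {M} 1≤R M≥1
      step : Σ (Rows G s (R * M)) (λ A → ∀ i a → X (cell A i a) ≡ true) → Σ (Rows G (suc s) M) λ A → ∀ i a → X (cell A i a) ≡ true
      step (A , inX) = fst ext , λ { zero a → ∧-elimˡ (fst (snd ext) a)
                                     ; (suc i) a → subst (λ v → X v ≡ true) (sym (snd (snd (snd ext) i a))) (inX i _) } where
        Good : V → Bool
        Good = set λ v → all? (λ i → M ≤? dR A v i)
        enough : 2 ^ (s * (R * M)) * M ≤ # (X ∩ Good)
        enough = *-cancelˡ-≤ R {{>-nonZero 1≤R}} ((m≤n⊔m (ks-bound s (R * M)) _ & big) & good-many M M≥1 (s≤s⁻¹ s<r) X dense A inX)
        ext = extend M M≥1 A (X ∩ Good) (λ v e → set⁻ (λ v → all? λ i → M ≤? dR A v i) (∧-elimʳ {X v} e)) enough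

#-list≤ : ∀ {n k} (f : Fin k → Fin n) → # (memᵇ (tabulate f)) ≤ k
#-list≤ f = #-memᵇ≤ (tabulate f) &= length-tabulate f

module Zigzag {n : ℕ} (G : Graph n) where
  open Graphs G

  -- Lengthens a walk at its front by alternating the given vertices ws with fresh cells.
  zigzag : ∀ {Cell : V → Set} {k} → Many k Cell → ∀ ws {x xs e} → Path x xs e → Unique xs → Unique ws →
    (∀ {v} → v ∈ ws → v ∉ xs) → (∀ {v} → v ∈ ws → Adj v x) → (∀ {y v} → Cell y → v ∈ ws → Adj y v) →
    length xs + 2 * length ws ≤ k →
    ∃ λ y → ∃ λ ys → Path y ys e × Unique ys × length ys ≡ length xs + 2 * length ws ×
      (∀ {v} → v ∈ ys → v ∈ xs ⊎ v ∈ ws ⊎ Cell v) × (y ≡ x ⊎ Cell y)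
  zigzag m [] {x} {xs} p u _ _ _ _ _ = x , xs , p , u , sym (+-identityʳ _) , inl , inl refl
  zigzag m (v ∷ ws) {x} {xs} p u uw@(_ ∷ uw') disj vx cell le
    with fresh xs (lin {t = 0} (suc (2 * length ws)) ≤-refl (lem (length xs) (length ws)) & le) m where
    lem : ∀ a b → suc a + 0 + suc (2 * b) ≡ a + 2 * suc b + 0
    lem = solve-∀
  ... | y , cy , y∉ with zigzag m ws {y} {y ∷ v ∷ xs} (cell cy (here refl) ∷ (vx (here refl) ∷ p))
        (∉⇒All≢ (∈-∷-∉ (Adj-≢ (cell cy (here refl))) y∉) ∷ (∉⇒All≢ (disj (here refl)) ∷ u)) uw'
        (λ m → ∈-∷-∉ (Adj-≢ (Adj-sym (cell cy (there m)))) (∈-∷-∉ (λ { refl → Unique-∷⁻ uw m }) (disj (there m))))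
        (λ m → Adj-sym (cell cy (there m))) (λ cy m → cell cy (there m))
        (lem (length xs) (length ws) =& le) where
    lem : ∀ a b → suc (suc a) + 2 * b ≡ a + 2 * suc b
    lem = solve-∀
  ...   | z , ys , p' , u' , len , inc , front = z , ys , p' , u' , len ∙ lem (length xs) (length ws) , inc' , inr ([ (λ { refl → cy }) , id ]′ front) where
    lem : ∀ a b → suc (suc a) + 2 * b ≡ a + 2 * suc b
    lem = solve-∀
    inc' : ∀ {a} → a ∈ ys → a ∈ xs ⊎ a ∈ v ∷ ws ⊎ _
    inc' m with inc m
    ... | inl (here refl)         = inr (inr cy)
    ... | inl (there (here refl)) = inr (inl (here refl))
    ... | inl (there (there h))   = inl h
    ... | inr (inl h)            = inr (inl (there h))
    ... | inr (inr h)            = inr (inr h)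

-- A partition is a map to `Maybe (Fin r)`, where `nothing` marks the exceptional vertices:
-- unclassified ones at first, apexes later.
is : ∀ {r} → Fin r → Maybe (Fin r) → Bool
is i nothing  = false
is i (just j) = does (j ≟ᶠ i)

is⁻ : ∀ {r} (i : Fin r) c → is i c ≡ true → c ≡ just i
is⁻ i (just j) e = cong just (from-does (j ≟ᶠ i) e)

is⁺ : ∀ {r} (i : Fin r) {c} → c ≡ just i → is i c ≡ true
is⁺ i refl = dec-true (i ≟ᶠ i) refl

isN : ∀ {r} → Maybe (Fin r) → Bool
isN nothing  = true
isN (just _) = false

isN⁻ : ∀ {r} (c : Maybe (Fin r)) → isN c ≡ true → c ≡ nothing
isN⁻ nothing _ = refl

∑-is : ∀ {r} (c : Maybe (Fin r)) → ∑ (λ i → 𝟙 (is i c)) + 𝟙 (isN c) ≡ 1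
∑-is {r} nothing = cong (_+ 1) (∑-zero {r} λ _ → refl)
∑-is {r} (just j) = +-identityʳ _ ∙ ∑-remove (λ i → 𝟙 (does (j ≟ᶠ i))) j ∙
  (cong₂ _+_ (cong 𝟙 (dec-true (j ≟ᶠ j) refl)) (∑-zero λ i → other i)) where
  other : ∀ i → 𝟙 (not (does (i ≟ᶠ j))) * 𝟙 (does (j ≟ᶠ i)) ≡ 0
  other i with i ≟ᶠ j | j ≟ᶠ i
  ... | yes _ | _ = refl
  ... | no _  | no _ = refl
  ... | no ne | yes e = ⊥-elim (ne (sym e))

∑-classes : ∀ {n r} (P : Fin n → Bool) (c : Fin n → Maybe (Fin r)) →
  ∑ (λ i → # (P ∩ (is i ∘ c))) + # (P ∩ (isN ∘ c)) ≡ # P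
∑-classes P c = (cong₂ _+_ ((∑-cong λ i → (#-∑ (P ∩ (is i ∘ c))) ∙ (∑-cong λ v → 𝟙-∧ (P v) (is i (c v)))) ∙
      ∑-comm (λ i v → 𝟙 (P v) * 𝟙 (is i (c v))) ∙ (∑-cong λ v → ∑-*ˡ (𝟙 (P v)) (λ i → 𝟙 (is i (c v)))))
    ((#-∑ (P ∩ (isN ∘ c))) ∙ (∑-cong λ v → 𝟙-∧ (P v) (isN (c v))))) ∙
  sym (∑-distrib-+ (λ v → 𝟙 (P v) * ∑ (λ i → 𝟙 (is i (c v)))) (λ v → 𝟙 (P v) * 𝟙 (isN (c v)))) ∙
    (∑-cong λ v → sym (*-distribˡ-+ (𝟙 (P v)) (∑ (λ i → 𝟙 (is i (c v)))) _) ∙ cong (𝟙 (P v) *_) (∑-is (c v)) ∙ *-identityʳ _) ∙ sym (#-∑ P)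

∑-classes≤ : ∀ {n r} (P : Fin n → Bool) (c : Fin n → Maybe (Fin r)) → ∑ (λ i → # (P ∩ (is i ∘ c))) ≤ # P
∑-classes≤ P c = m≤m+n _ _ &= ∑-classes P c

large-class : ∀ {k r} M → 1 ≤ M → suc r * M ≤ k → (c : Fin k → Fin (suc r)) → ∃ λ i → M ≤ # (λ a → is i (just (c a)))
large-class {k} {r} (suc M) _ le c with any? (λ i → suc M ≤? # (λ a → is i (just (c a))))
... | yes p = p
... | no ¬p = ⊥-elim (<-irrefl refl (<-≤-trans (≤-<-trans total (*-monoʳ-< (suc r) ≤-refl)) le)) where
  total : k ≤ suc r * M
  total = subst (_≤ suc r * M) ((sym (+-identityʳ _) ∙ cong (∑ (λ i → # (λ a → is i (just (c a)))) +_) (sym (#-zero {k} (λ _ → false) λ _ → refl))) ∙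
      ∑-classes full (just ∘ c) ∙ #-full k)
    (∑-≤const M λ i → s≤s⁻¹ (≰⇒> (λ h → ¬p (i , h))))

-- A rough partition with boundedly many unclassified vertices.

module RoughConst (q ρ m : ℕ) where
  open TuranConst ρ
  open Widths q m renaming (width to w)

  private
    r ℓ : ℕ
    r = suc (suc ρ)
    ℓ = 2 + 2 * q

  opaque
    -- `K₀` is the inner degree up to which a vertex counts as low. A vertex of a class may miss
    -- `2 * L` cells of each foreign row. The row length `M` is chosen so that `ℓ` such vertices
    -- still have `L` common neighbours in every foreign row.
    K₀ L M : ℕ
    K₀ = 8 * q * R'
    L  = suc (w + 16 * q * R' + 2 * q)
    M  = L + ℓ * (2 * L)

    K₀-def : K₀ ≡ 8 * q * R'
    K₀-def = refl

    M-def : M ≡ L + ℓ * (2 * L)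
    M-def = refl

    w≤L : w ≤ L
    w≤L = lin {t = 0} (suc (16 * q * R' + 2 * q)) ≤-refl (lem w (16 * q * R') (2 * q)) where
      lem : ∀ w a b → w + 0 + suc (a + b) ≡ suc (w + a + b) + 0
      lem = solve-∀

    16qR'≤L : 16 * q * R' ≤ L
    16qR'≤L = lin {t = 0} (suc (w + 2 * q)) ≤-refl (lem w (16 * q * R') (2 * q)) where
      lem : ∀ w a b → a + 0 + suc (w + b) ≡ suc (w + a + b) + 0
      lem = solve-∀

    2q<L : 2 * q < L
    2q<L = s≤s (m≤n+m (2 * q) (w + 16 * q * R'))

    L≤M : L ≤ M
    L≤M = m≤m+n L (ℓ * (2 * L))

    K₀<L : K₀ < L
    K₀<L = s≤s (*-monoˡ-≤ R' (*-monoˡ-≤ q {8} {16} (m≤m+n 8 8)) & lin {t = 0} (w + 2 * q) ≤-refl (lem w (16 * q * R') (2 * q))) where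
      lem : ∀ w a b → a + 0 + (w + b) ≡ w + a + b + 0
      lem = solve-∀

  opaque
    -- `C` bounds the vertices with `L` neighbours in every row, `c₀` is the error term in
    -- `initial-few`, and `c₁` is the final bound on the unclassified vertices.
    C c₀ c₁ n₀ : ℕ
    C  = 2 ^ (r * M) * w
    c₀ = M * r + 2 * q * (r * M) + (M + L) * C
    c₁ = M * r + r * (M * K₀) + 2 * q * (r * M) + (M + L) * C
    n₀ = c₀ + 4 * (r * r) + 2 * ks-bound r (r * M)

    C-def : C ≡ 2 ^ (r * M) * w
    C-def = refl

    c₀-def : c₀ ≡ M * r + 2 * q * (r * M) + (M + L) * C
    c₀-def = refl

    c₁-def : c₁ ≡ M * r + r * (M * K₀) + 2 * q * (r * M) + (M + L) * C
    c₁-def = refl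

    c₀≤n₀ : c₀ ≤ n₀
    c₀≤n₀ = m≤m+n c₀ (4 * (r * r)) & m≤m+n (c₀ + 4 * (r * r)) _

    4rr≤n₀ : 4 * (r * r) ≤ n₀
    4rr≤n₀ = m≤n+m (4 * (r * r)) c₀ & m≤m+n (c₀ + 4 * (r * r)) _

    ks≤n₀ : 2 * ks-bound r (r * M) ≤ n₀
    ks≤n₀ = m≤n+m (2 * ks-bound r (r * M)) (c₀ + 4 * (r * r))

-- Every degree is at least `(1 - 1/r) n - 1`, cleared of denominators.
MinDegree : ∀ {n} → ℕ → Graph n → Set
MinDegree {n} ρ G = ∀ v → suc ρ * n ≤ suc (suc ρ) * Graphs.d G v full + suc (suc ρ)

module Rough {n : ℕ} (q ρ m : ℕ) (G : Graph n) (free : ForbiddenFree q ρ m G) (md : MinDegree ρ G) where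
  open Graphs G
  open Embeddings G
  open Blobs q ρ m G free
  open Cells G
  open Zigzag G
  open ErdosGallai G
  open TuranConst ρ
  open RoughConst q ρ m
  open Widths q m renaming (width to w)

  r : ℕ
  r = suc (suc ρ)

  1≤w : 1 ≤ w
  1≤w = s≤s z≤n & matching-width

  T : Set
  T = Rows G r M

  GoodAt : T → V → Fin r → Set
  GoodAt A v i = ∀ j → j ≢ i → nR A v j ≤ 2 * L

  goodAt? : ∀ A v i → Dec (GoodAt A v i)
  goodAt? A v i = all? λ j → ¬? (j ≟ᶠ i) →-dec (nR A v j ≤? 2 * L)

  common : List V → V → Bool
  common []       x = true
  common (y ∷ ys) x = common ys x ∧ adj G y x

  common⁻ : ∀ {ys x} → common ys x ≡ true → ∀ {y} → y ∈ ys → Adj y x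
  common⁻ {z ∷ zs} {x} e (here refl) = ∧-elimʳ {common zs x} e
  common⁻ {z ∷ zs} e (there m) = common⁻ {zs} (∧-elimˡ e) m

  common-many : ∀ (A : T) j ys → (∀ {y} → y ∈ ys → nR A y j ≤ 2 * L) →
    M ≤ # (λ a → common ys (cell A j a)) + length ys * (2 * L)
  common-many A j [] h = ≤-reflexive (sym (+-identityʳ _ ∙ #-full M))
  common-many A j (y ∷ ys) h = common-many A j ys (λ m → h (there m)) &
    +-monoˡ-≤ _ (#-split P Q =& +-monoʳ-≤ (# (P ∩ Q))
      (#-mono {P = P ∩ ∁ Q} {Q = ∁ Q} (λ a → ∧-elimʳ {P a}) & h (here refl))) &=
      +-assoc (# (P ∩ Q)) (2 * L) _ where
    P Q : Fin M → Bool
    P a = common ys (cell A j a)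
    Q a = adj G y (cell A j a)

  -- The vertices of a path on `ℓ` good vertices jointly miss at most `ℓ * (2 * L)` cells of any row
  -- other than `i`, so at least `w` common neighbours remain there and `F₁` appears.
  good-pathfree : ∀ (A : T) i X → (∀ v → X v ≡ true → GoodAt A v i) → PathFree (suc (2 * q)) X
  good-pathfree A i X good {xs = xs} p u sat with length xs ≤? suc (2 * q)
  ... | yes le = le
  ... | no gt with Path-take p (suc (2 * q)) (≰⇒> gt)
  ...   | ys , z , p' , len , sub , uniq = ⊥-elim (F₁-blob In complete-In rich i p' (uniq u) (λ m → inl (refl , inl m)) (≤-reflexive (sym len))) where
    Core : V → Set
    Core x = x ∈ ys ⊎ ∃ λ a → x ≡ cell A i a
    Row : Fin r → V → Set
    Row j x = ∃ λ a → x ≡ cell A j a × common ys x ≡ true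
    core-row : ∀ {j x y} → j ≢ i → Core x → Row j y → Adj x y
    core-row ne (inl m) (_ , _ , c) = common⁻ {ys} c m
    core-row ne (inr (a , refl)) (b , refl , _) = cell-adj A a b (ne ∘ sym)
    row-row : ∀ {j j' x y} → j ≢ j' → Row j x → Row j' y → Adj x y
    row-row ne (a , refl , _) (b , refl , _) = cell-adj A a b ne
    row-many : ∀ j → j ≢ i → Many w (Row j)
    row-many j ne = Many-image (cell A j) (cell-inj A j) (λ {a} e → a , refl , e) (pick w (λ a → common ys (cell A j a)) enough) where
      enough : w ≤ # (λ a → common ys (cell A j a))
      enough = w≤L & +-cancelʳ-≤ ((2 + 2 * q) * (2 * L)) _ _ (subst₂ _≤_ M-def
        (cong (λ k → # (λ a → common ys (cell A j a)) + k * (2 * L)) len)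
        (common-many A j ys λ m → good _ (sat (sub m)) j ne))
    core-many : Many w Core
    core-many = Many-image (cell A i) (cell-inj A i) (λ {a} _ → inr (a , refl)) (Many-≤ (w≤L & L≤M) Many-all)
    open Centred i Core Row core-row row-row core-many row-many

  row-degree : ∀ (A : T) i (Q : V → Bool) → ∑ (λ v → 𝟙 (Q v) * dR A v i) ≡ ∑ (λ a → d (cell A i a) Q)
  row-degree A i Q = (∑-cong λ v → cong (𝟙 (Q v) *_) (#-∑ (λ a → adj G v (cell A i a))) ∙ sym (∑-*ˡ (𝟙 (Q v)) (λ a → 𝟙 (adj G v (cell A i a))))) ∙
    ∑-comm (λ v a → 𝟙 (Q v) * 𝟙 (adj G v (cell A i a))) ∙ (∑-cong λ a →
      (∑-cong λ v → cong (λ b → 𝟙 (Q v) * 𝟙 b) (adj-sym G v (cell A i a)) ∙ *-comm (𝟙 (Q v)) _ ∙ sym (𝟙-∧ (adj G (cell A i a) v) (Q v))) ∙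
        sym (#-∑ (adj G (cell A i a) ∩ Q)))

  -- The vertices of row `i` are themselves good at `i`, so `Q` together with the row is path-free
  -- and Erdős-Gallai bounds all edges within the union.
  cross-bound : ∀ (A : T) i Q → (∀ v → Q v ≡ true → GoodAt A v i) → ∑ (λ v → 𝟙 (Q v) * dR A v i) ≤ 2 * q * (# Q + M)
  cross-bound A i Q good = row-degree A i Q =& (∑-mono le & ∑-inj (cell A i) (cell-inj A i) (λ x → 𝟙 (X x) * d x X)) &
    fst (EG q X (good-pathfree A i X X-good)) & *-monoʳ-≤ (2 * q) size where
    X : V → Bool
    X v = Q v ∨ memᵇ (tabulate (cell A i)) v
    X-row : ∀ a → X (cell A i a) ≡ true
    X-row a = ∨-introʳ {Q (cell A i a)} (dec-true (_ ∈ᶠ? tabulate (cell A i)) (∈-tabulate⁺ {f = cell A i} a))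
    X-good : ∀ v → X v ≡ true → GoodAt A v i
    X-good v e with ∨-elim {Q v} e
    ... | inl h = good v h
    ... | inr h with ∈-tabulate⁻ (from-does (v ∈ᶠ? tabulate (cell A i)) h)
    ...   | a , refl = λ j ne → #-zero (λ b → not (adj G (cell A i a) (cell A j b)))
                         (λ b → cong not (cell-adj A a b (ne ∘ sym))) =& z≤n
    size : # X ≤ # Q + M
    size = #-split X Q =& +-mono-≤ (#-mono {P = X ∩ Q} {Q = Q} (λ v → ∧-elimʳ {X v}))
      ((#-mono {P = X ∩ ∁ Q} {Q = memᵇ (tabulate (cell A i))} λ v e → rest v e) & #-list≤ (cell A i)) where
      rest : ∀ v → (X ∩ ∁ Q) v ≡ true → memᵇ (tabulate (cell A i)) v ≡ true
      rest v e with ∨-elim {Q v} (∧-elimˡ e)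
      ... | inr h = h
      ... | inl h = ⊥-elim (true≢false h (not-true (∧-elimʳ {X v} e)))
    le : ∀ a → d (cell A i a) Q ≤ 𝟙 (X (cell A i a)) * d (cell A i a) X
    le a = (#-mono {P = adj G (cell A i a) ∩ Q} {Q = adj G (cell A i a) ∩ X}
        λ v e → ∧-intro (∧-elimˡ e) (∨-introˡ (∧-elimʳ {adj G (cell A i a) v} e))) &=
      (sym (+-identityʳ _) ∙ cong (λ b → 𝟙 b * d (cell A i a) X) (sym (X-row a)))

  -- Vertices with many neighbours in every row are few: otherwise K_{r+1}(w) appears, and it contains F₁.
  rich-vertices : ∀ (A : T) → # (set λ v → all? λ i → L ≤? dR A v i) ≤ C
  rich-vertices A with # (set λ v → all? λ i → L ≤? dR A v i) ≤? C
  ... | yes le = le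
  ... | no gt = ⊥-elim (step (extend w 1≤w A B (λ v e i → w≤L & set⁻ (λ v → all? λ i → L ≤? dR A v i) e i)
                          (sym C-def =& (<⇒≤ (≰⇒> gt))))) where
    B : V → Bool
    B = set λ v → all? λ i → L ≤? dR A v i
    step : Σ (Rows G (suc r) w) _ → ⊥
    step (K , _) = finish zz where
      -- Two of the `r + 1` rows are merged into one part, where an alternating path has
      -- `2 * suc q + 1` vertices, more than `ℓ`.
      In : Fin r → V → Set
      In zero    x = (∃ λ a → x ≡ cell K zero a) ⊎ (∃ λ a → x ≡ cell K (suc zero) a)
      In (suc j) x = ∃ λ a → x ≡ cell K (suc (suc j)) a
      complete-In : Complete G In
      complete-In {zero}  {zero}  ne _ _ = ⊥-elim (ne refl)
      complete-In {zero}  {suc j} ne (inl (a , refl)) (b , refl) = cell-adj K a b λ ()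
      complete-In {zero}  {suc j} ne (inr (a , refl)) (b , refl) = cell-adj K a b λ ()
      complete-In {suc i} {zero}  ne (a , refl) (inl (b , refl)) = cell-adj K a b λ ()
      complete-In {suc i} {zero}  ne (a , refl) (inr (b , refl)) = cell-adj K a b λ ()
      complete-In {suc i} {suc j} ne (a , refl) (b , refl) = cell-adj K a b λ { refl → ne refl }
      rich : ∀ j → Many w (In j)
      rich zero    = Many-image (cell K zero) (cell-inj K zero) (λ {a} _ → inl (a , refl)) Many-all
      rich (suc j) = Many-image (cell K (suc (suc j))) (cell-inj K (suc (suc j))) (λ {a} _ → a , refl) Many-all
      q<w : suc q ≤ w
      q<w = (m≤n*m (suc q) 2 & n≤1+n _) & zigzag-width
      w₀ : Fin w
      w₀ = fromℕ< 1≤w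
      side : Fin (suc q) → V
      side i = cell K (suc zero) (inject≤ i q<w)
      W : List V
      W = tabulate side
      zz = zigzag {Cell = λ x → ∃ λ a → x ≡ cell K zero a} {k = w}
        (Many-image (cell K zero) (cell-inj K zero) (λ {a} _ → a , refl) Many-all) W [ cell K zero w₀ ] ([] ∷ [])
        (Uniqueₚ.tabulate⁺ λ e → inject≤-injective q<w q<w _ _ (cell-inj K (suc zero) e))
        (λ m → λ { (here e) → Adj-≢ (side-adj m (w₀ , refl)) e }) (λ m → side-adj m (w₀ , refl)) (λ c m → Adj-sym (side-adj m c))
        (cong (λ k → suc (2 * k)) (length-tabulate side) =& zigzag-width) where
        side-adj : ∀ {v x} → v ∈ W → (∃ λ a → x ≡ cell K zero a) → Adj v x
        side-adj m (a , refl) with ∈-tabulate⁻ {f = side} m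
        ... | i , refl = cell-adj K _ a λ ()
      finish : (∃ λ y → ∃ λ ys → Path y ys (cell K zero w₀) × Unique ys × length ys ≡ suc (2 * length W) ×
        (∀ {v} → v ∈ ys → v ∈ cell K zero w₀ ∷ [] ⊎ v ∈ W ⊎ ∃ λ a → v ≡ cell K zero a) ×
        (y ≡ cell K zero w₀ ⊎ ∃ λ a → y ≡ cell K zero a)) → ⊥
      finish (y , ys , p , u , len , inc , _) = F₁-blob In complete-In rich zero p u (λ m → sat (inc m))
        (n≤1+n _ &= sym (len ∙ cong (λ k → suc (2 * k)) (length-tabulate side) ∙ cong suc (*-suc 2 q))) where
        sat : ∀ {v} → v ∈ cell K zero w₀ ∷ [] ⊎ v ∈ W ⊎ (∃ λ a → v ≡ cell K zero a) → In zero v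
        sat (inl (here refl)) = inl (w₀ , refl)
        sat (inr (inl m)) with ∈-tabulate⁻ {f = side} m
        ... | i , refl = inr (_ , refl)
        sat (inr (inr c)) = inl c

#-is : ∀ {n} (i : Fin n) → # (isᵇ i) ≡ 1
#-is i = #-remove (isᵇ i) i ∙ cong₂ (λ b k → 𝟙 b + k) (dec-true (i ≟ᶠ i) refl) (#-zero (isᵇ i ∩ ∁ (isᵇ i)) λ v → lem (isᵇ i v)) where
  lem : ∀ b → b ∧ not b ≡ false
  lem true  = refl
  lem false = refl

∑-one : ∀ {k} (f : Fin (suc k) → ℕ) i c → (∀ j → j ≢ i → f j ≤ c) → ∑ f ≤ k * c + f i
∑-one {k} f i c h = ∑-remove f i =& +-monoʳ-≤ (f i) (∑-mono le &=
    ((#-∑* c (∁ (isᵇ i))) ∙ cong (_* c) size)) &= +-comm (f i) _ where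
  size : # (∁ (isᵇ i)) ≡ k
  size = +-cancelˡ-≡ 1 _ _ (cong (_+ # (∁ (isᵇ i))) (sym (#-is i)) ∙ (#-∁ (isᵇ i)))
  le : ∀ v → 𝟙 (not (does (v ≟ᶠ i))) * f v ≤ 𝟙 (not (isᵇ i v)) * c
  le v with v ≟ᶠ i
  ... | yes _ = z≤n
  ... | no ne = +-monoˡ-≤ 0 (h v ne)

∑-pair : ∀ {k} (f : Fin k → ℕ) {i j} → j ≢ i → f i + f j ≤ ∑ f
∑-pair f {i} {j} ne = +-monoʳ-≤ (f i) (le & ∑-term (λ v → 𝟙 (not (does (v ≟ᶠ i))) * f v) j) &= sym (∑-remove f i) where
  le : f j ≤ 𝟙 (not (does (j ≟ᶠ i))) * f j
  le with j ≟ᶠ i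
  ... | yes e = ⊥-elim (ne e)
  ... | no _ = ≤-reflexive (sym (+-identityʳ _))

module Classes {n : ℕ} (q ρ m : ℕ) (G : Graph n) (free : ForbiddenFree q ρ m G) (md : MinDegree ρ G) where
  open Graphs G
  open Embeddings G
  open Cells G
  open ErdosGallai G
  open TuranConst ρ
  open RoughConst q ρ m
  open Rough q ρ m G free md
  open Widths q m renaming (width to w)

  opaque
    cls : T → V → Maybe (Fin r)
    cls A v with any? (goodAt? A v)
    ... | yes (i , _) = just i
    ... | no _        = nothing

    cls-good : ∀ A v {i} → cls A v ≡ just i → GoodAt A v i
    cls-good A v e with any? (goodAt? A v)
    cls-good A v refl | yes (i , g) = g

    cls-bad : ∀ A v → cls A v ≡ nothing → ∀ i → ¬ GoodAt A v i
    cls-bad A v e i g with any? (goodAt? A v)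
    cls-bad A v e i g | no ¬g = ¬g (i , g)

  Bad : T → V → Bool
  Bad A v = isN (cls A v)

  -- Double counting of edges into the rows. By the minimum degree the rows receive about
  -- `(r - 1) * M` edges per vertex. A classified vertex exceeds this by at most its degree to one
  -- row, chosen freely by `κ`; an unclassified vertex falls short by at least `L`, unless it is one
  -- of the few with many neighbours in every row.
  bad-bound : ∀ A (κ : V → Fin r) → L * # (Bad A) ≤ M * r + ∑ (λ v → 𝟙 (not (Bad A v)) * dR A v (κ v)) + (M + L) * C
  bad-bound A κ = lin 0 (+-mono-≤ total S≥) (lem (L * # (Bad A)) S M r n ρ X ((M + L) * # B)) &
      +-monoʳ-≤ (M * r + X) (*-monoʳ-≤ (M + L) (rich-vertices A)) where
    B : V → Bool
    B = set λ v → all? λ i → L ≤? dR A v i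
    S X : ℕ
    S = ∑ (λ v → ∑ (dR A v))
    X = ∑ (λ v → 𝟙 (not (Bad A v)) * dR A v (κ v))
    rM : ∀ v → ∑ (dR A v) + ∑ (nR A v) ≡ r * M
    rM v = sym (∑-distrib-+ (dR A v) (nR A v)) ∙ ∑-cong (dR+nR A v) ∙ ∑-const r M
    pointwise : ∀ v → ∑ (dR A v) + L * 𝟙 (Bad A v) ≤ suc ρ * M + 𝟙 (not (Bad A v)) * dR A v (κ v) + (M + L) * 𝟙 (B v)
    pointwise v with cls A v in eqc
    ... | just i = ((cong (∑ (dR A v) +_) (*-zeroʳ L) ∙ +-identityʳ _) =&
          (∑-one (dR A v) (κ v) M λ j _ → #≤n λ a → adj G v (cell A j a))) &
          cong (suc ρ * M +_) (sym (+-identityʳ _)) =& m≤m+n _ _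
    ... | nothing with B v in eqb
    ...   | true = +-monoˡ-≤ (L * 1) (m≤m+n _ _ &= rM v) &= lem₀ M L ρ where
      lem₀ : ∀ M L ρ → suc (suc ρ) * M + L * 1 ≡ suc ρ * M + 0 + (M + L) * 1
      lem₀ = solve-∀
    ...   | false = two where
      two : ∑ (dR A v) + L * 1 ≤ suc ρ * M + 0 + (M + L) * 0
      two with any? (λ i → ¬? (L ≤? dR A v i))
      ... | no ¬p = ⊥-elim (set-false (λ v → all? λ i → L ≤? dR A v i) eqb λ i →
              case L ≤? dR A v i of λ { (yes p) → p ; (no ¬h) → ⊥-elim (¬p (i , ¬h)) })
      -- Row `i` has fewer than `L` neighbours of `v`. As `v` is not good at `i`, it misses more
      -- than `2 * L` cells of a further row `j`, a net deficit of more than `L`.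
      ... | yes (i , few) with any? (λ j → ¬? (j ≟ᶠ i) ×-dec ¬? (nR A v j ≤? 2 * L))
      ...   | no ¬p = ⊥-elim (cls-bad A v eqc i λ j ne → case nR A v j ≤? 2 * L of λ { (yes p) → p ; (no ¬h) → ⊥-elim (¬p (j , ne , ¬h)) })
      ...   | yes (j , ne , miss) = lin 2 (+-mono-≤ (+-mono-≤ (+-mono-≤ (+-mono-≤ (≰⇒> few) (≰⇒> miss)) (∑-pair (nR A v) ne))
              (≤-reflexive (rM v))) (≤-reflexive (sym (dR+nR A v i))))
              (lem₁ (∑ (dR A v)) (∑ (nR A v)) L ρ M (nR A v j) (dR A v i) (nR A v i)) where
        lem₁ : ∀ D N L ρ M nj di ni → D + L * 1 + (L + nj + N + suc (suc ρ) * M + (di + ni)) + 2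
             ≡ suc ρ * M + 0 + (M + L) * 0 + (suc di + suc (2 * L) + (ni + nj) + (D + N) + M)
        lem₁ = solve-∀
    total : S + L * # (Bad A) ≤ n * (suc ρ * M) + X + (M + L) * # B
    total = subst₂ _≤_
      (∑-distrib-+ (λ v → ∑ (dR A v)) (λ v → L * 𝟙 (Bad A v)) ∙ cong (S +_) (∑-*ˡ L (λ v → 𝟙 (Bad A v)) ∙ cong (L *_) (sym (#-∑ (Bad A)))))
      (∑-distrib-+ (λ v → suc ρ * M + 𝟙 (not (Bad A v)) * dR A v (κ v)) (λ v → (M + L) * 𝟙 (B v)) ∙
        (cong₂ _+_ (∑-distrib-+ (λ v → suc ρ * M) (λ v → 𝟙 (not (Bad A v)) * dR A v (κ v)) ∙ cong (_+ X) (∑-const n _))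
          (∑-*ˡ (M + L) (λ v → 𝟙 (B v)) ∙ cong ((M + L) *_) (sym (#-∑ B)))))
      (∑-mono pointwise)
    S≥ : M * (suc ρ * n) ≤ S + M * r
    S≥ = *-cancelˡ-≤ r (((sym (*-assoc r M _) ∙ sym ((∑-cong {r} λ i → ∑-const M (suc ρ * n)) ∙ ∑-const r _ ∙ sym (*-assoc r M _))) =&
        (∑-mono λ i → ∑-mono λ a → md (cell A i a))) &= eq) where
      eq : ∑ (λ i → ∑ (λ a → r * d (cell A i a) full + r)) ≡ r * (S + M * r)
      eq = (∑-cong λ i → ∑-distrib-+ (λ a → r * d (cell A i a) full) (λ _ → r) ∙ (cong₂ _+_ (∑-*ˡ r λ a → d (cell A i a) full) (∑-const M r))) ∙
        ∑-distrib-+ (λ i → r * ∑ (λ a → d (cell A i a) full)) (λ _ → M * r) ∙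
          (cong₂ _+_ (∑-*ˡ r λ i → ∑ (λ a → d (cell A i a) full)) (∑-const r (M * r))) ∙
            sym (*-distribˡ-+ r (∑ (λ i → ∑ (λ a → d (cell A i a) full))) (M * r)) ∙ cong (λ s → r * (s + M * r)) (sym (∑-dR A full) ∙ (∑-cong λ v → +-identityʳ _))
    lem : ∀ x S M r n ρ X y → x + (n * (suc ρ * M) + X + y + (S + M * r)) + 0 ≡ M * r + X + y + (S + x + M * (suc ρ * n))
    lem = solve-∀

injective⇒onto : ∀ {k} (f : Fin k → Fin k) → (∀ {i j} → f i ≡ f j → i ≡ j) → ∀ i → ∃ λ j → f j ≡ i
injective⇒onto {suc k} f inj i with any? (λ j → f j ≟ᶠ i)
... | yes p = p
... | no ¬p = ⊥-elim (1+n≰n (injective⇒≤ {f = λ j → punchOut {i = i} {j = f j} (λ e → ¬p (j , sym e))}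
                λ {x} {y} e → inj (punchOut-injective (λ e' → ¬p (x , sym e')) (λ e' → ¬p (y , sym e')) e)))

κOf : ∀ {r} → Maybe (Fin (suc r)) → Fin (suc r)
κOf (just i) = i
κOf nothing  = zero

module RoughMain {n : ℕ} (q ρ m : ℕ) (G : Graph n) (free : ForbiddenFree q ρ m G) (md : MinDegree ρ G)
                 (1≤q : 1 ≤ q) (big : RoughConst.n₀ q ρ m ≤ n) where
  open Graphs G
  open Embeddings G
  open Cells G
  open ErdosGallai G
  open TuranConst ρ
  open RoughConst q ρ m
  open Rough q ρ m G free md
  open Classes q ρ m G free md
  open Turan ρ using (Dense; rows-in)

  private
    1≤M : 1 ≤ M
    1≤M = (s≤s z≤n & K₀<L) & L≤M

  Cl : T → Fin r → V → Bool
  Cl A i v = is i (cls A v)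

  Cl-good : ∀ A i v → Cl A i v ≡ true → GoodAt A v i
  Cl-good A i v e = cls-good A v (is⁻ i (cls A v) e)

  Cl-pathfree : ∀ A i → PathFree (suc (2 * q)) (Cl A i)
  Cl-pathfree A i = good-pathfree A i (Cl A i) (Cl-good A i)

  -- A vertex has at most `n / r + 1` non-neighbours, itself included. This is within the proportion
  -- allowed by `Dense` as long as `X` omits at most `n / (2 * R')` vertices and `n ≥ 4 r²`.
  dense : ∀ X → 2 * (R' * n) ≤ 2 * (R' * # X) + n → Dense X
  dense X le v _ = *-cancelˡ-≤ 2 (lin 0 (+-mono-≤ (+-mono-≤ le (*-monoʳ-≤ (4 * r) rnd)) (4rr≤n₀ & big))
      (subst₂ (λ R R' → 2 * (R * nd v X) + (2 * (R' * # X) + n + 4 * r * (n + r) + n) + 0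
                      ≡ 2 * (R' * # X) + (2 * (R' * n) + 4 * r * (r * nd v X) + 4 * (r * r))) (sym R-def) (sym R'-def) (lem r n (nd v X) (# X)))) where
    nd+d : nd v X + d v full ≤ n
    nd+d = +-mono-≤ (#-mono {P = X ∩ ∁ (adj G v)} {Q = ∁ (adj G v)} λ w → ∧-elimʳ {X w})
      (#-mono {P = adj G v ∩ full} {Q = adj G v} λ w → ∧-elimˡ) &= (+-comm (# (∁ (adj G v))) _ ∙ (#-∁ (adj G v)))
    rnd : r * nd v X ≤ n + r
    rnd = lin 0 (+-mono-≤ (*-monoʳ-≤ r nd+d) (md v)) (lem' ρ (nd v X) (d v full) n) where
      lem' : ∀ ρ a d n → suc (suc ρ) * a + (suc (suc ρ) * n + (suc (suc ρ) * d + suc (suc ρ))) + 0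
                       ≡ n + suc (suc ρ) + (suc (suc ρ) * (a + d) + suc ρ * n)
      lem' = solve-∀
    lem : ∀ r n a x → 2 * (2 * (r * r) * a) + (2 * ((2 * r + 1) * x) + n + 4 * r * (n + r) + n) + 0
                    ≡ 2 * ((2 * r + 1) * x) + (2 * ((2 * r + 1) * n) + 4 * r * (r * a) + 4 * (r * r))
    lem = solve-∀

  rows-inside : ∀ X → 2 * (R' * n) ≤ 2 * (R' * # X) + n → Σ (Rows G r (r * M)) λ A → ∀ i a → X (cell A i a) ≡ true
  rows-inside X le = rows-in r (r * M) (1≤M & m≤m+n M (suc ρ * M)) ≤-refl X (dense X le)
    (*-cancelˡ-≤ 2 ((ks≤n₀ & big) & half)) where
    R'≥1 : 1 ≤ R'
    R'≥1 = subst (1 ≤_) (sym R'-def) (m≤n+m 1 (2 * r))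
    half : n ≤ 2 * # X
    half = *-cancelˡ-≤ R' {{>-nonZero R'≥1}} (lin 0 (+-mono-≤ le (m≤n*m n R' {{>-nonZero R'≥1}})) (lem R' n (# X)) & ≤-refl) where
      lem : ∀ R n x → R * n + (2 * (R * x) + n + R * n) + 0 ≡ R * (2 * x) + (2 * (R * n) + n)
      lem = solve-∀

  NonLow? : ∀ A v → Dec (∃ λ i → Cl A i v ≡ true × K₀ < d v (Cl A i))
  NonLow? A v = any? λ i → (Cl A i v ≟ᵇ true) ×-dec (K₀ <? d v (Cl A i))

  NL : T → V → Bool
  NL A = set (NonLow? A)

  2q≢0 : NonZero (2 * q)
  2q≢0 = >-nonZero (1≤q & m≤n*m q 2)

  -- Erdős-Gallai in each class: the inner degrees add up to at most `2 * q * n`, and `K₀` is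
  -- `2 * q * (4 * R')`.
  nonlow-few : ∀ A → 4 * R' * # (NL A) ≤ n
  nonlow-few A = *-cancelˡ-≤ (2 * q) {{2q≢0}} ((lem q R' (# (NL A)) ∙ cong (_* # (NL A)) (sym K₀-def)) =& total) where
    lem : ∀ q R x → 2 * q * (4 * R * x) ≡ 8 * q * R * x
    lem = solve-∀
    part : ∀ i → K₀ * # (NL A ∩ Cl A i) ≤ 2 * q * # (Cl A i)
    part i = ((*-comm K₀ _ ∙ sym (#-∑* K₀ (NL A ∩ Cl A i))) =& ∑-mono pw) &
                     fst (EG q (Cl A i) (Cl-pathfree A i)) where
      pw : ∀ v → 𝟙 ((NL A ∩ Cl A i) v) * K₀ ≤ 𝟙 (Cl A i v) * d v (Cl A i)
      pw v with NL A v in en | Cl A i v in ec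
      ... | false | _ = z≤n
      ... | true | false = z≤n
      ... | true | true with set⁻ (NonLow? A) en
      ...   | j , ej , gt = +-monoˡ-≤ 0 (subst (λ k → K₀ ≤ d v (Cl A k)) (just-injective (sym (is⁻ j (cls A v) ej) ∙ is⁻ i (cls A v) ec)) (<⇒≤ gt))
    none : # (NL A ∩ (isN ∘ cls A)) ≡ 0
    none = #-zero _ λ v → ¬true⇒false λ e → case set⁻ (NonLow? A) (∧-elimˡ e) of λ { (i , ei , _) →
      case sym (is⁻ i (cls A v) ei) ∙ isN⁻ (cls A v) (∧-elimʳ {NL A v} e) of λ () }
    total : K₀ * # (NL A) ≤ 2 * q * n
    total = (cong (K₀ *_) (sym (∑-classes (NL A) (cls A)) ∙ cong (∑ (λ i → # (NL A ∩ Cl A i)) +_) none ∙ +-identityʳ _) ∙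
        sym (∑-*ˡ K₀ λ i → # (NL A ∩ Cl A i))) =&
      ∑-mono part & ∑-*ˡ (2 * q) (λ i → # (Cl A i)) =&
        *-monoʳ-≤ (2 * q) (∑-classes≤ full (cls A) &= #-full n)

  -- `bad-bound` with each vertex charged to its own class, where `cross-bound` applies. The total
  -- is at most `4 * q * n`, and `L` is at least `16 * q * R'`.
  initial-few : ∀ A → 4 * R' * # (Bad A) ≤ n
  initial-few A = *-cancelˡ-≤ (4 * q) {{>-nonZero (1≤q & m≤n*m q 4)}} (lem q R' (# (Bad A)) =&
      *-monoˡ-≤ (# (Bad A)) 16qR'≤L & bad-bound A (κOf ∘ cls A) & +-monoˡ-≤ ((M + L) * C) (+-monoʳ-≤ (M * r) X≤) &
        lin 0 (+-mono-≤ (+-mono-≤ c₀≤ n≤) z≤n) (lem₂ (M * r) q n (r * M) ((M + L) * C))) where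
    lem : ∀ q R x → 4 * q * (4 * R * x) ≡ 16 * q * R * x
    lem = solve-∀
    n≤ : n ≤ 2 * q * n
    n≤ = m≤n*m n (2 * q) {{2q≢0}}
    c₀≤ : M * r + 2 * q * (r * M) + (M + L) * C ≤ n
    c₀≤ = sym c₀-def =& c₀≤n₀ & big
    lem₂ : ∀ a q n c e → a + 2 * q * (n + c) + e + (n + 2 * q * n + 0) + 0 ≡ 4 * q * n + (a + 2 * q * c + e + n + 0)
    lem₂ = solve-∀
    X≤ : ∑ (λ v → 𝟙 (not (Bad A v)) * dR A v (κOf (cls A v))) ≤ 2 * q * (n + r * M)
    X≤ = ∑-mono pw & ∑-comm (λ v i → 𝟙 (Cl A i v) * dR A v i) =&
      (∑-mono λ i → cross-bound A i (Cl A i) (Cl-good A i)) &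
      (∑-*ˡ (2 * q) (λ i → # (Cl A i) + M) ∙ cong (2 * q *_) (∑-distrib-+ (λ i → # (Cl A i)) (λ _ → M) ∙ cong (∑ (λ i → # (Cl A i)) +_) (∑-const r M))) =&
        *-monoʳ-≤ (2 * q) (+-monoˡ-≤ (r * M) (classes≤ &= #-full n)) where
      classes≤ : ∑ (λ i → # (Cl A i)) ≤ # {n} full
      classes≤ = ∑-classes≤ full (cls A)
      pw : ∀ v → 𝟙 (not (Bad A v)) * dR A v (κOf (cls A v)) ≤ ∑ (λ i → 𝟙 (Cl A i v) * dR A v i)
      pw v with cls A v
      ... | nothing = z≤n
      ... | just j = cong (λ b → 𝟙 b * dR A v j) (sym (dec-true (j ≟ᶠ j) refl)) =& ∑-term (λ i → 𝟙 (is i (just j)) * dR A v i) j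

  LowRows : T → T → Set
  LowRows A B = ∀ i a → Cl A i (cell B i a) ≡ true × d (cell B i a) (Cl A i) ≤ K₀

  -- Discarding unclassified vertices and those of high inner degree costs at most `n / (2 * R')`
  -- vertices, so rows of length `r * M` still exist among the rest. Each is cut down to `M`
  -- vertices of its most frequent class.
  low-rows : ∀ A → 4 * R' * # (Bad A) ≤ n → Σ T (LowRows A)
  low-rows A few = step (rows-inside Low enough) where
    Low : V → Bool
    Low v = not (Bad A v) ∧ not (NL A v)
    enough : 2 * (R' * n) ≤ 2 * (R' * # Low) + n
    enough = *-cancelˡ-≤ 2 (lin 0 (+-mono-≤ (+-mono-≤ few (nonlow-few A)) (*-monoʳ-≤ (4 * R') size)) (lem R' n (# (Bad A)) (# (NL A)) (# Low))) where
      lem : ∀ R n b l x → 2 * (2 * (R * n)) + (n + n + 4 * R * (b + l + x)) + 0 ≡ 2 * (2 * (R * x) + n) + (4 * R * b + 4 * R * l + 4 * R * n)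
      lem = solve-∀
      size : n ≤ # (Bad A) + # (NL A) + # Low
      size = (sym (#-∁ (Bad A)) ∙ cong (# (Bad A) +_) (#-split (∁ (Bad A)) (NL A))) =&
        +-monoʳ-≤ (# (Bad A)) (+-monoˡ-≤ (# Low) (#-mono {P = ∁ (Bad A) ∩ NL A} {Q = NL A} λ v → ∧-elimʳ {not (Bad A v)})) &=
          sym (+-assoc (# (Bad A)) _ _)
    step : (Σ (Rows G r (r * M)) λ B → ∀ i a → Low (cell B i a) ≡ true) → Σ T (LowRows A)
    step (B , low) = record { cell = λ i → cell (fst sub) (π⁻¹ i) ; cell-inj = λ i → cell-inj (fst sub) (π⁻¹ i)
        ; cell-adj = λ a b ne → cell-adj (fst sub) a b λ e → ne (sym (snd (onto _)) ∙ cong π e ∙ snd (onto _)) } ,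
        λ i a → subst (λ k → Cl A k (cell (fst sub) (π⁻¹ i) a) ≡ true × d (cell (fst sub) (π⁻¹ i) a) (Cl A k) ≤ K₀) (snd (onto i))
          (in-class (π⁻¹ i) a , low-degree (π⁻¹ i) a) where
      col : ∀ j a → ∃ λ i → cls A (cell B j a) ≡ just i
      col j a with cls A (cell B j a) in e
      ... | just i = i , refl
      ... | nothing = case sym (low j a) ∙ cong (λ c → not (isN c) ∧ not (NL A (cell B j a))) e of λ ()
      chosen : ∀ j → ∃ λ i → M ≤ # (λ a → is i (just (fst (col j a))))
      chosen j = large-class M 1≤M ≤-refl (λ a → fst (col j a))
      π : Fin r → Fin r
      π j = fst (chosen j)
      sub = subRows {M' = M} B (λ j a → is (π j) (just (fst (col j a)))) (λ j → snd (chosen j))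
      in-class : ∀ j a → Cl A (π j) (cell (fst sub) j a) ≡ true
      in-class j a with snd sub j a
      ... | b , eq , h = cong (λ v → is (π j) (cls A v)) eq ∙ cong (is (π j)) (snd (col j b)) ∙ h
      low-degree : ∀ j a → d (cell (fst sub) j a) (Cl A (π j)) ≤ K₀
      low-degree j a with d (cell (fst sub) j a) (Cl A (π j)) ≤? K₀
      ... | yes le = le
      ... | no gt with snd sub j a
      ...   | b , eq , h = ⊥-elim (true≢false (subst (λ v → NL A v ≡ true) eq (set⁺ (NonLow? A) (π j , in-class j a , ≰⇒> gt)))
                (not-true (∧-elimʳ {not (Bad A (cell B j b))} (low j b))))
      -- Two rows in one class would give a vertex at least `M > K₀` neighbours in its own class.
      π-inj : ∀ {i j} → π i ≡ π j → i ≡ j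
      π-inj {i} {j} e with i ≟ᶠ j
      ... | yes p = p
      ... | no ne = ⊥-elim (<-irrefl refl (<-≤-trans (K₀<L & L≤M) (≤-trans
              (Many⇒≤# (adj G (cell (fst sub) i a₀) ∩ Cl A (π i)) (many (cell (fst sub) j) (cell-inj (fst sub) j)
                λ b → ∧-intro (cell-adj (fst sub) a₀ b ne) (subst (λ k → Cl A k (cell (fst sub) j b) ≡ true) (sym e) (in-class j b))))
              (low-degree i a₀))))
        where a₀ = fromℕ< 1≤M
      onto : ∀ i → ∃ λ j → π j ≡ i
      onto = injective⇒onto π π-inj
      π⁻¹ : Fin r → Fin r
      π⁻¹ i = fst (onto i)

  -- In `bad-bound` for `B`, vertices classified by `A` are charged to their old class, where the
  -- cells of `B` have degree at most `K₀`. Only the vertices bad for `A` contribute in proportion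
  -- to their number, with factor `2 * q`. Since `L > 2 * q`, no progress means that this number was
  -- already at most `c₁`.
  improve : ∀ A B → LowRows A B → # (Bad A) ≤ c₁ ⊎ # (Bad B) < # (Bad A)
  improve A B low with # (Bad B) <? # (Bad A)
  ... | yes lt = inr lt
  ... | no ge = inl (bound &= sym c₁-def) where
    β : ℕ
    β = # (Bad A)
    κ : V → Fin r
    κ v = pickκ (cls A v) (cls B v) where
      pickκ : Maybe (Fin r) → Maybe (Fin r) → Fin r
      pickκ (just i) _ = i
      pickκ nothing  c = κOf c
    Q : Fin r → V → Bool
    Q i = Bad A ∩ Cl B i
    X : ℕ
    X = ∑ (λ v → 𝟙 (not (Bad B v)) * dR B v (κ v))
    X₁ X₂ : ℕ
    X₁ = ∑ (λ i → ∑ (λ v → 𝟙 (Cl A i v) * dR B v i))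
    X₂ = ∑ (λ i → ∑ (λ v → 𝟙 (Q i v) * dR B v i))
    pw : ∀ v → 𝟙 (not (Bad B v)) * dR B v (κ v) ≤ ∑ (λ i → 𝟙 (Cl A i v) * dR B v i) + ∑ (λ i → 𝟙 (Q i v) * dR B v i)
    pw v with cls A v | cls B v
    ... | just j | c = (𝟙*≤ (not (isN c)) (dR B v j) & (sym (+-identityʳ _) ∙ cong (λ b → 𝟙 b * dR B v j) (sym (dec-true (j ≟ᶠ j) refl))) =&
                     ∑-term (λ i → 𝟙 (is i (just j)) * dR B v i) j) & m≤m+n _ _ where
      𝟙*≤ : ∀ b x → 𝟙 b * x ≤ x
      𝟙*≤ true  x = ≤-reflexive (+-identityʳ x)
      𝟙*≤ false x = z≤n
    ... | nothing | nothing = z≤n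
    ... | nothing | just j = (cong (λ b → 𝟙 b * dR B v j) (sym (dec-true (j ≟ᶠ j) refl)) =&
                     ∑-term (λ i → 𝟙 (is i (just j)) * dR B v i) j) & m≤n+m _ _
    X≤ : X ≤ X₁ + X₂
    X≤ = ∑-mono pw &= (∑-distrib-+ (λ v → ∑ (λ i → 𝟙 (Cl A i v) * dR B v i)) (λ v → ∑ (λ i → 𝟙 (Q i v) * dR B v i)) ∙
      (cong₂ _+_ (∑-comm λ v i → 𝟙 (Cl A i v) * dR B v i) (∑-comm λ v i → 𝟙 (Q i v) * dR B v i)))
    X₁≤ : X₁ ≤ r * (M * K₀)
    X₁≤ = ∑-≤const (M * K₀) λ i → row-degree B i (Cl A i) =& (∑-≤const K₀ λ a → snd (low i a))
    X₂≤ : X₂ ≤ 2 * q * (β + r * M)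
    X₂≤ = (∑-mono λ i → cross-bound B i (Q i) (λ v e → Cl-good B i v (∧-elimʳ {Bad A v} e))) &
      (∑-*ˡ (2 * q) (λ i → # (Q i) + M) ∙ cong (2 * q *_) (∑-distrib-+ (λ i → # (Q i)) (λ _ → M) ∙ cong (∑ (λ i → # (Q i)) +_) (∑-const r M))) =&
        *-monoʳ-≤ (2 * q) (+-monoˡ-≤ (r * M) (∑-classes≤ (Bad A) (cls B)))
    c : ℕ
    c = M * r + r * (M * K₀) + 2 * q * (r * M) + (M + L) * C
    bound : β ≤ c
    bound = +-cancelˡ-≤ (2 * q * β) _ _ ((lem₁ q β =& *-monoˡ-≤ β 2q<L & *-monoʳ-≤ L (≮⇒≥ ge) & bad-bound B κ) &
      +-monoˡ-≤ ((M + L) * C) (+-monoʳ-≤ (M * r) (X≤ & +-mono-≤ X₁≤ X₂≤)) &=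
        lem₂ (M * r) (r * (M * K₀)) q β (r * M) ((M + L) * C)) where
      lem₁ : ∀ q b → 2 * q * b + b ≡ suc (2 * q) * b
      lem₁ = solve-∀
      lem₂ : ∀ a b q β e f → a + (b + 2 * q * (β + e)) + f ≡ 2 * q * β + (a + b + 2 * q * e + f)
      lem₂ = solve-∀

  rough : Σ T λ A → # (Bad A) ≤ c₁
  rough = descend (# (Bad A₀)) A₀ ≤-refl (initial-few A₀) where
    descend : ∀ k A → # (Bad A) ≤ k → 4 * R' * # (Bad A) ≤ n → Σ T λ A → # (Bad A) ≤ c₁
    next : ∀ k A → # (Bad A) ≤ k → 4 * R' * # (Bad A) ≤ n → ∀ B → # (Bad A) ≤ c₁ ⊎ # (Bad B) < # (Bad A) → Σ T λ A → # (Bad A) ≤ c₁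
    descend k A le few = next k A le few (fst (low-rows A few)) (improve A _ (snd (low-rows A few)))
    next k A le few B (inl h) = A , h
    next zero A le few B (inr lt) = ⊥-elim (1+n≰n (lt & le & z≤n))
    next (suc k) A le few B (inr lt) = descend k B (s≤s⁻¹ (lt & le)) (*-monoʳ-≤ (4 * R') (<⇒≤ lt) & few)
    A₀ : T
    A₀ = fst (subRows (fst (rows-inside full (cong (λ k → 2 * (R' * k)) (sym (#-full n)) =& m≤m+n _ n)))
           (λ _ _ → true) (λ _ → m≤m+n M (suc ρ * M) &= sym (#-full (r * M))))

-- Depth-first forests and small pieces of path-free classes.

Unique-++⁻ˡ : ∀ {A : Set} (xs : List A) {ys} → Unique (xs ++ ys) → Unique xs
Unique-++⁻ˡ [] u = []
Unique-++⁻ˡ (x ∷ xs) u@(_ ∷ u') = ∉⇒All≢ (λ m → Unique-∷⁻ u (∈-++⁺ˡ m)) ∷ Unique-++⁻ˡ xs u'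

Unique-++⁻ʳ : ∀ {A : Set} (xs : List A) {ys} → Unique (xs ++ ys) → Unique ys
Unique-++⁻ʳ [] u = u
Unique-++⁻ʳ (x ∷ xs) (_ ∷ u) = Unique-++⁻ʳ xs u

Unique-++-disjoint : ∀ {A : Set} (xs : List A) {ys x} → Unique (xs ++ ys) → x ∈ xs → x ∉ ys
Unique-++-disjoint (x ∷ xs) u (here refl) m = Unique-∷⁻ u (∈-++⁺ʳ xs m)
Unique-++-disjoint (x ∷ xs) (_ ∷ u) (there h) m = Unique-++-disjoint xs u h m

lookup⊆concat : ∀ {A : Set} (Ps : List (List A)) k {x} → x ∈ lookup Ps k → x ∈ concat Ps
lookup⊆concat (P ∷ Ps) zero    m = ∈-++⁺ˡ m
lookup⊆concat (P ∷ Ps) (suc k) m = ∈-++⁺ʳ P (lookup⊆concat Ps k m)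

concat-disjoint : ∀ {A : Set} (Ps : List (List A)) → Unique (concat Ps) → ∀ {j k x} → j ≢ k → x ∈ lookup Ps j → x ∉ lookup Ps k
concat-disjoint (P ∷ Ps) u {zero}  {zero}  ne a b = ne refl
concat-disjoint (P ∷ Ps) u {zero}  {suc k} ne a b = Unique-++-disjoint P u a (lookup⊆concat Ps k b)
concat-disjoint (P ∷ Ps) u {suc j} {zero}  ne a b = Unique-++-disjoint P u b (lookup⊆concat Ps j a)
concat-disjoint (P ∷ Ps) u {suc j} {suc k} ne a b = concat-disjoint Ps (Unique-++⁻ʳ P u) (ne ∘ cong suc) a b

concat-unique : ∀ {A : Set} (Ps : List (List A)) → Unique (concat Ps) → ∀ k → Unique (lookup Ps k)
concat-unique (P ∷ Ps) u zero    = Unique-++⁻ˡ P u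
concat-unique (P ∷ Ps) u (suc k) = concat-unique Ps (Unique-++⁻ʳ P u) k

concat-length : ∀ {A : Set} c (Ps : List (List A)) → (∀ k → length (lookup Ps k) ≤ c) → length (concat Ps) ≤ length Ps * c
concat-length c [] h = z≤n
concat-length c (P ∷ Ps) h = length-++ P =& +-mono-≤ (h zero) (concat-length c Ps λ k → h (suc k))

Monotone : (ℕ → ℕ) → Set
Monotone f = ∀ {a b} → a ≤ b → f a ≤ f b

opaque
  -- Size thresholds by remaining height: if the subtrees have at most `N = growth f c₀ h` vertices
  -- each and `N * suc (f N)` in total, then there are at least `f N` of them.
  growth : (ℕ → ℕ) → ℕ → ℕ → ℕ
  growth f c₀ zero    = c₀
  growth f c₀ (suc h) = growth f c₀ h * suc (f (growth f c₀ h))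

  growth-step : ∀ f c₀ h → growth f c₀ h ≤ growth f c₀ (suc h)
  growth-step f c₀ h = m≤m*n (growth f c₀ h) (suc (f (growth f c₀ h)))

  growth-≥ : ∀ f c₀ h → c₀ ≤ growth f c₀ h
  growth-≥ f c₀ zero    = ≤-refl
  growth-≥ f c₀ (suc h) = growth-≥ f c₀ h & growth-step f c₀ h

  growth-mono : ∀ f c₀ {h h'} → h ≤ h' → growth f c₀ h ≤ growth f c₀ h'
  growth-mono f c₀ {h} {zero} z≤n = ≤-refl
  growth-mono f c₀ {h} {suc h'} le with m≤n⇒m<n∨m≡n le
  ... | inl (s≤s lt) = growth-mono f c₀ lt & growth-step f c₀ h'
  ... | inr refl     = ≤-refl

  growth-suc : ∀ f c₀ h → growth f c₀ (suc h) ≡ growth f c₀ h * suc (f (growth f c₀ h))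
  growth-suc f c₀ h = refl

  growth-mono-start : ∀ {f} → Monotone f → ∀ {c c'} → c ≤ c' → ∀ h → growth f c h ≤ growth f c' h
  growth-mono-start mono le zero    = le
  growth-mono-start mono le (suc h) =
    *-mono-≤ (growth-mono-start mono le h) (s≤s (mono (growth-mono-start mono le h)))

module Forests {n : ℕ} (G : Graph n) where
  open Graphs G

  Below : List V → V → Set
  Below []      v = ⊤
  Below (a ∷ _) v = Adj v a

  -- A depth-first forest on the listed vertices, hanging below the path anc (deepest
  -- vertex first): edges only join a vertex to its ancestors and descendants.
  data Forest : List V → List V → Set where
    nil  : ∀ {anc} → Forest anc []
    node : ∀ {anc v Xs Ys} → Below anc v → Forest (v ∷ anc) Xs → Forest anc Ys →
           (∀ {x y} → x ∈ v ∷ Xs → y ∈ Ys → ¬ Adj x y) → Forest anc (v ∷ Xs ++ Ys)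

  -- The subtree of one child is exhausted before the next child is taken, so no edge can join
  -- different subtrees; `k` is fuel.
  dfs : ∀ k a anc X → length X ≤ k → ∃ λ Y → ∃ λ R → X ↭ Y ++ R × Forest (a ∷ anc) Y ×
    (∀ {y x} → y ∈ a ∷ Y → x ∈ R → ¬ Adj y x)
  dfs k a anc X le with Any.any? (λ v → adj G v a ≟ᵇ true) X
  ... | no ¬e = [] , X , ↭-refl , nil , λ { (here refl) m h → ¬e (Any.map (λ { refl → Adj-sym h }) m) }
  dfs zero a anc [] le | yes ()
  dfs (suc k) a anc X le | yes e with find e
  ... | v , v∈ , va with ∈-∃++ v∈
  ...   | us , ws , refl with dfs k v (a ∷ anc) (us ++ ws) (s≤s⁻¹ (sym (Perm.↭-length (Perm.shift v us ws)) =& le))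
  ...     | Y₁ , R₁ , π₁ , F₁ , no₁ with dfs k a anc R₁ (m≤n+m (length R₁) (length Y₁) & ≤-reflexive
              (sym (length-++ Y₁) ∙ sym (Perm.↭-length π₁) ∙ refl) &
              s≤s⁻¹ (sym (Perm.↭-length (Perm.shift v us ws)) =& le))
  ...       | Y₂ , R₂ , π₂ , F₂ , no₂ = v ∷ Y₁ ++ Y₂ , R₂ ,
    ↭-trans (Perm.shift v us ws) (↭-prep v (↭-trans π₁ (↭-trans (Perm.++⁺ˡ Y₁ π₂) (↭-sym (Perm.++-assoc Y₁ Y₂ R₂))))) ,
    node va F₁ F₂ (λ x∈ y∈ → no₁ x∈ (Perm.∈-resp-↭ (↭-sym π₂) (∈-++⁺ˡ y∈))) , none where
    none : ∀ {y x} → y ∈ a ∷ v ∷ Y₁ ++ Y₂ → x ∈ R₂ → ¬ Adj y x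
    none (here refl) x∈ = no₂ (here refl) x∈
    none (there (here refl)) x∈ = no₁ (here refl) (Perm.∈-resp-↭ (↭-sym π₂) (∈-++⁺ʳ Y₂ x∈))
    none (there (there m)) x∈ with ∈-++⁻ Y₁ m
    ... | inl m₁ = no₁ (there m₁) (Perm.∈-resp-↭ (↭-sym π₂) (∈-++⁺ʳ Y₂ x∈))
    ... | inr m₂ = no₂ (there m₂) x∈

  forest : ∀ k X → length X ≤ k → ∃ λ Y → X ↭ Y × Forest [] Y
  forest k [] le = [] , ↭-refl , nil
  forest (suc k) (v ∷ X) (s≤s le) with dfs (length X) v [] X ≤-refl
  ... | Y₁ , R₁ , π₁ , F₁ , no₁ with forest k R₁ (m≤n+m (length R₁) (length Y₁) & ≤-reflexive
          (sym (length-++ Y₁) ∙ sym (Perm.↭-length π₁)) & le)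
  ...   | Y₂ , π₂ , F₂ = v ∷ Y₁ ++ Y₂ , ↭-prep v (↭-trans π₁ (Perm.++⁺ˡ Y₁ π₂)) ,
          node tt F₁ F₂ λ x∈ y∈ → no₁ x∈ (Perm.∈-resp-↭ (↭-sym π₂) y∈)

  -- A small separator `Y` of `S` together with disjoint bounded sets, each a nonempty union of
  -- components of `S` without `Y`.
  record Pieces (q : ℕ) (S : V → Bool) (c K : ℕ) : Set where
    field
      Y        : List V
      Y-len    : length Y ≤ suc (2 * q)
      Y-sub    : ∀ {x} → x ∈ Y → S x ≡ true
      P        : Fin K → List V
      P-len    : ∀ k → length (P k) ≤ c
      P-pos    : ∀ k → ∃ λ x → x ∈ P k
      P-uniq   : ∀ k → Unique (P k)
      P-sub    : ∀ k {x} → x ∈ P k → S x ≡ true × x ∉ Y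
      P-disj   : ∀ {j k x} → j ≢ k → x ∈ P j → x ∉ P k
      P-closed : ∀ k {x y} → x ∈ P k → S y ≡ true → Adj x y → y ∈ Y ⊎ y ∈ P k

  Pieces-weaken : ∀ {q S c c' K K'} → c ≤ c' → K' ≤ K → Pieces q S c K → Pieces q S c' K'
  Pieces-weaken c≤ K≤ p = record
    { Y = Y ; Y-len = Y-len ; Y-sub = Y-sub ; P = λ k → P (inject≤ k K≤) ; P-len = λ k → P-len _ & c≤
    ; P-pos = λ k → P-pos _ ; P-uniq = λ k → P-uniq _ ; P-sub = λ k → P-sub _
    ; P-disj = λ ne → P-disj (λ e → ne (inject≤-injective K≤ K≤ _ _ e)) ; P-closed = λ k → P-closed _ }
    where open Pieces p

  module TreeDepth (q : ℕ) (S : V → Bool) (pf : PathFree (suc (2 * q)) S) (f : ℕ → ℕ) (c₀ : ℕ) (1≤c₀ : 1 ≤ c₀) where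
    N : ℕ → ℕ
    N = growth f c₀

    Result : Set
    Result = ∃ λ c → c₀ ≤ c × c ≤ N (suc (2 * q)) × Pieces q S c (f c)

    Chain : List V → Set
    Chain []       = ⊤
    Chain (a ∷ as) = ∃ λ e → Path a (a ∷ as) e

    record Position (anc X : List V) : Set where
      field
        uX    : Unique X
        uA    : Unique anc
        disj  : ∀ {x} → x ∈ X → x ∉ anc
        subX  : ∀ {x} → x ∈ X → S x ≡ true
        subA  : ∀ {x} → x ∈ anc → S x ≡ true
        clo   : ∀ {x y} → x ∈ X → S y ≡ true → Adj x y → y ∈ X ⊎ y ∈ anc
        chain : Chain anc

    extend-chain : ∀ {anc v} → Below anc v → Chain anc → Chain (v ∷ anc)
    extend-chain {[]}    {v} _ _ = v , [ v ]
    extend-chain {a ∷ _} h (e , p) = e , h ∷ p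

    descend : ∀ {anc v Xs Ys} → Below anc v → (∀ {x y} → x ∈ v ∷ Xs → y ∈ Ys → ¬ Adj x y) →
      Position anc (v ∷ Xs ++ Ys) → Position (v ∷ anc) Xs
    descend {anc} {v} {Xs} {Ys} b sep p = record
      { uX = Unique-++⁻ˡ Xs (Unique-++⁻ʳ (v ∷ []) uX) ; uA = ∉⇒All≢ (disj (here refl)) ∷ uA
      ; disj = λ m → ∈-∷-∉ (λ { refl → Unique-∷⁻ uX (∈-++⁺ˡ m) }) (disj (there (∈-++⁺ˡ m)))
      ; subX = λ m → subX (there (∈-++⁺ˡ m)) ; subA = λ { (here refl) → subX (here refl) ; (there m) → subA m }
      ; clo = clo' ; chain = extend-chain b chain } where
      open Position p
      clo' : ∀ {x y} → x ∈ Xs → S y ≡ true → Adj x y → y ∈ Xs ⊎ y ∈ v ∷ anc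
      clo' m sy a with clo (there (∈-++⁺ˡ m)) sy a
      ... | inr h = inr (there h)
      ... | inl (here refl) = inr (here refl)
      ... | inl (there h) with ∈-++⁻ Xs h
      ...   | inl h₁ = inl h₁
      ...   | inr h₂ = ⊥-elim (sep (there m) h₂ a)

    sibling : ∀ {anc v Xs Ys} → (∀ {x y} → x ∈ v ∷ Xs → y ∈ Ys → ¬ Adj x y) → Position anc (v ∷ Xs ++ Ys) → Position anc Ys
    sibling {anc} {v} {Xs} {Ys} sep p = record
      { uX = Unique-++⁻ʳ (v ∷ Xs) uX ; uA = uA ; disj = λ m → disj (∈-++⁺ʳ (v ∷ Xs) m) ; subX = λ m → subX (∈-++⁺ʳ (v ∷ Xs) m)
      ; subA = subA ; clo = clo' ; chain = chain } where
      open Position p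
      clo' : ∀ {x y} → x ∈ Ys → S y ≡ true → Adj x y → y ∈ Ys ⊎ y ∈ anc
      clo' m sy a with clo (∈-++⁺ʳ (v ∷ Xs) m) sy a
      ... | inr h = inr h
      ... | inl h with ∈-++⁻ (v ∷ Xs) h
      ...   | inl h₁ = ⊥-elim (sep h₁ m (Adj-sym a))
      ...   | inr h₂ = inl h₂

    ClosedPiece : ℕ → List V → List V → Set
    ClosedPiece c anc P = length P ≤ c × (∃ λ x → x ∈ P) × (∀ {x y} → x ∈ P → S y ≡ true → Adj x y → y ∈ anc ⊎ y ∈ P)

    collect : ∀ h anc X → Position anc X → length anc + suc h ≡ suc (2 * q) → N (suc h) ≤ length X →
      (Ps : List (List V)) → concat Ps ≡ X → All (ClosedPiece (N h) anc) Ps → Result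
    collect h anc _ pos len big Ps refl all = N h , growth-≥ f c₀ h , growth-mono f c₀ (n≤1+n h & m≤n+m (suc h) (length anc) &= len) , record
      { Y = anc ; Y-len = m≤m+n _ (suc h) &= len ; Y-sub = subA
      ; P = λ k → lookup Ps (idx k) ; P-len = λ k → fst (at k) ; P-pos = λ k → fst (snd (at k))
      ; P-uniq = λ k → concat-unique Ps uX (idx k)
      ; P-sub = λ k m → subX (lookup⊆concat Ps (idx k) m) , disj (lookup⊆concat Ps (idx k) m)
      ; P-disj = λ ne → concat-disjoint Ps uX (λ e → ne (inject≤-injective enough enough _ _ e))
      ; P-closed = λ k → snd (snd (at k)) } where
      open Position pos
      piece : ∀ k → ClosedPiece (N h) anc (lookup Ps k)
      piece k = All.lookup all (∈-lookup k)
      enough : f (N h) ≤ length Ps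
      enough = n≤1+n _ & *-cancelʳ-≤ _ _ (N h) {{>-nonZero (1≤c₀ & growth-≥ f c₀ h)}}
        (*-comm (suc (f (N h))) (N h) =& (sym (growth-suc f c₀ h) =& big) & (concat-length (N h) Ps λ k → fst (piece k)))
      idx : Fin (f (N h)) → Fin (length Ps)
      idx k = inject≤ k enough
      at : ∀ k → ClosedPiece (N h) anc (lookup Ps (idx k))
      at k = piece (idx k)

    -- Either some subtree is large, and the search continues inside it with its root added to the
    -- ancestors, or all subtrees are small and therefore numerous. In that case they are the pieces
    -- and the ancestors are the separator.
    descent : ∀ h anc X → Forest anc X → Position anc X → length anc + h ≡ suc (2 * q) → N h ≤ length X → Result
    scan : ∀ h anc X → Forest anc X → Position anc X → length anc + suc h ≡ suc (2 * q) →
      Result ⊎ ∃ λ Ps → concat Ps ≡ X × All (ClosedPiece (N h) anc) Ps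

    descent zero anc _ nil pos len big = case 1≤c₀ & growth-≥ f c₀ zero & big of λ ()
    -- With the height used up, `v` and its ancestors form a path on `2 + 2 * q` vertices.
    descent zero anc _ (node {v = v} b F₁ F₂ sep) pos len big = ⊥-elim (1+n≰n (cong suc (sym len ∙ +-identityʳ _) =&
      (pf (snd (extend-chain b chain)) (∉⇒All≢ (disj (here refl)) ∷ uA) λ { (here refl) → subX (here refl) ; (there m) → subA m })))
      where open Position pos
    descent (suc h) anc X F pos len big with scan h anc X F pos len
    ... | inl res = res
    ... | inr (Ps , eq , all) = collect h anc X pos len big Ps eq all

    scan h anc _ nil pos len = inr ([] , refl , [])
    scan h anc _ (node {v = v} {Xs} {Ys} b F₁ F₂ sep) pos len with N h ≤? length Xs
    ... | yes big = inl (descent h (v ∷ anc) Xs F₁ (descend b sep pos) (sym (+-suc (length anc) h) ∙ len) big)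
    ... | no small with scan h anc Ys F₂ (sibling sep pos) len
    ...   | inl res = inl res
    ...   | inr (Ps , refl , all) = inr ((v ∷ Xs) ∷ Ps , refl , (≰⇒> small , (v , here refl) , closed) ∷ all) where
      open Position pos
      closed : ∀ {x y} → x ∈ v ∷ Xs → S y ≡ true → Adj x y → y ∈ anc ⊎ y ∈ v ∷ Xs
      closed m sy a with clo (∈-++⁺ˡ {xs = v ∷ Xs} m) sy a
      ... | inr h = inl h
      ... | inl h with ∈-++⁻ (v ∷ Xs) h
      ...   | inl h₁ = inr h₁
      ...   | inr h₂ = ⊥-elim (sep m h₂ a)

    pieces : N (suc (2 * q)) ≤ # S → Result
    pieces big = go (forest (length X) X ≤-refl) where
      X : List V
      X = filter (λ v → S v ≟ᵇ true) (allFin n)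
      X-sub : ∀ {x} → x ∈ X → S x ≡ true
      X-sub m = snd (∈-filter⁻ (λ v → S v ≟ᵇ true) {xs = allFin n} m)
      X-cov : ∀ {x} → S x ≡ true → x ∈ X
      X-cov e = ∈-filter⁺ (λ v → S v ≟ᵇ true) (∈-allFin _) e
      go : (∃ λ Y → X ↭ Y × Forest [] Y) → Result
      go (Y , π , F) = descent (suc (2 * q)) [] Y F (record
        { uX = Unique-resp-↭ π (Uniqueₚ.filter⁺ (λ v → S v ≟ᵇ true) (Uniqueₚ.allFin⁺ n)) ; uA = []
        ; disj = λ _ () ; subX = λ m → X-sub (Perm.∈-resp-↭ (↭-sym π) m) ; subA = λ ()
        ; clo = λ _ sy _ → inl (Perm.∈-resp-↭ π (X-cov sy)) ; chain = tt }) refl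
        (big & #≤lcount S full X (λ v → X-cov) (λ _ _ → refl) & lcount≤length full X &= Perm.↭-length π)

-- The number F c of pieces demanded from every part depends on the common size bound c,
-- which is only known after the last part; so the earlier parts provide for the worst case.
module Simultaneous (h : ℕ) (F : ℕ → ℕ) (F-mono : Monotone F) where
 opaque
  reach : ℕ → ℕ → ℕ
  reach zero    c = c
  reach (suc k) c = reach k (growth (λ x → F (reach k x)) c h)

  reach-mono : ∀ k → Monotone (reach k)
  reach-mono zero    le = le
  reach-mono (suc k) le = reach-mono k (growth-mono-start (λ le' → F-mono (reach-mono k le')) le h)

  reach-≥ : ∀ k c → c ≤ reach k c
  reach-≥ zero    c = ≤-refl
  reach-≥ (suc k) c = growth-≥ _ c h & reach-≥ k _

  simultaneous : ∀ size k (Q : Fin k → ℕ → ℕ → Set) → (∀ i {c c' K K'} → c ≤ c' → K' ≤ K → Q i c K → Q i c' K') →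
    (∀ i f c₀ → 1 ≤ c₀ → growth f c₀ h ≤ size → ∃ λ c → c₀ ≤ c × c ≤ growth f c₀ h × Q i c (f c)) →
    ∀ c₀ → 1 ≤ c₀ → reach k c₀ ≤ size → ∃ λ c → c₀ ≤ c × c ≤ reach k c₀ × (∀ i → Q i c (F c))
  simultaneous size zero Q weaken find c₀ pos big = c₀ , ≤-refl , ≤-refl , λ ()
  simultaneous size (suc k) Q weaken find c₀ pos big
    with find zero (λ x → F (reach k x)) c₀ pos (reach-≥ k _ & big)
  ... | c₁ , c₀≤ , c₁≤ , p₁ with simultaneous size k (λ i → Q (suc i)) (λ i → weaken (suc i)) (λ i → find (suc i)) c₁ (pos & c₀≤)
                                   (reach-mono k c₁≤ & big)
  ...   | c , c₁≤c , c≤ , p = c , c₀≤ & c₁≤c , c≤ & reach-mono k c₁≤ ,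
          λ { zero → weaken zero c₁≤c (F-mono c≤) p₁ ; (suc i) → p i }

homog-pick : ∀ {N} k (t : Fin k → Fin N → Bool) K → 2 ^ k * K ≤ N →
  Σ (Fin K → Fin N) λ σ → (∀ {x y} → σ x ≡ σ y → x ≡ y) × (∀ j x y → t j (σ x) ≡ t j (σ y))
homog-pick {N} k t K le with homog k t K full (le &= sym (#-full N))
... | X' , sub , big , hom with pick K X' big
...   | many σ inj sat = σ , inj , λ j x y → hom j (σ x) (σ y) (sat x) (sat y)

#-any : ∀ {n k} (Q : Fin k → Fin n → Bool) → # (set λ x → any? λ i → Q i x ≟ᵇ true) ≤ ∑ (λ i → # (Q i))
#-any Q = (#-∑ _) =& ∑-mono le &= (∑-comm (λ x i → 𝟙 (Q i x)) ∙ (∑-cong λ i → sym (#-∑ (Q i)))) where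
  le : ∀ x → 𝟙 (set (λ x → any? λ i → Q i x ≟ᵇ true) x) ≤ ∑ (λ i → 𝟙 (Q i x))
  le x with set (λ x → any? λ i → Q i x ≟ᵇ true) x in e
  ... | false = z≤n
  ... | true with set⁻ (λ x → any? λ i → Q i x ≟ᵇ true) e
  ...   | i , q = cong 𝟙 (sym q) =& ∑-term (λ i → 𝟙 (Q i x)) i

-- Choose one group after the other: each of the at most `r * K` earlier choices blocks at most `D`
-- candidates.
avoid-conflicts : ∀ {N} r K D (conf : Fin r → Fin r → Fin N → Fin N → Bool) →
  (∀ {i j} k → i ≢ j → # (conf i j k) ≤ D) → (∀ i j k k' → conf i j k k' ≡ conf j i k' k) → r * (K * D) + K ≤ N →
  Σ (Fin r → Fin K → Fin N) λ σ → (∀ i {x y} → σ i x ≡ σ i y → x ≡ y) × (∀ {i j} x y → i ≢ j → conf i j (σ i x) (σ j y) ≡ false)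
avoid-conflicts zero K D conf few sy le = (λ ()) , (λ ()) , λ { {()} }
avoid-conflicts {N} (suc r) K D conf few sy le
  with avoid-conflicts r K D (λ i j → conf (suc i) (suc j)) (λ k ne → few k (ne ∘ suc-injective)) (λ i j → sy (suc i) (suc j))
         (+-monoˡ-≤ K (m≤n+m _ (K * D)) & le)
... | σ , inj , ok = τ , τ-inj , τ-ok where
  blocked : Fin r → Fin N → Bool
  blocked j = set λ x → any? λ k → conf (suc j) zero (σ j k) x ≟ᵇ true
  B : Fin N → Bool
  B = set λ x → any? λ j → blocked j x ≟ᵇ true
  few-blocked : # B ≤ r * (K * D)
  few-blocked = #-any blocked & (∑-≤const (K * D) λ j → #-any (λ k → conf (suc j) zero (σ j k)) &
    (∑-≤const D λ k → few (σ j k) λ ()))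
  open Many (pick K (∁ B) (+-cancelˡ-≤ (# B) _ _ (+-monoˡ-≤ K few-blocked &
    +-monoˡ-≤ K (m≤n+m (r * (K * D)) (K * D)) & le &= sym (#-∁ B)))) renaming (at to σ₀; at-inj to σ₀-inj; at-sat to free)
  τ : Fin (suc r) → Fin K → Fin N
  τ zero    = σ₀
  τ (suc i) = σ i
  τ-inj : ∀ i {x y} → τ i x ≡ τ i y → x ≡ y
  τ-inj zero    = σ₀-inj
  τ-inj (suc i) = inj i
  new : ∀ j x y → conf (suc j) zero (σ j x) (σ₀ y) ≡ false
  new j x y = ¬true⇒false λ e → true≢false (set⁺ (λ x → any? λ j → blocked j x ≟ᵇ true)
    (j , set⁺ (λ x → any? λ k → conf (suc j) zero (σ j k) x ≟ᵇ true) (x , e))) (not-true (free y))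
  τ-ok : ∀ {i j} x y → i ≢ j → conf i j (τ i x) (τ j y) ≡ false
  τ-ok {zero}  {zero}  x y ne = ⊥-elim (ne refl)
  τ-ok {zero}  {suc j} x y ne = sy zero (suc j) (σ₀ x) (σ j y) ∙ new j y x
  τ-ok {suc i} {zero}  x y ne = new i x y
  τ-ok {suc i} {suc j} x y ne = ok x y (ne ∘ cong suc)

-- Symmetric copies and the configuration they form.

opaque
  -- The pieces needed to retain `K` alike. The three powers of two pay for comparing lengths, inner
  -- adjacencies, and adjacencies to the `ζ` exceptional vertices.
  demand : ℕ → ℕ → ℕ → ℕ
  demand ζ c K = 2 ^ suc c * (2 ^ (c * c) * (2 ^ (c * ζ) * K))

  demand-def : ∀ ζ c K → demand ζ c K ≡ 2 ^ suc c * (2 ^ (c * c) * (2 ^ (c * ζ) * K))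
  demand-def ζ c K = refl

  demand-mono : ∀ {ζ ζ' c c' K K'} → ζ ≤ ζ' → c ≤ c' → K ≤ K' → demand ζ c K ≤ demand ζ' c' K'
  demand-mono ζ≤ c≤ K≤ = *-mono-≤ (^-monoʳ-≤ 2 (s≤s c≤)) (*-mono-≤ (^-monoʳ-≤ 2 (*-mono-≤ c≤ c≤)) (*-mono-≤ (^-monoʳ-≤ 2 (*-mono-≤ c≤ ζ≤)) K≤))

module UniformPieces {n : ℕ} (G : Graph n) where
  open Graphs G
  open Forests G

  -- Symmetric subgraphs: the pieces are copies of one labelled graph and have identical traces on
  -- `Z`.
  record Uniform (q : ℕ) (S : V → Bool) (Y : List V) {ζ : ℕ} (Z : Fin ζ → V) (c K : ℕ) : Set where
    field
      t        : ℕ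
      t-pos    : 1 ≤ t
      t≤c      : t ≤ c
      P        : Fin K → Fin t → V
      P-inj    : ∀ {k k' a a'} → P k a ≡ P k' a' → k ≡ k' × a ≡ a'
      P-sub    : ∀ k a → S (P k a) ≡ true × P k a ∉ Y
      P-closed : ∀ k a {y} → S y ≡ true → Adj (P k a) y → y ∈ Y ⊎ ∃ λ b → y ≡ P k b
      Γ-same   : ∀ k k' a b → adj G (P k a) (P k b) ≡ adj G (P k' a) (P k' b)
      Θ-same   : ∀ k k' a z → adj G (P k a) (Z z) ≡ adj G (P k' a) (Z z)

  make-uniform : ∀ {q S ζ c} (Z : Fin ζ → V) K → 1 ≤ K → (p : Pieces q S c (demand ζ c K)) → Uniform q S (Pieces.Y p) Z c K
  make-uniform {q} {S} {ζ} {c} Z K 1≤K p = equal-length (homog-pick (suc c) (λ j k → toℕ j ≡ᵇ length (P k)) K₁ (≤-reflexive (sym (demand-def ζ c K)))) where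
    open Pieces p
    K₁ K₂ : ℕ
    K₂ = 2 ^ (c * ζ) * K
    K₁ = 2 ^ (c * c) * K₂
    1≤K₁ : 1 ≤ K₁
    1≤K₁ = *-mono-≤ (m^n>0 2 (c * c)) (*-mono-≤ (m^n>0 2 (c * ζ)) 1≤K)
    equal-length : Σ (Fin K₁ → Fin (demand ζ c K)) (λ σ → (∀ {x y} → σ x ≡ σ y → x ≡ y) ×
      (∀ j x y → (toℕ j ≡ᵇ length (P (σ x))) ≡ (toℕ j ≡ᵇ length (P (σ y))))) → Uniform q S Y Z c K
    equal-length (σ , inj , hom) = same-type (homog-pick (t * t) (λ j k → adj G (L k (fst (remQuot t j))) (L k (snd (remQuot {t} t j)))) K₂
        (*-monoˡ-≤ K₂ (^-monoʳ-≤ 2 (*-mono-≤ t≤ t≤)))) where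
      k₀ : Fin K₁
      k₀ = fromℕ< 1≤K₁
      t : ℕ
      t = length (P (σ k₀))
      t≤ : t ≤ c
      t≤ = P-len (σ k₀)
      len : ∀ k → length (P (σ k)) ≡ t
      len k = ≡ᵇ-true {length (P (σ k))} (subst (λ z → (z ≡ᵇ t) ≡ true) (toℕ-fromℕ< (s≤s (P-len (σ k))))
        (hom j k₀ k ∙ ≡⇒≡ᵇ-true (toℕ-fromℕ< (s≤s (P-len (σ k)))))) where
        j : Fin (suc c)
        j = fromℕ< (s≤s (P-len (σ k)))
      L : Fin K₁ → Fin t → V
      L k a = lookup (P (σ k)) (cast (sym (len k)) a)
      L∈ : ∀ k a → L k a ∈ P (σ k)
      L∈ k a = ∈-lookup (cast (sym (len k)) a)
      L-inj : ∀ {k k' a a'} → L k a ≡ L k' a' → k ≡ k' × a ≡ a'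
      L-inj {k} {k'} {a} {a'} e with k ≟ᶠ k'
      ... | no ne = ⊥-elim (P-disj (λ e' → ne (inj e')) (L∈ k a) (subst (_∈ P (σ k')) (sym e) (L∈ k' a')))
      ... | yes refl = refl , toℕ-injective (sym (toℕ-cast (sym (len k)) a) ∙ cong toℕ (lookup-injective (P-uniq (σ k)) e) ∙ toℕ-cast (sym (len k)) a')
      L-onto : ∀ k {y} → y ∈ P (σ k) → ∃ λ a → y ≡ L k a
      L-onto k {y} m = cast (len k) (Any.index m) , lookup-index m ∙ cong (lookup (P (σ k))) (toℕ-injective
        (sym (toℕ-cast (sym (len k)) _ ∙ toℕ-cast (len k) (Any.index m))))
      same-type : Σ (Fin K₂ → Fin K₁) (λ τ → (∀ {x y} → τ x ≡ τ y → x ≡ y) × (∀ j x y →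
        adj G (L (τ x) (fst (remQuot t j))) (L (τ x) (snd (remQuot {t} t j))) ≡ adj G (L (τ y) (fst (remQuot t j))) (L (τ y) (snd (remQuot {t} t j))))) →
        Uniform q S Y Z c K
      same-type (τ , τ-inj , τ-hom) = same-trace (homog-pick (t * ζ) (λ j k → adj G (L (τ k) (fst (remQuot ζ j))) (Z (snd (remQuot {t} ζ j)))) K
          (*-monoˡ-≤ K (^-monoʳ-≤ 2 (*-monoˡ-≤ ζ t≤)))) where
        same-trace : Σ (Fin K → Fin K₂) (λ υ → (∀ {x y} → υ x ≡ υ y → x ≡ y) × (∀ j x y →
          adj G (L (τ (υ x)) (fst (remQuot ζ j))) (Z (snd (remQuot {t} ζ j))) ≡ adj G (L (τ (υ y)) (fst (remQuot ζ j))) (Z (snd (remQuot {t} ζ j))))) →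
          Uniform q S Y Z c K
        same-trace (υ , υ-inj , υ-hom) = record
          { t = t ; t-pos = s≤s z≤n & toℕ<n (Any.index (snd (P-pos (σ k₀)))) ; t≤c = t≤
          ; P = λ k → L (τ (υ k))
          ; P-inj = λ e → υ-inj (τ-inj (fst (L-inj e))) , snd (L-inj e)
          ; P-sub = λ k a → P-sub (σ (τ (υ k))) (L∈ (τ (υ k)) a)
          ; P-closed = λ k a sy h → case P-closed (σ (τ (υ k))) (L∈ (τ (υ k)) a) sy h of λ { (inl m) → inl m ; (inr m) → inr (L-onto (τ (υ k)) m) }
          ; Γ-same = λ k k' a b → subst (λ p → adj G (L (τ (υ k)) (fst p)) (L (τ (υ k)) (snd p)) ≡ adj G (L (τ (υ k')) (fst p)) (L (τ (υ k')) (snd p)))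
              (remQuot-combine a b) (τ-hom (combine a b) (υ k) (υ k'))
          ; Θ-same = λ k k' a z → subst (λ p → adj G (L (τ (υ k)) (fst p)) (Z (snd p)) ≡ adj G (L (τ (υ k')) (fst p)) (Z (snd p)))
              (remQuot-combine a z) (υ-hom (combine a z) k k') }

  opaque
    uniformise : ∀ {q S ζ c} (Z : Fin ζ → V) K → 1 ≤ K → (p : Pieces q S c (demand ζ c K)) → Uniform q S (Pieces.Y p) Z c K
    uniformise = make-uniform

bool-iff : ∀ {a b : Bool} → (a ≡ true → b ≡ true) → (b ≡ true → a ≡ true) → a ≡ b
bool-iff {true}  {true}  f g = refl
bool-iff {false} {false} f g = refl
bool-iff {true}  {false} f g = sym (f refl)
bool-iff {false} {true}  f g = g refl

private
  upper-arith : ∀ ρ n q {a b x} → suc ρ * n ≤ suc (suc ρ) * x + suc (suc ρ) → x ≤ 2 * q + b → a + b ≤ n →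
    suc (suc ρ) * a ≤ n + (2 * (q * suc (suc ρ)) + suc (suc ρ))
  upper-arith ρ n q {a} {b} {x} h₁ h₂ h₃ = lin 0 (+-mono-≤ (+-mono-≤ h₁ (*-monoʳ-≤ (2 + ρ) h₂)) (*-monoʳ-≤ (2 + ρ) h₃)) (lem ρ n q a b x) where
    lem : ∀ ρ n q a b x → suc (suc ρ) * a + ((suc (suc ρ) * x + suc (suc ρ)) + suc (suc ρ) * (2 * q + b) + suc (suc ρ) * n) + 0
                        ≡ n + (2 * (q * suc (suc ρ)) + suc (suc ρ)) + (suc ρ * n + suc (suc ρ) * x + suc (suc ρ) * (a + b))
    lem = solve-∀

  lower-arith : ∀ ρ n s {a x b c} → suc (suc ρ) * x ≤ suc ρ * (n + s) + suc (suc ρ) * a → b ≤ c → n ≤ x + b →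
    n ≤ suc (suc ρ) * a + (suc (suc ρ) * c + suc ρ * s)
  lower-arith ρ n s {a} {x} {b} {c} h₁ h₂ h₃ = lin 0 (+-mono-≤ (+-mono-≤ h₁ (*-monoʳ-≤ (2 + ρ) h₂)) (*-monoʳ-≤ (2 + ρ) h₃)) (lem ρ n s a x b c) where
    lem : ∀ ρ n s a x b c → n + (suc ρ * (n + s) + suc (suc ρ) * a + suc (suc ρ) * c + suc (suc ρ) * (x + b)) + 0
                          ≡ suc (suc ρ) * a + (suc (suc ρ) * c + suc ρ * s) + (suc (suc ρ) * x + suc (suc ρ) * b + suc (suc ρ) * n)
    lem = solve-∀

  missing-arith : ∀ ρ n {s a z x y y' e} → suc ρ * n ≤ suc (suc ρ) * x + suc (suc ρ) → x ≤ y + y' → y ≤ e → n ≤ suc (suc ρ) * a + s →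
    a + (y' + z) ≤ n → suc (suc ρ) * z ≤ s + suc (suc ρ) + suc (suc ρ) * e
  missing-arith ρ n {s} {a} {z} {x} {y} {y'} {e} h₁ h₂ h₃ h₄ h₅ = lin 0 (+-mono-≤ (+-mono-≤ (+-mono-≤ h₁ (*-monoʳ-≤ (2 + ρ) h₂))
      (*-monoʳ-≤ (2 + ρ) h₃)) (+-mono-≤ h₄ (*-monoʳ-≤ (2 + ρ) h₅))) (lem ρ n s a z x y y' e) where
    lem : ∀ ρ n s a z x y y' e → suc (suc ρ) * z + ((suc (suc ρ) * x + suc (suc ρ)) + suc (suc ρ) * (y + y') + suc (suc ρ) * e + ((suc (suc ρ) * a + s) + suc (suc ρ) * n)) + 0
       ≡ (s + suc (suc ρ) + suc (suc ρ) * e) + (suc ρ * n + suc (suc ρ) * x + suc (suc ρ) * y + (n + suc (suc ρ) * (a + (y' + z))))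
    lem = solve-∀

-- The symmetric picture of `G`. Each class contains `K` copies of one graph, a copy is separated
-- from the rest of its class except through `Z`, and copies from different classes are completely
-- joined.
record Config {n} (ρ : ℕ) (G : Graph n) (c K : ℕ) : Set where
  field
    cls    : Fin n → Maybe (Fin (2 + ρ))
    ζ      : ℕ
    Z      : Fin ζ → Fin n
    Z-inj  : ∀ {z z'} → Z z ≡ Z z' → z ≡ z'
    bad⇒Z  : ∀ y → cls y ≡ nothing → ∃ λ z → y ≡ Z z
    t      : Fin (2 + ρ) → ℕ
    t-pos  : ∀ i → 1 ≤ t i
    t≤c    : ∀ i → t i ≤ c
    P      : ∀ i → Fin K → Fin (t i) → Fin n
    P-inj  : ∀ i {k k' a a'} → P i k a ≡ P i k' a' → k ≡ k' × a ≡ a'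
    P-cls  : ∀ i k a → cls (P i k a) ≡ just i
    P∉Z    : ∀ i k a z → P i k a ≢ Z z
    closed : ∀ i k a {y} → cls y ≡ just i → adj G (P i k a) y ≡ true → (∃ λ z → y ≡ Z z) ⊎ ∃ λ b → y ≡ P i k b
    Γ-same : ∀ i k k' a b → adj G (P i k a) (P i k b) ≡ adj G (P i k' a) (P i k' b)
    Θ-same : ∀ i k k' a z → adj G (P i k a) (Z z) ≡ adj G (P i k' a) (Z z)
    compl  : ∀ {i j} k k' a b → i ≢ j → adj G (P i k a) (P j k' b) ≡ true

module Assemble {n : ℕ} (q ρ : ℕ) (G : Graph n) (cls : Fin n → Maybe (Fin (2 + ρ))) (c₁ ζ₀ D c K K₁ : ℕ)
    (few-bad : # (isN ∘ cls) ≤ c₁) (few-total : c₁ + suc (suc ρ) * suc (2 * q) ≤ ζ₀)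
    (few-missing : ∀ i v → Graphs.d G v (is i ∘ cls) ≤ suc (2 * q) + c → # (∁ (is i ∘ cls) ∩ ∁ (adj G v)) ≤ D)
    (1≤K₁ : 1 ≤ K₁) (enough : suc (suc ρ) * (K * (c * D)) + K ≤ K₁)
    (pieces : ∀ i → Forests.Pieces G q (is i ∘ cls) c (demand ζ₀ c K₁)) where
  open Graphs G
  open Forests G
  open UniformPieces G

  private
    r : ℕ
    r = suc (suc ρ)

    Sᶜ : Fin r → V → Bool
    Sᶜ i = is i ∘ cls

    Bad : V → Bool
    Bad = isN ∘ cls

  open Pieces
  inY : Fin r → V → Bool
  inY i = memᵇ (Y (pieces i))
  anyY? : ∀ v → Dec (∃ λ i → inY i v ≡ true)
  anyY? v = any? λ i → inY i v ≟ᵇ true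
  -- Unclassified vertices and the separators of all classes. Its size is bounded by `ζ₀` before any
  -- piece is selected, because the number of pieces demanded depends on that bound.
  Zset : V → Bool
  Zset v = Bad v ∨ set anyY? v
  Zset-few : # Zset ≤ ζ₀
  Zset-few = #-split Zset (Bad) =& +-mono-≤ (#-mono {P = Zset ∩ Bad} {Q = Bad} (λ v → ∧-elimʳ {Zset v}) & few-bad)
      (#-mono {P = Zset ∩ ∁ (Bad)} {Q = set anyY?} onlyY & #-any inY & (∑-≤const (suc (2 * q)) λ i → #-memᵇ≤ (Y (pieces i)) & Y-len (pieces i))) &
      few-total where
    onlyY : ∀ v → (Zset ∩ ∁ (Bad)) v ≡ true → set anyY? v ≡ true
    onlyY v e with ∨-elim {Bad v} (∧-elimˡ e)
    ... | inr h = h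
    ... | inl h = ⊥-elim (true≢false h (not-true (∧-elimʳ {Zset v} e)))
  open Many (pick (# Zset) Zset ≤-refl) renaming (at to Z; at-inj to Z-inj; at-sat to Z-sat)
  Z-cov : ∀ v → Zset v ≡ true → ∃ λ z → v ≡ Z z
  Z-cov v e with any? (λ z → v ≟ᶠ Z z)
  ... | yes p = p
  ... | no ¬p = ⊥-elim (<-irrefl refl (s≤s (Many⇒≤# (Zset ∩ ∁ (isᵇ v)) (many Z Z-inj λ z →
          ∧-intro (Z-sat z) (not-false (dec-false (Z z ≟ᶠ v) λ h → ¬p (z , sym h))))) &=
          sym (#-remove Zset v ∙ cong (λ b → 𝟙 b + # (Zset ∩ ∁ (isᵇ v))) e)))
  U : ∀ i → Uniform q (Sᶜ i) (Y (pieces i)) Z c (K₁)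
  U i = uniformise Z K₁ 1≤K₁ (Pieces-weaken {K = demand ζ₀ c K₁} {K' = demand (# Zset) c K₁} ≤-refl (demand-mono Zset-few ≤-refl ≤-refl) (pieces i))
  module U i = Uniform (U i)
  cls-U : ∀ i k a → cls (U.P i k a) ≡ just i
  cls-U i k a = is⁻ i (cls (U.P i k a)) (fst (U.P-sub i k a))
  Copy : Set
  Copy = Fin K₁
  Q? : ∀ i j (k : Copy) (a : Fin (U.t i)) (k' : Copy) → Dec (∃ λ b → adj G (U.P i k a) (U.P j k' b) ≡ false)
  Q? i j k a k' = any? λ b → adj G (U.P i k a) (U.P j k' b) ≟ᵇ false
  Q : ∀ i j (k : Copy) → Fin (U.t i) → Copy → Bool
  Q i j k a = set (Q? i j k a)
  conf? : ∀ i j (k k' : Copy) → Dec (∃ λ a → Q i j k a k' ≡ true)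
  conf? i j k k' = any? λ a → Q i j k a k' ≟ᵇ true
  conf : Fin r → Fin r → Copy → Copy → Bool
  conf i j k = set (conf? i j k)
  conf⁻ : ∀ i j k k' → conf i j k k' ≡ true → ∃ λ a → ∃ λ b → adj G (U.P i k a) (U.P j k' b) ≡ false
  conf⁻ i j k k' e = fst w , set⁻ (Q? i j k (fst w)) (snd w) where
    w : ∃ λ a → Q i j k a k' ≡ true
    w = set⁻ (conf? i j k) e
  conf⁺ : ∀ i j k k' a b → adj G (U.P i k a) (U.P j k' b) ≡ false → conf i j k k' ≡ true
  conf⁺ i j k k' a b e = set⁺ (conf? i j k) (a , set⁺ (Q? i j k a) (b , e))
  conf-swap : ∀ i j k k' → conf i j k k' ≡ true → conf j i k' k ≡ true
  conf-swap i j k k' e = flip (conf⁻ i j k k' e) where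
    flip : (∃ λ a → ∃ λ b → adj G (U.P i k a) (U.P j k' b) ≡ false) → conf j i k' k ≡ true
    flip (a , b , h) = conf⁺ j i k' k b a (adj-sym G (U.P j k' b) (U.P i k a) ∙ h)
  conf-sym : ∀ i j k k' → conf i j k k' ≡ conf j i k' k
  conf-sym i j k k' = bool-iff (conf-swap i j k k') (conf-swap j i k' k)
  covered : ∀ i k a w → Sᶜ i w ≡ true → Adj (U.P i k a) w → w ∈ Y (pieces i) ++ tabulate (U.P i k)
  covered i k a w sw h = [ ∈-++⁺ˡ , (λ { (b , refl) → ∈-++⁺ʳ (Y (pieces i)) (∈-tabulate⁺ {f = U.P i k} b) }) ]′ (U.P-closed i k a sw h)
  inner : ∀ i k a → d (U.P i k a) (Sᶜ i) ≤ suc (2 * q) + c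
  inner i k a = #≤lcount (adj G (U.P i k a) ∩ Sᶜ i) full (Y (pieces i) ++ tabulate (U.P i k))
      (λ w e → covered i k a w (∧-elimʳ {adj G (U.P i k a) w} e) (∧-elimˡ e)) (λ _ _ → refl) &
    lcount≤length full (Y (pieces i) ++ tabulate (U.P i k)) &
      (length-++ (Y (pieces i)) ∙ cong (length (Y (pieces i)) +_) (length-tabulate (U.P i k))) =&
        +-mono-≤ (Y-len (pieces i)) (U.t≤c i)
  few : ∀ {i j} k a → i ≢ j → # (Q i j k a) ≤ D
  few {i} {j} k a ne = Many⇒≤# (∁ (Sᶜ i) ∩ ∁ (adj G (U.P i k a))) (nonneighbours (pick (# (Q i j k a)) (Q i j k a) ≤-refl)) &
      few-missing i (U.P i k a) (inner i k a) where
    outside : ∀ k' b → (∁ (Sᶜ i)) (U.P j k' b) ≡ true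
    outside k' b = not-false (¬true⇒false λ e → ne (just-injective (sym (is⁻ i (cls (U.P j k' b)) e) ∙ cls-U j k' b)))
    nonneighbours : Many (# (Q i j k a)) (λ k' → Q i j k a k' ≡ true) →
      Many (# (Q i j k a)) (λ v → (∁ (Sᶜ i) ∩ ∁ (adj G (U.P i k a))) v ≡ true)
    nonneighbours (many σ σ-inj σ-sat) = many (λ x → U.P j (σ x) (fst (wit x))) (λ e → σ-inj (fst (U.P-inj j e)))
        λ x → ∧-intro (outside (σ x) (fst (wit x))) (not-false (snd (wit x))) where
      wit : ∀ x → ∃ λ b → adj G (U.P i k a) (U.P j (σ x) b) ≡ false
      wit x = set⁻ (Q? i j k a) (σ-sat x)
  -- A copy has at most `c` vertices, each missing at most `D` vertices outside its class. As copies
  -- are disjoint, each missed vertex spoils one copy only.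
  conf-few : ∀ {i j} k → i ≢ j → # (conf i j k) ≤ c * D
  conf-few {i} {j} k ne = #-any (Q i j k) & (∑-≤const D λ a → few k a ne) & *-monoˡ-≤ D (U.t≤c i)
  finish : Σ (Fin r → Fin (K) → Fin (K₁)) (λ σ → (∀ i {x y} → σ i x ≡ σ i y → x ≡ y) × (∀ {i j} x y → i ≢ j → conf i j (σ i x) (σ j y) ≡ false)) →
    Config ρ G c (K)
  finish (σ , σ-inj , ok) = record
    { cls = cls ; ζ = # Zset ; Z = Z ; Z-inj = Z-inj ; bad⇒Z = λ y e → Z-cov y (∨-introˡ (subst (λ c → isN c ≡ true) (sym e) refl))
    ; t = U.t ; t-pos = U.t-pos ; t≤c = U.t≤c ; P = λ i k → U.P i (σ i k)
    ; P-inj = λ i e → σ-inj i (fst (U.P-inj i e)) , snd (U.P-inj i e)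
    ; P-cls = λ i k → cls-U i (σ i k)
    ; P∉Z = λ i k a z e → notZ i (σ i k) a (subst (λ v → Zset v ≡ true) (sym e) (Z-sat z))
    ; closed = λ i k a {y} cy h → close i (σ i k) a (U.P-closed i (σ i k) a (is⁺ i cy) h)
    ; Γ-same = λ i k k' → U.Γ-same i _ _ ; Θ-same = λ i k k' → U.Θ-same i _ _
    ; compl = λ {i} {j} k k' a b ne → case bool (adj G (U.P i (σ i k) a) (U.P j (σ j k') b)) of λ { (inl h) → h
        ; (inr h) → ⊥-elim (true≢false (conf⁺ i j _ _ a b h) (ok k k' ne)) } } where
    close : ∀ i k a {y} → y ∈ Y (pieces i) ⊎ (∃ λ b → y ≡ U.P i k b) → (∃ λ z → y ≡ Z z) ⊎ ∃ λ b → y ≡ U.P i k b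
    close i k a (inr p) = inr p
    close i k a {y} (inl m) = inl (Z-cov y (∨-introʳ {Bad y} (set⁺ anyY? (i , dec-true (y ∈ᶠ? Y (pieces i)) m))))
    notY : ∀ i j k a → U.P i k a ∉ Y (pieces j)
    notY i j k a m = go (i ≟ᶠ j) m where
      go : Dec (i ≡ j) → U.P i k a ∉ Y (pieces j)
      go (yes refl) m = snd (U.P-sub i k a) m
      go (no ne)    m = ne (just-injective (sym (cls-U i k a) ∙ is⁻ j (cls (U.P i k a)) (Y-sub (pieces j) m)))
    notZ : ∀ i k a → Zset (U.P i k a) ≡ true → ⊥
    notZ i k a e = [ (λ h → bad (isN⁻ (cls (U.P i k a)) h)) , (λ h → inY-⊥ (set⁻ anyY? h)) ]′ (∨-elim {Bad (U.P i k a)} e) where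
      bad : cls (U.P i k a) ≡ nothing → ⊥
      bad h = case sym (cls-U i k a) ∙ h of λ ()
      inY-⊥ : (∃ λ j → inY j (U.P i k a) ≡ true) → ⊥
      inY-⊥ (j , m) = notY i j k a (from-does (U.P i k a ∈ᶠ? Y (pieces j)) m)

  config : Config ρ G c K
  config = finish (avoid-conflicts r K (c * D) conf conf-few conf-sym enough)

module ConfigConst (q ρ m : ℕ) (Kf : ℕ → ℕ) (Kf-mono : Monotone Kf) where
  open RoughConst q ρ m

  private
    r : ℕ
    r = suc (suc ρ)

  opaque
    -- `s₁` and `s₂` are the errors in `class-upper` and `class-lower`; `ζ₀` bounds the exceptional
    -- set.
    s₁ s₂ ζ₀ : ℕ
    s₁ = 2 * (q * r) + r
    s₂ = r * c₁ + suc ρ * s₁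
    ζ₀ = c₁ + r * suc (2 * q)

    s₁-def : s₁ ≡ 2 * (q * r) + r
    s₁-def = refl
    s₂-def : s₂ ≡ r * c₁ + suc ρ * s₁
    s₂-def = refl
    ζ₀-def : ζ₀ ≡ c₁ + r * suc (2 * q)
    ζ₀-def = refl

    missing : ℕ → ℕ
    missing c = s₂ + r + r * (suc (2 * q) + c)

    missing-def : ∀ c → missing c ≡ s₂ + r + r * (suc (2 * q) + c)
    missing-def c = refl

    missing-mono : Monotone missing
    missing-mono le = +-monoʳ-≤ (s₂ + r) (*-monoʳ-≤ r (+-monoʳ-≤ (suc (2 * q)) le))

  opaque
    K₁ : ℕ → ℕ
    K₁ c = r * (Kf c * (c * missing c)) + Kf c

    K₁-def : ∀ c → K₁ c ≡ r * (Kf c * (c * missing c)) + Kf c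
    K₁-def c = refl

    Kf≤K₁ : ∀ c → Kf c ≤ K₁ c
    Kf≤K₁ c = m≤n+m (Kf c) _

    K₁-mono : Monotone K₁
    K₁-mono le = +-mono-≤ (*-monoʳ-≤ r (*-mono-≤ (Kf-mono le) (*-mono-≤ le (missing-mono le)))) (Kf-mono le)

  F : ℕ → ℕ
  F c = demand ζ₀ c (K₁ c)

  F-mono : Monotone F
  F-mono le = demand-mono ≤-refl le (K₁-mono le)

  opaque
    n₁ : ℕ
    n₁ = n₀ + (r * Simultaneous.reach (suc (2 * q)) F F-mono r 1 + s₂)

    n₀≤n₁ : n₀ ≤ n₁
    n₀≤n₁ = m≤m+n n₀ _

    reach≤n₁ : r * Simultaneous.reach (suc (2 * q)) F F-mono r 1 + s₂ ≤ n₁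
    reach≤n₁ = m≤n+m _ n₀

    c₂ : ℕ
    c₂ = Simultaneous.reach (suc (2 * q)) F F-mono r 1

    c₂-def : c₂ ≡ Simultaneous.reach (suc (2 * q)) F F-mono r 1
    c₂-def = refl

module ConfigMain {n : ℕ} (q ρ m : ℕ) (G : Graph n) (free : ForbiddenFree q ρ m G) (md : MinDegree ρ G)
                  (1≤q : 1 ≤ q) (Kf : ℕ → ℕ) (Kf-mono : Monotone Kf) (Kf-pos : ∀ c → 1 ≤ Kf c)
                  (large : ConfigConst.n₁ q ρ m Kf Kf-mono ≤ n) where
  open Graphs G
  open Forests G
  open UniformPieces G
  open ErdosGallai G
  open RoughConst q ρ m
  open ConfigConst q ρ m Kf Kf-mono
  open Rough q ρ m G free md using (r; T)
  open Classes q ρ m G free md using (cls; Bad)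
  open RoughMain q ρ m G free md 1≤q (n₀≤n₁ & large) using (Cl; Cl-pathfree; rough)

  opaque
    A : T
    A = fst rough

    few-bad : # (Bad A) ≤ c₁
    few-bad = snd rough

  S : Fin r → V → Bool
  S = Cl A

  d-split : ∀ v X → d v full ≡ d v X + d v (∁ X)
  d-split v X = #-split (adj G v ∩ full) X ∙ (cong₂ _+_ (lem X) (lem (∁ X))) where
    lem : ∀ X → # ((adj G v ∩ full) ∩ X) ≡ d v X
    lem X = (#-∑ _) ∙ (∑-cong λ w → cong 𝟙 (pt (adj G v w) (X w))) ∙ sym (#-∑ (adj G v ∩ X)) where
      pt : ∀ a b → (a ∧ true) ∧ b ≡ a ∧ b
      pt true  b = refl
      pt false b = refl

  d-∁ : ∀ v X → d v (∁ X) + # (∁ X ∩ ∁ (adj G v)) ≡ # (∁ X)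
  d-∁ v X = cong (_+ # (∁ X ∩ ∁ (adj G v))) ((#-∑ _) ∙ (∑-cong λ w → cong 𝟙 (comm (adj G v w) (not (X w)))) ∙ sym (#-∑ (∁ X ∩ adj G v))) ∙
    sym (#-split (∁ X) (adj G v)) where
    comm : ∀ a b → a ∧ b ≡ b ∧ a
    comm true  true  = refl
    comm true  false = refl
    comm false true  = refl
    comm false false = refl

  -- By Erdős-Gallai a nonempty class has a vertex with at most `2 * q` neighbours inside; its
  -- degree, nearly `(1 - 1/r) n`, has to fit into the complement of the class.
  class-upper : ∀ i → r * # (S i) ≤ n + s₁
  class-upper i = go (any? λ v → (S i v ≟ᵇ true) ×-dec (d v (S i) ≤? 2 * q)) where
    go : Dec (∃ λ v → S i v ≡ true × d v (S i) ≤ 2 * q) → r * # (S i) ≤ n + s₁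
    go (yes (v , sv , low)) = subst (λ s → r * # (S i) ≤ n + s) (sym s₁-def) (upper-arith ρ n q (md v) x≤ (≤-reflexive (#-∁ (S i)))) where
      x≤ : d v full ≤ 2 * q + # (∁ (S i))
      x≤ = d-split v (S i) =& +-mono-≤ low (m≤m+n _ _ &= d-∁ v (S i))
    go (no ¬low) = (cong (r *_) empty ∙ *-zeroʳ r) =& z≤n where
      dense : suc (2 * q) * # (S i) ≤ E (S i) (S i)
      dense = (*-comm (suc (2 * q)) _ ∙ sym (#-∑* (suc (2 * q)) (S i))) =& (∑-mono λ v → ≤-𝟙* (S i v) λ sv → ≰⇒> λ le → ¬low (v , sv , le))
      empty : # (S i) ≡ 0
      empty = n≤0⇒n≡0 (+-cancelʳ-≤ (2 * q * # (S i)) _ _ (dense & fst (EG q (S i) (Cl-pathfree A i))))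

  -- The other `r - 1` classes obey `class-upper` and few vertices are unclassified, so this class
  -- has to make up the rest.
  class-lower : ∀ i → n ≤ r * # (S i) + s₂
  class-lower i = subst (λ s → n ≤ r * # (S i) + s) (sym s₂-def) (lower-arith ρ n s₁ {a = # (S i)} others few-bad (≤-reflexive (sym total))) where
    total : ∑ (λ j → # (S j)) + # (Bad A) ≡ n
    total = ∑-classes full (cls A) ∙ #-full n
    others : r * ∑ (λ j → # (S j)) ≤ suc ρ * (n + s₁) + r * # (S i)
    others = sym (∑-*ˡ r λ j → # (S j)) =& (∑-one (λ j → r * # (S j)) i (n + s₁) λ j _ → class-upper j)

  -- With few neighbours in class `i`, the degree of `v` is nearly the size of the complement of
  -- that class.
  few-missing : ∀ i v c → d v (S i) ≤ suc (2 * q) + c → # (∁ (S i) ∩ ∁ (adj G v)) ≤ missing c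
  few-missing i v c low = m≤n*m (# (∁ (S i) ∩ ∁ (adj G v))) r & subst (λ k → r * # (∁ (S i) ∩ ∁ (adj G v)) ≤ k) (sym (missing-def c))
    (missing-arith ρ n {a = # (S i)} {z = # (∁ (S i) ∩ ∁ (adj G v))} (md v) (≤-reflexive (d-split v (S i))) low (class-lower i)
      (≤-reflexive (cong (# (S i) +_) (d-∁ v (S i)) ∙ (#-∁ (S i)))))

  open Simultaneous (suc (2 * q)) F F-mono

  config : ∃ λ c → c ≤ c₂ × Config ρ G c (Kf c)
  config = assemble (simultaneous (reach r 1) r (λ i c K → Pieces q (S i) c K) (λ i → Pieces-weaken)
      (λ i f c₀ pos le → TreeDepth.pieces q (S i) (Cl-pathfree A i) f c₀ pos (le & size i)) 1 ≤-refl ≤-refl) where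
    size : ∀ i → reach r 1 ≤ # (S i)
    size i = *-cancelˡ-≤ r (+-cancelʳ-≤ s₂ _ _ ((reach≤n₁ & large) & class-lower i))
    assemble : (∃ λ c → 1 ≤ c × c ≤ reach r 1 × ((i : Fin r) → Pieces q (S i) c (F c))) → ∃ λ c → c ≤ c₂ × Config ρ G c (Kf c)
    assemble (c , _ , c≤ , pieces) = c , c≤ &= sym c₂-def , Assemble.config q ρ G (cls A) c₁ ζ₀ (missing c) c (Kf c) (K₁ c) few-bad (≤-reflexive (sym ζ₀-def))
      (λ i v → few-missing i v c) (Kf-pos c & Kf≤K₁ c) (≤-reflexive (sym (K₁-def c))) pieces

-- The weighted deletion inequality.

+-exchange : ∀ a b c d → a + b + (c + d) ≡ a + c + (b + d)
+-exchange = solve-∀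

lsum : ∀ {A : Set} → (A → ℕ) → List A → ℕ
lsum f []       = 0
lsum f (x ∷ xs) = f x + lsum f xs

module _ {A : Set} where
  lsum-++ : ∀ (f : A → ℕ) xs {ys} → lsum f (xs ++ ys) ≡ lsum f xs + lsum f ys
  lsum-++ f [] = refl
  lsum-++ f (x ∷ xs) = cong (f x +_) (lsum-++ f xs) ∙ sym (+-assoc (f x) _ _)

  lsum-map : ∀ {B : Set} (f : B → ℕ) (g : A → B) xs → lsum f (map g xs) ≡ lsum (λ a → f (g a)) xs
  lsum-map f g [] = refl
  lsum-map f g (x ∷ xs) = cong (f (g x) +_) (lsum-map f g xs)

  lsum-cong : ∀ {f g : A → ℕ} xs → (∀ {x} → x ∈ xs → f x ≡ g x) → lsum f xs ≡ lsum g xs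
  lsum-cong [] h = refl
  lsum-cong (x ∷ xs) h = cong₂ _+_ (h (here refl)) (lsum-cong xs λ m → h (there m))

  lsum-+ : ∀ (f g : A → ℕ) xs → lsum (λ a → f a + g a) xs ≡ lsum f xs + lsum g xs
  lsum-+ f g [] = refl
  lsum-+ f g (x ∷ xs) = cong (f x + g x +_) (lsum-+ f g xs) ∙ +-exchange (f x) (g x) _ _

  lsum-∑ : ∀ {k} (f : Fin k → A → ℕ) xs → ∑ (λ i → lsum (f i) xs) ≡ lsum (λ a → ∑ (λ i → f i a)) xs
  lsum-∑ {k} f [] = ∑-zero {k} λ _ → refl
  lsum-∑ f (x ∷ xs) = ∑-distrib-+ (λ i → f i x) (λ i → lsum (f i) xs) ∙ cong (∑ (λ i → f i x) +_) (lsum-∑ f xs)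

  lcount-++ : ∀ (P : A → Bool) xs {ys} → lcount P (xs ++ ys) ≡ lcount P xs + lcount P ys
  lcount-++ P [] = refl
  lcount-++ P (x ∷ xs) = cong (𝟙 (P x) +_) (lcount-++ P xs) ∙ sym (+-assoc (𝟙 (P x)) _ _)

  lcount-map : ∀ {B : Set} (P : B → Bool) (g : A → B) xs → lcount P (map g xs) ≡ lcount (λ a → P (g a)) xs
  lcount-map P g [] = refl
  lcount-map P g (x ∷ xs) = cong (𝟙 (P (g x)) +_) (lcount-map P g xs)

  lcount-cong : ∀ {P Q : A → Bool} xs → (∀ {x} → x ∈ xs → P x ≡ Q x) → lcount P xs ≡ lcount Q xs
  lcount-cong [] h = refl
  lcount-cong (x ∷ xs) h = cong₂ _+_ (cong 𝟙 (h (here refl))) (lcount-cong xs λ m → h (there m))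

  lcount-none : ∀ (P : A → Bool) xs → (∀ {x} → x ∈ xs → P x ≡ false) → lcount P xs ≡ 0
  lcount-none P [] h = refl
  lcount-none P (x ∷ xs) h = cong₂ _+_ (cong 𝟙 (h (here refl))) (lcount-none P xs λ m → h (there m))

  lcount-all : ∀ (P : A → Bool) xs → (∀ {x} → x ∈ xs → P x ≡ true) → lcount P xs ≡ length xs
  lcount-all P [] h = refl
  lcount-all P (x ∷ xs) h = cong₂ _+_ (cong 𝟙 (h (here refl))) (lcount-all P xs λ m → h (there m))

lcount-concat : ∀ {A : Set} (P : A → Bool) {k} (f : Fin k → List A) → lcount P (concat (tabulate f)) ≡ ∑ (λ i → lcount P (f i))
lcount-concat P {zero}  f = sym (∑-empty _)
lcount-concat P {suc k} f = lcount-++ P (f zero) ∙ cong (lcount P (f zero) +_) (lcount-concat P λ i → f (suc i)) ∙ sym (∑-suc λ i → lcount P (f i))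

length-concat-tabulate : ∀ {A : Set} {k} s (f : Fin k → List A) → (∀ i → length (f i) ≡ s) → length (concat (tabulate f)) ≡ k * s
length-concat-tabulate {k = zero}  s f h = refl
length-concat-tabulate {k = suc k} s f h = length-++ (f zero) ∙ (cong₂ _+_ (h zero) (length-concat-tabulate s (λ i → f (suc i)) λ i → h (suc i)))

Unique-concat-tabulate : ∀ {A : Set} {k} (f : Fin k → List A) → (∀ i → Unique (f i)) →
  (∀ {i j x} → i ≢ j → x ∈ f i → x ∉ f j) → Unique (concat (tabulate f))
Unique-concat-tabulate f u disj = Uniqueₚ.concat⁺ (Allₚ.tabulate⁺ u) (AllPairsₚ.tabulate⁺ λ ne p → disj ne (fst p) (snd p))

lcount≤# : ∀ {n} (P : Fin n → Bool) xs → Unique xs → lcount P xs ≤ # P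
lcount≤# P [] u = z≤n
lcount≤# P (x ∷ xs) u@(_ ∷ u') = +-monoʳ-≤ (𝟙 (P x)) ((lcount-cong xs λ {y} m → same y m) =& lcount≤# (P ∩ ∁ (isᵇ x)) xs u') &=
    sym (#-remove P x) where
  same : ∀ y → y ∈ xs → P y ≡ (P ∩ ∁ (isᵇ x)) y
  same y m with y ≟ᶠ x
  ... | yes refl = ⊥-elim (Unique-∷⁻ u m)
  ... | no _ with P y
  ...   | true  = refl
  ...   | false = refl

Unique-length : ∀ {n} (xs : List (Fin n)) → Unique xs → length xs ≤ n
Unique-length {n} xs u = sym (lcount-all full xs λ _ → refl) =& lcount≤# full xs u &= #-full n

#-lcount : ∀ {n} (P : Fin n → Bool) xs → Unique xs → (∀ {v} → v ∈ xs) → # P ≡ lcount P xs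
#-lcount P xs u all = ≤-antisym (#≤lcount P P xs (λ v _ → all) (λ _ → id)) (lcount≤# P xs u)

∑-single : ∀ {n} (f : Fin n → ℕ) x → ∑ (λ v → 𝟙 (isᵇ x v) * f v) ≡ f x
∑-single f x = ∑-remove (λ v → 𝟙 (isᵇ x v) * f v) x ∙ (cong₂ _+_ head (∑-zero rest)) ∙ +-identityʳ (f x) where
  head : 𝟙 (isᵇ x x) * f x ≡ f x
  head = cong (λ b → 𝟙 b * f x) (dec-true (x ≟ᶠ x) refl) ∙ +-identityʳ (f x)
  rest : ∀ v → 𝟙 (not (isᵇ x v)) * (𝟙 (isᵇ x v) * f v) ≡ 0
  rest v with v ≟ᶠ x
  ... | yes _ = refl
  ... | no _  = refl

∑-member : ∀ {n} (f : Fin n → ℕ) xs → Unique xs → ∑ (λ v → 𝟙 (memᵇ xs v) * f v) ≤ lsum f xs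
∑-member f [] u = ≤-reflexive (∑-zero λ v → refl)
∑-member f (x ∷ xs) u@(_ ∷ u') = ∑-remove (λ v → 𝟙 (memᵇ (x ∷ xs) v) * f v) x =& +-mono-≤
    (*-monoˡ-≤ (f x) (𝟙≤1 (memᵇ (x ∷ xs) x)) &= +-identityʳ (f x))
    (∑-mono le & ∑-member f xs u') where
  le : ∀ v → 𝟙 (not (does (v ≟ᶠ x))) * (𝟙 (memᵇ (x ∷ xs) v) * f v) ≤ 𝟙 (memᵇ xs v) * f v
  le v with v ≟ᶠ x
  ... | yes _ = z≤n
  ... | no _ = ≤-reflexive (+-identityʳ _)

weightᵇ : Bool → ℕ
weightᵇ true  = 1
weightᵇ false = 2

-- Vertices outside S count twice: this is the change of twice the edge number when S is deleted.
module Weights {n : ℕ} (G : Graph n) where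
  open Graphs G

  μ : List V → V → ℕ
  μ S v = weightᵇ (memᵇ S v)

  μ≤2 : ∀ S v → μ S v ≤ 2
  μ≤2 S v with memᵇ S v
  ... | true  = s≤s z≤n
  ... | false = ≤-refl

  μ-in : ∀ S v → v ∈ S → μ S v ≡ 1
  μ-in S v m rewrite dec-true (v ∈ᶠ? S) m = refl

  -- The right side is the loss in twice the edge number when `S` is deleted. The left side is the
  -- growth of the benchmark over as many vertices: a share of `r - 1` parts for each vertex, plus
  -- `2 * q * (2 * u)`. In the apex construction the latter is the contribution of `q` apexes of
  -- weight two, each seeing one more part.
  Deletion : (q ρ smax : ℕ) → Set
  Deletion q ρ smax = ∀ u → 2 * u ≤ smax → ∀ S → Unique S → length S ≡ suc (suc ρ) * (2 * u) →
    ∑ (λ v → μ S v * (suc ρ * (2 * u))) + 2 * q * (2 * u) ≤ ∑ (λ v → μ S v * lcount (adj G v) S)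

  module _ {q ρ smax : ℕ} (del : Deletion q ρ smax) where
    -- `ε` is the excess of a vertex over `r - 1` full parts of `S`; enough weighted excess must
    -- exist. If the available excess is no larger than required, `deletion-equal` determines every
    -- degree into `S`.
    deletion-bound : ∀ u → 2 * u ≤ smax → ∀ S → Unique S → length S ≡ suc (suc ρ) * (2 * u) → (ε : V → ℕ) →
      (∀ v → lcount (adj G v) S ≤ suc ρ * (2 * u) + ε v) → 2 * q * (2 * u) ≤ ∑ (λ v → μ S v * ε v)
    deletion-bound u le S uniq len ε h = +-cancelˡ-≤ (∑ (λ v → μ S v * (suc ρ * (2 * u)))) _ _ (del u le S uniq len &
      (∑-mono λ v → *-monoʳ-≤ (μ S v) (h v)) &= ((∑-cong λ v → *-distribˡ-+ (μ S v) (suc ρ * (2 * u)) (ε v)) ∙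
        ∑-distrib-+ (λ v → μ S v * (suc ρ * (2 * u))) (λ v → μ S v * ε v)))

    deletion-equal : ∀ u → 2 * u ≤ smax → ∀ S → Unique S → length S ≡ suc (suc ρ) * (2 * u) → (ε : V → ℕ) →
      (∀ v → lcount (adj G v) S ≤ suc ρ * (2 * u) + ε v) → ∑ (λ v → μ S v * ε v) ≤ 2 * q * (2 * u) →
      ∀ v → lcount (adj G v) S ≡ suc ρ * (2 * u) + ε v
    deletion-equal u le S uniq len ε h tight v = cancel (μ S v) (μ-pos v) (∑-equal (λ w → *-monoʳ-≤ (μ S w) (h w))
        (((∑-cong λ w → *-distribˡ-+ (μ S w) (suc ρ * (2 * u)) (ε w)) ∙ ∑-distrib-+ (λ w → μ S w * (suc ρ * (2 * u))) (λ w → μ S w * ε w)) =&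
          +-monoʳ-≤ _ tight & del u le S uniq len) v) where
      μ-pos : ∀ v → 1 ≤ μ S v
      μ-pos v with memᵇ S v
      ... | true  = ≤-refl
      ... | false = s≤s z≤n
      cancel : ∀ k {a b} → 1 ≤ k → k * a ≡ k * b → a ≡ b
      cancel (suc k) {a} {b} _ e = *-cancelˡ-≡ a b (suc k) e

-- The vertices of a forest are removed from the leaves up: each accounts for its edges to
-- its ancestors only.
module ForestWeight {n : ℕ} (G : Graph n) where
  open Graphs G
  open Forests G

  L : List V → List V → ℕ
  L X Y = lsum (λ a → lcount (adj G a) Y) X

  L-++ʳ : ∀ X Y {Z} → L X (Y ++ Z) ≡ L X Y + L X Z
  L-++ʳ X Y {Z} = (lsum-cong X λ {a} _ → lcount-++ (adj G a) Y) ∙ lsum-+ (λ a → lcount (adj G a) Y) (λ a → lcount (adj G a) Z) X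

  L-single : ∀ X v → L X (v ∷ []) ≡ lcount (adj G v) X
  L-single [] v = refl
  L-single (x ∷ X) v = cong₂ _+_ (+-identityʳ _ ∙ cong 𝟙 (adj-sym G x v)) (L-single X v)

  L-none : ∀ X Y → (∀ {x y} → x ∈ X → y ∈ Y → ¬ Adj x y) → L X Y ≡ 0
  L-none [] Y h = refl
  L-none (x ∷ X) Y h = cong₂ _+_ (lcount-none (adj G x) Y λ m → ¬true⇒false (h (here refl) m)) (L-none X Y λ a b → h (there a) b)

  L-cons : ∀ v W → L (v ∷ W) (v ∷ W) ≡ L W W + 2 * L W (v ∷ [])
  L-cons v W = (cong₂ _+_ (cong (λ b → 𝟙 b + lcount (adj G v) W) (adj-irr G v)) (L-++ʳ W (v ∷ []) {W})) ∙
    cong (_+ (L W (v ∷ []) + L W W)) (sym (L-single W v)) ∙ lem (L W (v ∷ [])) (L W W) where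
    lem : ∀ a b → a + (a + b) ≡ b + 2 * a
    lem = solve-∀

  module _ (q : ℕ) (k : V → ℕ) where
    forest-weight : ∀ {a as u X} → Forest (a ∷ as) X → Path a (a ∷ as) u → Unique (a ∷ as) → Unique X → (∀ {x} → x ∈ X → x ∉ a ∷ as) →
      (∀ {v anc} → Path v (v ∷ anc) u → Unique (v ∷ anc) → 1 ≤ length anc → length anc + k v ≤ q) →
      L X X + 2 * L X (a ∷ as) + 2 * lsum k X ≤ 2 * q * length X
    forest-weight nil p uA uX disj h = z≤n
    forest-weight {a} {as} (node {v = v} {Xs} {Ys} b F₁ F₂ sep) p uA uX@(_ ∷ uXY) disj h = combine-bounds
        (forest-weight F₁ (b ∷ p) uvA (Unique-++⁻ˡ Xs uXY) (λ m → ∈-∷-∉ (λ { refl → Unique-∷⁻ uX (∈-++⁺ˡ m) }) (disj (there (∈-++⁺ˡ m)))) h)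
        (forest-weight F₂ p uA (Unique-++⁻ʳ Xs uXY) (λ m → disj (there (∈-++⁺ʳ Xs m))) h)
        (+-monoˡ-≤ (k v) (lcount≤length (adj G v) (a ∷ as)) & h (b ∷ p) uvA (s≤s z≤n)) where
      uvA : Unique (v ∷ a ∷ as)
      uvA = ∉⇒All≢ (disj (here refl)) ∷ uA
      A : List V
      A = a ∷ as
      LW : L (Xs ++ Ys) (Xs ++ Ys) ≡ L Xs Xs + L Ys Ys
      LW = lsum-++ (λ x → lcount (adj G x) (Xs ++ Ys)) Xs ∙ (cong₂ _+_
        (L-++ʳ Xs Xs ∙ cong (L Xs Xs +_) (L-none Xs Ys λ m m' → sep (there m) m') ∙ +-identityʳ _)
        (L-++ʳ Ys Xs ∙ cong (_+ L Ys Ys) (L-none Ys Xs λ m m' e → sep (there m') m (Adj-sym e))))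
      Lv : L (Xs ++ Ys) (v ∷ []) ≡ L Xs (v ∷ [])
      Lv = lsum-++ (λ x → lcount (adj G x) (v ∷ [])) Xs ∙ cong (L Xs (v ∷ []) +_) (L-none Ys (v ∷ []) λ { m (here refl) e → sep (here refl) m (Adj-sym e) }) ∙ +-identityʳ _
      total : L (v ∷ Xs ++ Ys) (v ∷ Xs ++ Ys) + 2 * L (v ∷ Xs ++ Ys) A + 2 * lsum k (v ∷ Xs ++ Ys)
            ≡ (L Xs Xs + 2 * L Xs (v ∷ A) + 2 * lsum k Xs) + (L Ys Ys + 2 * L Ys A + 2 * lsum k Ys) + 2 * (lcount (adj G v) A + k v)
      total = (cong₂ _+_ (cong₂ (λ x y → x + 2 * y) (L-cons v (Xs ++ Ys) ∙ cong₂ (λ x y → x + 2 * y) LW Lv)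
            (cong (lcount (adj G v) A +_) (lsum-++ (λ x → lcount (adj G x) A) Xs)))
          (cong (λ z → 2 * (k v + z)) (lsum-++ k Xs))) ∙
        lem (L Xs Xs) (L Ys Ys) (L Xs (v ∷ [])) (lcount (adj G v) A) (L Xs A) (L Ys A) (k v) (lsum k Xs) (lsum k Ys) ∙
          cong (λ z → L Xs Xs + 2 * z + 2 * lsum k Xs + (L Ys Ys + 2 * L Ys A + 2 * lsum k Ys) + 2 * (lcount (adj G v) A + k v)) (sym (L-++ʳ Xs (v ∷ []) {A})) where
        lem : ∀ x y xv va xa ya kv kx ky → x + y + 2 * xv + 2 * (va + (xa + ya)) + 2 * (kv + (kx + ky))
            ≡ (x + 2 * (xv + xa) + 2 * kx) + (y + 2 * ya + 2 * ky) + 2 * (va + kv)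
        lem = solve-∀
      combine-bounds : L Xs Xs + 2 * L Xs (v ∷ A) + 2 * lsum k Xs ≤ 2 * q * length Xs → L Ys Ys + 2 * L Ys A + 2 * lsum k Ys ≤ 2 * q * length Ys →
        lcount (adj G v) A + k v ≤ q → L (v ∷ Xs ++ Ys) (v ∷ Xs ++ Ys) + 2 * L (v ∷ Xs ++ Ys) A + 2 * lsum k (v ∷ Xs ++ Ys) ≤ 2 * q * length (v ∷ Xs ++ Ys)
      combine-bounds h₁ h₂ h₃ = total =& +-mono-≤ (+-mono-≤ h₁ h₂) (*-monoʳ-≤ 2 h₃) &=
        (lem q (length Xs) (length Ys) ∙ cong (λ l → 2 * q * suc l) (sym (length-++ Xs))) where
        lem : ∀ q a b → 2 * q * a + 2 * q * b + 2 * q ≡ 2 * q * suc (a + b)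
        lem = solve-∀

induce : ∀ {k n} → Graph n → (Fin k → Fin n) → Graph k
adj     (induce G f) i j = adj G (f i) (f j)
adj-sym (induce G f) i j = adj-sym G (f i) (f j)
adj-irr (induce G f) i   = adj-irr G (f i)

-- The fingerprint of the first extremal graph.
record Apexes {n} (G : Graph n) (q r K : ℕ) : Set where
  field
    apex     : Fin q → Fin n
    apex-inj : ∀ {i j} → apex i ≡ apex j → i ≡ j
    rows     : Rows G r K
    apex-adj : ∀ z i a → adj G (apex z) (cell rows i a) ≡ true

-- Symmetric copies: notation shared by both cases.

module CaseSetup {n : ℕ} (q ρ m : ℕ) (G : Graph n) (free : ForbiddenFree q ρ m G) (c K smax : ℕ) (C : Config ρ G c K)
    (w≤K : Widths.width q m ≤ K) (2c≤K : 2 * c ≤ K) (2c≤smax : 2 * c ≤ smax) (del : Weights.Deletion G q ρ smax) where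
  open Graphs G
  open Embeddings G
  open Blobs q ρ m G free
  open Widths q m renaming (width to w)
  open Config C public
  open Weights G
  open Zigzag G

  r : ℕ
  r = suc (suc ρ)

  1<K : 1 < K
  1<K = (s≤s (s≤s z≤n) & matching-width) & w≤K

  k₀ k₁ : Fin K
  k₀ = fromℕ< (<⇒≤ 1<K)
  k₁ = fromℕ< 1<K

  k₀≢k₁ : k₀ ≢ k₁
  k₀≢k₁ e = case sym (toℕ-fromℕ< (<⇒≤ 1<K)) ∙ cong toℕ e ∙ toℕ-fromℕ< 1<K of λ ()

  a₀ : ∀ j → Fin (t j)
  a₀ j = fromℕ< (t-pos j)

  Γ : ∀ i → Graph (t i)
  Γ i = induce G (P i k₀)

  Γ-adj : ∀ i k a b → adj G (P i k a) (P i k b) ≡ adj (Γ i) a b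
  Γ-adj i k a b = Γ-same i k k₀ a b

  copies-apart : ∀ i {k k'} a b → k ≢ k' → ¬ Adj (P i k a) (P i k' b)
  copies-apart i {k} {k'} a b ne h = [ (λ { (z , e) → P∉Z i k' b z e }) , (λ { (_ , e) → ne (sym (fst (P-inj i e))) }) ]′
    (closed i k a (P-cls i k' b) h)

  cells-distinct : ∀ {i j k k' a b} → i ≢ j → P i k a ≢ P j k' b
  cells-distinct ne e = Adj-≢ (compl _ _ _ _ ne) e

  map-path : ∀ i k {x xs y} → Graphs.Path (Γ i) x xs y → Path (P i k x) (map (P i k) xs) (P i k y)
  map-path i k Graphs.[ x ] = [ P i k x ]
  map-path i k (_∷_ {x} {y} h p) = Γ-adj i k x y ∙ h ∷ map-path i k p

-- Edges in the copies of at most one class: finding q apexes.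

module CaseI {n : ℕ} (q ρ m : ℕ) (G : Graph n) (free : ForbiddenFree q ρ m G) (c K smax : ℕ) (C : Config ρ G c K)
    (w≤K : Widths.width q m ≤ K) (2c≤K : 2 * c ≤ K) (2c≤smax : 2 * c ≤ smax) (del : Weights.Deletion G q ρ smax)
    (i₀ : Fin (2 + ρ)) (plain : ∀ j → j ≢ i₀ → ∀ k a b → adj G (Config.P C j k a) (Config.P C j k b) ≡ false) where
  open Graphs G
  open Embeddings G
  open Blobs q ρ m G free
  open Widths q m renaming (width to w)
  open Weights G
  open Zigzag G
  open CaseSetup q ρ m G free c K smax C w≤K 2c≤K 2c≤smax del
  private
    Γ₀ : Graph (t i₀)
    Γ₀ = Γ i₀
    module Γ₀ = Graphs Γ₀
  open ForestWeight Γ₀ using (L)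

  -- Such vertices of `Z` can be added to part `i₀` of the frame. Because traces on `Z` are uniform,
  -- testing a single copy settles all of them.
  Yz? : ∀ z → Dec (∀ j → j ≢ i₀ → Adj (P j k₀ (a₀ j)) (Z z))
  Yz? z = all? λ j → ¬? (j ≟ᶠ i₀) →-dec (adj G (P j k₀ (a₀ j)) (Z z) ≟ᵇ true)

  Yz : Fin ζ → Bool
  Yz = set Yz?

  Yz-adj : ∀ {z} → Yz z ≡ true → ∀ j k → j ≢ i₀ → Adj (P j k (a₀ j)) (Z z)
  Yz-adj {z} e j k ne = Θ-same j k k₀ (a₀ j) z ∙ set⁻ Yz? e j ne

  Θ : Fin (t i₀) → Fin ζ → Bool
  Θ a z = adj G (P i₀ k₀ a) (Z z)

  Θ-adj : ∀ {a z} k → Θ a z ≡ true → Adj (P i₀ k a) (Z z)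
  Θ-adj {a} {z} k e = Θ-same i₀ k k₀ a z ∙ e

  apexes : Fin (t i₀) → ℕ
  apexes a = # (Yz ∩ Θ a)

  Core : V → Set
  Core v = (∃ λ k → ∃ λ a → v ≡ P i₀ k a) ⊎ ∃ λ z → Yz z ≡ true × v ≡ Z z

  Row : Fin r → V → Set
  Row j v = ∃ λ k → v ≡ P j k (a₀ j)

  core-row : ∀ {j x y} → j ≢ i₀ → Core x → Row j y → Adj x y
  core-row ne (inl (k , a , refl)) (k' , refl) = compl _ _ _ _ (ne ∘ sym)
  core-row ne (inr (z , yz , refl)) (k' , refl) = Adj-sym (Yz-adj yz _ k' ne)

  row-row : ∀ {j j' x y} → j ≢ j' → Row j x → Row j' y → Adj x y
  row-row ne (k , refl) (k' , refl) = compl _ _ _ _ ne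

  rep : ∀ j {Q : V → Set} → (∀ k → Q (P j k (a₀ j))) → Many w Q
  rep j h = Many-image (λ k → P j k (a₀ j)) (λ e → fst (P-inj j e)) (λ {k} _ → h k) (Many-≤ w≤K Many-all)

  core-many : Many w Core
  core-many = rep i₀ λ k → inl (k , a₀ i₀ , refl)

  rows-many : ∀ j → j ≢ i₀ → Many w (Row j)
  rows-many j _ = rep j λ k → k , refl

  open Centred i₀ Core Row core-row row-row core-many rows-many

  core-path : ∀ {x xs y} → Path x xs y → Unique xs → (∀ {v} → v ∈ xs → Core v) → length xs ≤ suc (2 * q)
  core-path {xs = xs} p u core = ≮⇒≥ λ gt → F₁-blob In complete-In rich i₀ p u (λ m → inl (refl , core m)) gt

  -- The set to be deleted: two copies of `X` in class `i₀` and `2 * u` representatives from every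
  -- other class. Two copies are taken because the number per class has to be even.
  module Deleting (X : List (Fin (t i₀))) (uX : Unique X) (closedX : ∀ {a b} → a ∈ X → adj Γ₀ a b ≡ true → b ∈ X) where
    u : ℕ
    u = length X

    2u≤2c : 2 * u ≤ 2 * c
    2u≤2c = *-monoʳ-≤ 2 (Unique-length X uX & t≤c i₀)

    2u≤K : 2 * u ≤ K
    2u≤K = 2u≤2c & 2c≤K

    S₀ : List V
    S₀ = map (P i₀ k₀) X ++ map (P i₀ k₁) X

    sel : ∀ i → Dec (i ≡ i₀) → List V
    sel i (yes _) = S₀
    sel i (no _)  = tabulate {n = 2 * u} λ x → P i (inject≤ x 2u≤K) (a₀ i)

    sel-len : ∀ i e → length (sel i e) ≡ 2 * u
    sel-len i (yes _) = length-++ (map (P i₀ k₀) X) ∙ (cong₂ _+_ (length-map _ X) (length-map _ X ∙ sym (+-identityʳ u)))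
    sel-len i (no _)  = length-tabulate {n = 2 * u} _

    S₀-cell : ∀ {v} → v ∈ S₀ → ∃ λ k → ∃ λ a → (k ≡ k₀ ⊎ k ≡ k₁) × a ∈ X × v ≡ P i₀ k a
    S₀-cell m with ∈-++⁻ (map (P i₀ k₀) X) m
    ... | inl h = let (a , a∈ , e) = ∈-map⁻ (P i₀ k₀) h in k₀ , a , inl refl , a∈ , e
    ... | inr h = let (a , a∈ , e) = ∈-map⁻ (P i₀ k₁) h in k₁ , a , inr refl , a∈ , e

    S₀-in : ∀ {k a} → k ≡ k₀ ⊎ k ≡ k₁ → a ∈ X → P i₀ k a ∈ S₀
    S₀-in (inl refl) m = ∈-++⁺ˡ (∈-map⁺ (P i₀ k₀) m)
    S₀-in (inr refl) m = ∈-++⁺ʳ (map (P i₀ k₀) X) (∈-map⁺ (P i₀ k₁) m)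

    sel-cell : ∀ i e {v} → v ∈ sel i e → ∃ λ k → ∃ λ a → v ≡ P i k a
    sel-cell i (yes refl) m = let (k , a , _ , _ , e) = S₀-cell m in k , a , e
    sel-cell i (no _) m = let (x , e) = ∈-tabulate⁻ {n = 2 * u} m in inject≤ x 2u≤K , a₀ i , e

    sel-uniq : ∀ i e → Unique (sel i e)
    sel-uniq i (yes _) = Uniqueₚ.++⁺ (Uniqueₚ.map⁺ (λ e → snd (P-inj i₀ e)) uX) (Uniqueₚ.map⁺ (λ e → snd (P-inj i₀ e)) uX)
      λ { (m₁ , m₂) → let (_ , _ , e₁) = ∈-map⁻ (P i₀ k₀) m₁ ; (_ , _ , e₂) = ∈-map⁻ (P i₀ k₁) m₂ in k₀≢k₁ (fst (P-inj i₀ (sym e₁ ∙ e₂))) }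
    sel-uniq i (no _) = Uniqueₚ.tabulate⁺ λ e → inject≤-injective 2u≤K 2u≤K _ _ (fst (P-inj i e))

    Si : Fin r → List V
    Si i = sel i (i ≟ᶠ i₀)

    S : List V
    S = concat (tabulate Si)

    S-uniq : Unique S
    S-uniq = Unique-concat-tabulate Si (λ i → sel-uniq i (i ≟ᶠ i₀)) λ {i} {j} ne m m' →
      let (k , a , e) = sel-cell i (i ≟ᶠ i₀) m ; (k' , a' , e') = sel-cell j (j ≟ᶠ i₀) m' in cells-distinct ne (sym e ∙ e')

    S-len : length S ≡ r * (2 * u)
    S-len = length-concat-tabulate (2 * u) Si λ i → sel-len i (i ≟ᶠ i₀)

    Si₀ : ∀ e → sel i₀ e ≡ S₀
    Si₀ (yes _) = refl
    Si₀ (no ne) = ⊥-elim (ne refl)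

    S₀⊆S : ∀ {v} → v ∈ S₀ → v ∈ S
    S₀⊆S m = ∈-concat⁺′ (subst (_ ∈_) (sym (Si₀ (i₀ ≟ᶠ i₀))) m) (∈-tabulate⁺ {f = Si} i₀)

    f : V → Fin r → ℕ
    f v i = lcount (adj G v) (Si i)

    f₀ : ∀ v → f v i₀ ≡ lcount (adj G v) S₀
    f₀ v = cong (lcount (adj G v)) (Si₀ (i₀ ≟ᶠ i₀))

    f≤ : ∀ v i → f v i ≤ 2 * u
    f≤ v i = lcount≤length (adj G v) (Si i) &= sel-len i (i ≟ᶠ i₀)

    A B ε : V → ℕ
    A v = 𝟙 (memᵇ S₀ v) * lcount (adj G v) S₀
    B v = ∑ (λ z → 𝟙 (isᵇ (Z z) v) * (𝟙 (Yz z) * lcount (adj G v) S₀))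
    ε v = A v + B v

    -- A vertex outside `Z` sees nothing of `S` in its own class, except that a vertex of a deleted
    -- copy sees its neighbours there (`A`). A vertex of `Z` not adjacent to some foreign
    -- representative misses that entire row; the others have excess at most their degree to the two
    -- copies (`B`).
    ∑f≤ : ∀ v → ∑ (f v) ≤ suc ρ * (2 * u) + ε v
    ∑f≤ v = byZ (any? λ z → v ≟ᶠ Z z) where
      at : ∀ i {e} → f v i ≤ e → ∑ (f v) ≤ suc ρ * (2 * u) + e
      at i le = (∑-one (f v) i (2 * u) λ j _ → f≤ v j) & +-monoʳ-≤ (suc ρ * (2 * u)) le
      none : ∀ i → (∀ {x} → x ∈ Si i → adj G v x ≡ false) → ∑ (f v) ≤ suc ρ * (2 * u) + ε v
      none i h = at i (lcount-none (adj G v) (Si i) h =& z≤n)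
      notAdj : ∀ i k a → (∀ {b} → adj (Γ i) a b ≡ true → v ≢ P i k b) → (∀ z → v ≢ Z z) → cls v ≡ just i → adj G v (P i k a) ≡ false
      notAdj i k a noΓ v∉Z cv = ¬true⇒false λ h → [ (λ { (z , e) → v∉Z z e }) ,
          (λ { (b , e) → noΓ {b} (sym (Γ-adj i k a b) ∙ cong (adj G (P i k a)) (sym e) ∙ Adj-sym h) e }) ]′ (closed i k a cv (Adj-sym h))
      byClass : (∀ z → v ≢ Z z) → ∀ i → cls v ≡ just i → (d₀ : Dec (i ≡ i₀)) → (∀ {x} → x ∈ Si i → x ∈ sel i d₀) → ∑ (f v) ≤ suc ρ * (2 * u) + ε v
      byClass v∉Z i cv (no ne) sub = none i λ m → let (x , e) = ∈-tabulate⁻ {n = 2 * u} (sub m) in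
        cong (adj G v) e ∙ notAdj i (inject≤ x 2u≤K) (a₀ i) (λ h → ⊥-elim (true≢false h (plain i ne k₀ _ _))) v∉Z cv
      byClass v∉Z i cv (yes refl) sub = byMem (v ∈ᶠ? S₀) refl where
        byMem : (dm : Dec (v ∈ S₀)) → does dm ≡ memᵇ S₀ v → ∑ (f v) ≤ suc ρ * (2 * u) + ε v
        byMem (yes m) e = at i₀ ((f₀ v ∙ sym (+-identityʳ _) ∙ cong (λ b → 𝟙 b * lcount (adj G v) S₀) e) =& m≤m+n (A v) (B v))
        byMem (no v∉) e = none i₀ λ m → let (k , a , k01 , a∈ , e') = S₀-cell (sub m) in
          cong (adj G v) e' ∙ notAdj i₀ k a (λ h ev → v∉ (subst (_∈ S₀) (sym ev) (S₀-in k01 (closedX a∈ h)))) v∉Z cv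
      byZ : Dec (∃ λ z → v ≡ Z z) → ∑ (f v) ≤ suc ρ * (2 * u) + ε v
      byZ (no ¬z) = go (cls v) refl where
        go : ∀ c → cls v ≡ c → ∑ (f v) ≤ suc ρ * (2 * u) + ε v
        go nothing  e = ⊥-elim (¬z (bad⇒Z v e))
        go (just i) e = byClass (λ z h → ¬z (z , h)) i e (i ≟ᶠ i₀) id
      byZ (yes (z , refl)) = go (bool (Yz z)) where
        go : Yz z ≡ true ⊎ Yz z ≡ false → ∑ (f (Z z)) ≤ suc ρ * (2 * u) + ε (Z z)
        go (inl e) = at i₀ (((f₀ (Z z) ∙ sym (cong₂ (λ a b → 𝟙 a * (𝟙 b * lcount (adj G (Z z)) S₀)) (dec-true (Z z ≟ᶠ Z z) refl) e ∙
            +-identityʳ _ ∙ +-identityʳ _)) =& ∑-term (λ z' → 𝟙 (isᵇ (Z z') (Z z)) * (𝟙 (Yz z') * lcount (adj G (Z z)) S₀)) z) & m≤n+m (B (Z z)) (A (Z z)))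
        go (inr e) = missing (any? λ j → ¬? (j ≟ᶠ i₀) ×-dec (adj G (P j k₀ (a₀ j)) (Z z) ≟ᵇ false)) where
          missing : Dec (∃ λ j → j ≢ i₀ × adj G (P j k₀ (a₀ j)) (Z z) ≡ false) → ∑ (f (Z z)) ≤ suc ρ * (2 * u) + ε (Z z)
          missing (no ¬p) = ⊥-elim (set-false Yz? e λ j ne → case bool (adj G (P j k₀ (a₀ j)) (Z z)) of λ { (inl h) → h ; (inr h) → ⊥-elim (¬p (j , ne , h)) })
          missing (yes (j , ne , h)) = none j λ m → side (j ≟ᶠ i₀) m where
            side : ∀ e {x} → x ∈ sel j e → adj G (Z z) x ≡ false
            side (yes e) m = ⊥-elim (ne e)
            side (no _) m = let (x , e) = ∈-tabulate⁻ {n = 2 * u} m in cong (adj G (Z z)) e ∙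
              adj-sym G (Z z) (P j (inject≤ x 2u≤K) (a₀ j)) ∙ Θ-same j (inject≤ x 2u≤K) k₀ (a₀ j) z ∙ h

    S₀-degree : ∀ {k} → k ≡ k₀ ⊎ k ≡ k₁ → ∀ a → lcount (adj G (P i₀ k a)) S₀ ≡ lcount (adj Γ₀ a) X
    S₀-degree {k} k01 a = lcount-++ (adj G (P i₀ k a)) (map (P i₀ k₀) X) ∙ (cong₂ _+_ (lcount-map _ (P i₀ k₀) X) (lcount-map _ (P i₀ k₁) X)) ∙ go k01 where
      same : ∀ k → lcount (λ b → adj G (P i₀ k a) (P i₀ k b)) X ≡ lcount (adj Γ₀ a) X
      same k = lcount-cong X λ {b} _ → Γ-adj i₀ k a b
      other : ∀ {k k'} → k ≢ k' → lcount (λ b → adj G (P i₀ k a) (P i₀ k' b)) X ≡ 0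
      other ne = lcount-none _ X λ {b} _ → ¬true⇒false (copies-apart i₀ a b ne)
      go : k ≡ k₀ ⊎ k ≡ k₁ → lcount (λ b → adj G (P i₀ k a) (P i₀ k₀ b)) X + lcount (λ b → adj G (P i₀ k a) (P i₀ k₁ b)) X ≡ lcount (adj Γ₀ a) X
      go (inl refl) = (cong₂ _+_ (same k₀) (other k₀≢k₁)) ∙ +-identityʳ _
      go (inr refl) = cong₂ _+_ (other (k₀≢k₁ ∘ sym)) (same k₁)

    A-total : ∑ (λ v → μ S v * A v) ≤ 2 * L X X
    A-total = ∑-mono le & ∑-member (λ v → lcount (adj G v) S₀) S₀ (subst Unique (Si₀ (i₀ ≟ᶠ i₀)) (sel-uniq i₀ (i₀ ≟ᶠ i₀))) &=
        (lsum-++ (λ v → lcount (adj G v) S₀) (map (P i₀ k₀) X) ∙ (cong₂ _+_ (copy (inl refl)) (copy (inr refl) ∙ sym (+-identityʳ _)))) where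
      copy : ∀ {k} → k ≡ k₀ ⊎ k ≡ k₁ → lsum (λ v → lcount (adj G v) S₀) (map (P i₀ k) X) ≡ L X X
      copy {k} k01 = lsum-map _ (P i₀ k) X ∙ (lsum-cong X λ {a} _ → S₀-degree k01 a)
      le : ∀ v → μ S v * A v ≤ A v
      le v = go (bool (memᵇ S₀ v)) where
        go : memᵇ S₀ v ≡ true ⊎ memᵇ S₀ v ≡ false → μ S v * A v ≤ A v
        go (inl e) = ≤-reflexive (cong (_* A v) (μ-in S v (S₀⊆S (from-does (v ∈ᶠ? S₀) e))) ∙ +-identityʳ (A v))
        go (inr e) = (cong (λ b → μ S v * (𝟙 b * lcount (adj G v) S₀)) e ∙ *-zeroʳ (μ S v)) =& z≤n

    B-total : ∑ (λ v → μ S v * B v) ≤ 4 * lsum apexes X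
    B-total = (∑-mono λ v → *-monoˡ-≤ (B v) (μ≤2 S v)) &= (∑-*ˡ 2 B ∙ cong (2 *_) total ∙ lem (lsum apexes X)) where
      lem : ∀ x → 2 * (2 * x) ≡ 4 * x
      lem = solve-∀
      degree : ∀ z → lcount (adj G (Z z)) S₀ ≡ 2 * lcount (λ a → Θ a z) X
      degree z = lcount-++ (adj G (Z z)) (map (P i₀ k₀) X) ∙ (cong₂ _+_ (side k₀) (side k₁ ∙ sym (+-identityʳ _))) where
        side : ∀ k → lcount (adj G (Z z)) (map (P i₀ k) X) ≡ lcount (λ a → Θ a z) X
        side k = lcount-map _ (P i₀ k) X ∙ (lcount-cong X λ {a} _ → adj-sym G (Z z) (P i₀ k a) ∙ Θ-same i₀ k k₀ a z)
      lcount-lsum : ∀ (P : Fin (t i₀) → Bool) xs → lcount P xs ≡ lsum (λ a → 𝟙 (P a)) xs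
      lcount-lsum P [] = refl
      lcount-lsum P (x ∷ xs) = cong (𝟙 (P x) +_) (lcount-lsum P xs)
      *-lsum : ∀ c (f : Fin (t i₀) → ℕ) xs → c * lsum f xs ≡ lsum (λ a → c * f a) xs
      *-lsum c f [] = *-zeroʳ c
      *-lsum c f (x ∷ xs) = *-distribˡ-+ c (f x) _ ∙ cong (c * f x +_) (*-lsum c f xs)
      total : ∑ B ≡ 2 * lsum apexes X
      total = ∑-comm (λ v z → 𝟙 (isᵇ (Z z) v) * (𝟙 (Yz z) * lcount (adj G v) S₀)) ∙
        (∑-cong λ z → ∑-single (λ v → 𝟙 (Yz z) * lcount (adj G v) S₀) (Z z) ∙ cong (𝟙 (Yz z) *_) (degree z) ∙
            swap (𝟙 (Yz z)) (lcount (λ a → Θ a z) X) ∙ cong (2 *_) (cong (𝟙 (Yz z) *_) (lcount-lsum (λ a → Θ a z) X) ∙ *-lsum (𝟙 (Yz z)) (λ a → 𝟙 (Θ a z)) X)) ∙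
          ∑-*ˡ 2 (λ z → lsum (λ a → 𝟙 (Yz z) * 𝟙 (Θ a z)) X) ∙ cong (2 *_) (lsum-∑ (λ z a → 𝟙 (Yz z) * 𝟙 (Θ a z)) X ∙
            (lsum-cong X λ {a} _ → (∑-cong λ z → sym (𝟙-∧ (Yz z) (Θ a z))) ∙ sym (#-∑ (Yz ∩ Θ a)))) where
        swap : ∀ a b → a * (2 * b) ≡ 2 * (a * b)
        swap = solve-∀

    -- `Deletion` with the excess split into inner edges of the two copies (weight one) and edges to
    -- attached vertices of `Z` (weight at most two), halved.
    weight : 2 * q * u ≤ L X X + 2 * lsum apexes X
    weight = *-cancelˡ-≤ 2 (lem₁ q u =& bound & +-mono-≤ A-total B-total &= lem₂ (L X X) (lsum apexes X)) where
      lem₁ : ∀ q u → 2 * (2 * q * u) ≡ 2 * q * (2 * u)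
      lem₁ = solve-∀
      lem₂ : ∀ a b → 2 * a + 4 * b ≡ 2 * (a + 2 * b)
      lem₂ = solve-∀
      bound : 2 * q * (2 * u) ≤ ∑ (λ v → μ S v * A v) + ∑ (λ v → μ S v * B v)
      bound = (deletion-bound {q} {ρ} {smax} del u (2u≤2c & 2c≤smax) S S-uniq S-len ε λ v → lcount-concat (adj G v) Si =& ∑f≤ v) &=
        ((∑-cong λ v → *-distribˡ-+ (μ S v) (A v) (B v)) ∙ ∑-distrib-+ (λ v → μ S v * A v) (λ v → μ S v * B v))

  -- An apex-rich vertex at the end of a long path would join two copies of that path
  -- through an alternating walk over all its apexes.
  arms : ∀ {x e arm} → Γ₀.Path x (x ∷ arm) e → Unique (x ∷ arm) → ∀ ws → Unique ws → 1 ≤ length ws → length ws ≤ suc q →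
    (∀ {z} → z ∈ ws → Yz z ≡ true × Θ x z ≡ true) → length ws + length arm ≤ q
  arms {x} {e} {arm} p uarm (z₀ ∷ ws) uws@(_ ∷ uws') _ (s≤s short) ok = finish (zigzag cells (map Z ws) (map-path i₀ k₀ p) (copy-unique k₀)
      (Uniqueₚ.map⁺ Z-inj uws') (λ m m' → Z∉copy k₀ m m') (λ m → Adj-sym (Z-adj m k₀)) (λ { (k , _ , refl) m → Z-adj m k })
      (cong₂ (λ a b → suc a + 2 * b) (length-map (P i₀ k₀) arm) (length-map Z ws) =& total≤)) where
    Cell : V → Set
    Cell v = ∃ λ k → k ≢ k₀ × v ≡ P i₀ k x
    copy : Fin K → List V
    copy k = map (P i₀ k) (x ∷ arm)
    copy-unique : ∀ k → Unique (copy k)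
    copy-unique k = Uniqueₚ.map⁺ (λ e → snd (P-inj i₀ e)) uarm
    copy⊆ : ∀ k {v} → v ∈ copy k → ∃ λ a → v ≡ P i₀ k a
    copy⊆ k m = let (a , _ , e) = ∈-map⁻ (P i₀ k) m in a , e
    arm≤ : length arm ≤ 2 * q
    arm≤ = s≤s⁻¹ (sym (length-map (P i₀ k₀) (x ∷ arm)) =& (core-path (map-path i₀ k₀ p) (copy-unique k₀)
      λ m → let (a , e) = copy⊆ k₀ m in inl (k₀ , a , e)))
    total≤ : suc (length arm) + 2 * length ws ≤ 4 + 4 * q
    total≤ = +-mono-≤ (s≤s arm≤) (*-monoʳ-≤ 2 short) & lin {t = 0} 3 ≤-refl (lem q) where
      lem : ∀ q → suc (2 * q) + 2 * q + 0 + 3 ≡ 4 + 4 * q + 0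
      lem = solve-∀
    cells : Many (4 + 4 * q) Cell
    cells = Many-image (λ k → P i₀ k x) (λ e → fst (P-inj i₀ e)) (λ { {k} (_ , ne) → k , ne , refl }) (avoid₁ k₀ (Many-≤ (arms-width & w≤K) Many-all))
    Z⁻ : ∀ {v} → v ∈ map Z ws → ∃ λ z → z ∈ ws × v ≡ Z z
    Z⁻ m = ∈-map⁻ Z m
    Z∉copy : ∀ k {v} → v ∈ map Z ws → v ∉ copy k
    Z∉copy k m m' = let (z , _ , e) = Z⁻ m ; (a , e') = copy⊆ k m' in P∉Z i₀ k a z (sym e' ∙ e)
    Z-adj : ∀ {v} → v ∈ map Z ws → ∀ k → Adj (P i₀ k x) v
    Z-adj m k = let (z , z∈ , e) = Z⁻ m in subst (Adj (P i₀ k x)) (sym e) (Θ-adj k (snd (ok (there z∈))))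
    finish : (∃ λ y → ∃ λ ys → Path y ys (P i₀ k₀ e) × Unique ys × length ys ≡ length (copy k₀) + 2 * length (map Z ws) ×
      (∀ {v} → v ∈ ys → v ∈ copy k₀ ⊎ v ∈ map Z ws ⊎ Cell v) × (y ≡ P i₀ k₀ x ⊎ Cell y)) → length (z₀ ∷ ws) + length arm ≤ q
    finish (y , ys , p' , u' , len , inc , front) = close (fresh ys (s≤s ((len ∙ cong₂ (λ a b → a + 2 * b) (length-map (P i₀ k₀) (x ∷ arm)) (length-map Z ws)) =& total') & ≤-refl) cells) where
      total' : suc (length arm) + 2 * length ws ≤ 3 + 4 * q
      total' = +-mono-≤ (s≤s arm≤) (*-monoʳ-≤ 2 short) & lin {t = 0} 2 ≤-refl (lem q) where
        lem : ∀ q → suc (2 * q) + 2 * q + 0 + 2 ≡ 3 + 4 * q + 0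
        lem = solve-∀
      ys-core : ∀ {v} → v ∈ ys → Core v
      ys-core m = case inc m of λ
        { (inl h) → let (a , e) = copy⊆ k₀ h in inl (k₀ , a , e)
        ; (inr (inl h)) → let (z , z∈ , e) = Z⁻ h in inr (z , fst (ok (there z∈)) , e)
        ; (inr (inr (k , _ , e))) → inl (k , x , e) }
      z₀∉ : Z z₀ ∉ ys
      z₀∉ m = case inc m of λ
        { (inl h) → let (a , e) = copy⊆ k₀ h in P∉Z i₀ k₀ a z₀ (sym e)
        ; (inr (inl h)) → let (z , z∈ , e) = Z⁻ h in Unique-∷⁻ uws (subst (_∈ ws) (sym (Z-inj e)) z∈)
        ; (inr (inr (k , _ , e))) → P∉Z i₀ k x z₀ (sym e) }
      z₀-adj : ∀ k → Adj (P i₀ k x) (Z z₀)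
      z₀-adj k = Θ-adj k (snd (ok (here refl)))
      front-adj : Adj (Z z₀) y
      front-adj = [ (λ { refl → Adj-sym (z₀-adj k₀) }) , (λ { (k , _ , refl) → Adj-sym (z₀-adj k) }) ]′ front
      close : (∃ λ v → Cell v × v ∉ ys) → length (z₀ ∷ ws) + length arm ≤ q
      -- The combined path, through both copies of the arm and all chosen apexes, has
      -- `2 * (length (z₀ ∷ ws) + length arm) + 1` vertices, and at most `2 * q + 1` are possible.
      close (_ , (k , k≢ , refl) , v∉) = *-cancelˡ-≤ 2 (s≤s⁻¹ ((lem (length ws) (length arm) ∙ sym whole-len) =&
          core-path (Path-reverse (map-path i₀ k p) ++⟨ z₀-adj k ⟩ (front-adj ∷ p')) whole-unique whole-core)) where
        arm-fresh : ∀ {v} → v ∈ copy k → v ∉ Z z₀ ∷ ys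
        arm-fresh m (here e) = let (a , e') = copy⊆ k m in P∉Z i₀ k a z₀ (sym e' ∙ e)
        arm-fresh m (there m') with copy⊆ k m
        ... | a , refl = case inc m' of λ
          { (inl h) → let (a' , e) = copy⊆ k₀ h in k≢ (fst (P-inj i₀ e))
          ; (inr (inl h)) → let (z , _ , e) = Z⁻ h in P∉Z i₀ k a z e
          ; (inr (inr (k' , _ , e))) → v∉ (subst (λ b → P i₀ k b ∈ ys) (snd (P-inj i₀ e)) m') }
        whole-unique : Unique (reverse (copy k) ++ Z z₀ ∷ ys)
        whole-unique = Uniqueₚ.++⁺ (Unique-resp-↭ (↭-sym (Perm.↭-reverse (copy k))) (copy-unique k)) (∉⇒All≢ z₀∉ ∷ u')
          λ { (m , m') → arm-fresh (Perm.∈-resp-↭ (Perm.↭-reverse (copy k)) m) m' }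
        whole-core : ∀ {v} → v ∈ reverse (copy k) ++ Z z₀ ∷ ys → Core v
        whole-core m = case ∈-++⁻ (reverse (copy k)) m of λ
          { (inl h) → let (a , e) = copy⊆ k (Perm.∈-resp-↭ (Perm.↭-reverse (copy k)) h) in inl (k , a , e)
          ; (inr (here e)) → inr (z₀ , fst (ok (here refl)) , e)
          ; (inr (there h)) → ys-core h }
        whole-len : length (reverse (copy k) ++ Z z₀ ∷ ys) ≡ suc (length arm) + suc (suc (length arm) + 2 * length ws)
        whole-len = length-++ (reverse (copy k)) ∙ cong₂ (λ a b → a + suc b) (length-reverse (copy k) ∙ length-map (P i₀ k) (x ∷ arm))
          (len ∙ cong₂ (λ a b → a + 2 * b) (length-map (P i₀ k₀) (x ∷ arm)) (length-map Z ws))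
        lem : ∀ a b → suc (2 * (suc a + b)) ≡ suc b + suc (suc b + 2 * a)
        lem = solve-∀

  -- If `v` has apexes, `arms` applies at `v`, with their number capped at `q + 1`; the resulting
  -- bound shows that the cap is not reached. Otherwise it applies at the other end `u`, with a
  -- single apex.
  spine-bound : ∀ {u v anc} → 1 ≤ apexes u → Γ₀.Path v (v ∷ anc) u → Unique (v ∷ anc) → 1 ≤ length anc → length anc + apexes v ≤ q
  spine-bound {u} {v} {anc} rich-u p uniq _ = go (apexes v) refl where
    take-apexes : ∀ x κ → κ ≤ apexes x → ∃ λ ws → length ws ≡ κ × Unique ws × (∀ {z} → z ∈ ws → Yz z ≡ true × Θ x z ≡ true)
    take-apexes x κ le = tabulate at , length-tabulate at , Uniqueₚ.tabulate⁺ at-inj ,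
        λ m → let (i , e) = ∈-tabulate⁻ {f = at} m in subst (λ z → Yz z ≡ true × Θ x z ≡ true) (sym e) (∧-elimˡ (at-sat i) , ∧-elimʳ {Yz (at i)} (at-sat i))
      where open Many (pick κ (Yz ∩ Θ x) le)
    uncons : ∀ {x xs y} → Γ₀.Path x xs y → ∃ λ ys → xs ≡ x ∷ ys
    uncons Γ₀.[ _ ] = [] , refl
    uncons (_ Graphs.∷ _) = _ , refl
    go : ∀ κ → apexes v ≡ κ → length anc + apexes v ≤ q
    go zero e = via (uncons (Γ₀.Path-reverse p)) (take-apexes u 1 rich-u) where
      via : (∃ λ ys → reverse (v ∷ anc) ≡ u ∷ ys) → (∃ λ ws → length ws ≡ 1 × Unique ws × (∀ {z} → z ∈ ws → Yz z ≡ true × Θ u z ≡ true)) → length anc + apexes v ≤ q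
      via (ys , eq) (ws , len , uws , ok) = (cong (length anc +_) e ∙ +-identityʳ _ ∙ len-ys) =&
          m≤n+m (length ys) (length ws) & arms (subst (λ l → Γ₀.Path u l v) eq (Γ₀.Path-reverse p))
            (subst Unique eq (Unique-resp-↭ (↭-sym (Perm.↭-reverse (v ∷ anc))) uniq)) ws uws (≤-reflexive (sym len)) (len =& s≤s z≤n) ok where
        len-ys : length anc ≡ length ys
        len-ys = cong pred (sym (length-reverse (v ∷ anc)) ∙ cong length eq)
          where open import Data.Nat using (pred)
    go (suc κ) e = via (take-apexes v (apexes v ⊓ suc q) (m⊓n≤m _ _)) where
      open import Data.Nat using (_⊓_)
      via : (∃ λ ws → length ws ≡ apexes v ⊓ suc q × Unique ws × (∀ {z} → z ∈ ws → Yz z ≡ true × Θ v z ≡ true)) → length anc + apexes v ≤ q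
      via (ws , len , uws , ok) = (+-comm (length anc) (apexes v) ∙ cong (_+ length anc) (sym exact)) =& bound where
        bound : apexes v ⊓ suc q + length anc ≤ q
        bound = subst (λ l → l + length anc ≤ q) len (arms p uniq ws uws (subst (1 ≤_) (sym len) (⊓-glb (subst (1 ≤_) (sym e) (s≤s z≤n)) (s≤s z≤n)))
          (len =& m⊓n≤n _ _) ok)
        exact : apexes v ⊓ suc q ≡ apexes v
        exact = m≤n⇒m⊓n≡m (≮⇒≥ λ lt → 1+n≰n (sym (m≥n⇒m⊓n≡n (<⇒≤ lt)) =& m≤m+n _ (length anc) & bound))

  -- If no vertex of the copy has an apex, `weight` makes it tight for Erdős-Gallai, and two of its
  -- copies contain `F₃`. Otherwise take `u` with an apex and the depth-first tree of its component.
  -- By `spine-bound` and `forest-weight` all other vertices together account for at most `2 * q`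
  -- each, so `weight` leaves at least `q` apexes at `u` itself.
  apexes-exist : Apexes G q r K
  apexes-exist = go (any? λ u → 1 ≤? apexes u) where
    indices : List (Fin (t i₀))
    indices = allFin (t i₀)
    go : Dec (∃ λ u → 1 ≤ apexes u) → Apexes G q r K
    go (no none) = ⊥-elim (clique (snd (ErdosGallai.EG Γ₀ q full pathfree) pos dense)) where
      pos : 0 < # (full {Fin (t i₀)})
      pos = t-pos i₀ &= sym (#-full (t i₀))
      pathfree : Γ₀.PathFree (suc (2 * q)) full
      pathfree {xs = xs} p u _ = sym (length-map (P i₀ k₀) xs) =& (core-path (map-path i₀ k₀ p) (Uniqueₚ.map⁺ (λ e → snd (P-inj i₀ e)) u)
        λ m → let (a , _ , e) = ∈-map⁻ (P i₀ k₀) m in inl (k₀ , a , e))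
      open Deleting indices (Uniqueₚ.allFin⁺ (t i₀)) (λ _ _ → ∈-allFin _)
      no-apexes : lsum apexes indices ≡ 0
      no-apexes = zero-sum indices where
        zero-sum : ∀ xs → lsum apexes xs ≡ 0
        zero-sum [] = refl
        zero-sum (a ∷ as) = cong₂ _+_ (n<1⇒n≡0 (≰⇒> λ h → none (a , h))) (zero-sum as)
      L-E : L indices indices ≤ Γ₀.E full full
      L-E = (lsum-cong indices λ {a} _ → sym (#-lcount (adj Γ₀ a) indices (Uniqueₚ.allFin⁺ (t i₀)) (∈-allFin _)) ∙ full-degree a) =&
          list-sum (λ a → Γ₀.d a full) indices (Uniqueₚ.allFin⁺ (t i₀)) where
        full-degree : ∀ a → # (adj Γ₀ a) ≡ Γ₀.d a full
        full-degree a = ≤-antisym (#-mono {P = adj Γ₀ a} {Q = adj Γ₀ a ∩ full} λ _ e → ∧-intro e refl) (#-mono {P = adj Γ₀ a ∩ full} {Q = adj Γ₀ a} λ _ → ∧-elimˡ)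
        list-sum : ∀ (g : Fin (t i₀) → ℕ) xs → Unique xs → lsum g xs ≤ ∑ (λ v → 1 * g v)
        list-sum g xs u = go' g xs u & (∑-mono λ v → ≤-reflexive (sym (+-identityʳ (g v)))) where
          go' : ∀ (g : Fin (t i₀) → ℕ) xs → Unique xs → lsum g xs ≤ ∑ g
          go' g [] u = z≤n
          go' g (x ∷ xs) u@(_ ∷ u') = +-monoʳ-≤ (g x) ((lsum-cong xs λ {y} m →
              sym (cong (λ b → 𝟙 (not b) * g y) (dec-false (y ≟ᶠ x) λ { refl → Unique-∷⁻ u m }) ∙ +-identityʳ (g y))) =&
              go' (λ v → 𝟙 (not (does (v ≟ᶠ x))) * g v) xs u') &= sym (∑-remove g x)
      dense : 2 * q * # (full {Fin (t i₀)}) ≤ Γ₀.E full full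
      dense = cong (2 * q *_) (#-full (t i₀) ∙ sym (length-tabulate id)) =&
        weight & (cong (λ z → L indices indices + 2 * z) no-apexes ∙ +-identityʳ _) =& L-E
      clique : Γ₀.Clique (suc (2 * q)) full → ⊥
      clique cq = F₃-blob In complete-In rich i₀ (λ i → P i₀ k₁ (cl (inject≤ i q≤))) (λ i → P i₀ k₀ (cl i))
          (λ ne → Γ-adj i₀ k₁ _ _ ∙ (cl-adj λ e → ne (inject≤-injective q≤ q≤ _ _ e))) (λ ne → cl-adj ne)
          (λ i j e → k₀≢k₁ (sym (fst (P-inj i₀ e))))
          (λ i → inl (refl , inl (_ , _ , refl))) (λ i → inl (refl , inl (_ , _ , refl))) where
        open Γ₀.Clique cq
        q≤ : suc q ≤ suc (2 * q)
        q≤ = s≤s (m≤n*m q 2)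
    go (yes (u , rich-u)) = found (Forests.dfs Γ₀ (length others) u [] others ≤-refl) where
      others : List (Fin (t i₀))
      others = filter (λ a → ¬? (a ≟ᶠ u)) indices
      found : (∃ λ Y → ∃ λ R → others ↭ Y ++ R × Forests.Forest Γ₀ (u ∷ []) Y × (∀ {y x} → y ∈ u ∷ Y → x ∈ R → ¬ Γ₀.Adj y x)) → Apexes G q r K
      found (Y , R , π , F , sep) = record
          { apex = λ i → Z (at i) ; apex-inj = λ e → at-inj (Z-inj e)
          ; rows = record { cell = cellᵣ ; cell-inj = λ j → cellᵣ-inj j (j ≟ᶠ i₀) ; cell-adj = λ {i} {j} a b ne → compl a b (index i (i ≟ᶠ i₀)) (index j (j ≟ᶠ i₀)) ne }
          ; apex-adj = λ z i a → Adj-sym (side i a (i ≟ᶠ i₀) z) } where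
        u∉Y : u ∉ Y
        u∉Y m = snd (∈-filter⁻ (λ a → ¬? (a ≟ᶠ u)) {xs = indices} (Perm.∈-resp-↭ (↭-sym π) (∈-++⁺ˡ m))) refl
        uY : Unique Y
        uY = Unique-++⁻ˡ Y (Unique-resp-↭ π (Uniqueₚ.filter⁺ (λ a → ¬? (a ≟ᶠ u)) (Uniqueₚ.allFin⁺ (t i₀))))
        uX : Unique (u ∷ Y)
        uX = ∉⇒All≢ u∉Y ∷ uY
        closedX : ∀ {a b} → a ∈ u ∷ Y → adj Γ₀ a b ≡ true → b ∈ u ∷ Y
        closedX {a} {b} m h = choose (b ≟ᶠ u) where
          choose : Dec (b ≡ u) → b ∈ u ∷ Y
          choose (yes e) = here e
          choose (no ne) = [ there , (λ m' → ⊥-elim (sep m m' h)) ]′ (∈-++⁻ Y (Perm.∈-resp-↭ π (∈-filter⁺ (λ a → ¬? (a ≟ᶠ u)) (∈-allFin b) ne)))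
        open Deleting (u ∷ Y) uX closedX using (weight)
        open ForestWeight Γ₀ using (forest-weight; L-cons)
        enough : q ≤ apexes u
        enough = *-cancelˡ-≤ 2 (lin 0 (+-mono-≤ weight (forest-weight q apexes F Γ₀.[ u ] ([] ∷ []) uY (λ { m (here refl) → u∉Y m }) λ p un 1≤ → spine-bound rich-u p un 1≤))
          (cong (λ l → 2 * q + (l + 2 * (apexes u + lsum apexes Y) + 2 * q * length Y) + 0) (L-cons u Y) ∙
            lem q (L Y Y) (L Y (u ∷ [])) (apexes u) (lsum apexes Y) (length Y))) where
          lem : ∀ q a b c e y → 2 * q + (a + 2 * b + 2 * (c + e) + 2 * q * y) + 0 ≡ 2 * c + (2 * q * suc y + (a + 2 * b + 2 * e))
          lem = solve-∀
        open Many (pick q (Yz ∩ Θ u) enough)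
        index : ∀ j → Dec (j ≡ i₀) → Fin (t j)
        index j (yes refl) = u
        index j (no _)     = a₀ j
        cellᵣ : Fin r → Fin K → V
        cellᵣ j k = P j k (index j (j ≟ᶠ i₀))
        cellᵣ-inj : ∀ j (e : Dec (j ≡ i₀)) {a b} → P j a (index j e) ≡ P j b (index j e) → a ≡ b
        cellᵣ-inj j e h = fst (P-inj j h)
        side : ∀ i a (e : Dec (i ≡ i₀)) z → Adj (P i a (index i e)) (Z (at z))
        side i a (yes refl) z = Θ-adj a (∧-elimʳ {Yz (at z)} (at-sat z))
        side i a (no ne)    z = Yz-adj (∧-elimˡ (at-sat z)) i a ne

-- The fingerprint of the second extremal graph: mutually joined rows, each consisting of `K`
-- disjoint edges.
record Pairs {n} (G : Graph n) (r K : ℕ) : Set where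
  field
    end      : Fin r → Fin K → Fin 2 → Fin n
    end-inj  : ∀ i {k k' a a'} → end i k a ≡ end i k' a' → k ≡ k' × a ≡ a'
    end-edge : ∀ i k {a a'} → a ≢ a' → adj G (end i k a) (end i k a') ≡ true
    end-adj  : ∀ {i j} k k' a a' → i ≢ j → adj G (end i k a) (end j k' a') ≡ true

-- Edges in the copies of two classes: an edge in every class.

module CaseII {n : ℕ} (q ρ m : ℕ) (G : Graph n) (free : ForbiddenFree q ρ m G) (c K smax : ℕ) (C : Config ρ G c K)
    (w≤K : Widths.width q m ≤ K) (2c≤K : 2 * c ≤ K) (2c≤smax : 2 * c ≤ smax) (del : Weights.Deletion G q ρ smax)
    (r≤2q : suc (suc ρ) ≤ 2 * q)
    (two-edges : ∀ i₀ → ∃ λ j → j ≢ i₀ × ∃ λ a → ∃ λ b → adj G (Config.P C j (CaseSetup.k₀ q ρ m G free c K smax C w≤K 2c≤K 2c≤smax del) a)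
                                                           (Config.P C j (CaseSetup.k₀ q ρ m G free c K smax C w≤K 2c≤K 2c≤smax del) b) ≡ true) where
  open Graphs G
  open Embeddings G
  open Blobs q ρ m G free
  open Widths q m renaming (width to w)
  open Weights G
  open CaseSetup q ρ m G free c K smax C w≤K 2c≤K 2c≤smax del

  Edge : Fin r → Set
  Edge i = ∃ λ a → ∃ λ b → adj (Γ i) a b ≡ true

  matching : ∀ {s} → s ≤ w → ∀ j {Q : V → Set} a b → adj (Γ j) a b ≡ true → (∀ k → Q (P j k a) × Q (P j k b)) → Matching s Q
  matching s≤w j a b h sat = record
    { mx = λ x → P j (inject≤ x s≤K) a ; my = λ x → P j (inject≤ x s≤K) b
    ; mx-inj = λ e → inject≤-injective s≤K s≤K _ _ (fst (P-inj j e)) ; my-inj = λ e → inject≤-injective s≤K s≤K _ _ (fst (P-inj j e))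
    ; mxy = λ x y e → Graphs.Adj-≢ (Γ j) h (snd (P-inj j e))
    ; mx-sat = λ x → fst (sat _) ; my-sat = λ x → snd (sat _) ; m-adj = λ x → Γ-adj j _ a b ∙ h }
    where s≤K = s≤w & w≤K

  -- Copies of one edge form large matchings, in class `i` and in another class, so a cherry in
  -- class `i` would complete `F₂`.
  cherry-free : ∀ i {a b c} → adj (Γ i) a b ≡ true → adj (Γ i) b c ≡ true → a ≡ c
  cherry-free i {a} {b} {c'} ab bc = go (a ≟ᶠ c') (two-edges i) where
    In : Fin r → V → Set
    In j v = ∃ λ k → ∃ λ a → v ≡ P j k a
    complete-In : Complete G In
    complete-In ne (_ , _ , refl) (_ , _ , refl) = compl _ _ _ _ ne
    rich : ∀ j → Many w (In j)
    rich j = Many-image (λ k → P j k (a₀ j)) (λ e → fst (P-inj j e)) (λ {k} _ → k , a₀ j , refl) (Many-≤ w≤K Many-all)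
    go : Dec (a ≡ c') → (∃ λ j → j ≢ i × Edge j) → a ≡ c'
    go (yes e) _ = e
    go (no ne) (j , j≢i , x , y , xy) = ⊥-elim (F₂-blob In complete-In rich (j≢i ∘ sym) {P i k₀ a} {P i k₀ b} {P i k₀ c'} ab bc
      (λ e → ne (snd (P-inj i e))) (_ , _ , refl) (_ , _ , refl) (_ , _ , refl)
      (matching matching-width i a b ab λ k → (k , a , refl) , (k , b , refl))
      (matching m≤width j x y xy λ k → (k , x , refl) , (k , y , refl)))

  edge? : ∀ i → Dec (Edge i)
  edge? i = any? λ a → any? λ b → adj (Γ i) a b ≟ᵇ true

  -- The smallest block to which `Deletion` applies with content, `u = 1`: an edge where there is
  -- one, otherwise two vertices from different copies.
  sel : ∀ i → Dec (Edge i) → List V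
  sel i (yes (a , b , _)) = P i k₀ a ∷ P i k₀ b ∷ []
  sel i (no _)            = P i k₀ (a₀ i) ∷ P i k₁ (a₀ i) ∷ []

  sel-uniq : ∀ i e → Unique (sel i e)
  sel-uniq i (yes (a , b , h)) = ((λ e → Graphs.Adj-≢ (Γ i) h (snd (P-inj i e))) ∷ []) ∷ [] ∷ []
  sel-uniq i (no _) = ((λ e → k₀≢k₁ (fst (P-inj i e))) ∷ []) ∷ [] ∷ []

  sel-len : ∀ i e → length (sel i e) ≡ 2
  sel-len i (yes _) = refl
  sel-len i (no _)  = refl

  sel-cell : ∀ i e {v} → v ∈ sel i e → ∃ λ k → ∃ λ a → v ≡ P i k a
  sel-cell i (yes (a , b , _)) (here e)         = k₀ , a , e
  sel-cell i (yes (a , b , _)) (there (here e)) = k₀ , b , e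
  sel-cell i (no _) (here e)         = k₀ , a₀ i , e
  sel-cell i (no _) (there (here e)) = k₁ , a₀ i , e

  Si : Fin r → List V
  Si i = sel i (edge? i)

  S : List V
  S = concat (tabulate Si)

  S-uniq : Unique S
  S-uniq = Unique-concat-tabulate Si (λ i → sel-uniq i (edge? i)) λ {i} {j} ne m m' →
    let (k , a , e) = sel-cell i (edge? i) m ; (k' , a' , e') = sel-cell j (edge? j) m' in cells-distinct ne (sym e ∙ e')

  S-len : length S ≡ r * (2 * 1)
  S-len = length-concat-tabulate 2 Si λ i → sel-len i (edge? i)

  Edgeᵇ : Fin r → Bool
  Edgeᵇ = set edge?

  ε : V → ℕ
  ε v = ∑ (λ i → 𝟙 (Edgeᵇ i) * 𝟙 (memᵇ (Si i) v))

  f : V → Fin r → ℕ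
  f v i = lcount (adj G v) (Si i)

  f≤2 : ∀ v i → f v i ≤ 2
  f≤2 v i = lcount≤length (adj G v) (Si i) &= sel-len i (edge? i)

  at : ∀ v i {e} → f v i ≤ e → ∑ (f v) ≤ suc ρ * 2 + e
  at v i le = (∑-one (f v) i 2 λ j _ → f≤2 v j) & +-monoʳ-≤ (suc ρ * 2) le

  -- By `cherry-free`, outside `Z` the only neighbour of a chosen end in its class is the other end
  -- of the edge.
  ordinary : ∀ v → (∀ z → v ≢ Z z) → ∀ i → cls v ≡ just i → f v i ≤ 𝟙 (Edgeᵇ i) * 𝟙 (memᵇ (Si i) v)
  ordinary v v∉Z i cv = go (edge? i) refl where
    nbr : ∀ k a → Adj v (P i k a) → ∃ λ b → adj (Γ i) a b ≡ true × v ≡ P i k b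
    nbr k a h = [ (λ { (z , e) → ⊥-elim (v∉Z z e) }) , (λ { (b , e) → b , sym (Γ-adj i k a b) ∙ cong (adj G (P i k a)) (sym e) ∙ Adj-sym h , e }) ]′
      (closed i k a cv (Adj-sym h))
    go : (d : Dec (Edge i)) → d ≡ edge? i → f v i ≤ 𝟙 (Edgeᵇ i) * 𝟙 (memᵇ (Si i) v)
    go (no ne) e = (cong (λ d → lcount (adj G v) (sel i d)) (sym e) ∙ lcount-none (adj G v) (sel i (no ne)) none) =& z≤n where
      none : ∀ {x} → x ∈ sel i (no ne) → adj G v x ≡ false
      none (here refl)         = ¬true⇒false λ h → let (b , ab , _) = nbr k₀ (a₀ i) h in ne (_ , _ , ab)
      none (there (here refl)) = ¬true⇒false λ h → let (b , ab , _) = nbr k₁ (a₀ i) h in ne (_ , _ , ab)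
    go (yes (a , b , ab)) e = byMem (v ∈ᶠ? sel i (yes (a , b , ab))) where
      D = yes (a , b , ab)
      same : lcount (adj G v) (sel i D) ≡ f v i
      same = cong (λ d → lcount (adj G v) (sel i d)) e
      byMem : Dec (v ∈ sel i D) → f v i ≤ 𝟙 (Edgeᵇ i) * 𝟙 (memᵇ (Si i) v)
      byMem (no v∉) = (sym same ∙ lcount-none (adj G v) (sel i D) none) =& z≤n where
        none : ∀ {x} → x ∈ sel i D → adj G v x ≡ false
        none (here refl)         = ¬true⇒false λ h → let (b' , ab' , ev) = nbr k₀ a h in
          v∉ (there (here (ev ∙ cong (P i k₀) (cherry-free i (Graphs.Adj-sym (Γ i) ab') ab))))
        none (there (here refl)) = ¬true⇒false λ h → let (b' , bb' , ev) = nbr k₀ b h in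
          v∉ (here (ev ∙ cong (P i k₀) (sym (cherry-free i ab bb'))))
      byMem (yes m) = sym same =& one m &= sym
          (cong₂ (λ x y → 𝟙 x * 𝟙 y) (set⁺ edge? (a , b , ab)) (dec-true (v ∈ᶠ? Si i) (subst (λ d → v ∈ sel i d) e m))) where
        one : v ∈ sel i D → lcount (adj G v) (sel i D) ≤ 1
        one (here refl) = cong (λ x → 𝟙 x + (𝟙 (adj G (P i k₀ a) (P i k₀ b)) + 0)) (adj-irr G (P i k₀ a)) =& +-identityʳ _ =& 𝟙≤1 _
        one (there (here refl)) = cong (λ x → 𝟙 (adj G (P i k₀ b) (P i k₀ a)) + (𝟙 x + 0)) (adj-irr G (P i k₀ b)) =& +-identityʳ _ =& 𝟙≤1 _

  module Special (z : Fin ζ) where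
    v : V
    v = Z z

    Attached : Fin r → V → Set
    Attached j x = ∃ λ k → ∃ λ a → x ≡ P j k a × Adj v x

    spread : ∀ j {a} k → Adj v (P j k a) → ∀ k' → Adj v (P j k' a)
    spread j {a} k h k' = adj-sym G v (P j k' a) ∙ Θ-same j k' k a z ∙ Adj-sym h

    first : ∀ j → 0 < f v j → ∃ λ a → ∀ k → Adj v (P j k a)
    first j pos = go (any? λ a → adj G v (P j k₀ a) ≟ᵇ true) where
      go : Dec (∃ λ a → Adj v (P j k₀ a)) → ∃ λ a → ∀ k → Adj v (P j k a)
      go (yes (a , h)) = a , spread j k₀ h
      go (no none) = ⊥-elim (<-irrefl (sym (lcount-none (adj G v) (Si j) λ m → ¬true⇒false λ h →
        let (k , a , e) = sel-cell j (edge? j) m in none (a , spread j k (subst (Adj v) e h) k₀))) pos)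

    full-edge : ∀ j → 2 ≤ f v j → Edge j → ∃ λ a → ∃ λ b → adj (Γ j) a b ≡ true × (∀ k → Adj v (P j k a) × Adj v (P j k b))
    full-edge j two ej = go (edge? j) two where
      both : ∀ x y → 2 ≤ 𝟙 x + (𝟙 y + 0) → x ≡ true × y ≡ true
      both true  true  _ = refl , refl
      both true  false (s≤s ())
      both false true  (s≤s ())
      both false false ()
      go : (d : Dec (Edge j)) → 2 ≤ lcount (adj G v) (sel j d) → ∃ λ a → ∃ λ b → adj (Γ j) a b ≡ true × (∀ k → Adj v (P j k a) × Adj v (P j k b))
      go (no ne) _ = ⊥-elim (ne ej)
      go (yes (a , b , ab)) h = a , b , ab , λ k → spread j k₀ (fst ends) k , spread j k₀ (snd ends) k
        where ends = both (adj G v (P j k₀ a)) (adj G v (P j k₀ b)) h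

    -- `v` is the centre of a cherry whose leaves are two copies of one vertex in row `jo`. Row `jo`
    -- has its own matching, and `v` sees both ends of every copied edge in row `jf`; this is `F₂`.
    clash : ∀ {jo jf} → jo ≢ jf → Edge jo → Edge jf → (∀ j → 0 < f v j) → 2 ≤ f v jf → ⊥
    clash {jo} {jf} ne (x , y , xy) ef pos two = close (first jo (pos jo)) (full-edge jf two ef) where
      Core : V → Set
      Core x = (∃ λ k → ∃ λ a → x ≡ P jo k a) ⊎ x ≡ v
      core-row : ∀ {j x y} → j ≢ jo → Core x → Attached j y → Adj x y
      core-row ne (inl (_ , _ , refl)) (_ , _ , refl , _) = compl _ _ _ _ (ne ∘ sym)
      core-row ne (inr refl) (_ , _ , _ , h) = h
      row-row : ∀ {j j' x y} → j ≢ j' → Attached j x → Attached j' y → Adj x y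
      row-row ne (_ , _ , refl , _) (_ , _ , refl , _) = compl _ _ _ _ ne
      rep : ∀ j {Q : V → Set} → (∀ k → Q (P j k (fst (first j (pos j))))) → Many w Q
      rep j h = Many-image (λ k → P j k (fst (first j (pos j)))) (λ e → fst (P-inj j e)) (λ {k} _ → h k) (Many-≤ w≤K Many-all)
      core-many : Many w Core
      core-many = rep jo λ k → inl (k , _ , refl)
      rows-many : ∀ j → j ≢ jo → Many w (Attached j)
      rows-many j _ = rep j λ k → k , _ , refl , snd (first j (pos j)) k
      open Centred jo Core Attached core-row row-row core-many rows-many
      close : (∃ λ a → ∀ k → Adj v (P jo k a)) → (∃ λ a → ∃ λ b → adj (Γ jf) a b ≡ true × (∀ k → Adj v (P jf k a) × Adj v (P jf k b))) → ⊥
      close (e , he) (a , b , ab , h) = F₂-blob In complete-In rich ne {P jo k₀ e} {v} {P jo k₁ e} (Adj-sym (he k₀)) (he k₁)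
        (λ eq → k₀≢k₁ (fst (P-inj jo eq))) (inl (refl , inl (_ , _ , refl))) (inl (refl , inr refl)) (inl (refl , inl (_ , _ , refl)))
        (matching matching-width jo x y xy λ k → inl (refl , inl (_ , _ , refl)) , inl (refl , inl (_ , _ , refl)))
        (matching m≤width jf a b ab λ k → inr (ne ∘ sym , k , a , refl , fst (h k)) , inr (ne ∘ sym , k , b , refl , snd (h k)))

    -- Either `v` misses a selected row altogether, or `clash` makes it miss at least one selected
    -- vertex in each of two classes with an edge; both cost at least two.
    no-excess : ∑ (f v) ≤ suc ρ * 2
    no-excess = go (any? λ i → f v i ≤? 0) (two-edges zero) where
      go : Dec (∃ λ i → f v i ≤ 0) → (∃ λ j → j ≢ zero × Edge j) → ∑ (f v) ≤ suc ρ * 2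
      go (yes (i , le)) _ = at v i le &= +-identityʳ _
      go (no none) (j₁ , _ , e₁) = pair (two-edges j₁) where
        pos : ∀ j → 0 < f v j
        pos j = ≰⇒> λ le → none (j , le)
        pair : (∃ λ j → j ≢ j₁ × Edge j) → ∑ (f v) ≤ suc ρ * 2
        pair (j₂ , ne , e₂) = sizes (f v j₁ ≤? 1) (f v j₂ ≤? 1) where
          sizes : Dec (f v j₁ ≤ 1) → Dec (f v j₂ ≤ 1) → ∑ (f v) ≤ suc ρ * 2
          sizes (no gt) _ = ⊥-elim (clash ne e₂ e₁ pos (≰⇒> gt))
          sizes (yes _) (no gt) = ⊥-elim (clash (ne ∘ sym) e₁ e₂ pos (≰⇒> gt))
          sizes (yes le₁) (yes le₂) = lin 0 (+-mono-≤ (+-mono-≤ (+-mono-≤ (∸-monoʳ-≤ 2 le₁) (∸-monoʳ-≤ 2 le₂)) (∑-pair (λ i → 2 ∸ f v i) ne)) (≤-reflexive total))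
              (lem ρ (∑ (f v)) (∑ (λ i → 2 ∸ f v i)) (2 ∸ f v j₁) (2 ∸ f v j₂)) where
            total : ∑ (f v) + ∑ (λ i → 2 ∸ f v i) ≡ r * 2
            total = sym (∑-distrib-+ (f v) (λ i → 2 ∸ f v i)) ∙ (∑-cong λ i → m+[n∸m]≡n (f≤2 v i)) ∙ ∑-const r 2
            lem : ∀ ρ F H a b → F + (a + b + H + suc (suc ρ) * 2) + 0 ≡ suc ρ * 2 + (1 + 1 + (a + b) + (F + H))
            lem = solve-∀

  ε-bound : ∀ v → lcount (adj G v) S ≤ suc ρ * (2 * 1) + ε v
  ε-bound v = lcount-concat (adj G v) Si =& go (any? λ z → v ≟ᶠ Z z) where
    go : Dec (∃ λ z → v ≡ Z z) → ∑ (f v) ≤ suc ρ * 2 + ε v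
    go (yes (z , refl)) = Special.no-excess z & m≤m+n _ _
    go (no ¬z) = byClass (cls v) refl where
      byClass : ∀ c → cls v ≡ c → ∑ (f v) ≤ suc ρ * 2 + ε v
      byClass nothing e = ⊥-elim (¬z (bad⇒Z v e))
      byClass (just i) e = at v i (ordinary v (λ z h → ¬z (z , h)) i e & ∑-term (λ i → 𝟙 (Edgeᵇ i) * 𝟙 (memᵇ (Si i) v)) i)

  ε-total : ∑ (λ v → μ S v * ε v) ≤ # Edgeᵇ * 2
  ε-total = ∑-mono le & (∑-comm (λ v i → 𝟙 (Edgeᵇ i) * 𝟙 (memᵇ (Si i) v)) ∙
      (∑-cong λ i → ∑-*ˡ (𝟙 (Edgeᵇ i)) (λ v → 𝟙 (memᵇ (Si i) v)) ∙ cong (𝟙 (Edgeᵇ i) *_) (sym (#-∑ (memᵇ (Si i)))))) =&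
    (∑-mono λ i → *-monoʳ-≤ (𝟙 (Edgeᵇ i)) (#-memᵇ≤ (Si i) &= sel-len i (edge? i))) &= (#-∑* 2 Edgeᵇ) where
    le : ∀ v → μ S v * ε v ≤ ε v
    le v = go (v ∈ᶠ? S) where
      go : Dec (v ∈ S) → μ S v * ε v ≤ ε v
      go (yes m) = ≤-reflexive (cong (_* ε v) (μ-in S v m) ∙ +-identityʳ (ε v))
      go (no v∉) = (cong (μ S v *_) none ∙ *-zeroʳ (μ S v)) =& z≤n where
        none : ε v ≡ 0
        none = ∑-zero λ i → cong (λ b → 𝟙 (Edgeᵇ i) * 𝟙 b) (dec-false (v ∈ᶠ? Si i) λ m → v∉ (∈-concat⁺′ m (∈-tabulate⁺ {f = Si} i))) ∙ *-zeroʳ (𝟙 (Edgeᵇ i))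

  -- Only ends of selected edges have excess, one each. That is two per class with an edge, against
  -- the required `4 * q`.
  edges-many : 2 * q ≤ # Edgeᵇ
  edges-many = *-cancelʳ-≤ _ _ 2 (deletion-bound {q} {ρ} {smax} del 1 2≤smax S S-uniq S-len ε ε-bound & ε-total) where
    2≤smax : 2 * 1 ≤ smax
    2≤smax = *-monoʳ-≤ 2 (t-pos zero & t≤c zero) & 2c≤smax

  pairs-exist : r ≡ 2 * q × Pairs G r K
  pairs-exist = ≤-antisym r≤2q (edges-many & #≤n Edgeᵇ) , record
      { end = λ i k → end i k ; end-inj = λ i {k} {k'} {a} {a'} e → end-inj i k k' a a' e ; end-edge = λ i k {a} {a'} → end-edge i k a a'
      ; end-adj = λ k k' a a' ne → compl _ _ _ _ ne } where
    edge : ∀ i → Edge i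
    edge i = set⁻ edge? (#-equal Edgeᵇ full (λ _ _ → refl) (#-full r =& r≤2q & edges-many) i refl)
    ix : ∀ i → Fin 2 → Fin (t i)
    ix i zero    = fst (edge i)
    ix i (suc _) = fst (snd (edge i))
    ix-adj : ∀ i → adj (Γ i) (ix i zero) (ix i (suc zero)) ≡ true
    ix-adj i = snd (snd (edge i))
    end : ∀ i → Fin K → Fin 2 → V
    end i k a = P i k (ix i a)
    ix-inj : ∀ i a a' → ix i a ≡ ix i a' → a ≡ a'
    ix-inj i zero zero e = refl
    ix-inj i zero (suc zero) e = ⊥-elim (Graphs.Adj-≢ (Γ i) (ix-adj i) e)
    ix-inj i (suc zero) zero e = ⊥-elim (Graphs.Adj-≢ (Γ i) (ix-adj i) (sym e))
    ix-inj i (suc zero) (suc zero) e = refl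
    end-inj : ∀ i k k' a a' → end i k a ≡ end i k' a' → k ≡ k' × a ≡ a'
    end-inj i k k' a a' e = fst (P-inj i e) , ix-inj i a a' (snd (P-inj i e))
    end-edge : ∀ i k a a' → a ≢ a' → Adj (end i k a) (end i k a')
    end-edge i k zero zero ne = ⊥-elim (ne refl)
    end-edge i k zero (suc zero) ne = Γ-adj i k _ _ ∙ ix-adj i
    end-edge i k (suc zero) zero ne = Adj-sym (Γ-adj i k _ _ ∙ ix-adj i)
    end-edge i k (suc zero) (suc zero) ne = ⊥-elim (ne refl)

lcount-tabulate : ∀ {A : Set} (P : A → Bool) {k} (f : Fin k → A) → lcount P (tabulate f) ≡ # (λ a → P (f a))
lcount-tabulate P {zero} f = sym ((#-∑ (λ a → P (f a))) ∙ ∑-empty _)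
lcount-tabulate P {suc k} f = cong (𝟙 (P (f zero)) +_) (lcount-tabulate P (λ a → f (suc a)) ∙ (#-∑ (λ a → P (f (suc a))))) ∙
  sym ((#-∑ (λ a → P (f a))) ∙ ∑-suc λ a → 𝟙 (P (f a)))

𝟙-classes : ∀ {r} (c : Maybe (Fin r)) → ∑ (λ i → 𝟙 (is i c)) ≡ 𝟙 (not (isN c))
𝟙-classes nothing  = +-cancelʳ-≡ 1 _ _ (∑-is nothing)
𝟙-classes (just i) = sym (+-identityʳ _) ∙ ∑-is (just i)

-- Counting edges across a partition.

module ClassCount {n r : ℕ} (G : Graph n) (cls : Fin n → Maybe (Fin r)) where
  open Graphs G

  Cl : Fin r → V → Bool
  Cl i = is i ∘ cls

  Ap Ord : V → Bool
  Ap  = isN ∘ cls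
  Ord = ∁ Ap

  N : ℕ
  N = # Ord

  ∑-Cl : ∑ (λ i → # (Cl i)) ≡ N
  ∑-Cl = (∑-cong λ i → #-∑ (Cl i)) ∙ ∑-comm (λ i v → 𝟙 (Cl i v)) ∙ (∑-cong λ v → 𝟙-classes (cls v)) ∙ sym (#-∑ Ord)

  Cl⊆Ord : ∀ i v → Cl i v ≡ true → Ord v ≡ true
  Cl⊆Ord i v e rewrite is⁻ i (cls v) e = refl

  E-classes : E Ord Ord ≡ ∑ (λ i → E (Cl i) Ord)
  E-classes = (∑-cong λ v → cong (_* d v Ord) (sym (𝟙-classes (cls v))) ∙
      *-comm (∑ (λ i → 𝟙 (is i (cls v)))) (d v Ord) ∙ sym (∑-*ˡ (d v Ord) (λ i → 𝟙 (is i (cls v)))) ∙ (∑-cong λ i → *-comm (d v Ord) _)) ∙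
    ∑-comm (λ v i → 𝟙 (Cl i v) * d v Ord)

  E-class : ∀ i → E (Cl i) Ord + # (Cl i) * # (Cl i) ≤ E (Cl i) (Cl i) + N * # (Cl i)
  E-class i = +-monoˡ-≤ (# (Cl i) * # (Cl i)) (E-splitʳ (Cl i) Ord (Cl i) =& +-mono-≤
      (E-mono {P = Cl i} {Q = Ord ∩ Cl i} (λ _ → id) (λ v → ∧-elimʳ {Ord v})) (E-const (Cl i) (Ord ∩ ∁ (Cl i)) (# (Ord ∩ ∁ (Cl i))) λ v _ →
        #-mono {P = adj G v ∩ (Ord ∩ ∁ (Cl i))} {Q = Ord ∩ ∁ (Cl i)} λ w → ∧-elimʳ {adj G v w})) &
    lem (E (Cl i) (Cl i)) (# (Ord ∩ ∁ (Cl i))) (# (Cl i)) =& +-monoʳ-≤ (E (Cl i) (Cl i)) (*-monoˡ-≤ (# (Cl i)) size) where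
    lem : ∀ e a b → e + a * b + b * b ≡ e + (a + b) * b
    lem = solve-∀
    size : # (Ord ∩ ∁ (Cl i)) + # (Cl i) ≤ N
    size = +-monoʳ-≤ (# (Ord ∩ ∁ (Cl i))) (#-mono {P = Cl i} {Q = Ord ∩ Cl i} λ v e → ∧-intro (Cl⊆Ord i v e) e) &=
      (+-comm (# (Ord ∩ ∁ (Cl i))) _ ∙ sym (#-split Ord (Cl i)))

  -- The ordered pairs from different classes number `N * N` minus the sum of the squared class
  -- sizes, and at most all of them are adjacent.
  class-count : E Ord Ord + ∑ (λ i → # (Cl i) * # (Cl i)) ≤ ∑ (λ i → E (Cl i) (Cl i)) + N * N
  class-count = (cong (_+ ∑ (λ i → # (Cl i) * # (Cl i))) E-classes ∙ sym (∑-distrib-+ (λ i → E (Cl i) Ord) (λ i → # (Cl i) * # (Cl i)))) =&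
    ∑-mono E-class &= (∑-distrib-+ (λ i → E (Cl i) (Cl i)) (λ i → N * # (Cl i)) ∙
      cong (∑ (λ i → E (Cl i) (Cl i)) +_) (∑-*ˡ N (λ i → # (Cl i)) ∙ cong (N *_) ∑-Cl))

others : ∀ {q} (z : Fin q) → ∃ λ l → suc (length l) ≡ q × z ∉ l × Unique l
others {suc q} z = tabulate (punchIn z) , cong suc (length-tabulate (punchIn z)) ,
  (λ m → let (i , e) = ∈-tabulate⁻ {f = punchIn z} m in punchInᵢ≢i z i (sym e)) , Uniqueₚ.tabulate⁺ (punchIn-injective z _ _)

-- Endgame with q apexes.

module ApexEnd {n : ℕ} (q ρ m : ℕ) (G : Graph n) (free : ForbiddenFree q ρ m G) (κ smax : ℕ) (1≤q : 1 ≤ q)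
    (w≤κ : Widths.width q m < κ) (κ≤smax : 2 * κ ≤ smax) (del : Weights.Deletion G q ρ smax)
    (T : Apexes G q (2 + ρ) (2 * κ)) where
  open Graphs G
  open Embeddings G
  open Cells G
  open Blobs q ρ m G free
  open Widths q m renaming (width to w)
  open Weights G
  open Zigzag G
  open ErdosGallai G
  open Apexes T

  private
    r K : ℕ
    r = suc (suc ρ)
    K = 2 * κ

    2w<K : 2 * w < K
    2w<K = *-monoʳ-< 2 w≤κ

    w≤K : w ≤ K
    w≤K = m≤n*m w 2 & (<⇒≤ 2w<K)

    1≤w : 1 ≤ w
    1≤w = s≤s z≤n & matching-width

  IsApex : V → Set
  IsApex v = ∃ λ z → v ≡ apex z

  isApex? : ∀ v → Dec (IsApex v)
  isApex? v = any? λ z → v ≟ᶠ apex z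

  Row : Fin r → V → Set
  Row i v = ∃ λ a → v ≡ cell rows i a

  row-many : ∀ i → Many K (Row i)
  row-many i = Many-image (cell rows i) (cell-inj rows i) (λ {a} _ → a , refl) Many-all

  module Around (i : Fin r) (v : V) (others-rich : ∀ j → j ≢ i → w ≤ dR rows v j) where
    Core : V → Set
    Core x = Row i x ⊎ IsApex x ⊎ x ≡ v

    Sel : Fin r → V → Set
    Sel j x = ∃ λ a → x ≡ cell rows j a × Adj v x

    core-row : ∀ {j x y} → j ≢ i → Core x → Sel j y → Adj x y
    core-row ne (inl (b , refl)) (a , refl , _) = cell-adj rows b a (ne ∘ sym)
    core-row ne (inr (inl (z , refl))) (a , refl , _) = apex-adj z _ a
    core-row ne (inr (inr refl)) (a , refl , h) = h

    row-row : ∀ {j j' x y} → j ≢ j' → Sel j x → Sel j' y → Adj x y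
    row-row ne (a , refl , _) (b , refl , _) = cell-adj rows a b ne

    rows-many : ∀ j → j ≢ i → Many w (Sel j)
    rows-many j ne = Many-image (cell rows j) (cell-inj rows j) (λ {a} h → a , refl , h) (pick w (λ a → adj G v (cell rows j a)) (others-rich j ne))

    open Centred i Core Sel core-row row-row (Many-map inl (Many-≤ w≤K (row-many i))) rows-many public

  -- A walk alternating between row `i` and the `q` apexes, prolonged by `v`, has `2 + 2 * q = ℓ`
  -- vertices in one part of a frame, giving `F₁`.
  blocked : ∀ i v → ¬ IsApex v → 1 ≤ dR rows v i → ¬ (∀ j → j ≢ i → w ≤ dR rows v j)
  blocked i v na pos others-rich = start (#-witness (λ a → adj G v (cell rows i a)) pos) where
    open Around i v others-rich
    start : (∃ λ a → Adj v (cell rows i a)) → ⊥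
    start (a , va) = finish (zigzag (row-many i) (tabulate apex) (Adj-sym va ∷ [ v ]) ((Adj-≢ (Adj-sym va) ∷ []) ∷ [] ∷ [])
        (Uniqueₚ.tabulate⁺ apex-inj) disj (λ m → ap-adj m (a , refl)) (λ c m → Adj-sym (ap-adj m c))
        (cong (λ l → 2 + 2 * l) (length-tabulate apex) =& (m≤m+n _ m & path-width) & w≤K)) where
      ap-adj : ∀ {x y} → x ∈ tabulate apex → Row i y → Adj x y
      ap-adj m (b , refl) = let (z , e) = ∈-tabulate⁻ {f = apex} m in subst (λ x → Adj x (cell rows i b)) (sym e) (apex-adj z i b)
      disj : ∀ {x} → x ∈ tabulate apex → x ∉ cell rows i a ∷ v ∷ []
      disj m (here e) = Adj-≢ (ap-adj m (a , refl)) e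
      disj m (there (here e)) = let (z , e') = ∈-tabulate⁻ {f = apex} m in na (z , sym e ∙ e')
      finish : (∃ λ y → ∃ λ ys → Path y ys v × Unique ys × length ys ≡ 2 + 2 * length (tabulate apex) ×
        (∀ {x} → x ∈ ys → x ∈ cell rows i a ∷ v ∷ [] ⊎ x ∈ tabulate apex ⊎ Row i x) × (y ≡ cell rows i a ⊎ Row i y)) → ⊥
      finish (y , ys , p , u , len , inc , _) = F₁-blob In complete-In rich i p u (λ m → inl (refl , core (inc m)))
          (≤-reflexive (sym (len ∙ cong (λ l → 2 + 2 * l) (length-tabulate apex)))) where
        core : ∀ {x} → x ∈ cell rows i a ∷ v ∷ [] ⊎ x ∈ tabulate apex ⊎ Row i x → Core x
        core (inl (here e)) = inl (a , e)
        core (inl (there (here e))) = inr (inr e)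
        core (inr (inl m)) = inr (inl (∈-tabulate⁻ {f = apex} m))
        core (inr (inr c)) = inl c

  Member : Fin r → V → Set
  Member i v = dR rows v i ≡ 0 × (∀ j → j ≢ i → dR rows v j ≡ K)

  total-rows : ∀ v → ∑ (dR rows v) + ∑ (nR rows v) ≡ r * K
  total-rows v = sym (∑-distrib-+ (dR rows v) (nR rows v)) ∙ ∑-cong (dR+nR rows v) ∙ ∑-const r K

  -- If just one row has fewer than `w` neighbours of `v`, then by `blocked` it has none. If two
  -- rows do, the inequality is strict because `K > 2 * w`. There is always at least one such row,
  -- again by `blocked`.
  degree : ∀ v → ¬ IsApex v → ∑ (dR rows v) ≤ suc ρ * K × (∑ (dR rows v) ≡ suc ρ * K → ∃ λ i → Member i v)
  degree v na = byFew (any? λ i → dR rows v i <? w) where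
    Goal : Set
    Goal = ∑ (dR rows v) ≤ suc ρ * K × (∑ (dR rows v) ≡ suc ρ * K → ∃ λ i → Member i v)
    byFew : Dec (∃ λ i → dR rows v i < w) → Goal
    byFew (no none) = ⊥-elim (blocked zero v na (1≤w & (≮⇒≥ λ h → none (zero , h))) λ j _ → ≮⇒≥ λ h → none (j , h))
    byFew (yes (i , few)) = second (any? λ j → ¬? (j ≟ᶠ i) ×-dec (dR rows v j <? w)) where
      second : Dec (∃ λ j → j ≢ i × dR rows v j < w) → Goal
      second (yes (j , ne , few')) = <⇒≤ strict , λ e → ⊥-elim (<-irrefl e strict) where
        strict : ∑ (dR rows v) < suc ρ * K
        strict = lin 2 (+-mono-≤ (+-mono-≤ (+-mono-≤ (+-mono-≤ few few') (∑-pair (nR rows v) ne)) (≤-reflexive (total-rows v)))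
                     (+-mono-≤ (+-mono-≤ (≤-reflexive (sym (dR+nR rows v i))) (≤-reflexive (sym (dR+nR rows v j)))) 2w<K))
          (lem ρ (∑ (dR rows v)) (∑ (nR rows v)) (dR rows v i) (dR rows v j) (nR rows v i) (nR rows v j) w K) where
          lem : ∀ ρ D N a b x y w K → suc D + (w + w + N + suc (suc ρ) * K + (a + x + (b + y) + K)) + 2
                                   ≡ suc ρ * K + (suc a + suc b + (x + y) + (D + N) + (K + K + suc (2 * w)))
          lem = solve-∀
      second (no none) = bound , member where
        rich : ∀ j → j ≢ i → w ≤ dR rows v j
        rich j ne = ≮⇒≥ λ h → none (j , ne , h)
        zero-i : dR rows v i ≡ 0
        zero-i = n<1⇒n≡0 (≰⇒> λ pos → blocked i v na pos rich)
        bound : ∑ (dR rows v) ≤ suc ρ * K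
        bound = (∑-one (dR rows v) i K λ j _ → #≤n λ a → adj G v (cell rows j a)) &= (cong (suc ρ * K +_) zero-i ∙ +-identityʳ _)
        member : ∑ (dR rows v) ≡ suc ρ * K → ∃ λ i → Member i v
        member e = i , zero-i , λ j ne → sym (+-identityʳ _) ∙ cong (dR rows v j +_) (sym (none-missing j ne)) ∙ dR+nR rows v j where
          none-missing : ∀ j → j ≢ i → nR rows v j ≡ 0
          none-missing j ne = n≤0⇒n≡0 (+-cancelˡ-≤ K _ _ ((+-monoˡ-≤ (nR rows v j) (≤-reflexive (sym (dR+nR rows v i) ∙ cong (_+ nR rows v i) zero-i)) &
            ∑-pair (nR rows v) ne) &= (+-cancelˡ-≡ (∑ (dR rows v)) _ _ (total-rows v ∙ +-comm K (suc ρ * K) ∙ cong (_+ K) (sym e)) ∙ sym (+-identityʳ K))))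

  S : List V
  S = concat (tabulate λ i → tabulate (cell rows i))

  lcount-S : ∀ v → lcount (adj G v) S ≡ ∑ (dR rows v)
  lcount-S v = lcount-concat (adj G v) (λ i → tabulate (cell rows i)) ∙ (∑-cong λ i → lcount-tabulate (adj G v) (cell rows i))

  ApexSet : V → Bool
  ApexSet = set isApex?

  #apex : # ApexSet ≤ q
  #apex = #≤lcount ApexSet full (tabulate apex) (λ v e → let (z , h) = set⁻ isApex? e in subst (_∈ tabulate apex) (sym h) (∈-tabulate⁺ {f = apex} z)) (λ _ _ → refl) &
    lcount≤length full (tabulate apex) &= length-tabulate apex

  -- Only the apexes have excess, at most `q` vertices with weight at most two and excess `K`. This
  -- is just what `Deletion` requires, so every degree into the rows is determined.
  exact : ∀ v → ∑ (dR rows v) ≡ suc ρ * K + 𝟙 (ApexSet v) * K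
  exact v = sym (lcount-S v) ∙ deletion-equal {q} {ρ} {smax} del κ κ≤smax S
      (Unique-concat-tabulate (λ i → tabulate (cell rows i)) (λ i → Uniqueₚ.tabulate⁺ (cell-inj rows i)) λ {i} {j} ne m m' →
        let (a , e) = ∈-tabulate⁻ {f = cell rows i} m ; (b , e') = ∈-tabulate⁻ {f = cell rows j} m' in Adj-≢ (cell-adj rows a b ne) (sym e ∙ e'))
      (length-concat-tabulate K (λ i → tabulate (cell rows i)) λ i → length-tabulate (cell rows i)) (λ v → 𝟙 (ApexSet v) * K)
      (λ v → lcount-S v =& upper v) total v where
    upper : ∀ v → ∑ (dR rows v) ≤ suc ρ * K + 𝟙 (ApexSet v) * K
    upper v = go (bool (ApexSet v)) where
      go : ApexSet v ≡ true ⊎ ApexSet v ≡ false → ∑ (dR rows v) ≤ suc ρ * K + 𝟙 (ApexSet v) * K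
      go (inl e) = m≤m+n _ _ & total-rows v =& ≤-reflexive (+-comm K (suc ρ * K) ∙ cong (suc ρ * K +_) (sym (cong (λ b → 𝟙 b * K) e ∙ +-identityʳ K)))
      go (inr e) = fst (degree v (set-false isApex? e)) & m≤m+n _ _
    total : ∑ (λ v → μ S v * (𝟙 (ApexSet v) * K)) ≤ 2 * q * K
    total = (∑-mono λ v → *-monoˡ-≤ (𝟙 (ApexSet v) * K) (μ≤2 S v)) & (∑-*ˡ 2 (λ v → 𝟙 (ApexSet v) * K) ∙ cong (2 *_) (#-∑* K ApexSet)) =&
      *-monoʳ-≤ 2 (*-monoˡ-≤ K #apex) &= sym (*-assoc 2 q K)

  member? : ∀ v i → Dec (Member i v)
  member? v i = (dR rows v i ≟ℕ 0) ×-dec all? λ j → ¬? (j ≟ᶠ i) →-dec (dR rows v j ≟ℕ K)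

  opaque
    cls : V → Maybe (Fin r)
    cls v = pickClass (isApex? v) (any? (member? v)) where
      pickClass : Dec (IsApex v) → Dec (∃ λ i → Member i v) → Maybe (Fin r)
      pickClass (yes _) _            = nothing
      pickClass (no _) (yes (i , _)) = just i
      pickClass (no _) (no _)        = nothing

    cls-just : ∀ v {i} → cls v ≡ just i → ¬ IsApex v × Member i v
    cls-just v e with isApex? v | any? (member? v)
    cls-just v refl | no na | yes (i , mem) = na , mem

    cls-nothing : ∀ v → cls v ≡ nothing → IsApex v
    cls-nothing v e with isApex? v | any? (member? v)
    ... | yes a | _ = a
    ... | no na | no ¬mem = ⊥-elim (¬mem (snd (degree v na) (exact v ∙ cong (λ b → suc ρ * K + 𝟙 b * K) (¬true⇒false λ e → na (set⁻ isApex? e)) ∙ +-identityʳ _)))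

    cls-apex : ∀ z → cls (apex z) ≡ nothing
    cls-apex z with isApex? (apex z)
    ... | yes _ = refl
    ... | no na = ⊥-elim (na (z , refl))

  open ClassCount G cls

  Cl-member : ∀ {i v} → Cl i v ≡ true → ¬ IsApex v × Member i v
  Cl-member {i} {v} e = cls-just v (is⁻ i (cls v) e)

  member-adj : ∀ {i v} → Member i v → ∀ j a → j ≢ i → Adj v (cell rows j a)
  member-adj {i} {v} (_ , h) j a ne = #-equal (λ a → adj G v (cell rows j a)) full (λ _ _ → refl) (≤-reflexive (#-full K ∙ sym (h j ne))) a refl

  module Class (i : Fin r) where
    Core : V → Set
    Core x = Row i x ⊎ IsApex x ⊎ Cl i x ≡ true

    core-row : ∀ {j x y} → j ≢ i → Core x → Row j y → Adj x y
    core-row ne (inl (b , refl)) (a , refl) = cell-adj rows b a (ne ∘ sym)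
    core-row ne (inr (inl (z , refl))) (a , refl) = apex-adj z _ a
    core-row ne (inr (inr e)) (a , refl) = member-adj (snd (Cl-member e)) _ a ne

    row-row : ∀ {j j' x y} → j ≢ j' → Row j x → Row j' y → Adj x y
    row-row ne (a , refl) (b , refl) = cell-adj rows a b ne

    rows-many : ∀ j → j ≢ i → Many w (Row j)
    rows-many j _ = Many-≤ w≤K (row-many j)

    open Centred i Core Row core-row row-row (Many-map inl (Many-≤ w≤K (row-many i))) rows-many public

    core-path : ∀ {x xs y} → Path x xs y → Unique xs → (∀ {v} → v ∈ xs → Core v) → length xs ≤ suc (2 * q)
    core-path p u core = ≮⇒≥ λ gt → F₁-blob In complete-In rich i p u (λ m → inl (refl , core m)) gt

    Cl-pathfree : PathFree (suc (2 * q)) (Cl i)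
    Cl-pathfree p u sat = core-path p u λ m → inr (inr (sat m))

    -- A row vertex, the apex `z`, `v` and `v'` form a path, which the other `q - 1` apexes lengthen
    -- to `4 + 2 * (q - 1) = ℓ` vertices.
    isolated : ∀ {v v' z} → Cl i v ≡ true → Cl i v' ≡ true → Adj v v' → ¬ Adj (apex z) v
    isolated {v} {v'} {z} cv cv' vv' zv = start (fresh (apex z ∷ v ∷ v' ∷ []) ((zigzag-small & zigzag-width) & w≤K) (row-many i)) (others z) where
      zigzag-small : 4 ≤ suc (2 * suc q)
      zigzag-small = *-monoʳ-≤ 2 (s≤s 1≤q) & n≤1+n _
      start : (∃ λ y → Row i y × y ∉ apex z ∷ v ∷ v' ∷ []) → (∃ λ l → suc (length l) ≡ q × z ∉ l × Unique l) → ⊥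
      start (y , (a , refl) , y∉) (l , len-l , z∉ , ul) = finish (zigzag (row-many i) W (Adj-sym (apex-adj z i a) ∷ (zv ∷ (vv' ∷ [ v' ]))) uniq
          (Uniqueₚ.map⁺ apex-inj ul) disj (λ m → ap-adj m (a , refl)) (λ c m → Adj-sym (ap-adj m c)) fits) where
        W : List V
        W = map apex l
        not-Cl : ∀ {z x} → Cl i x ≡ true → apex z ≢ x
        not-Cl {z} cx e = fst (Cl-member cx) (z , sym e)
        uniq : Unique (cell rows i a ∷ apex z ∷ v ∷ v' ∷ [])
        uniq = ∉⇒All≢ y∉ ∷ ((not-Cl cv ∷ not-Cl cv' ∷ []) ∷ (Adj-≢ vv' ∷ []) ∷ [] ∷ [])
        ap-adj : ∀ {x y} → x ∈ W → Row i y → Adj x y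
        ap-adj m (b , refl) = let (z' , _ , e) = ∈-map⁻ apex m in subst (λ x → Adj x (cell rows i b)) (sym e) (apex-adj z' i b)
        disj : ∀ {x} → x ∈ W → x ∉ cell rows i a ∷ apex z ∷ v ∷ v' ∷ []
        disj m (here e) = Adj-≢ (ap-adj m (a , refl)) e
        disj m (there (here e)) = let (z' , z'∈ , e') = ∈-map⁻ apex m in z∉ (subst (_∈ l) (apex-inj (sym e' ∙ e)) z'∈)
        disj m (there (there (here e))) = let (z' , _ , e') = ∈-map⁻ apex m in not-Cl cv (sym e' ∙ e)
        disj m (there (there (there (here e)))) = let (z' , _ , e') = ∈-map⁻ apex m in not-Cl cv' (sym e' ∙ e)
        total : 4 + 2 * length W ≡ 2 + 2 * q
        total = cong (λ k → 4 + 2 * k) (length-map apex l) ∙ lem (length l) ∙ cong (λ k → 2 + 2 * k) len-l where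
          lem : ∀ k → 4 + 2 * k ≡ 2 + 2 * suc k
          lem = solve-∀
        fits : 4 + 2 * length W ≤ K
        fits = total =& (m≤m+n (2 + 2 * q) m & path-width) & w≤K
        finish : (∃ λ y → ∃ λ ys → Path y ys v' × Unique ys × length ys ≡ 4 + 2 * length W ×
          (∀ {x} → x ∈ ys → x ∈ cell rows i a ∷ apex z ∷ v ∷ v' ∷ [] ⊎ x ∈ W ⊎ Row i x) × (y ≡ cell rows i a ⊎ Row i y)) → ⊥
        finish (y , ys , p , u , len , inc , _) = 1+n≰n (sym (len ∙ total) =& (core-path p u λ m → core (inc m))) where
          core : ∀ {x} → x ∈ cell rows i a ∷ apex z ∷ v ∷ v' ∷ [] ⊎ x ∈ W ⊎ Row i x → Core x
          core (inl (here e)) = inl (a , e)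
          core (inl (there (here e))) = inr (inl (z , e))
          core (inl (there (there (here refl)))) = inr (inr cv)
          core (inl (there (there (there (here refl))))) = inr (inr cv')
          core (inr (inl m)) = let (z' , _ , e) = ∈-map⁻ apex m in inr (inl (z' , e))
          core (inr (inr c)) = inl c

  away? : ∀ v → Dec (∀ z → adj G (apex z) v ≡ false)
  away? v = all? λ z → adj G (apex z) v ≟ᵇ false

  Away : V → Bool
  Away = set away?

  R : Fin r → V → Bool
  R i = Away ∩ Cl i

  R-pathfree : ∀ i → PathFree (suc (2 * q)) (R i)
  R-pathfree i = PathFree-⊆ (λ v → ∧-elimʳ {Away v}) (Class.Cl-pathfree i)

  edge-away : ∀ i {v v'} → Cl i v ≡ true → Cl i v' ≡ true → Adj v v' → Away v ≡ true
  edge-away i cv cv' h = set⁺ away? λ z → ¬true⇒false (Class.isolated i cv cv' h)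

  E-Cl : ∀ i → E (Cl i) (Cl i) ≤ E (R i) (R i)
  E-Cl i = ∑-mono λ v → go v (bool (Cl i v)) where
    go : ∀ v → Cl i v ≡ true ⊎ Cl i v ≡ false → 𝟙 (Cl i v) * d v (Cl i) ≤ 𝟙 (R i v) * d v (R i)
    go v (inr e) = cong (λ b → 𝟙 b * d v (Cl i)) e =& z≤n
    go v (inl e) = away (bool (Away v)) where
      away : Away v ≡ true ⊎ Away v ≡ false → 𝟙 (Cl i v) * d v (Cl i) ≤ 𝟙 (R i v) * d v (R i)
      away (inl a) = cong (λ b → 𝟙 b * d v (Cl i)) (e ∙ sym (∧-intro a e)) =& *-monoʳ-≤ (𝟙 (R i v))
        (#-mono {P = adj G v ∩ Cl i} {Q = adj G v ∩ R i} λ x h → ∧-intro {adj G v x} (∧-elimˡ h) (∧-intro (edge-away i (∧-elimʳ {adj G v x} h) e (Adj-sym (∧-elimˡ h))) (∧-elimʳ {adj G v x} h)))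
      away (inr a) = (cong (𝟙 (Cl i v) *_) (#-zero (adj G v ∩ Cl i) λ x → ¬true⇒false λ h →
        true≢false (edge-away i e (∧-elimʳ {adj G v x} h) (∧-elimˡ h)) a) ∙ *-zeroʳ (𝟙 (Cl i v))) =& z≤n

  Ap⇒apex : ∀ v → Ap v ≡ true → IsApex v
  Ap⇒apex v e = cls-nothing v (isN⁻ (cls v) e)

  #Ap : # Ap ≡ q
  #Ap = ≤-antisym ((#-mono {P = Ap} {Q = ApexSet} λ v e → set⁺ isApex? (Ap⇒apex v e)) & #apex)
    (Many⇒≤# Ap (many apex apex-inj λ z → cong isN (cls-apex z)))

  N+q : N + q ≡ n
  N+q = +-comm N q ∙ cong (_+ N) (sym #Ap) ∙ (#-∁ Ap)

  E-Ap : E Ap Ap + q ≤ q * q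
  E-Ap = (cong (E Ap Ap +_) (sym #Ap) ∙ cong (E Ap Ap +_) (#-∑ Ap) ∙ sym (∑-distrib-+ (λ v → 𝟙 (Ap v) * d v Ap) (λ v → 𝟙 (Ap v)))) =&
    ∑-mono le &= ((#-∑* q Ap) ∙ cong (_* q) #Ap) where
    le : ∀ v → 𝟙 (Ap v) * d v Ap + 𝟙 (Ap v) ≤ 𝟙 (Ap v) * q
    le v = go (bool (Ap v)) where
      go : Ap v ≡ true ⊎ Ap v ≡ false → 𝟙 (Ap v) * d v Ap + 𝟙 (Ap v) ≤ 𝟙 (Ap v) * q
      go (inl e) = subst (λ b → 𝟙 b * d v Ap + 𝟙 b ≤ 𝟙 b * q) (sym e) ((cong (_+ 1) (+-identityʳ (d v Ap)) ∙ +-comm (d v Ap) 1) =&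
        d-self Ap e &= (#Ap ∙ sym (+-identityʳ q)))
      go (inr e) = subst (λ b → 𝟙 b * d v Ap + 𝟙 b ≤ 𝟙 b * q) (sym e) z≤n

  Near : V → Bool
  Near = Ord ∩ ∁ Away

  E-cross : E Ap Ord ≤ q * # Near
  E-cross = E-sym Ap Ord =& ∑-mono le &= ((#-∑* q Near) ∙ *-comm (# Near) q) where
    le : ∀ v → 𝟙 (Ord v) * d v Ap ≤ 𝟙 (Near v) * q
    le v = go (bool (Away v)) where
      go : Away v ≡ true ⊎ Away v ≡ false → 𝟙 (Ord v) * d v Ap ≤ 𝟙 (Near v) * q
      go (inl a) = (cong (𝟙 (Ord v) *_) (#-zero (adj G v ∩ Ap) λ x → ¬true⇒false λ h →
        let (z , e) = Ap⇒apex x (∧-elimʳ {adj G v x} h) in true≢false (adj-sym G (apex z) v ∙ subst (Adj v) e (∧-elimˡ h)) (set⁻ away? a z)) ∙ *-zeroʳ (𝟙 (Ord v))) =& z≤n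
      go (inr a) = cong (λ b → 𝟙 b * d v Ap) (sym (cong (λ b → Ord v ∧ not b) a ∙ ∧-identityʳ-Bool (Ord v))) =&
        *-monoʳ-≤ (𝟙 (Near v)) ((#-mono {P = adj G v ∩ Ap} {Q = Ap} λ x → ∧-elimʳ {adj G v x}) &= #Ap) where
        ∧-identityʳ-Bool : ∀ b → b ∧ true ≡ b
        ∧-identityʳ-Bool true  = refl
        ∧-identityʳ-Bool false = refl

  ∑R : ∑ (λ i → # (R i)) + # Near ≤ N
  ∑R = +-monoˡ-≤ (# Near) le &= sym (#-split Ord Away) where
    le : ∑ (λ i → # (R i)) ≤ # (Ord ∩ Away)
    le = (∑-mono λ i → #-mono {P = R i} {Q = (Ord ∩ Away) ∩ Cl i} λ v e → ∧-intro (∧-intro (Cl⊆Ord i v (∧-elimʳ {Away v} e)) (∧-elimˡ e)) (∧-elimʳ {Away v} e)) &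
      ∑-classes≤ (Ord ∩ Away) cls

  squares : ℕ
  squares = ∑ (λ i → # (Cl i) * # (Cl i))

  -- The slack left by the classes and by the apex set vanishes in the extremal case.
  accounting : E full full + squares + q + (q * q ∸ (E Ap Ap + q)) + (2 * q * ∑ (λ i → # (R i)) ∸ ∑ (λ i → E (R i) (R i)))
    ≤ q * q + 2 * q * N + N * N
  accounting = arith (E-split full Ap) class-count (∑-mono E-Cl) E-cross ∑R (m+[n∸m]≡n E-Ap) (m+[n∸m]≡n ∑E-R) where
    ∑E-R : ∑ (λ i → E (R i) (R i)) ≤ 2 * q * ∑ (λ i → # (R i))
    ∑E-R = (∑-mono λ i → fst (EG q (R i) (R-pathfree i))) &= ∑-*ˡ (2 * q) (λ i → # (R i))
    arith : ∀ {e a c o s x y ρ' nr δ δ' N} → e ≡ a + 2 * c + o → o + s ≤ x + N * N → x ≤ y → c ≤ q * nr → ρ' + nr ≤ N →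
      a + q + δ ≡ q * q → y + δ' ≡ 2 * q * ρ' → e + s + q + δ + δ' ≤ q * q + 2 * q * N + N * N
    arith {e} {a} {c} {o} {s} {x} {y} {ρ'} {nr} {δ} {δ'} {N} refl h₁ h₂ h₃ h₄ h₅ h₆ =
      lin 0 (+-mono-≤ (+-mono-≤ (+-mono-≤ h₁ h₂) (+-mono-≤ (*-monoʳ-≤ 2 h₃) (*-monoʳ-≤ (2 * q) h₄))) (+-mono-≤ (≤-reflexive h₅) (≤-reflexive h₆)))
        (lem q a c o s x y ρ' nr δ δ' N) where
      lem : ∀ q a c o s x y p nr δ δ' N → a + 2 * c + o + s + q + δ + δ' + (x + N * N + y + (2 * (q * nr) + 2 * q * N) + (q * q + 2 * q * p)) + 0
          ≡ q * q + 2 * q * N + N * N + (o + s + x + (2 * c + 2 * q * (p + nr)) + (a + q + δ + (y + δ')))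
      lem = solve-∀

  upper : E full full + squares + q ≤ q * q + 2 * q * N + N * N
  upper = (m≤m+n _ _ & m≤m+n _ _) & accounting

  -- Equality makes the apexes a clique and every `R i` tight for Erdős-Gallai. An edge inside class
  -- `i` makes `R i` nonempty, hence it contains a clique on `2 * q + 1` vertices. The apexes and
  -- one cell of row `i` form a disjoint clique on `q + 1` vertices, and `F₃` appears.
  independent : q * q + 2 * q * N + N * N ≤ E full full + squares + q → ∀ i {v v'} → Cl i v ≡ true → Cl i v' ≡ true → ¬ Adj v v'
  independent tight i {v} {v'} cv cv' h = clash (snd (EG q (R i) (R-pathfree i)) (#-pos (R i) {v} (∧-intro (edge-away i cv cv' h) cv)) (dense i)) where
    slack : ∀ a b c → a + b + c ≤ a → b ≡ 0 × c ≡ 0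
    slack a b c le = m+n≡0⇒m≡0 b s0 , m+n≡0⇒n≡0 b s0 where
      s0 : b + c ≡ 0
      s0 = n≤0⇒n≡0 (+-cancelˡ-≤ a _ _ (sym (+-assoc a b c) =& le &= sym (+-identityʳ a)))
    zero-slack = slack (E full full + squares + q) _ _ (accounting & tight)
    Ap-full : q * q ≤ E Ap Ap + q
    Ap-full = m∸n≡0⇒m≤n (fst zero-slack)
    R-full : 2 * q * ∑ (λ i → # (R i)) ≤ ∑ (λ i → E (R i) (R i))
    R-full = m∸n≡0⇒m≤n (snd zero-slack)
    dense : ∀ i → 2 * q * # (R i) ≤ E (R i) (R i)
    dense i = ≤-reflexive (sym (∑-equal (λ i → fst (EG q (R i) (R-pathfree i))) (∑-*ˡ (2 * q) (λ i → # (R i)) =& R-full) i))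
    apex-clique : Clique q Ap
    apex-clique = go q #Ap Ap-full where
      go : ∀ q → # Ap ≡ q → q * q ≤ E Ap Ap + q → Clique q Ap
      go q e le = record { cl = at ; cl-inj = at-inj ; cl-sat = at-sat ; cl-adj = λ {a} {b} ne → all-adj (at a) (at b) (at-sat a) (at-sat b) (ne ∘ at-inj) } where
        open Many (pick q Ap (≤-reflexive (sym e)))
        full-degree : ∀ v → 𝟙 (Ap v) * d v Ap + 𝟙 (Ap v) ≡ 𝟙 (Ap v) * q
        full-degree = ∑-equal (λ v → bound v (bool (Ap v))) (((#-∑* q Ap) ∙ cong (_* q) e) =&
          le &= sym (∑-distrib-+ (λ v → 𝟙 (Ap v) * d v Ap) (λ v → 𝟙 (Ap v)) ∙ cong (E Ap Ap +_) (sym (#-∑ Ap) ∙ e))) where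
          bound : ∀ v → Ap v ≡ true ⊎ Ap v ≡ false → 𝟙 (Ap v) * d v Ap + 𝟙 (Ap v) ≤ 𝟙 (Ap v) * q
          bound v (inl t) = subst (λ b → 𝟙 b * d v Ap + 𝟙 b ≤ 𝟙 b * q) (sym t) ((cong (_+ 1) (+-identityʳ (d v Ap)) ∙ +-comm (d v Ap) 1) =&
            d-self Ap t &= (e ∙ sym (+-identityʳ q)))
          bound v (inr t) = subst (λ b → 𝟙 b * d v Ap + 𝟙 b ≤ 𝟙 b * q) (sym t) z≤n
        all-adj : ∀ x y → Ap x ≡ true → Ap y ≡ true → x ≢ y → Adj x y
        all-adj x y ax ay ne = ∧-elimˡ (#-equal (adj G x ∩ Ap) (Ap ∩ ∁ (isᵇ x))
          (λ u h → ∧-intro (∧-elimʳ {adj G x u} h) (not-false (dec-false (u ≟ᶠ x) λ u≡x → Adj-≢ (∧-elimˡ h) (sym u≡x))))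
          (s≤s⁻¹ ((cong (λ b → 𝟙 b + # (Ap ∩ ∁ (isᵇ x))) (sym ax) ∙ sym (#-remove Ap x) ∙ e) =&
            ≤-reflexive (sym (+-identityʳ q) ∙ subst (λ b → 𝟙 b * q ≡ 𝟙 b * d x Ap + 𝟙 b) ax (sym (full-degree x)) ∙ cong (_+ 1) (+-identityʳ (d x Ap)) ∙ +-comm (d x Ap) 1)))
          y (∧-intro ay (not-false (dec-false (y ≟ᶠ x) (ne ∘ sym)))))
    clash : Clique (suc (2 * q)) (R i) → ⊥
    clash cq = F₃-blob In complete-In rich i c (Clique.cl cq) c-adj (Clique.cl-adj cq) c≢ c-in (λ x → inl (refl , inr (inr (∧-elimʳ {Away (Clique.cl cq x)} (Clique.cl-sat cq x))))) where
      open Class i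
      open Clique apex-clique
      κ₀ : Fin K
      κ₀ = fromℕ< (1≤w & w≤K)
      c : Fin (suc q) → V
      c zero    = cell rows i κ₀
      c (suc z) = cl z
      ap : ∀ z → IsApex (cl z)
      ap z = Ap⇒apex (cl z) (cl-sat z)
      top : ∀ z → Adj (cl z) (cell rows i κ₀)
      top z = let (z' , e) = ap z in subst (λ x → Adj x (cell rows i κ₀)) (sym e) (apex-adj z' i κ₀)
      c-adj : ∀ {a b} → a ≢ b → Adj (c a) (c b)
      c-adj {zero}  {zero}  ne = ⊥-elim (ne refl)
      c-adj {zero}  {suc b} ne = Adj-sym (top b)
      c-adj {suc a} {zero}  ne = top a
      c-adj {suc a} {suc b} ne = cl-adj (ne ∘ cong suc)
      c≢ : ∀ a b → c a ≢ Clique.cl cq b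
      c≢ zero b e = true≢false (subst (Adj (apex z₀)) e (apex-adj z₀ i κ₀)) (set⁻ away? (∧-elimˡ (Clique.cl-sat cq b)) z₀)
        where z₀ = fromℕ< 1≤q
      c≢ (suc a) b e = fst (Cl-member {i} (∧-elimʳ {Away (Clique.cl cq b)} (Clique.cl-sat cq b))) (let (z , e') = ap a in z , sym e ∙ e')
      c-in : ∀ a → In i (c a)
      c-in zero    = inl (refl , inl (κ₀ , refl))
      c-in (suc a) = inl (refl , inr (inl (ap a)))

-- Endgame with a matching in every class.

#≤1 : ∀ {n} (P : Fin n → Bool) → (∀ x y → P x ≡ true → P y ≡ true → x ≡ y) → # P ≤ 1
#≤1 P h = ≮⇒≥ λ gt → go (pick 2 P gt) where
  go : Many 2 (λ x → P x ≡ true) → ⊥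
  go (many at at-inj at-sat) = case at-inj (h (at zero) (at (suc zero)) (at-sat zero) (at-sat (suc zero))) of λ ()

module Parity {n : ℕ} (G : Graph n) where
  open Graphs G

  opaque
    unfolding ∑

    symmetric-even : ∀ {k} (f : Fin k → Fin k → ℕ) → (∀ i j → f i j ≡ f j i) → (∀ i → f i i ≡ 0) → ∃ λ h → ∑ (λ i → ∑ (f i)) ≡ 2 * h
    symmetric-even {zero}  f sy irr = 0 , refl
    symmetric-even {suc k} f sy irr with symmetric-even (λ i j → f (suc i) (suc j)) (λ i j → sy (suc i) (suc j)) (λ i → irr (suc i))
    ... | h , eq = ∑ (λ j → f zero (suc j)) + h , (cong₂ _+_ (cong (_+ ∑ (λ j → f zero (suc j))) (irr zero))
        (∑-distrib-+ (λ i → f (suc i) zero) (λ i → ∑ (λ j → f (suc i) (suc j))) ∙ (cong₂ _+_ (∑-cong λ i → sy (suc i) zero) eq))) ∙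
        lem (∑ (λ j → f zero (suc j))) h where
      lem : ∀ a h → 0 + a + (a + 2 * h) ≡ 2 * (a + h)
      lem = solve-∀

  E-even : ∀ X → ∃ λ h → E X X ≡ 2 * h
  E-even X = let (h , e) = symmetric-even f f-sym f-irr in h , expand ∙ e where
    f : V → V → ℕ
    f v w = 𝟙 (X v) * (𝟙 (adj G v w) * 𝟙 (X w))
    f-sym : ∀ v w → f v w ≡ f w v
    f-sym v w = cong (λ b → 𝟙 (X v) * (𝟙 b * 𝟙 (X w))) (adj-sym G v w) ∙ lem (𝟙 (X v)) (𝟙 (adj G w v)) (𝟙 (X w)) where
      lem : ∀ a b c → a * (b * c) ≡ c * (b * a)
      lem = solve-∀
    f-irr : ∀ v → f v v ≡ 0
    f-irr v = cong (λ b → 𝟙 (X v) * (𝟙 b * 𝟙 (X v))) (adj-irr G v) ∙ *-zeroʳ (𝟙 (X v))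
    expand : E X X ≡ ∑ (λ v → ∑ (f v))
    expand = ∑-cong λ v → cong (𝟙 (X v) *_) ((#-∑ (adj G v ∩ X)) ∙ (∑-cong λ w → 𝟙-∧ (adj G v w) (X w))) ∙ sym (∑-*ˡ (𝟙 (X v)) (λ w → 𝟙 (adj G v w) * 𝟙 (X w)))

  -- The degree sum is even, so a graph of maximum degree one on an odd set leaves a vertex out.
  matching-sum : ∀ X → (∀ v → X v ≡ true → d v X ≤ 1) → E X X ≤ 2 * (# X / 2)
  matching-sum X h = snd even =& *-monoʳ-≤ 2 half≤ where
    even = E-even X
    half≤ : fst even ≤ # X / 2
    half≤ = sym (m*n/n≡m (fst even) 2) =& /-monoˡ-≤ 2 ((*-comm (fst even) 2 ∙ sym (snd even)) =&
      E-const X X 1 h &= +-identityʳ (# X))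

module PairEnd {n : ℕ} (q ρ m : ℕ) (G : Graph n) (free : ForbiddenFree q ρ m G) (K smax : ℕ) (r≡2q : suc (suc ρ) ≡ 2 * q)
    (4w<K : 4 * Widths.width q m < K) (K≤smax : 2 * K ≤ smax) (del : Weights.Deletion G q ρ smax)
    (T : Pairs G (2 + ρ) K) where
  open Graphs G
  open Embeddings G
  open Blobs q ρ m G free
  open Widths q m renaming (width to w)
  open Weights G
  open Pairs T

  private
    r : ℕ
    r = suc (suc ρ)

    w≤K : w ≤ K
    w≤K = m≤n*m w 4 & (<⇒≤ 4w<K)

    1≤w : 1 ≤ w
    1≤w = s≤s z≤n & matching-width

  other : Fin 2 → Fin 2
  other zero    = suc zero
  other (suc _) = zero

  other≢ : ∀ a → a ≢ other a
  other≢ zero ()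
  other≢ (suc zero) ()

  InPair : Fin r → V → Set
  InPair i v = ∃ λ k → ∃ λ a → v ≡ end i k a

  Si : Fin r → List V
  Si i = tabulate (λ k → end i k zero) ++ tabulate (λ k → end i k (suc zero))

  side : V → Fin r → Fin 2 → Fin K → Bool
  side v i a k = adj G v (end i k a)

  pd : V → Fin r → ℕ
  pd v i = # (side v i zero) + # (side v i (suc zero))

  both : V → Fin r → Fin K → Bool
  both v i = side v i zero ∩ side v i (suc zero)

  lcount-Si : ∀ v i → lcount (adj G v) (Si i) ≡ pd v i
  lcount-Si v i = lcount-++ (adj G v) (tabulate λ k → end i k zero) ∙
    (cong₂ _+_ (lcount-tabulate (adj G v) (λ k → end i k zero)) (lcount-tabulate (adj G v) (λ k → end i k (suc zero))))

  Si-cell : ∀ i {v} → v ∈ Si i → InPair i v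
  Si-cell i m = [ (λ h → let (k , e) = ∈-tabulate⁻ h in k , zero , e) , (λ h → let (k , e) = ∈-tabulate⁻ h in k , suc zero , e) ]′
    (∈-++⁻ (tabulate λ k → end i k zero) m)

  Si-in : ∀ i k a → end i k a ∈ Si i
  Si-in i k zero       = ∈-++⁺ˡ (∈-tabulate⁺ {f = λ k → end i k zero} k)
  Si-in i k (suc zero) = ∈-++⁺ʳ (tabulate λ k → end i k zero) (∈-tabulate⁺ {f = λ k → end i k (suc zero)} k)

  pd≤ : ∀ v i → pd v i ≤ 2 * K
  pd≤ v i = +-mono-≤ (#≤n (side v i zero)) (#≤n (side v i (suc zero)) &= sym (+-identityʳ K))

  matching : ∀ {s} → s ≤ w → ∀ i {Q : V → Set} (σ : Many w λ (k : Fin K) → Q (end i k zero) × Q (end i k (suc zero))) → Matching s Q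
  matching s≤w i σ = Matching-≤ s≤w record
    { mx = λ x → end i (at x) zero ; my = λ x → end i (at x) (suc zero)
    ; mx-inj = λ e → at-inj (fst (end-inj i e)) ; my-inj = λ e → at-inj (fst (end-inj i e))
    ; mxy = λ x y e → case snd (end-inj i e) of λ ()
    ; mx-sat = λ x → fst (at-sat x) ; my-sat = λ x → snd (at-sat x) ; m-adj = λ x → end-edge i (at x) λ () }
    where open Many σ

  all-pairs : ∀ {Q : Fin K → Set} → (∀ k → Q k) → Many w Q
  all-pairs h = Many-map (λ {k} _ → h k) (Many-≤ w≤K Many-all)

  pair-adj : ∀ {i j x y} → i ≢ j → InPair i x → InPair j y → Adj x y
  pair-adj ne (k , a , refl) (k' , a' , refl) = end-adj k k' a a' ne

  pair-many : ∀ j {Q : V → Set} → (∀ {v} → InPair j v → Q v) → Many w Q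
  pair-many j h = Many-image (λ k → end j k zero) (λ e → fst (end-inj j e)) (λ {k} _ → h (k , zero , refl)) (Many-≤ w≤K Many-all)

  Rich : V → Fin r → Set
  Rich v j = Many w (λ x → InPair j x × Adj v x)

  half : ∀ v j → 2 * w ≤ pd v j → ∃ λ a → w ≤ # (side v j a)
  half v j h = go (w ≤? # (side v j zero)) (w ≤? # (side v j (suc zero))) where
    go : Dec (w ≤ # (side v j zero)) → Dec (w ≤ # (side v j (suc zero))) → ∃ λ a → w ≤ # (side v j a)
    go (yes le) _ = zero , le
    go (no _) (yes le) = suc zero , le
    go (no a) (no b) = ⊥-elim (<-irrefl refl (s≤s h & +-mono-<-≤ (≰⇒> a) (<⇒≤ (≰⇒> b)) &= cong (w +_) (sym (+-identityʳ w))))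

  rich-from : ∀ v j → 2 * w ≤ pd v j → Rich v j
  rich-from v j h = let (a , le) = half v j h in
    Many-image (λ k → end j k a) (λ e → fst (end-inj j e)) (λ {k} h → (k , a , refl) , h) (pick w (side v j a) le)

  rich-both : ∀ v j → w ≤ # (both v j) → Rich v j
  rich-both v j le = Many-image (λ k → end j k zero) (λ e → fst (end-inj j e)) (λ {k} h → (k , zero , refl) , ∧-elimˡ h) (pick w (both v j) le)

  module Around (i : Fin r) (v : V) (others-rich : ∀ j → j ≢ i → Rich v j) where
    Core : V → Set
    Core x = InPair i x ⊎ x ≡ v

    Sel : Fin r → V → Set
    Sel j x = InPair j x × Adj v x

    core-row : ∀ {j x y} → j ≢ i → Core x → Sel j y → Adj x y
    core-row ne (inl p) (p' , _) = pair-adj (ne ∘ sym) p p'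
    core-row ne (inr refl) (_ , h) = h

    row-row : ∀ {j j' x y} → j ≢ j' → Sel j x → Sel j' y → Adj x y
    row-row ne (p , _) (p' , _) = pair-adj ne p p'

    open Centred i Core Sel core-row row-row (pair-many i inl) others-rich public

    own-matching : Matching (3 + m) (In i)
    own-matching = matching matching-width i (all-pairs λ k → inl (refl , inl (k , zero , refl)) , inl (refl , inl (k , suc zero , refl)))

    -- The cherry runs from `v` over a neighbour in row `i` to the partner of that neighbour. The
    -- pairs of row `i₁` seen entirely by `v` are the second matching of `F₂`.
    no-cherry : ∀ {i₁} → i₁ ≢ i → w ≤ # (both v i₁) → ∀ k a → Adj v (end i k a) → v ≢ end i k (other a) → ⊥
    no-cherry {i₁} ne full₁ k a h v≢ = F₂-blob In complete-In rich (ne ∘ sym) h (end-edge i k (other≢ a)) v≢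
      (inl (refl , inr refl)) (inl (refl , inl (k , a , refl))) (inl (refl , inl (k , other a , refl)))
      own-matching (matching m≤width i₁ (Many-map (λ {k} e → inr (ne , (k , zero , refl) , ∧-elimˡ e) , inr (ne , (k , suc zero , refl) , ∧-elimʳ {side v i₁ zero k} e)) (pick w (both v i₁) full₁)))

  another : ∀ (i : Fin r) → ∃ λ j → j ≢ i
  another zero    = suc zero , λ ()
  another (suc i) = zero , λ ()

  FullTo : V → Fin r → Set
  FullTo v j = ∀ k a → Adj v (end j k a)

  Member : Fin r → V → Set
  Member i v = ∀ j → j ≢ i → FullTo v j

  full-rich : ∀ {v j} → FullTo v j → w ≤ # (both v j)
  full-rich {v} {j} h = w≤K & Many⇒≤# (both v j) (Many-map (λ {k} _ → ∧-intro (h k zero) (h k (suc zero))) Many-all)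

  full-from : ∀ v j → pd v j ≡ 2 * K → FullTo v j
  full-from v j e k zero = #-equal (side v j zero) full (λ _ _ → refl) (#-full K =&
    +-cancelʳ-≤ K _ _ ((cong (K +_) (sym (+-identityʳ K)) ∙ sym e) =& +-monoʳ-≤ (# (side v j zero)) (#≤n (side v j (suc zero))))) k refl
  full-from v j e k (suc zero) = #-equal (side v j (suc zero)) full (λ _ _ → refl) (#-full K =&
    +-cancelˡ-≤ K _ _ ((cong (K +_) (sym (+-identityʳ K)) ∙ sym e) =& +-monoˡ-≤ (# (side v j (suc zero))) (#≤n (side v j zero)))) k refl

  neighbour : ∀ v i → 1 ≤ pd v i → ∃ λ k → ∃ λ a → Adj v (end i k a)
  neighbour v i pos = go (any? λ k → any? λ a → adj G v (end i k a) ≟ᵇ true) where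
    go : Dec (∃ λ k → ∃ λ a → Adj v (end i k a)) → ∃ λ k → ∃ λ a → Adj v (end i k a)
    go (yes p) = p
    go (no none) = ⊥-elim (<-irrefl (sym (cong₂ _+_ (#-zero (side v i zero) λ k → ¬true⇒false λ h → none (k , zero , h))
      (#-zero (side v i (suc zero)) λ k → ¬true⇒false λ h → none (k , suc zero , h)))) pos)

  pd-both : ∀ v i → pd v i ≤ K + # (both v i)
  pd-both v i = cong (# (side v i zero) +_) (#-split (side v i (suc zero)) (side v i zero)) =&
    lem (# (side v i zero)) _ _ =& +-mono-≤ (+-monoʳ-≤ (# (side v i zero))
        (#-mono {P = side v i (suc zero) ∩ ∁ (side v i zero)} {Q = ∁ (side v i zero)} λ k → ∧-elimʳ {side v i (suc zero) k}) &= (#-∁ (side v i zero)))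
      (#-mono {P = side v i (suc zero) ∩ side v i zero} {Q = both v i} λ k h → ∧-intro (∧-elimʳ {side v i (suc zero) k} h) (∧-elimˡ h)) where
    lem : ∀ a b c → a + (b + c) ≡ a + c + b
    lem = solve-∀

  total-missing : ∀ v → ∑ (pd v) + ∑ (λ i → 2 * K ∸ pd v i) ≡ r * (2 * K)
  total-missing v = sym (∑-distrib-+ (pd v) (λ i → 2 * K ∸ pd v i)) ∙ (∑-cong λ i → m+[n∸m]≡n (pd≤ v i)) ∙ ∑-const r (2 * K)

  -- A vertex with a neighbour in every row misses more than one row.
  outside-degree : ∀ v → (∀ i → ¬ InPair i v) → (∀ i → 1 ≤ pd v i) → ∑ (pd v) < suc ρ * (2 * K)
  outside-degree v v∉ pos = ≰⇒> λ big → byFull big (any? λ i → w ≤? # (both v i)) where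
    -- Two rows with fewer than `2 * w` neighbours each miss more than `4 * K - 4 * w` cells, while
    -- at most `2 * K` may be missed in all.
    two-poor : suc ρ * (2 * K) ≤ ∑ (pd v) → ∀ {i j} → j ≢ i → pd v i < 2 * w → ¬ pd v j < 2 * w
    two-poor big {i} {j} ne pi pj = <-irrefl refl (arith ρ K w big (total-missing v) (∑-pair (λ i → 2 * K ∸ pd v i) ne) (m+[n∸m]≡n (pd≤ v i)) (m+[n∸m]≡n (pd≤ v j)) pi pj 4w<K) where
      arith : ∀ ρ K w {P H a b x y} → suc ρ * (2 * K) ≤ P → P + H ≡ suc (suc ρ) * (2 * K) → x + y ≤ H → a + x ≡ 2 * K → b + y ≡ 2 * K →
        a < 2 * w → b < 2 * w → 4 * w < K → K < K
      arith ρ K w {P} {H} {a} {b} {x} {y} h₁ h₂ h₃ h₄ h₅ h₆ h₇ h₈ = lin (K + 2)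
          (+-mono-≤ (+-mono-≤ (+-mono-≤ h₁ (≤-reflexive h₂)) (+-mono-≤ h₃ (≤-reflexive (sym h₄)))) (+-mono-≤ (+-mono-≤ (≤-reflexive (sym h₅)) h₆) (+-mono-≤ h₇ h₈)))
          (lem ρ K w P H a b x y) where
        lem : ∀ ρ K w P H a b x y → suc K + (P + suc (suc ρ) * (2 * K) + (H + (a + x)) + (b + y + 2 * w + (2 * w + K))) + (K + 2)
            ≡ K + (suc ρ * (2 * K) + (P + H) + (x + y + 2 * K) + (2 * K + suc a + (suc b + suc (4 * w))))
        lem = solve-∀
    close : suc ρ * (2 * K) ≤ ∑ (pd v) → ∀ {i₁} → w ≤ # (both v i₁) → ∀ i₀ → i₁ ≢ i₀ → (∀ j → j ≢ i₀ → 2 * w ≤ pd v j ⊎ j ≡ i₁) → ⊥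
    close big {i₁} full₁ i₀ ne ok = fin (neighbour v i₀ (pos i₀)) where
      rich : ∀ j → j ≢ i₀ → Rich v j
      rich j nj = [ rich-from v j , (λ { refl → rich-both v j full₁ }) ]′ (ok j nj)
      fin : (∃ λ k → ∃ λ a → Adj v (end i₀ k a)) → ⊥
      fin (k , a , h) = Around.no-cherry i₀ v rich ne full₁ k a h λ e → v∉ i₀ (k , other a , e)
    byFull : suc ρ * (2 * K) ≤ ∑ (pd v) → Dec (∃ λ i → w ≤ # (both v i)) → ⊥
    byFull big (yes (i₁ , full₁)) = byPoor (any? λ j → ¬? (j ≟ᶠ i₁) ×-dec (pd v j <? 2 * w)) where
      byPoor : Dec (∃ λ j → j ≢ i₁ × pd v j < 2 * w) → ⊥
      byPoor (yes (j , ne , poor)) = close big full₁ j (ne ∘ sym) λ j' nj → inl (≮⇒≥ (two-poor big (nj ∘ id) poor))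
      byPoor (no none) = let (i₀ , ne) = another i₁ in close big full₁ i₀ (ne ∘ sym) λ j nj → case (j ≟ᶠ i₁) of λ
        { (yes e) → inr e ; (no nj₁) → inl (≮⇒≥ λ poor → none (j , nj₁ , poor)) }
    -- No row has `w` pairs seen entirely, so each contributes at most `K + w`. For `r ≥ 3` the
    -- total is then too small. For `r = 2`, where `ℓ = 4`, `v` lies on a path of four vertices
    -- inside one part, and `F₁` appears.
    byFull big (no none) = byRank ρ refl where
      small : ∀ i → pd v i ≤ K + w
      small i = pd-both v i & +-monoʳ-≤ K (<⇒≤ (≰⇒> λ h → none (i , h)))
      byRank : ∀ ρ' → ρ' ≡ ρ → ⊥
      byRank (suc ρ') refl = <-irrefl refl (arith ρ' K w big (∑-≤const (K + w) small) 4w<K) where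
        arith : ∀ ρ K w {P} → suc (suc ρ) * (2 * K) ≤ P → P ≤ suc (2 + ρ) * (K + w) → 4 * w < K → K < K
        arith ρ K w {P} h₁ h₂ h₃ = lin (3 * (ρ * w) + w + ρ) (+-mono-≤ (+-mono-≤ h₁ h₂) (*-monoʳ-≤ (suc ρ) h₃)) (lem ρ K w P) where
          lem : ∀ ρ K w P → suc K + (P + suc (2 + ρ) * (K + w) + suc ρ * K) + (3 * (ρ * w) + w + ρ)
              ≡ K + (suc (suc ρ) * (2 * K) + P + suc ρ * suc (4 * w))
          lem = solve-∀
      byRank zero refl = fourth (half v zero (enough zero)) where
        enough : ∀ i → 2 * w ≤ pd v i
        enough i = arith K w big (∑-one (pd v) i (K + w) λ j _ → small j) 4w<K where
          arith : ∀ K w {P x} → 1 * (2 * K) ≤ P → P ≤ 1 * (K + w) + x → 4 * w < K → 2 * w ≤ x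
          arith K w {P} {x} h₁ h₂ h₃ = lin (w + 1) (+-mono-≤ (+-mono-≤ h₁ h₂) h₃) (lem K w P x) where
            lem : ∀ K w P x → 2 * w + (P + (1 * (K + w) + x) + K) + (w + 1) ≡ x + (1 * (2 * K) + P + suc (4 * w))
            lem = solve-∀
        open Around zero v (λ j _ → rich-from v j (enough j))
        fourth : (∃ λ a → w ≤ # (side v zero a)) → ⊥
        fourth (a , le) = go (pick 2 (side v zero a) ((s≤s (s≤s z≤n) & matching-width) & le)) where
          go : Many 2 (λ k → side v zero a k ≡ true) → ⊥
          go (many at at-inj at-sat) = F₁-blob In complete-In rich zero
              (end-edge zero k (other≢ a ∘ sym) ∷ (Adj-sym (at-sat zero) ∷ (at-sat (suc zero) ∷ [ end zero k' a ])))
              ((e≢ (λ e → other≢ a (sym (snd (end-inj zero e)))) ∷ out k (other a) ∷ e≢ (λ e → other≢ a (sym (snd (end-inj zero e)))) ∷ []) ∷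
                (out k a ∷ e≢ (λ e → k≢k' (fst (end-inj zero e))) ∷ []) ∷ (Adj-≢ (at-sat (suc zero)) ∷ []) ∷ [] ∷ [])
              (λ m → inl (refl , core m)) (≤-reflexive (cong (2 +_) (sym r≡2q))) where
            k k' : Fin K
            k  = at zero
            k' = at (suc zero)
            k≢k' : k ≢ k'
            k≢k' e = case at-inj e of λ ()
            e≢ : ∀ {x y : V} → (x ≡ y → ⊥) → x ≢ y
            e≢ = id
            out : ∀ k a → end zero k a ≢ v
            out k a e = v∉ zero (k , a , sym e)
            core : ∀ {x} → x ∈ end zero k (other a) ∷ end zero k a ∷ v ∷ end zero k' a ∷ [] → Core x
            core (here e) = inl (k , other a , e)
            core (there (here e)) = inl (k , a , e)
            core (there (there (here e))) = inr e
            core (there (there (there (here e)))) = inl (k' , a , e)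

  -- A vertex of a pair sees every other row completely, so a neighbour in its own row other than
  -- its partner would create the cherry excluded by `no-cherry`.
  own-row : ∀ i k a → pd (end i k a) i ≤ 1
  own-row i k a = go a refl where
    v : V
    v = end i k a
    only : ∀ k' a' → Adj v (end i k' a') → k ≡ k' × a ≡ other a'
    only k' a' h = decide (v ≟ᶠ end i k' (other a')) where
      decide : Dec (v ≡ end i k' (other a')) → k ≡ k' × a ≡ other a'
      decide (yes e) = end-inj i e
      decide (no ne) = ⊥-elim (let (i₁ , i₁≢i) = another i in
        Around.no-cherry i v (λ j nj → rich-both v j (full-rich λ k″ a″ → end-adj k k″ a a″ (nj ∘ sym))) i₁≢i (full-rich λ k″ a″ → end-adj k k″ a a″ (i₁≢i ∘ sym)) k' a' h ne)
    side-0 : ∀ a' → a ≢ other a' → # (side v i a') ≡ 0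
    side-0 a' ne = #-zero (side v i a') λ k' → ¬true⇒false λ h → ne (snd (only k' a' h))
    side-1 : ∀ a' → # (side v i a') ≤ 1
    side-1 a' = #≤1 (side v i a') λ k₁ k₂ h₁ h₂ → sym (fst (only k₁ a' h₁)) ∙ fst (only k₂ a' h₂)
    go : ∀ b → a ≡ b → pd v i ≤ 1
    go zero refl = cong (_+ # (side v i (suc zero))) (side-0 zero λ ()) =& side-1 (suc zero)
    go (suc zero) refl = +-monoʳ-≤ (# (side v i zero)) (≤-reflexive (side-0 (suc zero) λ ())) & +-identityʳ _ =& side-1 zero

  S : List V
  S = concat (tabulate Si)

  S-out : ∀ {v i} → InPair i v → v ∈ S
  S-out {i = i} (k , a , refl) = ∈-concat⁺′ (Si-in i k a) (∈-tabulate⁺ {f = Si} i)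

  S-in : ∀ {v} → v ∈ S → ∃ λ i → InPair i v
  S-in {v} m = let (xs , m' , xs∈) = ∈-concat⁻′ (tabulate Si) m ; (i , e) = ∈-tabulate⁻ {f = Si} xs∈ in i , Si-cell i (subst (v ∈_) e m')

  lcount-S : ∀ v → lcount (adj G v) S ≡ ∑ (pd v)
  lcount-S v = lcount-concat (adj G v) Si ∙ ∑-cong (lcount-Si v)

  Si-unique : ∀ i → Unique (Si i)
  Si-unique i = Uniqueₚ.++⁺ (Uniqueₚ.tabulate⁺ λ e → fst (end-inj i e)) (Uniqueₚ.tabulate⁺ λ e → fst (end-inj i e))
    λ { (m , m') → let (k , e) = ∈-tabulate⁻ m ; (k' , e') = ∈-tabulate⁻ m' in case snd (end-inj i (sym e ∙ e')) of λ () }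

  S-unique : Unique S
  S-unique = Unique-concat-tabulate Si Si-unique λ {i} {j} ne m m' → apart ne (Si-cell i m) (Si-cell j m') where
    apart : ∀ {i j v} → i ≢ j → InPair i v → ¬ InPair j v
    apart ne (k , a , refl) (k' , a' , e) = Adj-≢ (end-adj k k' a a' ne) e

  S-length : length S ≡ r * (2 * K)
  S-length = length-concat-tabulate (2 * K) Si λ i → length-++ (tabulate λ k → end i k zero) ∙ (cong₂ _+_ (length-tabulate λ k → end i k zero) (length-tabulate (λ k → end i k (suc zero)) ∙ sym (+-identityʳ K)))

  degree≤ : ∀ v → lcount (adj G v) S ≤ suc ρ * (2 * K) + 𝟙 (memᵇ S v)
  degree≤ v = lcount-S v =& go (v ∈ᶠ? S) where
    go : (D : Dec (v ∈ S)) → ∑ (pd v) ≤ suc ρ * (2 * K) + 𝟙 (does D)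
    go (yes m) with S-in m
    ... | i , k , a , refl = (∑-one (pd v) i (2 * K) λ j _ → pd≤ v j) & +-monoʳ-≤ (suc ρ * (2 * K)) (own-row i k a)
    go (no v∉) = decide (any? λ i → pd v i ≟ℕ 0) & m≤m+n _ _ where
      decide : Dec (∃ λ i → pd v i ≡ 0) → ∑ (pd v) ≤ suc ρ * (2 * K)
      decide (yes (i , e)) = (∑-one (pd v) i (2 * K) λ j _ → pd≤ v j) &= (cong (suc ρ * (2 * K) +_) e ∙ +-identityʳ _)
      decide (no none) = <⇒≤ (outside-degree v (λ i h → v∉ (S-out h)) λ i → n≢0⇒n>0 λ e → none (i , e))

  -- Each vertex of `S` has excess at most one and weight one. The total is at most
  -- `r * (2 * K) = 2 * q * (2 * K)`, exactly what `Deletion` requires.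
  exact : ∀ v → ∑ (pd v) ≡ suc ρ * (2 * K) + 𝟙 (memᵇ S v)
  exact v = sym (lcount-S v) ∙ deletion-equal {q} {ρ} {smax} del K K≤smax S S-unique S-length (λ v → 𝟙 (memᵇ S v)) degree≤ total v where
    weigh : ∀ b → weightᵇ b * 𝟙 b ≡ 𝟙 b
    weigh true  = refl
    weigh false = refl
    total : ∑ (λ v → μ S v * 𝟙 (memᵇ S v)) ≤ 2 * q * (2 * K)
    total = ((∑-cong λ v → weigh (memᵇ S v)) ∙ sym (#-∑ (memᵇ S))) =& #-memᵇ≤ S &=
      (S-length ∙ cong (_* (2 * K)) r≡2q)

  member : ∀ v → ∃ λ i → Member i v
  member v = go (v ∈ᶠ? S) refl where
    go : (D : Dec (v ∈ S)) → D ≡ (v ∈ᶠ? S) → ∃ λ i → Member i v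
    go (yes m) _ with S-in m
    ... | i , k , a , refl = i , λ j ne k' a' → end-adj k k' a a' (ne ∘ sym)
    go (no v∉) e₀ = decide (any? λ i → pd v i ≟ℕ 0) where
      sum≡ : ∑ (pd v) ≡ suc ρ * (2 * K)
      sum≡ = exact v ∙ cong (λ D → suc ρ * (2 * K) + 𝟙 (does D)) (sym e₀) ∙ +-identityʳ _
      missing : ∑ (λ i → 2 * K ∸ pd v i) ≡ 2 * K
      missing = +-cancelˡ-≡ (suc ρ * (2 * K)) _ _ (cong (_+ ∑ (λ i → 2 * K ∸ pd v i)) (sym sum≡) ∙ total-missing v ∙ +-comm (2 * K) (suc ρ * (2 * K)))
      decide : Dec (∃ λ i → pd v i ≡ 0) → ∃ λ i → Member i v
      decide (yes (i , e)) = i , λ j ne → full-from v j (≤-antisym (pd≤ v j) (m∸n≡0⇒m≤n (n≤0⇒n≡0 (+-cancelˡ-≤ (2 * K) _ _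
        (cong (λ x → (2 * K ∸ x) + (2 * K ∸ pd v j)) (sym e) =& ∑-pair (λ i → 2 * K ∸ pd v i) ne &= (missing ∙ sym (+-identityʳ (2 * K)))))))) 
      decide (no none) = ⊥-elim (<-irrefl sum≡ (outside-degree v (λ i h → v∉ (S-out h)) λ i → n≢0⇒n>0 λ e → none (i , e)))

  opaque
    cls : V → Fin r
    cls v = fst (member v)

    cls-member : ∀ v → Member (cls v) v
    cls-member v = snd (member v)

  open ClassCount G (λ v → just (cls v)) public using (Cl)
  open ClassCount G (λ v → just (cls v)) using (class-count)

  Cl-member : ∀ i v → Cl i v ≡ true → Member i v
  Cl-member i v e = subst (λ j → Member j v) (just-injective (is⁻ i (just (cls v)) e)) (cls-member v)

  -- All vertices of class `i` see the other rows completely, so a cherry inside the class, with the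
  -- pairs of two rows as matchings, would be `F₂`.
  class-matching : ∀ i v → Cl i v ≡ true → d v (Cl i) ≤ 1
  class-matching i v cv = #≤1 (adj G v ∩ Cl i) λ x y hx hy → decide x y hx hy (x ≟ᶠ y) where
    Core : V → Set
    Core x = InPair i x ⊎ Member i x
    core-row : ∀ {j x y} → j ≢ i → Core x → InPair j y → Adj x y
    core-row ne (inl p) p' = pair-adj (ne ∘ sym) p p'
    core-row ne (inr h) (k' , a' , refl) = h _ ne k' a'
    rows-many : ∀ j → j ≢ i → Many w (InPair j)
    rows-many j _ = pair-many j id
    open Centred i Core InPair core-row pair-adj (pair-many i inl) rows-many
    matched : ∀ {s} → s ≤ w → ∀ j {Q : V → Set} → (∀ {v} → InPair j v → Q v) → Matching s Q
    matched le j h = matching le j (all-pairs λ k → h (k , zero , refl) , h (k , suc zero , refl))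
    decide : ∀ x y → (adj G v ∩ Cl i) x ≡ true → (adj G v ∩ Cl i) y ≡ true → Dec (x ≡ y) → x ≡ y
    decide x y hx hy (yes e) = e
    decide x y hx hy (no ne) = ⊥-elim (F₂-blob In complete-In rich (snd (another i) ∘ sym) (Adj-sym (∧-elimˡ {adj G v x} hx)) (∧-elimˡ {adj G v y} hy) ne
      (inl (refl , inr (Cl-member i x (∧-elimʳ {adj G v x} hx)))) (inl (refl , inr (Cl-member i v cv))) (inl (refl , inr (Cl-member i y (∧-elimʳ {adj G v y} hy))))
      (matched matching-width i λ p → inl (refl , inl p)) (matched m≤width (fst (another i)) λ p → inr (snd (another i) , p)))

  upper : E full full + ∑ (λ i → # (Cl i) * # (Cl i)) ≤ ∑ (λ i → 2 * (# (Cl i) / 2)) + n * n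
  upper = class-count & +-mono-≤ (∑-mono λ i → Parity.matching-sum G (Cl i) (class-matching i)) (≤-reflexive (cong₂ _*_ (#-full n) (#-full n)))

-- Doubled edge numbers of the two constructions.

quotient : ∀ c {e} m .{{_ : NonZero m}} → e < m → (c * m + e) / m ≡ c
quotient c {e} m lt = +-distrib-/-∣ˡ {c * m} e (divides c refl) ∙ cong₂ _+_ (m*n/n≡m c m) (m<n⇒m/n≡0 lt) ∙ +-identityʳ c

greedy : (ℕ → ℕ) → ℕ → ℕ
greedy b zero    = 0
greedy b (suc n) = 2 * (n ∸ b n) + greedy b n

-- A graph built by adding vertex k with at most b k missing edges to its predecessors. The
-- two profiles with (shift, s) = (q, 1) and (0, 2) belong to the two extremal constructions.
module Profile (ρ : ℕ) where
  private
    r : ℕ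
    r = suc (suc ρ)

  missed : ℕ → ℕ → ℕ → ℕ
  missed p σ k = suc σ * ((k ∸ p) / (suc σ * r))

  profile : ℕ → ℕ → ℕ → ℕ
  profile p σ = greedy (missed p σ)

  missed≤/ : ∀ p σ k → missed p σ k ≤ k / r
  missed≤/ p σ k = m*n≤o⇒m≤o/n* (suc σ * ((k ∸ p) / (suc σ * r))) (k ∸ p) (lem (suc σ) ((k ∸ p) / (suc σ * r)) r =& m/n*n≤m (k ∸ p) (suc σ * r)) &
      /-monoˡ-≤ r (m∸n≤m k p) where
    m*n≤o⇒m≤o/n* : ∀ x y → x * r ≤ y → x ≤ y / r
    m*n≤o⇒m≤o/n* x y h = sym (m*n/n≡m x r) =& /-monoˡ-≤ r h
    lem : ∀ s x r → s * x * r ≡ x * (s * r)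
    lem = solve-∀

  missed≤ : ∀ p σ k → missed p σ k ≤ k
  missed≤ p σ k = missed≤/ p σ k & m/n≤m k r

  private
    step : ∀ {x F m A s} → m + x ≡ s → F + suc (2 * m) * s ≡ s * s + A → 2 * x + F + suc (2 * m) * suc s ≡ suc s * suc s + A
    step {x} {F} {m} {A} refl e = lem₁ x F m ∙ cong (λ z → 2 * x + suc (2 * m) + z) e ∙ lem₂ x m A where
      lem₁ : ∀ x F m → 2 * x + F + suc (2 * m) * suc (m + x) ≡ 2 * x + suc (2 * m) + (F + suc (2 * m) * (m + x))
      lem₁ = solve-∀
      lem₂ : ∀ x m A → 2 * x + suc (2 * m) + ((m + x) * (m + x) + A) ≡ suc (m + x) * suc (m + x) + A
      lem₂ = solve-∀

  level : ℕ → ℕ → ℕ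
  level σ c = suc σ * suc σ * (c * suc c)

  -- A closed form arranged for `convex-balance`: on each period of length `suc σ * r` the deficit
  -- of the profile from `n * n` is linear in `n`, with slope and constant depending on `c` only.
  profile-value : ∀ σ c e → e ≤ suc σ * r → let n = c * (suc σ * r) + e in
    profile 0 σ n + suc (2 * (suc σ * c)) * n ≡ n * n + r * level σ c
  profile-value σ c (suc e) lt = subst (λ k → profile 0 σ k + suc (2 * (suc σ * c)) * k ≡ k * k + r * level σ c) (sym (+-suc (c * (suc σ * r)) e))
    (subst (λ z → 2 * (n ∸ suc σ * z) + profile 0 σ n + suc (2 * (suc σ * c)) * suc n ≡ suc n * suc n + r * level σ c) (sym (quotient c (suc σ * r) lt))
      (step {n ∸ suc σ * c} {profile 0 σ n} {suc σ * c} {r * level σ c} (m+[n∸m]≡n below) (profile-value σ c e (<⇒≤ lt)))) where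
    n = c * (suc σ * r) + e
    below : suc σ * c ≤ n
    below = (*-comm (suc σ) c =& *-monoʳ-≤ c (m≤m*n (suc σ) r)) & m≤m+n _ e
  profile-value σ zero zero _ = lem σ ρ where
    lem : ∀ σ ρ → suc (2 * (suc σ * 0)) * 0 ≡ suc (suc ρ) * (suc σ * suc σ * (0 * 1))
    lem = solve-∀
  -- `e` may reach a full period, where the formulas for `c` and `suc c` agree; this carries the
  -- induction into the next period.
  profile-value σ (suc c) zero _ = subst (λ k → profile 0 σ k + suc (2 * (suc σ * suc c)) * k ≡ k * k + r * level σ (suc c)) shift
    (change (c * (suc σ * r)) (profile 0 σ (c * (suc σ * r) + suc σ * r)) (profile-value σ c (suc σ * r) ≤-refl)) where
    shift : c * (suc σ * r) + suc σ * r ≡ suc c * (suc σ * r) + 0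
    shift = +-comm (c * (suc σ * r)) _ ∙ sym (+-identityʳ _)
    change : ∀ z F → F + suc (2 * (suc σ * c)) * (z + suc σ * r) ≡ (z + suc σ * r) * (z + suc σ * r) + r * level σ c →
      {{z ≡ c * (suc σ * r)}} → F + suc (2 * (suc σ * suc c)) * (z + suc σ * r) ≡ (z + suc σ * r) * (z + suc σ * r) + r * level σ (suc c)
    change z F h {{refl}} = lem₁ F c (suc σ) r ∙ cong (_+ 2 * suc σ * (c * (suc σ * r) + suc σ * r)) h ∙ lem₂ c (suc σ) r where
      lem₁ : ∀ F c s r → F + suc (2 * (s * suc c)) * (c * (s * r) + s * r) ≡ F + suc (2 * (s * c)) * (c * (s * r) + s * r) + 2 * s * (c * (s * r) + s * r)
      lem₁ = solve-∀
      lem₂ : ∀ c s r → (c * (s * r) + s * r) * (c * (s * r) + s * r) + r * (s * s * (c * suc c)) + 2 * s * (c * (s * r) + s * r)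
        ≡ (c * (s * r) + s * r) * (c * (s * r) + s * r) + r * (s * s * (suc c * suc (suc c)))
      lem₂ = solve-∀

  profile-at : ∀ σ n → profile 0 σ n + suc (2 * (suc σ * (n / (suc σ * r)))) * n ≡ n * n + r * level σ (n / (suc σ * r))
  profile-at σ n = subst (λ k → profile 0 σ k + suc (2 * (suc σ * c)) * k ≡ k * k + r * level σ c) (sym (m≡m%n+[m/n]*n n (suc σ * r) ∙ +-comm (n % (suc σ * r)) _))
    (profile-value σ c (n % (suc σ * r)) (<⇒≤ (m%n<n n (suc σ * r))))
    where c = n / (suc σ * r)

  profile-prefix : ∀ p σ j → j ≤ p → profile p σ j + j ≡ j * j
  profile-prefix p σ zero    _  = refl
  profile-prefix p σ (suc j) lt = cong (λ z → 2 * (j ∸ suc σ * z) + profile p σ j + suc j) (cong (_/ (suc σ * r)) (m≤n⇒m∸n≡0 (<⇒≤ lt)) ∙ 0/n≡0 (suc σ * r)) ∙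
    cong (λ z → 2 * (j ∸ z) + profile p σ j + suc j) (*-zeroʳ (suc σ)) ∙ lem₁ j (profile p σ j) ∙ cong (λ z → 2 * j + suc z) (profile-prefix p σ j (<⇒≤ lt)) ∙ lem₂ j where
    lem₁ : ∀ j F → 2 * j + F + suc j ≡ 2 * j + suc (F + j)
    lem₁ = solve-∀
    lem₂ : ∀ j → 2 * j + suc (j * j) ≡ suc j * suc j
    lem₂ = solve-∀

  -- The first `p` vertices act as apexes: `p * (p - 1)` for the pairs among them and `2 * p * N`
  -- for their edges to the rest.
  profile-shift : ∀ p σ N → profile p σ (p + N) + p ≡ p * p + 2 * p * N + profile 0 σ N
  profile-shift p σ zero = cong (λ k → profile p σ k + p) (+-identityʳ p) ∙ profile-prefix p σ p ≤-refl ∙ lem p where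
    lem : ∀ p → p * p ≡ p * p + 2 * p * 0 + 0
    lem = solve-∀
  profile-shift p σ (suc N) = cong (λ k → profile p σ k + p) (+-suc p N) ∙ cong (λ z → 2 * (p + N ∸ suc σ * (z / (suc σ * r))) + profile p σ (p + N) + p) (m+n∸m≡n p N) ∙
    cong (λ z → 2 * z + profile p σ (p + N) + p) (+-∸-assoc p (missed≤ 0 σ N)) ∙ lem₁ p (N ∸ missed 0 σ N) (profile p σ (p + N)) ∙
      cong (2 * (p + (N ∸ missed 0 σ N)) +_) (profile-shift p σ N) ∙ lem₂ p (N ∸ missed 0 σ N) N (profile 0 σ N) where
    lem₁ : ∀ p x F → 2 * (p + x) + F + p ≡ 2 * (p + x) + (F + p)
    lem₁ = solve-∀
    lem₂ : ∀ p x N F → 2 * (p + x) + (p * p + 2 * p * N + F) ≡ p * p + 2 * p * suc N + (2 * x + F)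
    lem₂ = solve-∀

  -- A new vertex misses at most `n / r` earlier ones. This rate of growth is what forces the
  -- minimum degree of robust graphs.
  profile-suc : ∀ p σ n → profile p σ n + 2 * (n ∸ n / r) ≤ profile p σ (suc n)
  profile-suc p σ n = +-comm (profile p σ n) _ =& +-monoˡ-≤ (profile p σ n) (*-monoʳ-≤ 2 (∸-monoʳ-≤ n (missed≤/ p σ n)))

  private
    profile-block₀ : ∀ σ N τ → let t = τ * suc σ in
      profile 0 σ (N + r * t) ≡ profile 0 σ N + 2 * suc ρ * t * N + r * suc ρ * (t * t) + t * r * σ
    profile-block₀ σ N τ = +-cancelʳ-≡ (suc (2 * (s * (c + τ))) * (N + r * t)) _ _ (trans
        (subst (λ k → profile 0 σ k + suc (2 * (s * (c + τ))) * k ≡ k * k + r * level σ (c + τ)) N+ (profile-value σ (c + τ) e (<⇒≤ (m%n<n N (s * r)))))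
        (sym (lem₁ ρ σ τ c N (profile 0 σ N) ∙ cong (_+ rest) (profile-at σ N) ∙ lem₂ ρ σ τ c N))) where
      s t c e rest : ℕ
      s = suc σ
      t = τ * s
      c = N / (s * r)
      e = N % (s * r)
      rest = 2 * suc ρ * t * N + r * suc ρ * (t * t) + t * r * σ + 2 * s * τ * N + suc (2 * (s * (c + τ))) * (r * t)
      N+ : (c + τ) * (s * r) + e ≡ N + r * t
      N+ = lem c τ s r e ∙ cong (_+ r * t) (sym (m≡m%n+[m/n]*n N (s * r))) where
        lem : ∀ c τ s r e → (c + τ) * (s * r) + e ≡ e + c * (s * r) + r * (τ * s)
        lem = solve-∀
      lem₁ : ∀ ρ σ τ c N F → F + 2 * suc ρ * (τ * suc σ) * N + suc (suc ρ) * suc ρ * (τ * suc σ * (τ * suc σ)) + τ * suc σ * suc (suc ρ) * σ + suc (2 * (suc σ * (c + τ))) * (N + suc (suc ρ) * (τ * suc σ))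
        ≡ F + suc (2 * (suc σ * c)) * N + (2 * suc ρ * (τ * suc σ) * N + suc (suc ρ) * suc ρ * (τ * suc σ * (τ * suc σ)) + τ * suc σ * suc (suc ρ) * σ + 2 * suc σ * τ * N + suc (2 * (suc σ * (c + τ))) * (suc (suc ρ) * (τ * suc σ)))
      lem₁ = solve-∀
      lem₂ : ∀ ρ σ τ c N → N * N + suc (suc ρ) * (suc σ * suc σ * (c * suc c)) + (2 * suc ρ * (τ * suc σ) * N + suc (suc ρ) * suc ρ * (τ * suc σ * (τ * suc σ)) + τ * suc σ * suc (suc ρ) * σ + 2 * suc σ * τ * N + suc (2 * (suc σ * (c + τ))) * (suc (suc ρ) * (τ * suc σ)))
        ≡ (N + suc (suc ρ) * (τ * suc σ)) * (N + suc (suc ρ) * (τ * suc σ)) + suc (suc ρ) * (suc σ * suc σ * ((c + τ) * suc (c + τ)))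
      lem₂ = solve-∀

  -- The two constructions differ only in the last term, `2 * p + r * σ` per unit of `t`: it is
  -- `2 * q` with apexes and `r` with matchings.
  profile-block : ∀ p σ N τ → let t = τ * suc σ in
    profile p σ (p + N + r * t) ≡ profile p σ (p + N) + (2 * suc ρ * t * (p + N) + r * suc ρ * (t * t) + t * (2 * p + r * σ))
  profile-block p σ N τ = combine-values ρ σ (τ * suc σ) p N (cong (λ k → profile p σ k + p) (+-assoc p N (r * (τ * suc σ))) ∙ profile-shift p σ (N + r * (τ * suc σ)))
      (profile-shift p σ N) (profile-block₀ σ N τ) where
    combine-values : ∀ ρ σ t p N {x y F F'} → x + p ≡ p * p + 2 * p * (N + suc (suc ρ) * t) + F' → y + p ≡ p * p + 2 * p * N + F →
      F' ≡ F + 2 * suc ρ * t * N + suc (suc ρ) * suc ρ * (t * t) + t * suc (suc ρ) * σ →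
      x ≡ y + (2 * suc ρ * t * (p + N) + suc (suc ρ) * suc ρ * (t * t) + t * (2 * p + suc (suc ρ) * σ))
    combine-values ρ σ t p N {x} {y} {F} h₁ h₂ refl = +-cancelʳ-≡ p _ _ (h₁ ∙ lem₂ ρ σ t p N F ∙ cong (_+ extra) (sym h₂) ∙ lem₁ y p extra) where
      extra : ℕ
      extra = 2 * suc ρ * t * (p + N) + suc (suc ρ) * suc ρ * (t * t) + t * (2 * p + suc (suc ρ) * σ)
      lem₁ : ∀ y p x → y + p + x ≡ y + x + p
      lem₁ = solve-∀
      lem₂ : ∀ ρ σ t p N F → p * p + 2 * p * (N + suc (suc ρ) * t) + (F + 2 * suc ρ * t * N + suc (suc ρ) * suc ρ * (t * t) + t * suc (suc ρ) * σ)
        ≡ p * p + 2 * p * N + F + (2 * suc ρ * t * (p + N) + suc (suc ρ) * suc ρ * (t * t) + t * (2 * p + suc (suc ρ) * σ))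
      lem₂ = solve-∀

-- `B` and `A` describe a line lying below `x * x` minus the reward `ω`. Summed over the classes,
-- the line gives the value encoded by `F`, and equality of the sums puts every class on the line.
convex-balance : ∀ {k} (x ω : Fin k → ℕ) {N F} A B → ∑ x ≡ N → F + B * N ≡ N * N + k * A → (∀ i → B * x i + ω i ≤ x i * x i + A) →
  N * N + ∑ ω ≤ F + ∑ (λ i → x i * x i) × (F + ∑ (λ i → x i * x i) ≤ N * N + ∑ ω → ∀ i → B * x i + ω i ≡ x i * x i + A)
convex-balance {k} x ω {N} {F} A B sum≡ val h = bound , λ tight → ∑-equal h (rhs =& lin 0 (+-mono-≤ tight (≤-reflexive (sym val))) (lem₂ _ (k * A) F (B * N) (N * N) (∑ ω)) &= sym lhs) where
  lhs : ∑ (λ i → B * x i + ω i) ≡ B * N + ∑ ω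
  lhs = ∑-distrib-+ (λ i → B * x i) ω ∙ cong (_+ ∑ ω) (∑-*ˡ B x ∙ cong (B *_) sum≡)
  rhs : ∑ (λ i → x i * x i + A) ≡ ∑ (λ i → x i * x i) + k * A
  rhs = ∑-distrib-+ (λ i → x i * x i) (λ _ → A) ∙ cong (∑ (λ i → x i * x i) +_) (∑-const k A)
  lem₂ : ∀ sq kA F BN NN w → sq + kA + (NN + w + (F + BN)) + 0 ≡ BN + w + (F + sq + (NN + kA))
  lem₂ = solve-∀
  bound : N * N + ∑ ω ≤ F + ∑ (λ i → x i * x i)
  bound = lin 0 (+-mono-≤ (sym lhs =& ∑-mono h &= rhs) (≤-reflexive (sym val))) (lem (N * N) (∑ ω) (∑ (λ i → x i * x i)) (k * A) F (B * N)) where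
    lem : ∀ NN w sq kA F BN → NN + w + (sq + kA + (F + BN)) + 0 ≡ F + sq + (BN + w + (NN + kA))
    lem = solve-∀

private
  vanish : ∀ {a b k} → b ≡ a + k → a ≡ b → k ≡ 0
  vanish {a} {b} {k} e e' = +-cancelˡ-≡ a k 0 (sym e ∙ sym e' ∙ sym (+-identityʳ a))

  square-vanish : ∀ k → k * k ≡ 0 → k ≡ 0
  square-vanish zero _ = refl

-- The difference of the two sides is `(x - a)(x - a - 1)`, nonnegative on the integers and zero
-- only at `a` and `a + 1`.
square-tangent : ∀ a x → suc (2 * (1 * a)) * x + 0 ≤ x * x + a * suc a × (suc (2 * (1 * a)) * x + 0 ≡ x * x + a * suc a → x ≡ a ⊎ x ≡ suc a)
square-tangent a x = go (x ≤? a) where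
  Goal : ℕ → ℕ → Set
  Goal a x = suc (2 * (1 * a)) * x + 0 ≤ x * x + a * suc a × (suc (2 * (1 * a)) * x + 0 ≡ x * x + a * suc a → x ≡ a ⊎ x ≡ suc a)
  below : ∀ k x → Goal (x + k) x
  below k x = m+n≤o⇒m≤o _ (≤-reflexive (sym (lem k x))) , λ e → inl (sym (cong (x +_) (zero-k (vanish (lem k x) e)) ∙ +-identityʳ x)) where
    lem : ∀ k x → x * x + (x + k) * suc (x + k) ≡ suc (2 * (1 * (x + k))) * x + 0 + k * suc k
    lem = solve-∀
    zero-k : k * suc k ≡ 0 → k ≡ 0
    zero-k e = m*n≡0⇒m≡0 k (suc k) e
  above : ∀ k a → Goal a (suc a + k)
  above k a = m+n≤o⇒m≤o _ (≤-reflexive (sym (lem k a))) , λ e → inr (cong (suc a +_) (m*n≡0⇒m≡0 k (suc k) (vanish (lem k a) e)) ∙ +-identityʳ (suc a)) where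
    lem : ∀ k a → (suc a + k) * (suc a + k) + a * suc a ≡ suc (2 * (1 * a)) * (suc a + k) + 0 + k * suc k
    lem = solve-∀
  go : Dec (x ≤ a) → Goal a x
  go (yes le) = subst (λ a → Goal a x) (m+[n∸m]≡n le) (below (a ∸ x) x)
  go (no gt)  = subst (Goal a) (m+[n∸m]≡n (≰⇒> gt)) (above (x ∸ suc a) a)

-- For even `x` the difference is `(x - 2c)(x - 2c - 2)`, for odd `x` it is `(x - 2c - 1)²`. This is
-- where part sizes differing by two come from.
matching-tangent : ∀ c x → suc (2 * (2 * c)) * x + 2 * (x / 2) ≤ x * x + 4 * (c * suc c) ×
  (suc (2 * (2 * c)) * x + 2 * (x / 2) ≡ x * x + 4 * (c * suc c) → 2 * c ≤ x × x ≤ 2 * c + 2)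
matching-tangent c x = subst (Goal c) (+-comm (2 * (x / 2)) (x % 2) ∙ cong (x % 2 +_) (*-comm 2 (x / 2)) ∙ sym (m≡m%n+[m/n]*n x 2)) (cases (x / 2) (x % 2) (m%n<n x 2)) where
  Goal : ℕ → ℕ → Set
  Goal c x = suc (2 * (2 * c)) * x + 2 * (x / 2) ≤ x * x + 4 * (c * suc c) ×
    (suc (2 * (2 * c)) * x + 2 * (x / 2) ≡ x * x + 4 * (c * suc c) → 2 * c ≤ x × x ≤ 2 * c + 2)
  half : ∀ y e → e < 2 → (2 * y + e) / 2 ≡ y
  half y e lt = cong (λ z → (z + e) / 2) (*-comm 2 y) ∙ quotient y 2 lt
  Goal' : ℕ → ℕ → ℕ → Set
  Goal' c x h = suc (2 * (2 * c)) * x + 2 * h ≤ x * x + 4 * (c * suc c) ×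
    (suc (2 * (2 * c)) * x + 2 * h ≡ x * x + 4 * (c * suc c) → 2 * c ≤ x × x ≤ 2 * c + 2)
  even-below : ∀ k y → Goal' (y + k) (2 * y + 0) y
  even-below k y = m+n≤o⇒m≤o _ (≤-reflexive (sym (lem k y))) , λ e → let k0 = m*n≡0⇒m≡0 k (suc k) (m+n≡0⇒m≡0 (k * suc k) (vanish (lem k y) e)) in
      ≤-reflexive (cong (λ k → 2 * (y + k)) k0 ∙ l₁ y) , lin (2 * k + 2) (z≤n {0}) (l₂ y k) where
    lem : ∀ k y → (2 * y + 0) * (2 * y + 0) + 4 * ((y + k) * suc (y + k)) ≡ suc (2 * (2 * (y + k))) * (2 * y + 0) + 2 * y + (k * suc k + 3 * (k * suc k))
    lem = solve-∀
    l₁ : ∀ y → 2 * (y + 0) ≡ 2 * y + 0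
    l₁ = solve-∀
    l₂ : ∀ y k → 2 * y + 0 + 0 + (2 * k + 2) ≡ 2 * (y + k) + 2 + 0
    l₂ = solve-∀
  even-above : ∀ k c → Goal' c (2 * (suc c + k) + 0) (suc c + k)
  even-above k c = m+n≤o⇒m≤o _ (≤-reflexive (sym (lem k c))) , λ e → let k0 = m*n≡0⇒m≡0 k (suc k) (m+n≡0⇒m≡0 (k * suc k) (vanish (lem k c) e)) in
      lin (2 * k + 2) (z≤n {0}) (l₂ c k) , ≤-reflexive (cong (λ k → 2 * (suc c + k) + 0) k0 ∙ l₁ c) where
    lem : ∀ k c → (2 * (suc c + k) + 0) * (2 * (suc c + k) + 0) + 4 * (c * suc c) ≡ suc (2 * (2 * c)) * (2 * (suc c + k) + 0) + 2 * (suc c + k) + (k * suc k + 3 * (k * suc k))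
    lem = solve-∀
    l₁ : ∀ c → 2 * (suc c + 0) + 0 ≡ 2 * c + 2
    l₁ = solve-∀
    l₂ : ∀ c k → 2 * c + 0 + (2 * k + 2) ≡ 2 * (suc c + k) + 0 + 0
    l₂ = solve-∀
  odd-below : ∀ k y → Goal' (y + k) (2 * y + 1) y
  odd-below k y = m+n≤o⇒m≤o _ (≤-reflexive (sym (lem k y))) , λ e → let k0 = square-vanish k (m+n≡0⇒m≡0 (k * k) (vanish (lem k y) e)) in
      (cong (λ k → 2 * (y + k)) k0 ∙ l₁ y) =& m≤m+n (2 * y) 1 , lin (2 * k + 1) (z≤n {0}) (l₂ y k) where
    lem : ∀ k y → (2 * y + 1) * (2 * y + 1) + 4 * ((y + k) * suc (y + k)) ≡ suc (2 * (2 * (y + k))) * (2 * y + 1) + 2 * y + (k * k + 3 * (k * k))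
    lem = solve-∀
    l₁ : ∀ y → 2 * (y + 0) ≡ 2 * y
    l₁ = solve-∀
    l₂ : ∀ y k → 2 * y + 1 + 0 + (2 * k + 1) ≡ 2 * (y + k) + 2 + 0
    l₂ = solve-∀
  odd-above : ∀ k c → Goal' c (2 * (c + k) + 1) (c + k)
  odd-above k c = m+n≤o⇒m≤o _ (≤-reflexive (sym (lem k c))) , λ e → let k0 = square-vanish k (m+n≡0⇒m≡0 (k * k) (vanish (lem k c) e)) in
      lin (2 * k + 1) (z≤n {0}) (l₂ c k) , (cong (λ k → 2 * (c + k) + 1) k0 ∙ l₁ c) =& +-monoʳ-≤ (2 * c) (n≤1+n 1) where
    lem : ∀ k c → (2 * (c + k) + 1) * (2 * (c + k) + 1) + 4 * (c * suc c) ≡ suc (2 * (2 * c)) * (2 * (c + k) + 1) + 2 * (c + k) + (k * k + 3 * (k * k))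
    lem = solve-∀
    l₁ : ∀ c → 2 * (c + 0) + 1 ≡ 2 * c + 1
    l₁ = solve-∀
    l₂ : ∀ c k → 2 * c + 0 + (2 * k + 1) ≡ 2 * (c + k) + 1 + 0
    l₂ = solve-∀
  cases : ∀ y e → e < 2 → Goal c (2 * y + e)
  cases y zero lt = subst (λ h → Goal' c (2 * y + 0) h) (sym (half y 0 lt)) (go (y ≤? c)) where
    go : Dec (y ≤ c) → Goal' c (2 * y + 0) y
    go (yes le) = subst (λ c → Goal' c (2 * y + 0) y) (m+[n∸m]≡n le) (even-below (c ∸ y) y)
    go (no gt)  = subst (λ y → Goal' c (2 * y + 0) y) (m+[n∸m]≡n (≰⇒> gt)) (even-above (y ∸ suc c) c)
  cases y (suc zero) lt = subst (λ h → Goal' c (2 * y + 1) h) (sym (half y 1 lt)) (go (y ≤? c)) where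
    go : Dec (y ≤ c) → Goal' c (2 * y + 1) y
    go (yes le) = subst (λ c → Goal' c (2 * y + 1) y) (m+[n∸m]≡n le) (odd-below (c ∸ y) y)
    go (no gt)  = subst (λ y → Goal' c (2 * y + 1) y) (m+[n∸m]≡n (<⇒≤ (≰⇒> gt))) (odd-above (y ∸ c) c)
  cases y (suc (suc _)) (s≤s (s≤s ()))

-- The constructions contain no forbidden graph.

≢⇒neq : ∀ {n} {x y : Fin n} → x ≢ y → not ⌊ x ≟ᶠ y ⌋ ≡ true
≢⇒neq {x = x} {y} ne = not-false (isYes≗does (x ≟ᶠ y) ∙ dec-false (x ≟ᶠ y) ne)

⊗-intro : ∀ {a b} (A : Graph a) (B : Graph b) x y → x ≢ y → Block ⊤ A B (splitAt a x) (splitAt a y) → adj (A ⊗ᴳ B) x y ≡ true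
⊗-intro {a} A B x y ne h with splitAt a x | splitAt a y
... | inl u | inl v = ∧-intro (≢⇒neq ne) (∨-introˡ h)
... | inr u | inr v = ∧-intro (≢⇒neq ne) (∨-introˡ h)
... | inl u | inr v = ∧-intro (≢⇒neq ne) refl
... | inr u | inl v = ∧-intro (≢⇒neq ne) refl

∪-intro : ∀ {a b} (A : Graph a) (B : Graph b) x y → x ≢ y → Block ⊥ A B (splitAt a x) (splitAt a y) → adj (A ∪ᴳ B) x y ≡ true
∪-intro {a} A B x y ne h with splitAt a x | splitAt a y
... | inl u | inl v = ∧-intro (≢⇒neq ne) (∨-introˡ h)
... | inr u | inr v = ∧-intro (≢⇒neq ne) (∨-introˡ h)

↑ˡ≢↑ʳ : ∀ {a b} (x : Fin a) (y : Fin b) → x ↑ˡ b ≢ a ↑ʳ y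
↑ˡ≢↑ʳ {a} {b} x y e = case sym (splitAt-↑ˡ a x b) ∙ cong (splitAt a) e ∙ splitAt-↑ʳ a b y of λ ()

⊗-introˡ : ∀ {a b} (A : Graph a) (B : Graph b) {x y} → adj A x y ≡ true → adj (A ⊗ᴳ B) (x ↑ˡ b) (y ↑ˡ b) ≡ true
⊗-introˡ {a} {b} A B {x} {y} h = ⊗-intro A B _ _ (λ e → Graphs.Adj-≢ A h (↑ˡ-injective b x y e)) (subst₂ (Block ⊤ A B) (sym (splitAt-↑ˡ a x b)) (sym (splitAt-↑ˡ a y b)) h)

⊗-introʳ : ∀ {a b} (A : Graph a) (B : Graph b) {x y} → adj B x y ≡ true → adj (A ⊗ᴳ B) (a ↑ʳ x) (a ↑ʳ y) ≡ true
⊗-introʳ {a} {b} A B {x} {y} h = ⊗-intro A B _ _ (λ e → Graphs.Adj-≢ B h (↑ʳ-injective a x y e)) (subst₂ (Block ⊤ A B) (sym (splitAt-↑ʳ a b x)) (sym (splitAt-↑ʳ a b y)) h)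

⊗-cross : ∀ {a b} (A : Graph a) (B : Graph b) x y → adj (A ⊗ᴳ B) (x ↑ˡ b) (a ↑ʳ y) ≡ true
⊗-cross {a} {b} A B x y = ⊗-intro A B _ _ (↑ˡ≢↑ʳ x y) (subst₂ (Block ⊤ A B) (sym (splitAt-↑ˡ a x b)) (sym (splitAt-↑ʳ a b y)) tt)

∪-introˡ : ∀ {a b} (A : Graph a) (B : Graph b) {x y} → adj A x y ≡ true → adj (A ∪ᴳ B) (x ↑ˡ b) (y ↑ˡ b) ≡ true
∪-introˡ {a} {b} A B {x} {y} h = ∪-intro A B _ _ (λ e → Graphs.Adj-≢ A h (↑ˡ-injective b x y e)) (subst₂ (Block ⊥ A B) (sym (splitAt-↑ˡ a x b)) (sym (splitAt-↑ˡ a y b)) h)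

∪-introʳ : ∀ {a b} (A : Graph a) (B : Graph b) {x y} → adj B x y ≡ true → adj (A ∪ᴳ B) (a ↑ʳ x) (a ↑ʳ y) ≡ true
∪-introʳ {a} {b} A B {x} {y} h = ∪-intro A B _ _ (λ e → Graphs.Adj-≢ B h (↑ʳ-injective a x y e)) (subst₂ (Block ⊥ A B) (sym (splitAt-↑ʳ a b x)) (sym (splitAt-↑ʳ a b y)) h)

module Restrictions {n : ℕ} (G : Graph n) where
  open Graphs G
  open Embeddings G

  join-⊆⁻ : ∀ {a b} (A : Graph a) (B : Graph b) → (A ⊗ᴳ B) ⊆ᴳ G → Σ (A ⊆ᴳ G) λ f → Σ (B ⊆ᴳ G) λ g → ∀ i j → Adj (fst f i) (fst g j)
  join-⊆⁻ {a} {b} A B (h , inj , pres) = ((λ i → h (i ↑ˡ b)) , (λ x y e → ↑ˡ-injective b x y (inj _ _ e)) , λ u v e → pres _ _ (⊗-introˡ A B e)) ,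
    ((λ j → h (a ↑ʳ j)) , (λ x y e → ↑ʳ-injective a x y (inj _ _ e)) , λ u v e → pres _ _ (⊗-introʳ A B e)) , λ i j → pres _ _ (⊗-cross A B i j)

  union-⊆⁻ : ∀ {a b} (A : Graph a) (B : Graph b) → (A ∪ᴳ B) ⊆ᴳ G → Σ (A ⊆ᴳ G) λ f → Σ (B ⊆ᴳ G) λ g → ∀ i j → fst f i ≢ fst g j
  union-⊆⁻ {a} {b} A B (h , inj , pres) = ((λ i → h (i ↑ˡ b)) , (λ x y e → ↑ˡ-injective b x y (inj _ _ e)) , λ u v e → pres _ _ (∪-introˡ A B e)) ,
    ((λ j → h (a ↑ʳ j)) , (λ x y e → ↑ʳ-injective a x y (inj _ _ e)) , λ u v e → pres _ _ (∪-introʳ A B e)) , λ i j e → ↑ˡ≢↑ʳ i j (inj _ _ e)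

  path-⊆⁻ : ∀ {k} (f : path k ⊆ᴳ G) i j → toℕ j ≡ suc (toℕ i) → Adj (fst f i) (fst f j)
  path-⊆⁻ {k} (f , _ , pres) i j e = pres i j (fromRel-intro {k} (λ i j → toℕ j ≡ᵇ suc (toℕ i)) {i} {j} (λ { refl → 1+n≢n (sym e) }) (inl (≡⇒≡ᵇ-true e)))

  complete-⊆⁻ : ∀ {k} (f : complete k ⊆ᴳ G) {i j} → i ≢ j → Adj (fst f i) (fst f j)
  complete-⊆⁻ {k} (f , _ , pres) ne = pres _ _ (fromRel-intro {k} (λ _ _ → true) ne (inl refl))

  copies-⊆⁻ : ∀ k (f : copies k (complete 2) ⊆ᴳ G) → Matching k (λ v → ∃ λ i → v ≡ fst f i)
  copies-⊆⁻ zero f = record { mx = λ () ; my = λ () ; mx-inj = λ { {()} } ; my-inj = λ { {()} } ; mxy = λ () ; mx-sat = λ () ; my-sat = λ () ; m-adj = λ () }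
  copies-⊆⁻ (suc k) f = build (fst (union-⊆⁻ (complete 2) (copies k (complete 2)) f)) (λ i → i ↑ˡ (k * 2) , refl) (fst rest) (λ i → 2 ↑ʳ i , refl) (snd rest)
      (copies-⊆⁻ k (fst rest)) where
    rest = snd (union-⊆⁻ (complete 2) (copies k (complete 2)) f)
    build : (e : complete 2 ⊆ᴳ G) → (∀ i → ∃ λ j → fst e i ≡ fst f j) → (g : copies k (complete 2) ⊆ᴳ G) → (∀ i → ∃ λ j → fst g i ≡ fst f j) →
      (∀ i j → fst e i ≢ fst g j) → Matching k (λ v → ∃ λ i → v ≡ fst g i) → Matching (suc k) (λ v → ∃ λ i → v ≡ fst f i)
    build e e-in g g-in disj M = record
      { mx = λ { zero → fst e zero ; (suc i) → mx i }
      ; my = λ { zero → fst e (suc zero) ; (suc i) → my i }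
      ; mx-inj = λ { {zero} {zero} _ → refl ; {zero} {suc j} h → ⊥-elim (apart zero (mx-sat j) h) ; {suc i} {zero} h → ⊥-elim (apart zero (mx-sat i) (sym h)) ; {suc i} {suc j} h → cong suc (mx-inj h) }
      ; my-inj = λ { {zero} {zero} _ → refl ; {zero} {suc j} h → ⊥-elim (apart (suc zero) (my-sat j) h) ; {suc i} {zero} h → ⊥-elim (apart (suc zero) (my-sat i) (sym h)) ; {suc i} {suc j} h → cong suc (my-inj h) }
      ; mxy = λ { zero zero → Adj-≢ (complete-⊆⁻ e λ ()) ; zero (suc j) → apart zero (my-sat j) ; (suc i) zero h → apart (suc zero) (mx-sat i) (sym h) ; (suc i) (suc j) → mxy i j }
      ; mx-sat = λ { zero → e-in zero ; (suc i) → lift (mx-sat i) }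
      ; my-sat = λ { zero → e-in (suc zero) ; (suc i) → lift (my-sat i) }
      ; m-adj = λ { zero → complete-⊆⁻ e (λ ()) ; (suc i) → m-adj i } } where
      open Matching M
      apart : ∀ i {v} → (∃ λ j → v ≡ fst g j) → fst e i ≢ v
      apart i (j , refl) h = disj i j h
      lift : ∀ {v} → (∃ λ j → v ≡ fst g j) → ∃ λ j → v ≡ fst f j
      lift (j , refl) = g-in j

  record Groups (k m : ℕ) (Q : V → Set) : Set where
    field
      grp     : Fin k → Fin m → V
      grp-inj : ∀ j {a b} → grp j a ≡ grp j b → a ≡ b
      grp-adj : ∀ {i j} a b → i ≢ j → Adj (grp i a) (grp j b)
      grp-sat : ∀ j a → Q (grp j a)

  turan-⊆⁻ : ∀ m k (f : turan (m * k) k ⊆ᴳ G) → Groups k m (λ v → ∃ λ x → v ≡ fst f x)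
  turan-⊆⁻ m zero f = record { grp = λ () ; grp-inj = λ () ; grp-adj = λ { {()} } ; grp-sat = λ () }
  turan-⊆⁻ m (suc k) (f , inj , pres) = record
    { grp = λ j a → f (combine a j)
    ; grp-inj = λ j {a} {b} e → sym (cong fst (remQuot-combine {m} {suc k} a j)) ∙ cong (λ x → fst (remQuot {m} (suc k) x)) (inj _ _ e) ∙ cong fst (remQuot-combine {m} {suc k} b j)
    ; grp-adj = λ {i} {j} a b ne → pres _ _ (fromRel-intro {m * suc k} (λ i j → not (toℕ i % suc k ≡ᵇ toℕ j % suc k)) {combine a i} {combine b j} (λ e → ne (apart i j a b (cong toℕ e))) (inl (not-false (differ _ _ λ e → ne (toℕ-injective (sym (res a i) ∙ e ∙ res b j))))))
    ; grp-sat = λ j a → combine a j , refl } where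
    res : ∀ (a : Fin m) (i : Fin (suc k)) → toℕ (combine a i) % suc k ≡ toℕ i
    res a i = cong (_% suc k) (toℕ-combine a i ∙ +-comm (suc k * toℕ a) (toℕ i) ∙ cong (toℕ i +_) (*-comm (suc k) (toℕ a))) ∙
      [m+kn]%n≡m%n (toℕ i) (toℕ a) (suc k) ∙ m<n⇒m%n≡m (toℕ<n i)
    apart : ∀ i j (a b : Fin m) → toℕ (combine a i) ≡ toℕ (combine b j) → i ≡ j
    apart i j a b e = toℕ-injective (sym (res a i) ∙ cong (_% suc k) e ∙ res b j)
    differ : ∀ x y → x ≢ y → (x ≡ᵇ y) ≡ false
    differ x y ne = ¬true⇒false λ h → ne (≡ᵇ-true h)

  -- What the three forbidden graphs have in common.
  record Hub (q ρ m : ℕ) : Set₁ where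
    field
      Core     : V → Set
      groups   : Groups (suc ρ) m (λ v → ∀ {x} → Core x → Adj x v)
      matching : Matching (suc q) Core
      {x y z}  : V
      xy       : Adj x y
      yz       : Adj y z
      x≢z      : x ≢ z
      x-core   : Core x
      y-core   : Core y
      z-core   : Core z

  module _ {q ρ m : ℕ} (1≤q : 1 ≤ q) (q<m : suc q ≤ m) where
    private
      double : ∀ {k} e → e < 2 → Fin k → ∀ {b} → 2 * k ≤ b → Fin b
      double {k} e lt i {b} le = fromℕ< {2 * toℕ i + e} (lin 0 (+-mono-≤ lt (*-monoʳ-≤ 2 (toℕ<n i))) (lem (toℕ i) e k) & le) where
        lem : ∀ i e k → suc (2 * i + e) + (2 + 2 * k) + 0 ≡ 2 * k + (suc e + 2 * suc i)
        lem = solve-∀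

      toℕ-double : ∀ {k} e (lt : e < 2) (i : Fin k) {b} (le : 2 * k ≤ b) → toℕ (double e lt i le) ≡ 2 * toℕ i + e
      toℕ-double e lt i le = toℕ-fromℕ< _

      double-inj : ∀ {k} e e' (lt : e < 2) (lt' : e' < 2) (i j : Fin k) {b} (le : 2 * k ≤ b) → double e lt i le ≡ double e' lt' j le → e ≡ e' × i ≡ j
      double-inj e e' lt lt' i j le h = sym (rem (toℕ i) e lt) ∙ cong (_% 2) h' ∙ rem (toℕ j) e' lt' , toℕ-injective (sym (quo (toℕ i) e lt) ∙ cong (_/ 2) h' ∙ quo (toℕ j) e' lt') where
        h' : 2 * toℕ i + e ≡ 2 * toℕ j + e'
        h' = sym (toℕ-double e lt i le) ∙ cong toℕ h ∙ toℕ-double e' lt' j le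
        flip' : ∀ i e → 2 * i + e ≡ e + i * 2
        flip' = solve-∀
        rem : ∀ i e → e < 2 → (2 * i + e) % 2 ≡ e
        rem i e lt = cong (_% 2) (flip' i e) ∙ [m+kn]%n≡m%n e i 2 ∙ m<n⇒m%n≡m lt
        quo : ∀ i e → e < 2 → (2 * i + e) / 2 ≡ i
        quo i e lt = cong (λ z → (z + e) / 2) (*-comm 2 i) ∙ quotient i 2 lt

      even : ∀ {k} → Fin k → ∀ {b} → 2 * k ≤ b → Fin b
      even = double 0 (s≤s z≤n)
      odd : ∀ {k} → Fin k → ∀ {b} → 2 * k ≤ b → Fin b
      odd = double 1 (s≤s (s≤s z≤n))

      doubled-matching : ∀ {k b} {P : V → Set} (le : 2 * k ≤ b) (f : Fin b → V) → (∀ x y → f x ≡ f y → x ≡ y) → (∀ i → P (f i)) →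
        (∀ i j → toℕ j ≡ suc (toℕ i) → Adj (f i) (f j)) → Matching k P
      doubled-matching le f inj sat a = record
        { mx = λ i → f (even i le) ; my = λ i → f (odd i le)
        ; mx-inj = λ {i} {j} e → snd (double-inj 0 0 (s≤s z≤n) (s≤s z≤n) i j le (inj _ _ e)) ; my-inj = λ {i} {j} e → snd (double-inj 1 1 (s≤s (s≤s z≤n)) (s≤s (s≤s z≤n)) i j le (inj _ _ e))
        ; mxy = λ i j e → case fst (double-inj 0 1 (s≤s z≤n) (s≤s (s≤s z≤n)) i j le (inj _ _ e)) of λ ()
        ; mx-sat = λ i → sat _ ; my-sat = λ i → sat _
        ; m-adj = λ i → a _ _ (toℕ-double 1 (s≤s (s≤s z≤n)) i le ∙ +-suc (2 * toℕ i) 0 ∙ cong suc (sym (toℕ-double 0 (s≤s z≤n) i le))) }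

    hub₁ : ((path (2 + 2 * q) ∪ᴳ edgeless m) ⊗ᴳ turan (m * suc ρ) (suc ρ)) ⊆ᴳ G → Hub q ρ m
    hub₁ emb = build (join-⊆⁻ (path (2 + 2 * q) ∪ᴳ edgeless m) (turan (m * suc ρ) (suc ρ)) emb) where
      build : (Σ ((path (2 + 2 * q) ∪ᴳ edgeless m) ⊆ᴳ G) λ f → Σ (turan (m * suc ρ) (suc ρ) ⊆ᴳ G) λ g → ∀ i j → Adj (fst f i) (fst g j)) → Hub q ρ m
      build (f , g , cross) = record
        { Core = λ v → ∃ λ i → v ≡ fst f i
        ; groups = record { Groups (turan-⊆⁻ m (suc ρ) g) ; grp-sat = λ j a → λ { (i , refl) → near i (Groups.grp-sat (turan-⊆⁻ m (suc ρ) g) j a) } }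
        ; matching = doubled-matching (≤-reflexive (*-suc 2 q)) (fst p) (fst (snd p)) in-f (path-⊆⁻ p)
        ; xy = path-⊆⁻ p zero (suc zero) refl ; yz = path-⊆⁻ p (suc zero) z₂ (toℕ-fromℕ< 2<)
        ; x≢z = λ e → case cong toℕ (fst (snd p) _ _ e) ∙ toℕ-fromℕ< 2< of λ ()
        ; x-core = in-f zero ; y-core = in-f (suc zero) ; z-core = in-f z₂ } where
        p : path (2 + 2 * q) ⊆ᴳ G
        p = fst (union-⊆⁻ (path (2 + 2 * q)) (edgeless m) f)
        in-f : ∀ i → ∃ λ j → fst p i ≡ fst f j
        in-f i = i ↑ˡ m , refl
        2< : 2 < 2 + 2 * q
        2< = s≤s (s≤s (1≤q & m≤m+n q _))
        z₂ : Fin (2 + 2 * q)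
        z₂ = fromℕ< 2<
        near : ∀ i {v} → (∃ λ x → v ≡ fst g x) → Adj (fst f i) v
        near i (x , refl) = cross i x

    hub₂ : ((path 3 ∪ᴳ copies m (complete 2)) ⊗ᴳ copies m (complete 2) ⊗ᴳ turan (m * ρ) ρ) ⊆ᴳ G → Hub q ρ m
    hub₂ emb = build (join-⊆⁻ (path 3 ∪ᴳ copies m (complete 2)) (copies m (complete 2) ⊗ᴳ turan (m * ρ) ρ) emb) where
      build : (Σ ((path 3 ∪ᴳ copies m (complete 2)) ⊆ᴳ G) λ f → Σ ((copies m (complete 2) ⊗ᴳ turan (m * ρ) ρ) ⊆ᴳ G) λ g → ∀ i j → Adj (fst f i) (fst g j)) → Hub q ρ m
      build (f , g , cross) = second (union-⊆⁻ (path 3) (copies m (complete 2)) f) (λ i → i ↑ˡ (m * 2) , refl) (λ i → 3 ↑ʳ i , refl)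
          (join-⊆⁻ (copies m (complete 2)) (turan (m * ρ) ρ) g) (λ i → i ↑ˡ (m * ρ) , refl) (λ i → (m * 2) ↑ʳ i , refl) where
        second : (s : Σ (path 3 ⊆ᴳ G) λ p → Σ (copies m (complete 2) ⊆ᴳ G) λ c → ∀ i j → fst p i ≢ fst c j) →
          (∀ i → ∃ λ j → fst (fst s) i ≡ fst f j) → (∀ i → ∃ λ j → fst (fst (snd s)) i ≡ fst f j) →
          (t : Σ (copies m (complete 2) ⊆ᴳ G) λ c → Σ (turan (m * ρ) ρ ⊆ᴳ G) λ t → ∀ i j → Adj (fst c i) (fst t j)) →
          (∀ i → ∃ λ j → fst (fst t) i ≡ fst g j) → (∀ i → ∃ λ j → fst (fst (snd t)) i ≡ fst g j) → Hub q ρ m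
        second (p , c₀ , _) p-in c₀-in (c₁ , t , c₁t) c₁-in t-in = record
          { Core = Core
          -- The Turán factor of `F₂` has only `ρ` parts; one end of every edge of the second
          -- matching supplies the remaining group.
          ; groups = record
            { grp = λ { zero a → mx₁ a ; (suc j) a → grp j a }
            ; grp-inj = λ { zero e → mx₁-inj e ; (suc j) e → grp-inj j e }
            ; grp-adj = λ { {zero} {zero} a b ne → ⊥-elim (ne refl) ; {zero} {suc j} a b ne → near₁ (mx₁-sat a) (grp-sat j b)
                          ; {suc i} {zero} a b ne → Adj-sym (near₁ (mx₁-sat b) (grp-sat i a)) ; {suc i} {suc j} a b ne → grp-adj a b (ne ∘ cong suc) }
            ; grp-sat = λ { zero a → λ { (i , refl) → near i (chain c₁-in (mx₁-sat a)) } ; (suc j) a → λ { (i , refl) → near i (chain t-in (grp-sat j a)) } } }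
          ; matching = Matching-≤ q<m (Matching-map (chain c₀-in) (copies-⊆⁻ m c₀))
          ; xy = path-⊆⁻ p zero (suc zero) refl ; yz = path-⊆⁻ p (suc zero) (suc (suc zero)) refl
          ; x≢z = λ e → case fst (snd p) _ _ e of λ ()
          ; x-core = p-in zero ; y-core = p-in (suc zero) ; z-core = p-in (suc (suc zero)) } where
          Core : V → Set
          Core v = ∃ λ i → v ≡ fst f i
          open Groups (turan-⊆⁻ m ρ t)
          open Matching (copies-⊆⁻ m c₁) renaming (mx to mx₁; mx-inj to mx₁-inj; mx-sat to mx₁-sat)
          near : ∀ i {v} → (∃ λ x → v ≡ fst g x) → Adj (fst f i) v
          near i (x , refl) = cross i x
          near₁ : ∀ {u v} → (∃ λ x → u ≡ fst c₁ x) → (∃ λ x → v ≡ fst t x) → Adj u v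
          near₁ (x , refl) (y , refl) = c₁t x y
          chain : ∀ {k l} {h : Fin k → V} {h' : Fin l → V} → (∀ i → ∃ λ j → h i ≡ h' j) → ∀ {v} → (∃ λ i → v ≡ h i) → ∃ λ j → v ≡ h' j
          chain sub (i , refl) = sub i

    hub₃ : ((complete (suc q) ∪ᴳ complete (suc (2 * q)) ∪ᴳ edgeless m) ⊗ᴳ turan (m * suc ρ) (suc ρ)) ⊆ᴳ G → Hub q ρ m
    hub₃ emb = build (join-⊆⁻ (complete (suc q) ∪ᴳ complete (suc (2 * q)) ∪ᴳ edgeless m) (turan (m * suc ρ) (suc ρ)) emb) where
      build : (Σ ((complete (suc q) ∪ᴳ complete (suc (2 * q)) ∪ᴳ edgeless m) ⊆ᴳ G) λ f → Σ (turan (m * suc ρ) (suc ρ) ⊆ᴳ G) λ g → ∀ i j → Adj (fst f i) (fst g j)) → Hub q ρ m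
      build (f , g , cross) = second (union-⊆⁻ (complete (suc q)) (complete (suc (2 * q)) ∪ᴳ edgeless m) f) (λ i → i ↑ˡ (suc (2 * q) + m) , refl) (λ i → suc q ↑ʳ (i ↑ˡ m) , refl) where
        second : (s : Σ (complete (suc q) ⊆ᴳ G) λ c → Σ ((complete (suc (2 * q)) ∪ᴳ edgeless m) ⊆ᴳ G) λ e → ∀ i j → fst c i ≢ fst e j) →
          (∀ i → ∃ λ j → fst (fst s) i ≡ fst f j) → (∀ i → ∃ λ j → fst (fst (snd s)) (i ↑ˡ m) ≡ fst f j) → Hub q ρ m
        second (c , e , disj) c-in d-in = record
          { Core = λ v → ∃ λ i → v ≡ fst f i
          ; groups = record { Groups (turan-⊆⁻ m (suc ρ) g) ; grp-sat = λ j a → λ { (i , refl) → near i (Groups.grp-sat (turan-⊆⁻ m (suc ρ) g) j a) } }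
          ; matching = record
            { mx = λ { zero → fst c zero ; (suc i) → mx i }
            ; my = λ { zero → fst c c₁ ; (suc i) → my i }
            ; mx-inj = λ { {zero} {zero} _ → refl ; {zero} {suc j} h → ⊥-elim (apart zero (snd (mx-sat j)) h) ; {suc i} {zero} h → ⊥-elim (apart zero (snd (mx-sat i)) (sym h)) ; {suc i} {suc j} h → cong suc (mx-inj h) }
            ; my-inj = λ { {zero} {zero} _ → refl ; {zero} {suc j} h → ⊥-elim (apart c₁ (snd (my-sat j)) h) ; {suc i} {zero} h → ⊥-elim (apart c₁ (snd (my-sat i)) (sym h)) ; {suc i} {suc j} h → cong suc (my-inj h) }
            ; mxy = λ { zero zero → Adj-≢ c-edge ; zero (suc j) → apart zero (snd (my-sat j)) ; (suc i) zero h → apart c₁ (snd (mx-sat i)) (sym h) ; (suc i) (suc j) → mxy i j }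
            ; mx-sat = λ { zero → c-in zero ; (suc i) → fst (mx-sat i) }
            ; my-sat = λ { zero → c-in c₁ ; (suc i) → fst (my-sat i) }
            ; m-adj = λ { zero → c-edge ; (suc i) → m-adj i } }
          ; xy = complete-⊆⁻ big {zero} {d₁} (λ e → case cong toℕ e ∙ toℕ-fromℕ< 1<d of λ ())
          ; yz = complete-⊆⁻ big {d₁} {d₂} (λ e → case sym (toℕ-fromℕ< 1<d) ∙ cong toℕ e ∙ toℕ-fromℕ< 2<d of λ ())
          ; x≢z = λ e → case cong toℕ (fst (snd big) zero d₂ e) ∙ toℕ-fromℕ< 2<d of λ ()
          ; x-core = d-in zero ; y-core = d-in d₁ ; z-core = d-in d₂ } where
          big : complete (suc (2 * q)) ⊆ᴳ G
          big = fst (union-⊆⁻ (complete (suc (2 * q))) (edgeless m) e)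
          1<d : 1 < suc (2 * q)
          1<d = s≤s (1≤q & m≤m+n q _)
          2<d : 2 < suc (2 * q)
          2<d = s≤s (*-monoʳ-≤ 2 1≤q)
          c₁ : Fin (suc q)
          c₁ = fromℕ< (s≤s 1≤q)
          d₁ d₂ : Fin (suc (2 * q))
          d₁ = fromℕ< 1<d
          d₂ = fromℕ< 2<d
          c-edge : Adj (fst c zero) (fst c c₁)
          c-edge = complete-⊆⁻ c λ e → case cong toℕ e ∙ toℕ-fromℕ< (s≤s 1≤q) of λ ()
          near : ∀ i {v} → (∃ λ x → v ≡ fst g x) → Adj (fst f i) v
          near i (x , refl) = cross i x
          apart : ∀ i {v} → (∃ λ j → v ≡ fst e j) → fst c i ≢ v
          apart i (j , refl) h = disj i j h
          open Matching (doubled-matching {q} {P = λ v → (∃ λ i → v ≡ fst f i) × ∃ λ j → v ≡ fst e j} (n≤1+n _) (fst big) (fst (snd big))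
            (λ i → d-in i , i ↑ˡ m , refl) λ i j h → complete-⊆⁻ big {i} {j} λ e → 1+n≢n (sym (cong toℕ e ∙ h)))

    hub-free : (Hub q ρ m → ⊥) → ForbiddenFree q ρ m G
    hub-free no-hub = record { noF₁ = no-hub ∘ hub₁ ; noF₂ = no-hub ∘ hub₂ ; noF₃ = no-hub ∘ hub₃ }

  Matching-avoid* : ∀ {k P} zs → Matching (length zs + k) P → Matching k (λ v → P v × v ∉ zs)
  Matching-avoid* [] M = Matching-map (λ h → h , λ ()) M
  Matching-avoid* {k} {P} (z ∷ zs) M = Matching-map (λ { ((h , ne) , m∉) → h , λ { (here e) → ne e ; (there m) → m∉ m } }) (Matching-avoid* zs (Matching-avoid z M))

  -- The core of a hub has `q + 1` disjoint edges, so one of them avoids the at most `q` uncoloured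
  -- vertices, and each group has `m > q` vertices. An edge and a vertex from each of the `r - 1`
  -- groups form a clique on `r + 1` coloured vertices, too many for `r` colours.
  colouring-free : ∀ {q ρ m} → 1 ≤ q → suc q ≤ m → (cls : V → Maybe (Fin (2 + ρ))) (zs : List V) → length zs ≤ q → (∀ v → cls v ≡ nothing → v ∈ zs) →
    (∀ {u v i} → Adj u v → cls u ≡ just i → cls v ≢ just i) → ForbiddenFree q ρ m G
  colouring-free {q} {ρ} {m} 1≤q q<m cls zs len covered proper = hub-free 1≤q q<m refute where
    coloured : ∀ v → v ∉ zs → ∃ λ i → cls v ≡ just i
    coloured v v∉ = go (cls v) refl where
      go : ∀ c → cls v ≡ c → ∃ λ i → cls v ≡ just i
      go (just i) e = i , e
      go nothing  e = ⊥-elim (v∉ (covered v e))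
    refute : Hub q ρ m → ⊥
    refute H = clash (pigeonhole ≤-refl colour) where
      open Hub H
      open Groups groups
      open Matching (Matching-avoid* {1} zs (Matching-≤ (+-comm (length zs) 1 =& s≤s len) matching))
      rep : ∀ j → ∃ λ v → (∃ λ a → v ≡ grp j a) × v ∉ zs
      rep j = fresh zs (s≤s len & q<m) (many (grp j) (grp-inj j) λ a → a , refl)
      t : Fin (3 + ρ) → V
      t zero          = mx zero
      t (suc zero)    = my zero
      t (suc (suc j)) = fst (rep j)
      t∉ : ∀ j → t j ∉ zs
      t∉ zero          = snd (mx-sat zero)
      t∉ (suc zero)    = snd (my-sat zero)
      t∉ (suc (suc j)) = snd (snd (rep j))
      colour : Fin (3 + ρ) → Fin (2 + ρ)
      colour j = fst (coloured (t j) (t∉ j))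
      core-t : ∀ {x} → Core x → ∀ j → Adj x (t (suc (suc j)))
      core-t c j = go (fst (snd (rep j))) where
        go : ∀ {v} → (∃ λ a → v ≡ grp j a) → Adj _ v
        go (a , refl) = grp-sat j a c
      reps : ∀ {i j} → i ≢ j → Adj (t (suc (suc i))) (t (suc (suc j)))
      reps {i} {j} ne = go (fst (snd (rep i))) (fst (snd (rep j))) where
        go : ∀ {u v} → (∃ λ a → u ≡ grp i a) → (∃ λ a → v ≡ grp j a) → Adj u v
        go (a , refl) (b , refl) = grp-adj a b ne
      t-adj : ∀ i j → i ≢ j → Adj (t i) (t j)
      t-adj zero zero ne = ⊥-elim (ne refl)
      t-adj zero (suc zero) ne = m-adj zero
      t-adj (suc zero) zero ne = Adj-sym (m-adj zero)
      t-adj (suc zero) (suc zero) ne = ⊥-elim (ne refl)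
      t-adj zero (suc (suc j)) ne = core-t (fst (mx-sat zero)) j
      t-adj (suc zero) (suc (suc j)) ne = core-t (fst (my-sat zero)) j
      t-adj (suc (suc i)) zero ne = Adj-sym (core-t (fst (mx-sat zero)) i)
      t-adj (suc (suc i)) (suc zero) ne = Adj-sym (core-t (fst (my-sat zero)) i)
      t-adj (suc (suc i)) (suc (suc j)) ne = reps (ne ∘ cong λ i → suc (suc i))
      clash : (∃ λ i → ∃ λ j → toℕ i < toℕ j × colour i ≡ colour j) → ⊥
      clash (i , j , lt , e) = proper (t-adj i j λ { refl → <-irrefl refl lt }) (snd (coloured (t i) (t∉ i))) (snd (coloured (t j) (t∉ j)) ∙ cong just (sym e))

  -- Each group has more than `r` vertices, hence two in one class, and no common neighbour of these
  -- lies in that class. So the `r - 1` groups occupy distinct classes that the core avoids; the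
  -- core lies in the single class left, where its cherry is impossible.
  matched-classes-free : ∀ {q ρ m} → 1 ≤ q → suc q ≤ m → suc (suc ρ) < m → (cls : V → Fin (2 + ρ)) →
    (∀ {u v w} → Adj u v → Adj u w → cls u ≡ cls v → cls u ≡ cls w → v ≡ w) → ForbiddenFree q ρ m G
  matched-classes-free {q} {ρ} {m} 1≤q q<m r<m cls one = hub-free 1≤q q<m refute where
    refute : Hub q ρ m → ⊥
    refute H = x≢z (one (Adj-sym xy) yz (own y-core ∙ sym (own x-core)) (own y-core ∙ sym (own z-core))) where
      open Hub H
      open Groups groups
      twice : ∀ j → ∃ λ a → ∃ λ b → a ≢ b × cls (grp j a) ≡ cls (grp j b)
      twice j = let (a , b , lt , e) = pigeonhole r<m (λ a → cls (grp j a)) in a , b , (λ h → <-irrefl (cong toℕ h) lt) , e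
      κ : Fin (suc ρ) → Fin (2 + ρ)
      κ j = cls (grp j (fst (twice j)))
      blocked : ∀ j {v} → (∀ a → Adj v (grp j a)) → cls v ≢ κ j
      blocked j adjacent e = let (a , b , ne , same) = twice j in ne (grp-inj j (one (adjacent a) (adjacent b) e (e ∙ same)))
      κ-inj : ∀ {i j} → κ i ≡ κ j → i ≡ j
      κ-inj {i} {j} e = go (i ≟ᶠ j) where
        go : Dec (i ≡ j) → i ≡ j
        go (yes h) = h
        go (no ne) = ⊥-elim (blocked j (λ a → grp-adj (fst (twice i)) a ne) e)
      pal : V → Fin (2 + ρ) → Fin (2 + ρ)
      pal v zero    = cls v
      pal v (suc j) = κ j
      pal-inj : ∀ {v} → Core v → ∀ {i j} → pal v i ≡ pal v j → i ≡ j
      pal-inj c {zero}  {zero}  e = refl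
      pal-inj c {zero}  {suc j} e = ⊥-elim (blocked j (λ a → grp-sat j a c) e)
      pal-inj c {suc i} {zero}  e = ⊥-elim (blocked i (λ a → grp-sat i a c) (sym e))
      pal-inj c {suc i} {suc j} e = cong suc (κ-inj e)
      own : ∀ {v} → Core v → cls v ≡ cls x
      own {v} c = go (injective⇒onto (pal x) (pal-inj x-core) (cls v)) where
        go : (∃ λ i → pal x i ≡ cls v) → cls v ≡ cls x
        go (zero , e)  = sym e
        go (suc j , e) = ⊥-elim (blocked j (λ a → grp-sat j a c) (sym e))

-- Edge numbers, vertex orders and explicit constructions.

<ᵇ-true : ∀ {a b} → (a <ᵇ b) ≡ true → a < b
<ᵇ-true {a} {b} h = <ᵇ⇒< a b (subst Booleans.T (sym h) tt)

<⇒<ᵇ-true : ∀ {a b} → a < b → (a <ᵇ b) ≡ true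
<⇒<ᵇ-true (s≤s (z≤n))       = refl
<⇒<ᵇ-true (s≤s (s≤s h)) = <⇒<ᵇ-true (s≤s h)

sum-tabulate : ∀ {A : Set} {n} (f : A → ℕ) (g : Fin n → A) → sum (map f (tabulate g)) ≡ ∑ (λ i → f (g i))
sum-tabulate {n = zero}  f g = sym (∑-empty _)
sum-tabulate {n = suc n} f g = cong (f (g zero) +_) (sum-tabulate f λ i → g (suc i)) ∙ sym (∑-suc λ i → f (g i))

before : ∀ {n} → Fin n → Fin n → Bool
before v u = toℕ u <ᵇ toℕ v

module Rank {n : ℕ} (P : Fin n → Bool) where
  rank : Fin n → ℕ
  rank v = # (P ∩ before v)

  private
    add : ∀ (Q : Fin n → Bool) {u} → Q u ≡ true → (∀ w → (P ∩ before u) w ≡ true → Q w ≡ true) → rank u < # Q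
    add Q {u} qu sub = s≤s (#-mono {P = P ∩ before u} {Q = Q ∩ ∁ (isᵇ u)} λ w h → ∧-intro (sub w h) (not-false (dec-false (w ≟ᶠ u) λ e →
        <-irrefl (cong toℕ e) (<ᵇ-true (∧-elimʳ {P w} h))))) &= sym (#-remove Q u ∙ cong (λ b → 𝟙 b + # (Q ∩ ∁ (isᵇ u))) qu)

  rank-< : ∀ v → P v ≡ true → rank v < # P
  rank-< v pv = add P pv λ w → ∧-elimˡ

  rank-mono : ∀ {u v} → P u ≡ true → toℕ u < toℕ v → rank u < rank v
  rank-mono {u} {v} pu lt = add (P ∩ before v) (∧-intro pu (<⇒<ᵇ-true lt)) λ w h → ∧-intro (∧-elimˡ h) (<⇒<ᵇ-true (<-trans (<ᵇ-true (∧-elimʳ {P w} h)) lt))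

  rank-inj : ∀ {u v} → P u ≡ true → P v ≡ true → rank u ≡ rank v → u ≡ v
  rank-inj {u} {v} pu pv e = go (<-cmp (toℕ u) (toℕ v)) where
    open import Relation.Binary.Definitions using (Tri; tri<; tri≈; tri>)
    go : Tri (toℕ u < toℕ v) (toℕ u ≡ toℕ v) (toℕ v < toℕ u) → u ≡ v
    go (tri< lt _ _) = ⊥-elim (<-irrefl e (rank-mono pu lt))
    go (tri≈ _ h _)  = toℕ-injective h
    go (tri> _ _ lt) = ⊥-elim (<-irrefl (sym e) (rank-mono pv lt))

#-before : ∀ {n} (v : Fin n) → toℕ v ≤ # (before v)
#-before v = Many⇒≤# (before v) (many (λ k → inject≤ k (<⇒≤ (toℕ<n v))) (λ e → inject≤-injective _ _ _ _ e)
  λ k → <⇒<ᵇ-true (s≤s (≤-reflexive (toℕ-inject≤ k _)) & toℕ<n k))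

∑-toℕ : ∀ (b : ℕ → ℕ) n → ∑ {n} (λ j → 2 * (toℕ j ∸ b (toℕ j))) ≡ greedy b n
∑-toℕ b n = go (λ k → 2 * (k ∸ b k)) n where
  from-top : (ℕ → ℕ) → ℕ → ℕ
  from-top f zero    = 0
  from-top f (suc n) = f n + from-top f n
  peel : ∀ f n → from-top f (suc n) ≡ f 0 + from-top (λ k → f (suc k)) n
  peel f zero    = refl
  peel f (suc n) = cong (f (suc n) +_) (peel f n) ∙ lem (f (suc n)) (f 0) _ where
    lem : ∀ a b c → a + (b + c) ≡ b + (a + c)
    lem = solve-∀
  sums : ∀ f n → ∑ {n} (λ j → f (toℕ j)) ≡ from-top f n
  sums f zero    = ∑-empty _
  sums f (suc n) = ∑-suc (λ j → f (toℕ j)) ∙ cong (f 0 +_) (sums (λ k → f (suc k)) n) ∙ sym (peel f n)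
  same : ∀ n → from-top (λ k → 2 * (k ∸ b k)) n ≡ greedy b n
  same zero    = refl
  same (suc n) = cong (2 * (n ∸ b n) +_) (same n)
  go : ∀ f n → ∑ {n} (λ j → 2 * (toℕ j ∸ b (toℕ j))) ≡ greedy b n
  go f n = sums (λ k → 2 * (k ∸ b k)) n ∙ same n

module EdgeCount {n : ℕ} (G : Graph n) where
  open Graphs G

  back : V → ℕ
  back j = # (λ i → adj G i j ∧ before j i)

  private
    -- The summand of `edgeCount` uses a local `indicator`; presenting it as the witness of a pair
    -- lets it be inferred instead of named.
    edgeCount-terms : Σ (V → V → ℕ) λ t → edgeCount G ≡ ∑ (λ i → ∑ (t i))
    edgeCount-terms = _ , sum-tabulate _ id ∙ (∑-cong λ i → sum-tabulate _ id)

    term≡ : ∀ i j → fst edgeCount-terms i j ≡ 𝟙 (adj G i j ∧ before j i)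
    term≡ i j with adj G i j ∧ before j i
    ... | true  = refl
    ... | false = refl

  edgeCount-back : edgeCount G ≡ ∑ back
  edgeCount-back = snd edgeCount-terms ∙ (∑-cong λ i → ∑-cong λ j → term≡ i j) ∙
      ∑-comm (λ i j → 𝟙 (adj G i j ∧ before j i)) ∙ (∑-cong λ j → sym (#-∑ (λ i → adj G i j ∧ before j i)))

  back+front : ∀ j → # (adj G j) ≡ back j + # (λ i → adj G i j ∧ before i j)
  back+front j = #-split (adj G j) (before j) ∙ (cong₂ _+_ (same (before j)) (≤-antisym
      (#-mono {P = adj G j ∩ ∁ (before j)} {Q = λ i → adj G i j ∧ before i j} λ i h → ∧-intro (Adj-sym (∧-elimˡ h)) (<⇒<ᵇ-true (later i (∧-elimˡ h) (∧-elimʳ {adj G j i} h))))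
      (#-mono {P = λ i → adj G i j ∧ before i j} {Q = adj G j ∩ ∁ (before j)} λ i h → ∧-intro (Adj-sym (∧-elimˡ h)) (not-false (¬true⇒false λ h' →
        <-asym (<ᵇ-true {toℕ i} {toℕ j} h') (<ᵇ-true (∧-elimʳ {adj G i j} h))))))) where
    same : ∀ (Q : V → Bool) → # (adj G j ∩ Q) ≡ # (λ i → adj G i j ∧ Q i)
    same Q = (#-∑ (adj G j ∩ Q)) ∙ (∑-cong λ i → cong (λ b → 𝟙 (b ∧ Q i)) (adj-sym G j i)) ∙ sym (#-∑ (λ i → adj G i j ∧ Q i))
    later : ∀ i → Adj j i → not (before j i) ≡ true → toℕ j < toℕ i
    later i h h' = ≤∧≢⇒< (≮⇒≥ λ lt → true≢false (<⇒<ᵇ-true lt) (not-true h')) λ e → Adj-≢ h (toℕ-injective e)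

  E≡2edges : E full full ≡ 2 * edgeCount G
  E≡2edges = (∑-cong λ v → +-identityʳ (d v full) ∙ #-cong-full v ∙ back+front v) ∙
    ∑-distrib-+ back (λ j → # (λ i → adj G i j ∧ before i j)) ∙ (cong₂ _+_ (sym edgeCount-back) front-sum) ∙ cong (edgeCount G +_) (sym (+-identityʳ _)) where
    #-cong-full : ∀ v → d v full ≡ # (adj G v)
    #-cong-full v = ≤-antisym (#-mono {P = adj G v ∩ full} {Q = adj G v} λ _ → ∧-elimˡ) (#-mono {P = adj G v} {Q = adj G v ∩ full} λ _ h → ∧-intro h refl)
    front-sum : ∑ (λ j → # (λ i → adj G i j ∧ before i j)) ≡ edgeCount G
    front-sum = (∑-cong λ j → #-∑ (λ i → adj G i j ∧ before i j)) ∙ ∑-comm (λ j i → 𝟙 (adj G i j ∧ before i j)) ∙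
      (∑-cong λ i → (∑-cong λ j → cong (λ b → 𝟙 (b ∧ before i j)) (adj-sym G i j)) ∙ sym (#-∑ (λ j → adj G j i ∧ before i j))) ∙ sym edgeCount-back

  -- Count each edge at its later end: vertex `j` has at least `j ∸ b j` earlier neighbours.
  greedy≤ : ∀ b → (∀ j → # (λ i → before j i ∧ not (adj G i j)) ≤ b (toℕ j)) → greedy b n ≤ 2 * edgeCount G
  greedy≤ b h = sym (∑-toℕ b n) =& (∑-mono λ j → *-monoʳ-≤ 2 (le j)) &= (∑-*ˡ 2 back ∙ cong (2 *_) (sym edgeCount-back)) where
    le : ∀ j → toℕ j ∸ b (toℕ j) ≤ back j
    le j = m≤n+o⇒m∸n≤o (toℕ j) (b (toℕ j)) (#-before j & #-split (before j) (λ i → adj G i j) =& +-comm (# (before j ∩ (λ i → adj G i j))) _ =& +-mono-≤ (h j)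
      (#-mono {P = before j ∩ (λ i → adj G i j)} {Q = λ i → adj G i j ∧ before j i} λ i e → ∧-intro (∧-elimʳ {before j i} e) (∧-elimˡ e)))

𝟙-mono : ∀ {b b'} → (b ≡ true → b' ≡ true) → 𝟙 b ≤ 𝟙 b'
𝟙-mono {true}  h rewrite h refl = ≤-refl
𝟙-mono {false} h = z≤n

-- An injection of vertices preserving adjacency is an isomorphism once the edge numbers agree.
spanning-iso : ∀ {a b} → a ≡ b → (G : Graph a) (H : Graph b) (f : Fin a → Fin b) → (∀ {x y} → f x ≡ f y → x ≡ y) →
  (∀ x y → adj G x y ≡ true → adj H (f x) (f y) ≡ true) → edgeCount H ≤ edgeCount G → G ≅ H
spanning-iso {a} refl G H f inj pres le = record
  { to = f ; from = λ y → fst (onto y) ; from-to = λ x → inj (snd (onto (f x))) ; to-from = λ y → snd (onto y) ; preserves = λ x y → same x y } where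
  onto = injective⇒onto f inj
  full-sum : ∀ {n} (G : Graph n) → ∑ (λ x → ∑ (λ y → 𝟙 (adj G x y))) ≡ 2 * edgeCount G
  full-sum G = (∑-cong λ x → sym (#-∑ (adj G x)) ∙ ≤-antisym (#-mono {P = adj G x} {Q = adj G x ∩ full} λ _ h → ∧-intro h refl)
    (#-mono {P = adj G x ∩ full} {Q = adj G x} λ _ → ∧-elimˡ) ∙ sym (+-identityʳ _)) ∙ EdgeCount.E≡2edges G
  𝟙-inj : ∀ b b' → 𝟙 b ≡ 𝟙 b' → b' ≡ b
  𝟙-inj true  true  _ = refl
  𝟙-inj false false _ = refl
  image≤ : ∑ (λ x → ∑ (λ y → 𝟙 (adj H (f x) (f y)))) ≤ ∑ (λ x → ∑ (λ y → 𝟙 (adj G x y)))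
  image≤ = ((∑-mono λ x → ∑-inj f inj λ y → 𝟙 (adj H (f x) y)) & ∑-inj f inj λ x → ∑ (λ y → 𝟙 (adj H x y))) &
    full-sum H =& *-monoʳ-≤ 2 le &= sym (full-sum G)
  rows≡ : ∀ x → ∑ (λ y → 𝟙 (adj G x y)) ≡ ∑ (λ y → 𝟙 (adj H (f x) (f y)))
  rows≡ = ∑-equal (λ x → ∑-mono λ y → 𝟙-mono (pres x y)) image≤
  same : ∀ x y → adj H (f x) (f y) ≡ adj G x y
  same x y = 𝟙-inj _ _ (∑-equal (λ y → 𝟙-mono (pres x y)) (≤-reflexive (sym (rows≡ x))) y)

module CliqueJoinTuran (q ρ N : ℕ) where
  private
    r : ℕ
    r = suc (suc ρ)

  graph : Graph (q + N)
  graph = complete q ⊗ᴳ turan N r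

  residue : ℕ → ℕ
  residue k = (k ∸ q) % r

  graph-adj : ∀ x y → x ≢ y → (q ≤ toℕ x → q ≤ toℕ y → residue (toℕ x) ≢ residue (toℕ y)) → adj graph x y ≡ true
  graph-adj x y ne h = ⊗-intro (complete q) (turan N r) x y ne (go (splitAt q x) (splitAt q y) refl refl) where
    go : ∀ s t → splitAt q x ≡ s → splitAt q y ≡ t → Block ⊤ (complete q) (turan N r) s t
    go (inl u) (inl v) e e' = fromRel-intro {q} (λ _ _ → true) (λ { refl → ne (sym (splitAt⁻¹-↑ˡ e) ∙ splitAt⁻¹-↑ˡ e') }) (inl refl)
    go (inl u) (inr v) e e' = tt
    go (inr u) (inl v) e e' = tt
    go (inr u) (inr v) e e' = fromRel-intro {N} (λ i j → not (toℕ i % r ≡ᵇ toℕ j % r)) {u} {v} (λ { refl → ne (sym (splitAt⁻¹-↑ʳ e) ∙ splitAt⁻¹-↑ʳ e') })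
        (inl (not-false (¬true⇒false λ k → h (m≤m+n q _ &= sym (pos x u e)) (m≤m+n q _ &= sym (pos y v e'))
          (res x u e ∙ ≡ᵇ-true k ∙ sym (res y v e'))))) where
      pos : ∀ x u → splitAt q x ≡ inr u → toℕ x ≡ q + toℕ u
      pos x u e = cong toℕ (sym (splitAt⁻¹-↑ʳ e)) ∙ toℕ-↑ʳ q u
      res : ∀ x u → splitAt q x ≡ inr u → residue (toℕ x) ≡ toℕ u % r
      res x u e = cong (_% r) (cong (_∸ q) (pos x u e) ∙ m+n∸m≡n q (toℕ u))

  free : ∀ {m} → 1 ≤ q → suc q ≤ m → ForbiddenFree q ρ m graph
  free 1≤q q<m = Restrictions.colouring-free graph 1≤q q<m (λ x → cls (splitAt q x)) (tabulate λ z → z ↑ˡ N) (≤-reflexive (length-tabulate λ z → z ↑ˡ N))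
      (λ v e → covered v (splitAt q v) refl e) λ {u} {v} h → proper u v (splitAt q u) (splitAt q v) (⊗-elim (complete q) (turan N r) u v h) where
    cls : Fin q ⊎ Fin N → Maybe (Fin r)
    cls (inl _) = nothing
    cls (inr j) = just (fromℕ< (m%n<n (toℕ j) r))
    covered : ∀ v s → splitAt q v ≡ s → cls s ≡ nothing → v ∈ tabulate (λ z → z ↑ˡ N)
    covered v (inl z) e _ = subst (_∈ tabulate λ z → z ↑ˡ N) (splitAt⁻¹-↑ˡ e) (∈-tabulate⁺ {f = λ z → z ↑ˡ N} z)
    proper : ∀ u v s t → Block ⊤ (complete q) (turan N r) s t → ∀ {i} → cls s ≡ just i → cls t ≢ just i
    proper u v (inr a) (inr b) h e e' = clash (snd (fromRel-elim (λ i j → not (toℕ i % r ≡ᵇ toℕ j % r)) {a} {b} h)) where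
      same : toℕ a % r ≡ toℕ b % r
      same = fromℕ<-injective _ _ _ _ (just-injective (e ∙ sym e'))
      clash : not (toℕ a % r ≡ᵇ toℕ b % r) ≡ true ⊎ not (toℕ b % r ≡ᵇ toℕ a % r) ≡ true → ⊥
      clash (inl k) = true≢false (≡⇒≡ᵇ-true same) (not-true k)
      clash (inr k) = true≢false (≡⇒≡ᵇ-true (sym same)) (not-true k)

  -- The earlier non-neighbours of `j` are Turán vertices with its residue. Their quotients by `r`
  -- are distinct and smaller than that of `j`, which bounds their number.
  edges≥ : Profile.profile ρ q 0 (q + N) ≤ 2 * edgeCount graph
  edges≥ = EdgeCount.greedy≤ graph (Profile.missed ρ q 0) λ j → few j &= sym (+-identityʳ _ ∙ /-congʳ {n = 1 * r} {o = r} {m = toℕ j ∸ q} (*-identityˡ r)) where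
    few : ∀ j → # (λ i → before j i ∧ not (adj graph i j)) ≤ (toℕ j ∸ q) / r
    few j = #≤-code ((toℕ j ∸ q) / r) _ (λ i → (toℕ i ∸ q) / r) (λ i e → less i (data-of i e))
        λ i i' e e' eq → code-inj i i' (data-of i e) (data-of i' e') eq where
      Data : Fin (q + N) → Set
      Data i = toℕ i < toℕ j × q ≤ toℕ i × residue (toℕ i) ≡ residue (toℕ j)
      data-of : ∀ i → (before j i ∧ not (adj graph i j)) ≡ true → Data i
      data-of i e = lt , go (q ≤? toℕ i) (residue (toℕ i) ≟ℕ residue (toℕ j)) where
        lt : toℕ i < toℕ j
        lt = <ᵇ-true (∧-elimˡ e)
        far : adj graph i j ≡ true → ⊥
        far h = true≢false h (not-true (∧-elimʳ {before j i} e))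
        go : Dec (q ≤ toℕ i) → Dec (residue (toℕ i) ≡ residue (toℕ j)) → q ≤ toℕ i × residue (toℕ i) ≡ residue (toℕ j)
        go (yes le) (yes r≡) = le , r≡
        go (no nle) _ = ⊥-elim (far (graph-adj i j (λ { refl → <-irrefl refl lt }) λ le _ → ⊥-elim (nle le)))
        go (yes _) (no ne) = ⊥-elim (far (graph-adj i j (λ { refl → <-irrefl refl lt }) λ _ _ → ne))
      same-code : ∀ {x y} → residue x ≡ residue y → (x ∸ q) / r ≡ (y ∸ q) / r → x ∸ q ≡ y ∸ q
      same-code {x} {y} e e' = m≡m%n+[m/n]*n (x ∸ q) r ∙ cong₂ (λ a b → a + b * r) e e' ∙ sym (m≡m%n+[m/n]*n (y ∸ q) r)
      less : ∀ i → Data i → (toℕ i ∸ q) / r < (toℕ j ∸ q) / r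
      less i (lt , le , e) = ≤∧≢⇒< (/-monoˡ-≤ r (∸-monoˡ-≤ q (<⇒≤ lt))) λ e' → <-irrefl (same-code e e') (∸-monoˡ-< lt le)
      code-inj : ∀ i i' → Data i → Data i' → (toℕ i ∸ q) / r ≡ (toℕ i' ∸ q) / r → i ≡ i'
      code-inj i i' (_ , le , e) (_ , le' , e') eq = toℕ-injective (∸-cancelʳ-≡ le le' (same-code (e ∙ sym e') eq))

two-in-pair : ∀ {a b c} → a / 2 ≡ b / 2 → a / 2 ≡ c / 2 → a ≢ b → a ≢ c → b ≡ c
two-in-pair {a} {b} {c} e e' ne ne' = m≡m%n+[m/n]*n b 2 ∙ cong₂ (λ x y → x + y * 2) parity (sym e ∙ e') ∙ sym (m≡m%n+[m/n]*n c 2) where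
  differ : ∀ {a b} → a / 2 ≡ b / 2 → a ≢ b → a % 2 ≢ b % 2
  differ {a} {b} e ne h = ne (m≡m%n+[m/n]*n a 2 ∙ cong₂ (λ x y → x + y * 2) h e ∙ sym (m≡m%n+[m/n]*n b 2))
  third : ∀ x y z → x < 2 → y < 2 → z < 2 → x ≢ y → x ≢ z → y ≡ z
  third 0 0 _ _ _ _ h _ = ⊥-elim (h refl)
  third 0 _ 0 _ _ _ _ h = ⊥-elim (h refl)
  third 1 1 _ _ _ _ h _ = ⊥-elim (h refl)
  third 1 _ 1 _ _ _ _ h = ⊥-elim (h refl)
  third 0 1 1 _ _ _ _ _ = refl
  third 1 0 0 _ _ _ _ _ = refl
  third (suc (suc _)) _ _ (s≤s (s≤s ())) _ _ _ _
  third _ (suc (suc _)) _ _ (s≤s (s≤s ())) _ _ _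
  third _ _ (suc (suc _)) _ _ (s≤s (s≤s ())) _ _
  parity : b % 2 ≡ c % 2
  parity = third (a % 2) (b % 2) (c % 2) (m%n<n a 2) (m%n<n b 2) (m%n<n c 2) (differ e ne) (differ e' ne')

-- The complete r-partite graph with a maximum matching in each part, the parts being residue classes.
module MatchedTuran (ρ n : ℕ) where
  private
    r : ℕ
    r = suc (suc ρ)

  rel : Fin n → Fin n → Bool
  rel i j = not (toℕ i % r ≡ᵇ toℕ j % r) ∨ (toℕ i / r / 2 ≡ᵇ toℕ j / r / 2)

  graph : Graph n
  graph = fromRel rel

  same-pair : ∀ {u v} → adj graph u v ≡ true → toℕ u % r ≡ toℕ v % r → toℕ u / r / 2 ≡ toℕ v / r / 2
  same-pair {u} {v} h e = [ (λ k → go u v e (∨-elim k)) , (λ k → sym (go v u (sym e) (∨-elim k))) ]′ (snd (fromRel-elim rel {u} {v} h)) where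
    go : ∀ u v → toℕ u % r ≡ toℕ v % r → not (toℕ u % r ≡ᵇ toℕ v % r) ≡ true ⊎ (toℕ u / r / 2 ≡ᵇ toℕ v / r / 2) ≡ true → toℕ u / r / 2 ≡ toℕ v / r / 2
    go u v e (inl k) = ⊥-elim (true≢false (≡⇒≡ᵇ-true e) (not-true k))
    go u v e (inr k) = ≡ᵇ-true k

  same-place : ∀ {u v : Fin n} → toℕ u % r ≡ toℕ v % r → toℕ u / r ≡ toℕ v / r → u ≡ v
  same-place {u} {v} e e' = toℕ-injective (m≡m%n+[m/n]*n (toℕ u) r ∙ cong₂ (λ x y → x + y * r) e e' ∙ sym (m≡m%n+[m/n]*n (toℕ v) r))

  free : ∀ {q m} → 1 ≤ q → suc q ≤ m → r < m → ForbiddenFree q ρ m graph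
  free 1≤q q<m r<m = Restrictions.matched-classes-free graph 1≤q q<m r<m (λ v → fromℕ< (m%n<n (toℕ v) r)) λ {u} {v} {w} uv uw e e' →
      unique u v w uv uw (fromℕ<-injective _ _ _ _ e) (fromℕ<-injective _ _ _ _ e') where
    unique : ∀ u v w → adj graph u v ≡ true → adj graph u w ≡ true → toℕ u % r ≡ toℕ v % r → toℕ u % r ≡ toℕ w % r → v ≡ w
    unique u v w uv uw e e' = same-place (sym e ∙ e') (two-in-pair {toℕ u / r} {toℕ v / r} {toℕ w / r} (same-pair {u} {v} uv e) (same-pair {u} {w} uw e')
      (λ h → Graphs.Adj-≢ graph {u} {v} uv (same-place e h)) λ h → Graphs.Adj-≢ graph {u} {w} uw (same-place e' h))

  edges≥ : Profile.profile ρ 0 1 n ≤ 2 * edgeCount graph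
  edges≥ = EdgeCount.greedy≤ graph (Profile.missed ρ 0 1) λ j → few j &= cong (2 *_) (m/n/o≡m/[n*o] (toℕ j) r 2 ∙ /-congʳ {n = r * 2} {o = 2 * r} {m = toℕ j} (*-comm r 2)) where
    few : ∀ j → # (λ i → before j i ∧ not (adj graph i j)) ≤ 2 * (toℕ j / r / 2)
    few j = #≤-code (2 * (toℕ j / r / 2)) _ (λ i → toℕ i / r) (λ i e → less i (data-of i e)) λ i i' e e' → same-place (fst (snd (data-of i e)) ∙ sym (fst (snd (data-of i' e')))) where
      Data : Fin n → Set
      Data i = toℕ i < toℕ j × toℕ i % r ≡ toℕ j % r × toℕ i / r / 2 ≢ toℕ j / r / 2
      data-of : ∀ i → (before j i ∧ not (adj graph i j)) ≡ true → Data i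
      data-of i e = lt , go (toℕ i % r ≟ℕ toℕ j % r) where
        lt : toℕ i < toℕ j
        lt = <ᵇ-true (∧-elimˡ e)
        far : rel i j ≡ true → ⊥
        far h = true≢false (fromRel-intro rel {i} {j} (λ { refl → <-irrefl refl lt }) (inl h)) (not-true (∧-elimʳ {before j i} e))
        go : Dec (toℕ i % r ≡ toℕ j % r) → toℕ i % r ≡ toℕ j % r × toℕ i / r / 2 ≢ toℕ j / r / 2
        go (yes h) = h , λ h' → far (∨-introʳ {not (toℕ i % r ≡ᵇ toℕ j % r)} (≡⇒≡ᵇ-true h'))
        go (no ne) = ⊥-elim (far (∨-introˡ (not-false (¬true⇒false λ k → ne (≡ᵇ-true k)))))
      less : ∀ i → Data i → toℕ i / r < 2 * (toℕ j / r / 2)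
      less i (lt , _ , ne) = s≤s (m≡m%n+[m/n]*n x 2 =& +-monoˡ-≤ (x / 2 * 2) (s≤s⁻¹ (m%n<n x 2))) &
          lem (x / 2) =& *-monoʳ-≤ 2 (≤∧≢⇒< (/-monoˡ-≤ 2 (/-monoˡ-≤ r (<⇒≤ lt))) ne) where
        x = toℕ i / r
        lem : ∀ h → suc (1 + h * 2) ≡ 2 * suc h
        lem = solve-∀

-- Recognising the extremal graphs.

Many-onto : ∀ {n} (Q : Fin n → Bool) (M : Many (# Q) (λ v → Q v ≡ true)) → ∀ {v} → Q v ≡ true → ∃ λ k → v ≡ Many.at M k
Many-onto Q (many at at-inj at-sat) {v} qv = go (any? λ k → v ≟ᶠ at k) where
  go : Dec (∃ λ k → v ≡ at k) → ∃ λ k → v ≡ at k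
  go (yes p) = p
  go (no ¬p) = ⊥-elim (<-irrefl refl (Many⇒≤# Q (many (λ { zero → v ; (suc k) → at k })
    (λ { {zero} {zero} _ → refl ; {zero} {suc k} e → ⊥-elim (¬p (k , e)) ; {suc k} {zero} e → ⊥-elim (¬p (k , sym e)) ; {suc k} {suc l} e → cong suc (at-inj e) })
    λ { zero → qv ; (suc k) → at-sat k })))

module ApexIso {n : ℕ} (q ρ a : ℕ) (G : Graph n) (cls : Fin n → Maybe (Fin (2 + ρ)))
    (#Ap : # (isN ∘ cls) ≡ q)
    (sizes : ∀ i → # (is i ∘ cls) ≡ a ⊎ # (is i ∘ cls) ≡ suc a)
    (independent : ∀ i {v v'} → is i (cls v) ≡ true → is i (cls v') ≡ true → ¬ Graphs.Adj G v v') where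
  open Graphs G
  open ClassCount G cls

  private
    r : ℕ
    r = suc (suc ρ)

  Big : Fin r → Bool
  Big i = does (# (Cl i) ≟ℕ suc a)

  size : ∀ i → # (Cl i) ≡ a + 𝟙 (Big i)
  size i = go (# (Cl i) ≟ℕ suc a) (sizes i) where
    go : (D : Dec (# (Cl i) ≡ suc a)) → # (Cl i) ≡ a ⊎ # (Cl i) ≡ suc a → # (Cl i) ≡ a + 𝟙 (does D)
    go (yes e) _ = e ∙ +-comm 1 a
    go (no ne) (inl e) = e ∙ sym (+-identityʳ a)
    go (no ne) (inr e) = ⊥-elim (ne e)

  N≡ : N ≡ r * a + # Big
  N≡ = sym ∑-Cl ∙ ∑-cong size ∙ ∑-distrib-+ (λ _ → a) (λ i → 𝟙 (Big i)) ∙ (cong₂ _+_ (∑-const r a) (sym (#-∑ Big)))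

  -- The larger classes take the first residues modulo r.
  π : Fin r → ℕ
  π i = if Big i then Rank.rank Big i else # Big + Rank.rank (∁ Big) i

  π-big : ∀ i → Big i ≡ true → π i ≡ Rank.rank Big i
  π-big i e = cong (λ b → if b then Rank.rank Big i else # Big + Rank.rank (∁ Big) i) e

  π-small : ∀ i → Big i ≡ false → π i ≡ # Big + Rank.rank (∁ Big) i
  π-small i e = cong (λ b → if b then Rank.rank Big i else # Big + Rank.rank (∁ Big) i) e

  π-big< : ∀ i → Big i ≡ true → π i < # Big
  π-big< i e = cong suc (π-big i e) =& Rank.rank-< Big i e

  π< : ∀ i → π i < r
  π< i = [ (λ e → π-big< i e & #≤n Big)
         , (λ e → cong suc (π-small i e) =& sym (+-suc (# Big) _) =& +-monoʳ-≤ (# Big) (Rank.rank-< (∁ Big) i (not-false e)) &= (#-∁ Big)) ]′ (bool (Big i))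

  π-inj : ∀ i j → π i ≡ π j → i ≡ j
  π-inj i j h = go (bool (Big i)) (bool (Big j)) where
    cross : ∀ i j → Big i ≡ true → Big j ≡ false → π i ≢ π j
    cross i j e e' h = <-irrefl h (π-big< i e & m≤m+n _ _ &= sym (π-small j e'))
    go : Big i ≡ true ⊎ Big i ≡ false → Big j ≡ true ⊎ Big j ≡ false → i ≡ j
    go (inl e) (inl e') = Rank.rank-inj Big e e' (sym (π-big i e) ∙ h ∙ π-big j e')
    go (inl e) (inr e') = ⊥-elim (cross i j e e' h)
    go (inr e) (inl e') = ⊥-elim (cross j i e' e (sym h))
    go (inr e) (inr e') = Rank.rank-inj (∁ Big) (not-false e) (not-false e') (+-cancelˡ-≡ (# Big) _ _ (sym (π-small i e) ∙ h ∙ π-small j e'))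

  -- Class `i` takes the positions congruent to `π i` modulo `r`, in order of rank, which is the
  -- layout of `turan`.
  slot : Fin r → V → ℕ
  slot i v = π i + Rank.rank (Cl i) v * r

  slot< : ∀ i v → Cl i v ≡ true → slot i v < N
  slot< i v cv = go (bool (Big i)) &= sym N≡ where
    k<  : Rank.rank (Cl i) v < a + 𝟙 (Big i)
    k< = Rank.rank-< (Cl i) v cv &= size i
    arith₁ : ∀ {p b k} → p < b → k < a + 1 → p + k * r < r * a + b
    arith₁ {p} {b} {k} h₁ h₂ = +-mono-≤ h₁ (*-monoˡ-≤ r (s≤s⁻¹ (h₂ &= +-comm a 1))) &= (+-comm b (a * r) ∙ cong (_+ b) (*-comm a r))
    arith₂ : ∀ {p b k} → p < r → k < a + 0 → p + k * r < r * a + b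
    arith₂ {p} {b} {k} h₁ h₂ = +-monoˡ-≤ (k * r) h₁ & *-monoˡ-≤ r (h₂ &= +-identityʳ a) & *-comm a r =& m≤m+n _ b
    go : Big i ≡ true ⊎ Big i ≡ false → slot i v < r * a + # Big
    go (inl e) = arith₁ (π-big< i e) (subst (λ b → Rank.rank (Cl i) v < a + 𝟙 b) e k<)
    go (inr e) = arith₂ (π< i) (subst (λ b → Rank.rank (Cl i) v < a + 𝟙 b) e k<)

  pos : V → Maybe (Fin r) → ℕ
  pos v nothing  = Rank.rank Ap v
  pos v (just i) = q + slot i v

  pos< : ∀ v c → cls v ≡ c → pos v c < q + N
  pos< v nothing  e = Rank.rank-< Ap v (cong isN e) & #Ap =& m≤m+n q N
  pos< v (just i) e = +-monoʳ-< q (slot< i v (is⁺ i e))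

  pos-inj : ∀ u v c c' → cls u ≡ c → cls v ≡ c' → pos u c ≡ pos v c' → u ≡ v
  pos-inj u v nothing nothing e e' h = Rank.rank-inj Ap (cong isN e) (cong isN e') h
  pos-inj u v nothing (just j) e e' h = ⊥-elim (<-irrefl h (Rank.rank-< Ap u (cong isN e) & #Ap =& m≤m+n q _))
  pos-inj u v (just i) nothing e e' h = ⊥-elim (<-irrefl (sym h) (Rank.rank-< Ap v (cong isN e') & #Ap =& m≤m+n q _))
  pos-inj u v (just i) (just j) e e' h = same (π-inj i j (sym (rem i u) ∙ cong (_% r) eq ∙ rem j v)) where
    eq : slot i u ≡ slot j v
    eq = +-cancelˡ-≡ q _ _ h
    rem : ∀ i v → slot i v % r ≡ π i
    rem i v = [m+kn]%n≡m%n (π i) (Rank.rank (Cl i) v) r ∙ m<n⇒m%n≡m (π< i)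
    same : i ≡ j → u ≡ v
    same refl = Rank.rank-inj (Cl i) (is⁺ i e) (is⁺ i e')
      (*-cancelʳ-≡ _ _ r (+-cancelˡ-≡ (π i) _ _ eq))

  f : V → Fin (q + N)
  f v = fromℕ< (pos< v (cls v) refl)

  toℕ-f : ∀ v → toℕ (f v) ≡ pos v (cls v)
  toℕ-f v = toℕ-fromℕ< (pos< v (cls v) refl)

  f-inj : ∀ {u v} → f u ≡ f v → u ≡ v
  f-inj {u} {v} e = pos-inj u v (cls u) (cls v) refl refl (sym (toℕ-f u) ∙ cong toℕ e ∙ toℕ-f v)

  open CliqueJoinTuran q ρ N using (residue; graph-adj) renaming (graph to H)

  iso : edgeCount H ≤ edgeCount G → G ≅ H
  iso le = spanning-iso (sym (cong (_+ N) (sym #Ap) ∙ (#-∁ Ap))) G H f f-inj (λ u v h → graph-adj (f u) (f v) (λ e → Adj-≢ h (f-inj e))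
      λ qu qv e → apart u v (cls u) (cls v) refl refl h (qu &= toℕ-f u) (qv &= toℕ-f v)
        (cong residue (sym (toℕ-f u)) ∙ e ∙ cong residue (toℕ-f v))) le where
    residue-pos : ∀ v i → residue (pos v (just i)) ≡ π i
    residue-pos v i = cong (_% r) (m+n∸m≡n q (slot i v)) ∙ [m+kn]%n≡m%n (π i) (Rank.rank (Cl i) v) r ∙ m<n⇒m%n≡m (π< i)
    apart : ∀ u v c c' → cls u ≡ c → cls v ≡ c' → Adj u v → q ≤ pos u c → q ≤ pos v c' → residue (pos u c) ≢ residue (pos v c')
    apart u v nothing c' e e' h qu qv _ = <-irrefl refl (Rank.rank-< Ap u (cong isN e) & #Ap =& qu)
    apart u v (just i) nothing e e' h qu qv _ = <-irrefl refl (Rank.rank-< Ap v (cong isN e') & #Ap =& qv)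
    apart u v (just i) (just j) e e' h qu qv k = clash (π-inj i j (sym (residue-pos u i) ∙ k ∙ residue-pos v j)) where
      clash : i ≡ j → ⊥
      clash refl = independent i (is⁺ i e) (is⁺ i e') h

module Position {n : ℕ} where
  private
    V : Set
    V = Fin n

  place-of : List V → V → ℕ
  place-of []       v = 0
  place-of (x ∷ xs) v = if does (v ≟ᶠ x) then 0 else suc (place-of xs v)

  place-here : ∀ x xs → place-of (x ∷ xs) x ≡ 0
  place-here x xs = cong (λ b → if b then 0 else suc (place-of xs x)) (dec-true (x ≟ᶠ x) refl)

  place-there : ∀ {x v} xs → v ≢ x → place-of (x ∷ xs) v ≡ suc (place-of xs v)
  place-there {x} {v} xs ne = cong (λ b → if b then 0 else suc (place-of xs v)) (dec-false (v ≟ᶠ x) ne)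

  place-< : ∀ {v} xs → v ∈ xs → place-of xs v < length xs
  place-< {v} (x ∷ xs) m = go (v ≟ᶠ x) m where
    go : Dec (v ≡ x) → v ∈ x ∷ xs → place-of (x ∷ xs) v < length (x ∷ xs)
    go (yes refl) _ = s≤s (≤-reflexive (place-here v xs)) & s≤s z≤n
    go (no ne) (here e) = ⊥-elim (ne e)
    go (no ne) (there m) = s≤s (≤-reflexive (place-there xs ne)) & s≤s (place-< xs m)

  place-inj : ∀ {u v} xs → u ∈ xs → v ∈ xs → place-of xs u ≡ place-of xs v → u ≡ v
  place-inj {u} {v} (x ∷ xs) mu mv h = go (u ≟ᶠ x) (v ≟ᶠ x) mu mv where
    go : Dec (u ≡ x) → Dec (v ≡ x) → u ∈ x ∷ xs → v ∈ x ∷ xs → u ≡ v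
    go (yes refl) (yes refl) _ _ = refl
    go (yes refl) (no ne) _ _ = case sym (place-here u xs) ∙ h ∙ place-there xs ne of λ ()
    go (no ne) (yes refl) _ _ = case sym (place-here v xs) ∙ sym h ∙ place-there xs ne of λ ()
    go (no ne) _ (here e) _ = ⊥-elim (ne e)
    go _ (no ne) _ (here e) = ⊥-elim (ne e)
    go (no ne) (no ne') (there m) (there m') = place-inj xs m m' (suc-injectiveℕ (sym (place-there xs ne) ∙ h ∙ place-there xs ne')) where
      suc-injectiveℕ : ∀ {a b} → suc a ≡ suc b → a ≡ b
      suc-injectiveℕ refl = refl

module Layout {n : ℕ} (G : Graph n) where
  open Graphs G
  open Position {n}

  Paired : List V → Set
  Paired ys = ∀ {u v} → u ∈ ys → v ∈ ys → Adj u v → place-of ys u / 2 ≡ place-of ys v / 2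

  -- Unmatched vertices are collected in acc, behind all the matched pairs.
  layout : ∀ k xs acc → length xs ≤ k → Unique (xs ++ acc) → (∀ {u v w} → u ∈ xs ++ acc → v ∈ xs ++ acc → w ∈ xs ++ acc → Adj u v → Adj u w → v ≡ w) →
    (∀ {u v} → u ∈ acc → v ∈ xs ++ acc → ¬ Adj u v) → ∃ λ ys → ys ↭ xs ++ acc × Paired ys
  layout k [] acc le uniq one lone = acc , ↭-refl , λ m m' h → ⊥-elim (lone m m' h)
  layout (suc k) (x ∷ xs) acc (s≤s le) uniq one lone = go (Any.any? (λ y → adj G x y ≟ᵇ true) xs) where
    M : List V
    M = x ∷ xs ++ acc
    Result : Set
    Result = ∃ λ ys → ys ↭ M × Paired ys
    pair : ∀ y as bs → xs ≡ as ++ y ∷ bs → Adj x y → Result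
    pair y as bs refl xy = extend (layout k (as ++ bs) acc ((n≤1+n _ &= sym (Perm.↭-length (Perm.shift y as bs))) & le)
        uniq' (λ m m' m″ → one (back m) (back m') (back m″)) λ m m' → lone m (back m')) where
      perm : x ∷ y ∷ ((as ++ bs) ++ acc) ↭ M
      perm = ↭-prep x (↭-sym (Perm.++⁺ʳ acc (Perm.shift y as bs)))
      back : ∀ {v} → v ∈ (as ++ bs) ++ acc → v ∈ M
      back m = Perm.∈-resp-↭ perm (there (there m))
      uniq″ : Unique (x ∷ y ∷ ((as ++ bs) ++ acc))
      uniq″ = Unique-resp-↭ (↭-sym perm) uniq
      uniq' : Unique ((as ++ bs) ++ acc)
      uniq' = drop₂ uniq″ where
        drop₂ : ∀ {x y : V} {zs} → Unique (x ∷ y ∷ zs) → Unique zs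
        drop₂ (_ ∷ _ ∷ u) = u
      extend : (∃ λ ys → ys ↭ (as ++ bs) ++ acc × Paired ys) → Result
      extend (ys , p , paired) = x ∷ y ∷ ys , ↭-trans (↭-prep x (↭-prep y p)) perm , λ {u} {v} mu mv h → decide u v h (position u mu) (position v mv) where
        full-uniq : Unique (x ∷ y ∷ ys)
        full-uniq = Unique-resp-↭ (↭-sym (↭-prep x (↭-prep y p))) uniq″
        x≢y : x ≢ y
        x≢y = Adj-≢ xy
        in-M : ∀ {v} → v ∈ ys → v ∈ M
        in-M m = back (Perm.∈-resp-↭ p m)
        x∈M : x ∈ M
        x∈M = here refl
        y∈M : y ∈ M
        y∈M = Perm.∈-resp-↭ perm (there (here refl))
        x∉ : x ∉ ys
        x∉ m = Unique-∷⁻ full-uniq (there m)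
        y∉ : y ∉ ys
        y∉ m = Unique-∷⁻ (tail full-uniq) m where
          tail : ∀ {x : V} {zs} → Unique (x ∷ zs) → Unique zs
          tail (_ ∷ u) = u
        Where : V → Set
        Where v = (v ≡ x × place-of (x ∷ y ∷ ys) v ≡ 0) ⊎ (v ≡ y × place-of (x ∷ y ∷ ys) v ≡ 1) ⊎ (v ∈ ys × place-of (x ∷ y ∷ ys) v ≡ 2 + place-of ys v)
        position : ∀ v → v ∈ x ∷ y ∷ ys → Where v
        position v (here refl) = inl (refl , place-here x (y ∷ ys))
        position v (there (here refl)) = inr (inl (refl , place-there (y ∷ ys) (x≢y ∘ sym) ∙ cong suc (place-here y ys)))
        position v (there (there m)) = inr (inr (m , place-there (y ∷ ys) (λ e → x∉ (subst (_∈ ys) e m)) ∙ cong suc (place-there ys λ e → y∉ (subst (_∈ ys) e m))))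
        half : ∀ k → (2 + k) / 2 ≡ suc (k / 2)
        half k = +-distrib-/-∣ˡ {2} k (divides 1 refl)
        decide : ∀ u v → Adj u v → Where u → Where v → place-of (x ∷ y ∷ ys) u / 2 ≡ place-of (x ∷ y ∷ ys) v / 2
        decide u v h (inl (_ , e)) (inl (_ , e')) = cong (_/ 2) (e ∙ sym e')
        decide u v h (inl (_ , e)) (inr (inl (_ , e'))) = cong (_/ 2) e ∙ sym (cong (_/ 2) e')
        decide u v h (inr (inl (_ , e))) (inl (_ , e')) = cong (_/ 2) e ∙ sym (cong (_/ 2) e')
        decide u v h (inr (inl (_ , e))) (inr (inl (_ , e'))) = cong (_/ 2) (e ∙ sym e')
        decide u v h (inr (inr (m , e))) (inr (inr (m' , e'))) = cong (_/ 2) e ∙ half (place-of ys u) ∙ cong suc (paired m m' h) ∙ sym (cong (_/ 2) e' ∙ half (place-of ys v))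
        decide u v h (inl (refl , _)) (inr (inr (m , _))) = ⊥-elim (y∉ (subst (_∈ ys) (one x∈M (in-M m) y∈M h xy) m))
        decide u v h (inr (inr (m , _))) (inl (refl , _)) = ⊥-elim (y∉ (subst (_∈ ys) (one x∈M (in-M m) y∈M (Adj-sym h) xy) m))
        decide u v h (inr (inl (refl , _))) (inr (inr (m , _))) = ⊥-elim (x∉ (subst (_∈ ys) (one y∈M (in-M m) x∈M h (Adj-sym xy)) m))
        decide u v h (inr (inr (m , _))) (inr (inl (refl , _))) = ⊥-elim (x∉ (subst (_∈ ys) (one y∈M (in-M m) x∈M (Adj-sym h) (Adj-sym xy)) m))
    go : Dec (Any.Any (λ y → Adj x y) xs) → Result
    go (yes some) = let (y , y∈ , h) = find some ; (as , bs , e) = ∈-∃++ y∈ in pair y as bs e h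
    go (no none) = finish (layout k xs (x ∷ acc) le (Unique-resp-↭ (↭-sym perm) uniq) (λ m m' m″ → one (fwd m) (fwd m') (fwd m″)) lone') where
      perm : xs ++ x ∷ acc ↭ M
      perm = Perm.shift x xs acc
      fwd : ∀ {v} → v ∈ xs ++ x ∷ acc → v ∈ M
      fwd = Perm.∈-resp-↭ perm
      lone-x : ∀ {v} → v ∈ M → ¬ Adj x v
      lone-x (here refl) h = Adj-≢ h refl
      lone-x (there m) h = [ (λ m → none (lose m h)) , (λ m → lone m (here refl) (Adj-sym h)) ]′ (∈-++⁻ xs m)
      lone' : ∀ {u v} → u ∈ x ∷ acc → v ∈ xs ++ x ∷ acc → ¬ Adj u v
      lone' (here refl) m = lone-x (fwd m)
      lone' (there m) m' = lone m (fwd m')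
      finish : (∃ λ ys → ys ↭ xs ++ x ∷ acc × Paired ys) → Result
      finish (ys , p , paired) = ys , ↭-trans p perm , paired

place : ∀ {k} (s : Fin k → ℕ) (i : Fin k) → Fin (s i) → Fin (sum (tabulate s))
place s zero    k = k ↑ˡ sum (tabulate λ i → s (suc i))
place s (suc i) k = s zero ↑ʳ place (λ i → s (suc i)) i k

place-injective : ∀ {k} (s : Fin k → ℕ) i j (a : Fin (s i)) (b : Fin (s j)) → place s i a ≡ place s j b → i ≡ j × toℕ a ≡ toℕ b
place-injective s zero zero a b e = refl , cong toℕ (↑ˡ-injective _ a b e)
place-injective s zero (suc j) a b e = ⊥-elim (↑ˡ≢↑ʳ a _ e)
place-injective s (suc i) zero a b e = ⊥-elim (↑ˡ≢↑ʳ b _ (sym e))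
place-injective s (suc i) (suc j) a b e = let (e₁ , e₂) = place-injective (λ i → s (suc i)) i j a b (↑ʳ-injective (s zero) _ _ e) in cong suc e₁ , e₂

Kplus-adj : ∀ {k} (s : Fin k → ℕ) i j (a : Fin (s i)) (b : Fin (s j)) → (i ≡ j → toℕ a ≢ toℕ b × toℕ a / 2 ≡ toℕ b / 2) →
  adj (Kplus (tabulate s)) (place s i a) (place s j b) ≡ true
Kplus-adj s zero zero a b h = ⊗-introˡ (matchingOn (s zero)) (Kplus (tabulate λ i → s (suc i))) {a} {b}
  (fromRel-intro {s zero} (λ i j → toℕ i / 2 ≡ᵇ toℕ j / 2) {a} {b} (λ e → fst (h refl) (cong toℕ e)) (inl (≡⇒≡ᵇ-true (snd (h refl)))))
Kplus-adj s zero (suc j) a b h = ⊗-cross (matchingOn (s zero)) (Kplus (tabulate λ i → s (suc i))) a (place (λ i → s (suc i)) j b)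
Kplus-adj s (suc i) zero a b h = Graphs.Adj-sym (Kplus (tabulate s)) {b ↑ˡ sum (tabulate λ i → s (suc i))} {s zero ↑ʳ place (λ i → s (suc i)) i a}
  (⊗-cross (matchingOn (s zero)) (Kplus (tabulate λ i → s (suc i))) b (place (λ i → s (suc i)) i a))
Kplus-adj s (suc i) (suc j) a b h = ⊗-introʳ (matchingOn (s zero)) (Kplus (tabulate λ i → s (suc i))) {place (λ i → s (suc i)) i a} {place (λ i → s (suc i)) j b}
  (Kplus-adj (λ i → s (suc i)) i j a b λ e → h (cong suc e))

Kplus-class : ∀ {k} (s : Fin k → ℕ) → Fin (sum (tabulate s)) → Fin k
Kplus-class {suc k} s x = [ (λ _ → zero) , (λ y → suc (Kplus-class (λ i → s (suc i)) y)) ]′ (splitAt (s zero) x)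

Kplus-matched : ∀ {k} (s : Fin k → ℕ) {x y z} → adj (Kplus (tabulate s)) x y ≡ true → adj (Kplus (tabulate s)) x z ≡ true →
  Kplus-class s x ≡ Kplus-class s y → Kplus-class s x ≡ Kplus-class s z → y ≡ z
Kplus-matched {suc k} s {x} {y} {z} xy xz e e' = go (splitAt (s zero) x) (splitAt (s zero) y) (splitAt (s zero) z) refl refl
    (⊗-elim A B x y xy) (⊗-elim A B x z xz) e e' where
  A = matchingOn (s zero)
  B = Kplus (tabulate λ i → s (suc i))
  class : Fin (s zero) ⊎ Fin (sum (tabulate λ i → s (suc i))) → Fin (suc k)
  class = [ (λ _ → zero) , (λ y → suc (Kplus-class (λ i → s (suc i)) y)) ]′
  pair-of : ∀ {u v} → adj A u v ≡ true → toℕ u ≢ toℕ v × toℕ u / 2 ≡ toℕ v / 2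
  pair-of {u} {v} h = let (ne , k) = fromRel-elim (λ i j → toℕ i / 2 ≡ᵇ toℕ j / 2) {u} {v} h in (λ e → ne (toℕ-injective e)) , [ ≡ᵇ-true , (λ h → sym (≡ᵇ-true h)) ]′ k
  go : ∀ s₁ s₂ s₃ → splitAt (s zero) y ≡ s₂ → splitAt (s zero) z ≡ s₃ → Block ⊤ A B s₁ s₂ → Block ⊤ A B s₁ s₃ → class s₁ ≡ class s₂ → class s₁ ≡ class s₃ → y ≡ z
  go (inl a) (inl b) (inl c) eb ec h h' _ _ = sym (splitAt⁻¹-↑ˡ eb) ∙ cong (_↑ˡ sum (tabulate λ i → s (suc i)))
    (toℕ-injective (two-in-pair {toℕ a} (snd (pair-of {a} {b} h)) (snd (pair-of {a} {c} h')) (fst (pair-of {a} {b} h)) (fst (pair-of {a} {c} h')))) ∙ splitAt⁻¹-↑ˡ ec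
  go (inr a) (inr b) (inr c) eb ec h h' e e' = sym (splitAt⁻¹-↑ʳ eb) ∙ cong (s zero ↑ʳ_)
    (Kplus-matched (λ i → s (suc i)) {a} {b} {c} h h' (suc-injective e) (suc-injective e')) ∙ splitAt⁻¹-↑ʳ ec

Kplus-free : ∀ {q ρ m} → 1 ≤ q → suc q ≤ m → suc (suc ρ) < m → (s : Fin (2 + ρ) → ℕ) → ForbiddenFree q ρ m (Kplus (tabulate s))
Kplus-free 1≤q q<m r<m s = Restrictions.matched-classes-free (Kplus (tabulate s)) 1≤q q<m r<m (Kplus-class s) λ {u} {v} {w} → Kplus-matched s {u} {v} {w}

module PairIso {n r : ℕ} (G : Graph n) (cls : Fin n → Fin r)
    (class-matching : ∀ i v → is i (just (cls v)) ≡ true → Graphs.d G v (λ u → is i (just (cls u))) ≤ 1) where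
  open Graphs G
  open Position {n}
  open Layout G
  open ClassCount G (λ v → just (cls v))

  sizes : Fin r → ℕ
  sizes i = # (Cl i)

  one : ∀ i {u v w} → Cl i u ≡ true → Cl i v ≡ true → Cl i w ≡ true → Adj u v → Adj u w → v ≡ w
  one i {u} {v} {w} cu cv cw uv uw = go (v ≟ᶠ w) where
    go : Dec (v ≡ w) → v ≡ w
    go (yes e) = e
    go (no ne) = ⊥-elim (<-irrefl refl (Many⇒≤# (adj G u ∩ Cl i) (many (λ { zero → v ; (suc zero) → w })
      (λ { {zero} {zero} _ → refl ; {zero} {suc zero} e → ⊥-elim (ne e) ; {suc zero} {zero} e → ⊥-elim (ne (sym e)) ; {suc zero} {suc zero} _ → refl })
      λ { zero → ∧-intro uv cv ; (suc zero) → ∧-intro uw cw }) & class-matching i u cu))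

  opaque
    -- Listing matched vertices in consecutive places with equal halves turns the matching in a
    -- class into a subgraph of `matchingOn`.
    ordering : ∀ i → ∃ λ ys → (∀ v → Cl i v ≡ true → v ∈ ys) × length ys ≡ sizes i × Paired ys
    ordering i = start (pick (# (Cl i)) (Cl i) ≤-refl) where
      start : Many (# (Cl i)) (λ v → Cl i v ≡ true) → ∃ λ ys → (∀ v → Cl i v ≡ true → v ∈ ys) × length ys ≡ sizes i × Paired ys
      start (many at at-inj at-sat) = finish (layout (length xs) xs [] ≤-refl (subst Unique (sym (++-identityʳ xs)) xs-unique)
          (λ m m' m″ → one i (in-class m) (in-class m') (in-class m″)) λ ()) where
        xs : List V
        xs = tabulate at
        xs-unique : Unique xs
        xs-unique = Uniqueₚ.tabulate⁺ at-inj
        in-class : ∀ {v} → v ∈ xs ++ [] → Cl i v ≡ true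
        in-class m = let (k , e) = ∈-tabulate⁻ {f = at} (subst (_ ∈_) (++-identityʳ xs) m) in cong (Cl i) e ∙ at-sat k
        covers : ∀ v → Cl i v ≡ true → v ∈ xs
        covers v cv = let (k , e) = Many-onto (Cl i) (many at at-inj at-sat) cv in subst (_∈ xs) (sym e) (∈-tabulate⁺ {f = at} k)
        finish : (∃ λ ys → ys ↭ xs ++ [] × Paired ys) → ∃ λ ys → (∀ v → Cl i v ≡ true → v ∈ ys) × length ys ≡ sizes i × Paired ys
        finish (ys , p , paired) = ys , (λ v cv → Perm.∈-resp-↭ (↭-sym p) (∈-++⁺ˡ (covers v cv))) ,
          Perm.↭-length p ∙ cong length (++-identityʳ xs) ∙ length-tabulate at , paired

  seat : Fin r → V → ℕ
  seat i = place-of (fst (ordering i))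

  own : ∀ v → Cl (cls v) v ≡ true
  own v = is⁺ (cls v) refl

  seat< : ∀ i v → Cl i v ≡ true → seat i v < sizes i
  seat< i v cv = place-< (fst (ordering i)) (fst (snd (ordering i)) v cv) &= fst (snd (snd (ordering i)))

  seatᶠ : ∀ v → Fin (sizes (cls v))
  seatᶠ v = fromℕ< (seat< (cls v) v (own v))

  toℕ-seat : ∀ v → toℕ (seatᶠ v) ≡ seat (cls v) v
  toℕ-seat v = toℕ-fromℕ< (seat< (cls v) v (own v))

  f : V → Fin (sum (tabulate sizes))
  f v = place sizes (cls v) (seatᶠ v)

  seat-inj : ∀ i {u v} → Cl i u ≡ true → Cl i v ≡ true → seat i u ≡ seat i v → u ≡ v
  seat-inj i {u} {v} cu cv = place-inj (fst (ordering i)) (fst (snd (ordering i)) u cu) (fst (snd (ordering i)) v cv)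

  f-inj : ∀ {u v} → f u ≡ f v → u ≡ v
  f-inj {u} {v} e = go (place-injective sizes (cls u) (cls v) (seatᶠ u) (seatᶠ v) e) where
    go : cls u ≡ cls v × toℕ (seatᶠ u) ≡ toℕ (seatᶠ v) → u ≡ v
    go (c , s) = seat-inj (cls v) (cong (λ c → is (cls v) (just c)) c ∙ own v) (own v)
      (cong (λ i → seat i u) (sym c) ∙ sym (toℕ-seat u) ∙ s ∙ toℕ-seat v)

  total : sum (tabulate sizes) ≡ n
  total = sum-tabulate' sizes ∙ ∑-Cl ∙ #-full n where
    sum-tabulate' : ∀ {k} (s : Fin k → ℕ) → sum (tabulate s) ≡ ∑ s
    sum-tabulate' {zero}  s = sym (∑-empty s)
    sum-tabulate' {suc k} s = cong (s zero +_) (sum-tabulate' λ i → s (suc i)) ∙ sym (∑-suc s)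

  iso : edgeCount (Kplus (tabulate sizes)) ≤ edgeCount G → G ≅ Kplus (tabulate sizes)
  iso = spanning-iso (sym total) G (Kplus (tabulate sizes)) f f-inj λ u v h → Kplus-adj sizes (cls u) (cls v) (seatᶠ u) (seatᶠ v) (pairs u v h) where
    pairs : ∀ u v → Adj u v → cls u ≡ cls v → toℕ (seatᶠ u) ≢ toℕ (seatᶠ v) ×
      toℕ (seatᶠ u) / 2 ≡ toℕ (seatᶠ v) / 2
    pairs u v h c = (λ s → Adj-≢ h (seat-inj (cls v) cu (own v) (sym su ∙ s ∙ toℕ-seat v))) ,
        cong (_/ 2) su ∙ snd (snd (snd (ordering (cls v)))) (fst (snd (ordering (cls v))) u cu) (fst (snd (ordering (cls v))) v (own v)) h ∙
          cong (_/ 2) (sym (toℕ-seat v)) where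
      cu : Cl (cls v) u ≡ true
      cu = cong (λ c → is (cls v) (just c)) c ∙ own v
      su : toℕ (seatᶠ u) ≡ seat (cls v) u
      su = toℕ-seat u ∙ cong (λ i → seat i u) c

-- Sharp bounds from the two fingerprints.

record ApexStructure {n : ℕ} (q ρ : ℕ) (G : Graph n) : Set where
  field
    cls         : Fin n → Maybe (Fin (2 + ρ))
    apexes      : # (isN ∘ cls) ≡ q
    base        : ℕ
    sizes       : ∀ i → # (is i ∘ cls) ≡ base ⊎ # (is i ∘ cls) ≡ suc base
    independent : ∀ i {v v'} → is i (cls v) ≡ true → is i (cls v') ≡ true → ¬ Graphs.Adj G v v'

record PairStructure {n : ℕ} (ρ : ℕ) (G : Graph n) : Set where
  field
    cls      : Fin n → Fin (2 + ρ)
    matching : ∀ i v → is i (just (cls v)) ≡ true → Graphs.d G v (λ u → is i (just (cls u))) ≤ 1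
    base     : ℕ
    sizes    : ∀ i → base ≤ # (λ v → is i (just (cls v))) × # (λ v → is i (just (cls v))) ≤ base + 2

-- E stands for twice the number of edges throughout.
Optimal : ∀ {n} → (ℕ → ℕ) → Graph n → Set → Set
Optimal {n} h G S = Graphs.E G full full ≤ h n × (h n ≤ Graphs.E G full full → S)

module ApexBound {n : ℕ} (q ρ m : ℕ) (G : Graph n) (free : ForbiddenFree q ρ m G) (κ smax : ℕ) (1≤q : 1 ≤ q)
    (w≤κ : Widths.width q m < κ) (κ≤smax : 2 * κ ≤ smax) (del : Weights.Deletion G q ρ smax)
    (T : Apexes G q (2 + ρ) (2 * κ)) where
  open Graphs G
  open Profile ρ
  private module A = ApexEnd q ρ m G free κ smax 1≤q w≤κ κ≤smax del T
  open ClassCount G A.cls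

  private
    r a : ℕ
    r = suc (suc ρ)
    -- The tangent is taken at the rounded-down average class size; `1 *` is the factor `suc σ` of
    -- the profile with `σ = 0`.
    a = N / (1 * r)

    level₀ : level 0 a ≡ a * suc a
    level₀ = +-identityʳ _

    tangent : ∀ i → suc (2 * (1 * a)) * # (Cl i) + 0 ≤ # (Cl i) * # (Cl i) + level 0 a
    tangent i = fst (square-tangent a (# (Cl i))) &= cong (# (Cl i) * # (Cl i) +_) (sym level₀)

    balance : N * N + ∑ {r} (λ _ → 0) ≤ profile 0 0 N + A.squares × (profile 0 0 N + A.squares ≤ N * N + ∑ {r} (λ _ → 0) →
      ∀ i → suc (2 * (1 * a)) * # (Cl i) + 0 ≡ # (Cl i) * # (Cl i) + level 0 a)
    balance = convex-balance (λ i → # (Cl i)) (λ _ → 0) (level 0 a) (suc (2 * (1 * a))) ∑-Cl (profile-at 0 N) tangent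

    zero-sum : N * N + ∑ {r} (λ _ → 0) ≡ N * N
    zero-sum = cong (N * N +_) (∑-zero {r} λ _ → refl) ∙ +-identityʳ _

    total : profile q 0 n + q ≡ q * q + 2 * q * N + profile 0 0 N
    total = cong (λ k → profile q 0 k + q) (sym (+-comm q N ∙ A.N+q)) ∙ profile-shift q 0 N

  optimal : Optimal (profile q 0) G (ApexStructure q ρ G)
  optimal = arith₁ {_} {A.squares} {q} {q * q + 2 * q * N} {N * N} {profile 0 0 N} A.upper (sym zero-sum =& fst balance) total , λ tight → record
      { cls = A.cls ; apexes = A.#Ap ; base = a
      ; sizes = λ i → snd (square-tangent a (# (Cl i))) (snd balance (arith₂ {_} {A.squares} {q} {q * q + 2 * q * N} {N * N} {profile 0 0 N} tight A.upper total &= sym zero-sum) i ∙ cong (# (Cl i) * # (Cl i) +_) level₀)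
      ; independent = A.independent (arith₃ {_} {A.squares} {q} {q * q + 2 * q * N} {N * N} {profile 0 0 N} tight (sym zero-sum =& fst balance) total) } where
    arith₁ : ∀ {e s q x NN F p} → e + s + q ≤ x + NN → NN ≤ F + s → p + q ≡ x + F → e ≤ p
    arith₁ {e} {s} {q} {x} {NN} {F} {p} h₁ h₂ h₃ = lin 0 (+-mono-≤ (+-mono-≤ h₁ h₂) (≤-reflexive (sym h₃))) (lem e s q x NN F p) where
      lem : ∀ e s q x NN F p → e + (x + NN + (F + s) + (p + q)) + 0 ≡ p + (e + s + q + NN + (x + F))
      lem = solve-∀
    arith₂ : ∀ {e s q x NN F p} → p ≤ e → e + s + q ≤ x + NN → p + q ≡ x + F → F + s ≤ NN
    arith₂ {e} {s} {q} {x} {NN} {F} {p} h₁ h₂ h₃ = lin 0 (+-mono-≤ (+-mono-≤ h₁ h₂) (≤-reflexive (sym h₃))) (lem e s q x NN F p) where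
      lem : ∀ e s q x NN F p → F + s + (e + (x + NN) + (p + q)) + 0 ≡ NN + (p + (e + s + q) + (x + F))
      lem = solve-∀
    arith₃ : ∀ {e s q x NN F p} → p ≤ e → NN ≤ F + s → p + q ≡ x + F → x + NN ≤ e + s + q
    arith₃ {e} {s} {q} {x} {NN} {F} {p} h₁ h₂ h₃ = lin 0 (+-mono-≤ (+-mono-≤ h₁ h₂) (≤-reflexive (sym h₃))) (lem e s q x NN F p) where
      lem : ∀ e s q x NN F p → x + NN + (e + (F + s) + (p + q)) + 0 ≡ e + s + q + (p + NN + (x + F))
      lem = solve-∀

module PairBound {n : ℕ} (q ρ m : ℕ) (G : Graph n) (free : ForbiddenFree q ρ m G) (K smax : ℕ) (r≡2q : suc (suc ρ) ≡ 2 * q)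
    (4w<K : 4 * Widths.width q m < K) (K≤smax : 2 * K ≤ smax) (del : Weights.Deletion G q ρ smax)
    (T : Pairs G (2 + ρ) K) where
  open Graphs G
  open Profile ρ
  private module B = PairEnd q ρ m G free K smax r≡2q 4w<K K≤smax del T
  open ClassCount G (λ v → just (B.cls v))

  private
    r c : ℕ
    r = suc (suc ρ)
    c = n / (2 * r)

    balance : n * n + ∑ (λ i → 2 * (# (Cl i) / 2)) ≤ profile 0 1 n + ∑ (λ i → # (Cl i) * # (Cl i)) ×
      (profile 0 1 n + ∑ (λ i → # (Cl i) * # (Cl i)) ≤ n * n + ∑ (λ i → 2 * (# (Cl i) / 2)) →
        ∀ i → suc (2 * (2 * c)) * # (Cl i) + 2 * (# (Cl i) / 2) ≡ # (Cl i) * # (Cl i) + level 1 c)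
    balance = convex-balance (λ i → # (Cl i)) (λ i → 2 * (# (Cl i) / 2)) (level 1 c) (suc (2 * (2 * c))) (∑-Cl ∙ #-full n) (profile-at 1 n)
      λ i → fst (matching-tangent c (# (Cl i)))

  optimal : Optimal (profile 0 1) G (PairStructure ρ G)
  optimal = arith₁ {E full full} {∑ (λ i → # (Cl i) * # (Cl i))} {∑ (λ i → 2 * (# (Cl i) / 2))} {n * n} B.upper (fst balance) , λ tight → record
      { cls = B.cls ; matching = B.class-matching ; base = 2 * c
      ; sizes = λ i → snd (matching-tangent c (# (Cl i))) (snd balance (arith₂ {E full full} {∑ (λ i → # (Cl i) * # (Cl i))} {∑ (λ i → 2 * (# (Cl i) / 2))} {n * n} tight B.upper) i) } where
    arith₁ : ∀ {e s ω NN F} → e + s ≤ ω + NN → NN + ω ≤ F + s → e ≤ F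
    arith₁ {e} {s} {ω} {NN} {F} h₁ h₂ = lin 0 (+-mono-≤ h₁ h₂) (lem e s ω NN F) where
      lem : ∀ e s ω NN F → e + (ω + NN + (F + s)) + 0 ≡ F + (e + s + (NN + ω))
      lem = solve-∀
    arith₂ : ∀ {e s ω NN F} → F ≤ e → e + s ≤ ω + NN → F + s ≤ NN + ω
    arith₂ {e} {s} {ω} {NN} {F} h₁ h₂ = lin 0 (+-mono-≤ h₁ h₂) (lem e s ω NN F) where
      lem : ∀ e s ω NN F → F + s + (e + (ω + NN)) + 0 ≡ NN + ω + (F + (e + s))
      lem = solve-∀

Apexes-≤ : ∀ {n} {G : Graph n} {q r K K'} → K' ≤ K → Apexes G q r K → Apexes G q r K'
Apexes-≤ le T = record
  { apex = apex ; apex-inj = apex-inj ; apex-adj = λ z i a → apex-adj z i (inject≤ a le)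
  ; rows = record { cell = λ i a → cell rows i (inject≤ a le) ; cell-inj = λ i e → inject≤-injective le le _ _ (cell-inj rows i e) ; cell-adj = λ a b → cell-adj rows _ _ } }
  where open Apexes T

Pairs-≤ : ∀ {n} {G : Graph n} {r K K'} → K' ≤ K → Pairs G r K → Pairs G r K'
Pairs-≤ le T = record
  { end = λ i k → end i (inject≤ k le)
  ; end-inj = λ i e → inject≤-injective le le _ _ (fst (end-inj i e)) , snd (end-inj i e)
  ; end-edge = λ i k → end-edge i (inject≤ k le) ; end-adj = λ k k' → end-adj (inject≤ k le) (inject≤ k' le) }
  where open Pairs T

module Thresholds (q ρ m : ℕ) where
  open Widths q m renaming (width to w)

  private
    r : ℕ
    r = suc (suc ρ)

  opaque
    -- The copies demanded per class: `2 * c` supplies the representatives when one class has edges,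
    -- and `8 * w + 4` covers both endgames, which use `2 * suc w` cells or `suc (4 * w)` pairs per
    -- row.
    Kf : ℕ → ℕ
    Kf c = 2 * c + (8 * w + 4)

    Kf-mono : Monotone Kf
    Kf-mono le = +-monoˡ-≤ (8 * w + 4) (*-monoʳ-≤ 2 le)

    Kf-large : ∀ c → 8 * w + 4 ≤ Kf c
    Kf-large c = m≤n+m _ (2 * c)

    Kf-2c : ∀ c → 2 * c ≤ Kf c
    Kf-2c c = m≤m+n (2 * c) _

  open ConfigConst q ρ m Kf Kf-mono using (n₁; c₂)

  opaque
    -- `smax` bounds the vertices deleted per class, and `reach` is large enough for a whole
    -- deletion. Both depend only on the parameters, since `c₂` bounds the copy size for all graphs
    -- at once.
    smax reach : ℕ
    smax  = 2 * c₂ + (8 * w + 4)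
    reach = suc (r * smax)

    n₀ : ℕ
    n₀ = n₁ + (q + reach)

    2c≤smax : ∀ {c} → c ≤ c₂ → 2 * c ≤ smax
    2c≤smax le = *-monoʳ-≤ 2 le & m≤m+n _ _

    w≤smax : 8 * w + 4 ≤ smax
    w≤smax = m≤n+m _ (2 * c₂)

    1≤reach : 1 ≤ reach
    1≤reach = s≤s z≤n

    block≤reach : ∀ {s} → s ≤ smax → r * s ≤ reach
    block≤reach le = *-monoʳ-≤ r le & n≤1+n _

    n₁≤n₀ : n₁ ≤ n₀
    n₁≤n₀ = m≤m+n n₁ _

    reach≤n₀ : q + reach ≤ n₀
    reach≤n₀ = m≤n+m _ n₁

module Structure {n : ℕ} (q ρ m : ℕ) (1≤q : 1 ≤ q) (r≤2q : suc (suc ρ) ≤ 2 * q) (G : Graph n) (free : ForbiddenFree q ρ m G) (md : MinDegree ρ G)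
    (del : Weights.Deletion G q ρ (Thresholds.smax q ρ m)) (large : Thresholds.n₀ q ρ m ≤ n) where
  open Widths q m renaming (width to w)
  open Thresholds q ρ m
  open ConfigConst q ρ m Kf Kf-mono using (c₂)

  private
    r : ℕ
    r = suc (suc ρ)

    Goal : Set
    Goal = Optimal (Profile.profile ρ q 0) G (ApexStructure q ρ G) ⊎ (suc (suc ρ) ≡ 2 * q × Optimal (Profile.profile ρ 0 1) G (PairStructure ρ G))

    w-bound : ∀ w → w ≤ 8 * w + 4
    w-bound w = lin (7 * w + 4) (z≤n {0}) (lem w) where
      lem : ∀ w → w + 0 + (7 * w + 4) ≡ 8 * w + 4 + 0
      lem = solve-∀
    2κ-bound : ∀ w → 2 * suc w ≤ 8 * w + 4
    2κ-bound w = lin (6 * w + 2) (z≤n {0}) (lem w) where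
      lem : ∀ w → 2 * suc w + 0 + (6 * w + 2) ≡ 8 * w + 4 + 0
      lem = solve-∀
    K-bound : ∀ w → suc (4 * w) ≤ 8 * w + 4
    K-bound w = lin (4 * w + 3) (z≤n {0}) (lem w) where
      lem : ∀ w → suc (4 * w) + 0 + (4 * w + 3) ≡ 8 * w + 4 + 0
      lem = solve-∀
    2K-bound : ∀ w → 2 * suc (4 * w) ≤ 8 * w + 4
    2K-bound w = lin 2 (z≤n {0}) (lem w) where
      lem : ∀ w → 2 * suc (4 * w) + 0 + 2 ≡ 8 * w + 4 + 0
      lem = solve-∀

    from-apexes : ∀ {K} → 8 * w + 4 ≤ K → Apexes G q r K → Goal
    from-apexes le T = inl (ApexBound.optimal q ρ m G free (suc w) smax 1≤q ≤-refl (2κ-bound w & w≤smax) del (Apexes-≤ (2κ-bound w & le) T))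

    from-pairs : ∀ {K} → 8 * w + 4 ≤ K → r ≡ 2 * q × Pairs G r K → Goal
    from-pairs le (e , T) = inr (e , PairBound.optimal q ρ m G free (suc (4 * w)) smax e ≤-refl (2K-bound w & w≤smax) del (Pairs-≤ (K-bound w & le) T))

    module _ (c K : ℕ) (le : 8 * w + 4 ≤ K) (2c≤K : 2 * c ≤ K) (c≤ : 2 * c ≤ smax) (C : Config ρ G c K) where
      private
        w≤K : w ≤ K
        w≤K = w-bound w & le
        k₀ = CaseSetup.k₀ q ρ m G free c K smax C w≤K 2c≤K c≤ del

        Edge : Fin r → Set
        Edge j = ∃ λ a → ∃ λ b → adj G (Config.P C j k₀ a) (Config.P C j k₀ b) ≡ true

        edge? : ∀ j → Dec (Edge j)
        edge? j = any? λ a → any? λ b → adj G (Config.P C j k₀ a) (Config.P C j k₀ b) ≟ᵇ true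

        Single : Fin r → Set
        Single i₀ = ∀ j → j ≢ i₀ → ¬ Edge j

        single? : ∀ i₀ → Dec (Single i₀)
        single? i₀ = all? λ j → ¬? (j ≟ᶠ i₀) →-dec ¬? (edge? j)

      from-config : Goal
      from-config = go (any? single?) where
        go : Dec (∃ λ i₀ → Single i₀) → Goal
        go (yes (i₀ , single)) = from-apexes le (CaseI.apexes-exist q ρ m G free c K smax C w≤K 2c≤K c≤ del i₀
          λ j ne k a b → Config.Γ-same C j k k₀ a b ∙ (¬true⇒false λ h → single j ne (a , b , h)))
        go (no none) = from-pairs le (CaseII.pairs-exist q ρ m G free c K smax C w≤K 2c≤K c≤ del r≤2q two) where
          two : ∀ i₀ → ∃ λ j → j ≢ i₀ × Edge j
          two i₀ = decide (any? λ j → ¬? (j ≟ᶠ i₀) ×-dec edge? j) where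
            decide : Dec (∃ λ j → j ≢ i₀ × Edge j) → ∃ λ j → j ≢ i₀ × Edge j
            decide (yes p) = p
            decide (no ¬p) = ⊥-elim (none (i₀ , λ j ne h → ¬p (j , ne , h)))

    finish : (∃ λ c → c ≤ c₂ × Config ρ G c (Kf c)) → Goal
    finish (c , c≤ , C) = from-config c (Kf c) (Kf-large c) (Kf-2c c) (2c≤smax c≤) C

  ends : Goal
  ends = finish (ConfigMain.config q ρ m G free md 1≤q Kf Kf-mono (λ c → (s≤s z≤n & m≤n+m 4 (8 * w)) & Kf-large c) (n₁≤n₀ & large))

-- Robust graphs and descent.

induced-E : ∀ {n} (G : Graph n) (Q : Fin n → Bool) (M : Many (# Q) (λ v → Q v ≡ true)) →
  Graphs.E G Q Q ≤ Graphs.E (induce G (Many.at M)) full full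
induced-E G Q M@(many at at-inj at-sat) = enum (λ v → Graphs.d G v Q) & (∑-mono λ k → ((#-∑ (adj G (at k) ∩ Q)) ∙ (∑-cong λ w → flip𝟙 (adj G (at k) w) (Q w))) =&
    enum (λ w → 𝟙 (adj G (at k) w)) &= (sym (#-∑ (λ l → adj G (at k) (at l))) ∙ ≤-antisym
      (#-mono {P = λ l → adj G (at k) (at l)} {Q = adj (induce G at) k ∩ full} λ l h → ∧-intro h refl)
      (#-mono {P = adj (induce G at) k ∩ full} {Q = λ l → adj G (at k) (at l)} λ l → ∧-elimˡ) ∙ sym (+-identityʳ _))) where
  flip𝟙 : ∀ a b → 𝟙 (a ∧ b) ≡ 𝟙 b * 𝟙 a
  flip𝟙 true  true  = refl
  flip𝟙 true  false = refl
  flip𝟙 false true  = refl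
  flip𝟙 false false = refl
  lsum-tabulate : ∀ {k n} (f : Fin n → ℕ) (g : Fin k → Fin n) → lsum f (tabulate g) ≡ ∑ (λ i → f (g i))
  lsum-tabulate {zero}  f g = sym (∑-empty _)
  lsum-tabulate {suc k} f g = cong (f (g zero) +_) (lsum-tabulate f λ i → g (suc i)) ∙ sym (∑-suc λ i → f (g i))
  enum : ∀ (f : _ → ℕ) → ∑ (λ v → 𝟙 (Q v) * f v) ≤ ∑ (λ k → f (at k))
  enum f = (∑-mono λ v → *-monoˡ-≤ (f v) (mono v (bool (Q v)))) & ∑-member f (tabulate at) (Uniqueₚ.tabulate⁺ at-inj) &= lsum-tabulate f at where
    mono : ∀ v → Q v ≡ true ⊎ Q v ≡ false → 𝟙 (Q v) ≤ 𝟙 (memᵇ (tabulate at) v)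
    mono v (inl e) = let (k , h) = Many-onto Q M e in cong 𝟙 e =& ≤-reflexive (cong 𝟙 (sym (dec-true (v ∈ᶠ? tabulate at) (subst (_∈ tabulate at) (sym h) (∈-tabulate⁺ {f = at} k)))))
    mono v (inr e) = cong 𝟙 e =& z≤n

ForbiddenFree-⊆ : ∀ {k n q ρ m} {H : Graph k} {G : Graph n} → H ⊆ᴳ G → ForbiddenFree q ρ m G → ForbiddenFree q ρ m H
ForbiddenFree-⊆ {q = q} {ρ} {m} {H} {G} (f , inj , pres) free = record { noF₁ = λ e → noF₁ (lift (((path (2 + 2 * q) ∪ᴳ edgeless m) ⊗ᴳ turan (m * suc ρ) (suc ρ))) e)
  ; noF₂ = λ e → noF₂ (lift ((path 3 ∪ᴳ copies m (complete 2)) ⊗ᴳ copies m (complete 2) ⊗ᴳ turan (m * ρ) ρ) e)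
  ; noF₃ = λ e → noF₃ (lift ((complete (suc q) ∪ᴳ complete (suc (2 * q)) ∪ᴳ edgeless m) ⊗ᴳ turan (m * suc ρ) (suc ρ)) e) } where
  open ForbiddenFree free
  lift : ∀ {a} (F : Graph a) → F ⊆ᴳ H → F ⊆ᴳ G
  lift F (g , g-inj , g-pres) = f ∘ g , (λ x y e → g-inj x y (inj _ _ e)) , λ u v h → pres _ _ (g-pres u v h)

-- Deleting few vertices does not make the graph relatively denser.
Robust : ∀ {n} → (ℕ → ℕ) → ℕ → Graph n → Set
Robust {n} h d G = ∀ P → 1 ≤ # P → # P ≤ d → Graphs.E G (∁ P) (∁ P) + h n ≤ Graphs.E G full full + h (n ∸ # P)

module _ {n : ℕ} (G : Graph n) where
  open Graphs G

  -- The search runs over `Subset n`, which is finite and decidable, and is transferred to Boolean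
  -- predicates pointwise.
  robust? : ∀ h δ → Robust h δ G ⊎ ∃ λ P → 1 ≤ # P × # P ≤ δ × E full full + h (n ∸ # P) < E (∁ P) (∁ P) + h n
  robust? h δ = go (anySubset? dense?) where
    Dense : (V → Bool) → Set
    Dense P = 1 ≤ # P × # P ≤ δ × E full full + h (n ∸ # P) < E (∁ P) (∁ P) + h n
    dense? : (p : Subset n) → Dec (Dense (Vec.lookup p))
    dense? p = (1 ≤? # (Vec.lookup p)) ×-dec (# (Vec.lookup p) ≤? δ) ×-dec (E full full + h (n ∸ # (Vec.lookup p)) <? E (∁ (Vec.lookup p)) (∁ (Vec.lookup p)) + h n)
    #-cong : ∀ {P Q : V → Bool} → (∀ v → P v ≡ Q v) → # P ≡ # Q
    #-cong {P} {Q} e = (#-∑ P) ∙ (∑-cong λ v → cong 𝟙 (e v)) ∙ sym (#-∑ Q)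
    E-cong : ∀ {P Q : V → Bool} → (∀ v → P v ≡ Q v) → E P P ≡ E Q Q
    E-cong {P} {Q} e = ∑-cong λ v → cong₂ _*_ (cong 𝟙 (e v)) (#-cong {adj G v ∩ P} {adj G v ∩ Q} λ w → cong (adj G v w ∧_) (e w))
    go : Dec (∃ λ p → Dense (Vec.lookup p)) → Robust h δ G ⊎ ∃ Dense
    go (yes (p , h)) = inr (Vec.lookup p , h)
    go (no none) = inl λ P pos le → ≮⇒≥ λ lt → none (Vec.tabulate P , as P pos le lt) where
      as : ∀ P → 1 ≤ # P → # P ≤ δ → E full full + h (n ∸ # P) < E (∁ P) (∁ P) + h n → Dense (Vec.lookup (Vec.tabulate P))
      as P pos le lt = pos &= (sym #≡) , #≡ =& le ,
          subst₂ (λ x y → E full full + h (n ∸ x) < y + h n) (sym #≡) (sym (E-cong {∁ (Vec.lookup (Vec.tabulate P))} {∁ P} λ v → cong not (Vecₚ.lookup∘tabulate P v))) lt where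
        #≡ : # (Vec.lookup (Vec.tabulate P)) ≡ # P
        #≡ = #-cong {Vec.lookup (Vec.tabulate P)} {P} (Vecₚ.lookup∘tabulate P)

  module _ {h : ℕ → ℕ} {δ ρ : ℕ} (robust : Robust h δ G) where
    private
      r : ℕ
      r = suc (suc ρ)

    -- Delete a single vertex: its doubled degree is at least the last increment of `h`.
    robust-degree : 1 ≤ δ → (∀ n → h n + 2 * (n ∸ n / r) ≤ h (suc n)) → MinDegree ρ G
    robust-degree 1≤δ h-suc v = go n refl where
      #v : # (isᵇ v) ≡ 1
      #v = ≤-antisym (#≤1 (isᵇ v) λ x y hx hy → from-does (x ≟ᶠ v) hx ∙ sym (from-does (y ≟ᶠ v) hy)) (#-pos (isᵇ v) {v} (dec-true (v ≟ᶠ v) refl))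
      go : ∀ k → n ≡ k → suc ρ * n ≤ r * Graphs.d G v full + r
      go zero e = ⊥-elim (none (subst Fin e v)) where
        none : Fin 0 → ⊥
        none ()
      go (suc k) e = subst (λ n → suc ρ * n ≤ r * Graphs.d G v full + r) (sym e) (arith ρ k {E (∁ (isᵇ v)) (∁ (isᵇ v))} {h k} {k ∸ k / r} {Graphs.d G v full} {k / r}
          (+-monoʳ-≤ (E (∁ (isᵇ v)) (∁ (isᵇ v))) (h-suc k &= cong h (sym e)) &
            robust (isᵇ v) (≤-reflexive (sym #v)) (#v =& 1≤δ) &=
              (cong₂ _+_ (E-remove full v refl) (cong h ((cong₂ _∸_ e #v) ∙ refl)))) (m≤n+m∸n k (k / r)) (m/n*n≤m k r)) where
        arith : ∀ ρ k {e h x D t} → e + (h + 2 * x) ≤ e + 2 * D + h → k ≤ t + x → t * suc (suc ρ) ≤ k → suc ρ * suc k ≤ suc (suc ρ) * D + suc (suc ρ)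
        arith ρ k {e} {h} {x} {D} {t} h₁ h₂ h₃ = lin 1 (+-mono-≤ (*-monoʳ-≤ (2 + ρ) x≤D) (+-mono-≤ (*-monoʳ-≤ (2 + ρ) h₂) h₃)) (lem ρ k x D t) where
          x≤D : x ≤ D
          x≤D = *-cancelˡ-≤ 2 (+-cancelˡ-≤ (e + h) _ _ (+-assoc e h (2 * x) =& h₁ &= lem₀ e h D)) where
            lem₀ : ∀ e h D → e + 2 * D + h ≡ e + h + 2 * D
            lem₀ = solve-∀
          lem : ∀ ρ k x D t → suc ρ * suc k + (suc (suc ρ) * D + (suc (suc ρ) * (t + x) + k)) + 1
              ≡ suc (suc ρ) * D + suc (suc ρ) + (suc (suc ρ) * x + (suc (suc ρ) * k + t * suc (suc ρ)))
          lem = solve-∀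

    -- Delete `S` itself. Robustness compares the edges lost with the growth of `h` over
    -- `r * (2 * u)` vertices, which `h-block` bounds from below.
    robust-deletion : ∀ {q smax} → (∀ {s} → s ≤ smax → r * s ≤ δ) → q + δ ≤ n →
      (∀ n u → q ≤ n → h n + (2 * suc ρ * (2 * u) * n + r * suc ρ * (2 * u * (2 * u)) + 2 * q * (2 * u)) ≤ h (n + r * (2 * u))) → Weights.Deletion G q ρ smax
    robust-deletion {q} {smax} fits large h-block zero le S uniq len = (cong₂ _+_ ((∑-cong λ v → cong (Weights.μ G S v *_) (*-zeroʳ (suc ρ))) ∙ (∑-zero λ v → *-zeroʳ (Weights.μ G S v))) (*-zeroʳ (2 * q))) =& z≤n
    robust-deletion {q} {smax} fits large h-block u@(suc _) le S uniq len = cong (_+ 2 * q * (2 * u)) ((∑-cong λ v → *-comm (μ S v) (suc ρ * (2 * u))) ∙ ∑-*ˡ (suc ρ * (2 * u)) (μ S)) =&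
      arith ρ q (2 * u) n' {s} {∑ (μ S)} {_} {h n'} {h (n' + s)} {E P P} {E P (∁ P)} {E (∁ P) (∁ P)} refl weights (h-block n' u q≤n')
        (cong (E (∁ P) (∁ P) +_) (cong h n'+s) =& robust P (pos &= sym #P) (#P =& s≤δ) &= cong₂ (λ x y → x + h (n ∸ y)) (E-split full P) #P)
        edges where
      open Weights G
      P : V → Bool
      P = memᵇ S
      s n' : ℕ
      s  = r * (2 * u)
      n' = n ∸ s
      s≤δ : s ≤ δ
      s≤δ = fits le
      pos : 1 ≤ s
      pos = s≤s z≤n
      q≤n' : q ≤ n'
      q≤n' = m+n≤o⇒m≤o∸n q (+-monoʳ-≤ q s≤δ & large)
      n'+s : n' + s ≡ n
      n'+s = m∸n+n≡m (s≤δ & m≤n+m δ q & large)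
      #P : # P ≡ s
      #P = ≤-antisym (#-memᵇ≤ S) (sym (lcount-all P S λ {x} m → dec-true (x ∈ᶠ? S) m) =& lcount≤# P S uniq) ∙ len
      -- The total weight is `2 * n' + s`, so a share of `(r - 1) * (2 * u)` per unit of weight
      -- reproduces the quadratic terms of `h-block`.
      weights : ∑ (μ S) + s ≡ 2 * (n' + s)
      weights = cong (∑ (μ S) +_) (sym #P ∙ (#-∑ P)) ∙ sym (∑-distrib-+ (μ S) (λ v → 𝟙 (P v))) ∙ (∑-cong λ v → two (P v)) ∙ ∑-const n 2 ∙ *-comm n 2 ∙ cong (2 *_) (sym n'+s) where
        two : ∀ b → weightᵇ b + 𝟙 b ≡ 2
        two true  = refl
        two false = refl
      degree : ∀ v → d v P ≤ lcount (adj G v) S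
      degree v = #≤lcount (adj G v ∩ P) (adj G v) S (λ w h → from-does (w ∈ᶠ? S) (∧-elimʳ {adj G v w} h)) λ w → ∧-elimˡ
      edges : E P P + 2 * E P (∁ P) ≤ ∑ (λ v → μ S v * lcount (adj G v) S)
      edges = (cong (λ x → E P P + 2 * x) (E-sym P (∁ P)) ∙ cong (E P P +_) (sym (∑-*ˡ 2 λ v → 𝟙 (not (P v)) * d v P)) ∙ sym (∑-distrib-+ (λ v → 𝟙 (P v) * d v P) (λ v → 2 * (𝟙 (not (P v)) * d v P)))) =&
        (∑-mono λ v → weigh (P v) (d v P) =& *-monoʳ-≤ (μ S v) (degree v)) where
        weigh : ∀ b x → 𝟙 b * x + 2 * (𝟙 (not b) * x) ≡ weightᵇ b * x
        weigh true  x = +-identityʳ (x + 0)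
        weigh false x = cong (2 *_) (+-identityʳ x)
      arith : ∀ ρ q t n' {s M W hn hns pp pc cc} → s ≡ suc (suc ρ) * t → M + s ≡ 2 * (n' + s) →
        hn + (2 * suc ρ * t * n' + suc (suc ρ) * suc ρ * (t * t) + 2 * q * t) ≤ hns → cc + hns ≤ pp + 2 * pc + cc + hn → pp + 2 * pc ≤ W →
        suc ρ * t * M + 2 * q * t ≤ W
      arith ρ q t n' {s} {M} {W} {hn} {hns} {pp} {pc} {cc} refl h₁ h₂ h₃ h₄ = lin 0 (+-mono-≤ (+-mono-≤ (≤-reflexive (cong (suc ρ * t *_) h₁)) h₂) (+-mono-≤ h₃ h₄)) (lem ρ q t n' M W hn hns pp pc cc) where
        lem : ∀ ρ q t n' M W hn hns pp pc cc → suc ρ * t * M + 2 * q * t + (suc ρ * t * (2 * (n' + suc (suc ρ) * t)) + hns + (pp + 2 * pc + cc + hn + W)) + 0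
          ≡ W + (suc ρ * t * (M + suc (suc ρ) * t) + (hn + (2 * suc ρ * t * n' + suc (suc ρ) * suc ρ * (t * t) + 2 * q * t)) + (cc + hns + (pp + 2 * pc)))
        lem = solve-∀

module Chain (q ρ m : ℕ) (1≤q : 1 ≤ q) (r≤2q : suc (suc ρ) ≤ 2 * q) (h : ℕ → ℕ)
    (h-suc : ∀ n → h n + 2 * (n ∸ n / suc (suc ρ)) ≤ h (suc n))
    (h-block : ∀ n u → q ≤ n → h n + (2 * suc ρ * (2 * u) * n + suc (suc ρ) * suc ρ * (2 * u * (2 * u)) + 2 * q * (2 * u)) ≤ h (n + suc (suc ρ) * (2 * u)))
    (apex≤h : ∀ n → Profile.profile ρ q 0 n ≤ h n) (pair≤h : suc (suc ρ) ≡ 2 * q → ∀ n → Profile.profile ρ 0 1 n ≤ h n) where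
  open Thresholds q ρ m

  Ends : ∀ {n} → Graph n → Set
  Ends {n} G = ApexStructure q ρ G ⊎ (suc (suc ρ) ≡ 2 * q × PairStructure ρ G)

  module _ {n : ℕ} (G : Graph n) (free : ForbiddenFree q ρ m G) (large : n₀ ≤ n) where
    robust-optimal : Robust h reach G → Optimal h G (Ends G)
    robust-optimal robust = finish (Structure.ends q ρ m 1≤q r≤2q G free (robust-degree G {h} {reach} {ρ} robust 1≤reach h-suc)
        (robust-deletion G {h} {reach} {ρ} robust {q} {smax} block≤reach (reach≤n₀ & large) h-block) large) where
      finish : Optimal (Profile.profile ρ q 0) G (ApexStructure q ρ G) ⊎ (suc (suc ρ) ≡ 2 * q × Optimal (Profile.profile ρ 0 1) G (PairStructure ρ G)) → Optimal h G (Ends G)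
      finish (inl (le , tight)) = le & apex≤h n , λ t → inl (tight (apex≤h n & t))
      finish (inr (e , le , tight)) = le & pair≤h e n , λ t → inr (e , tight (pair≤h e n & t))

  opaque
    -- Chosen so that `n + reach * surplus` above it, with `n < n₀`, would force a surplus exceeding
    -- the square of the order.
    threshold : ℕ
    threshold = n₀ + reach * (n₀ * n₀) + reach

    small-⊥ : ∀ {n k} → n < n₀ → k ≤ n * n → threshold ≤ n + reach * k + reach → ⊥
    small-⊥ {n} {k} lt le big = <-irrefl refl (s≤s big & +-monoˡ-≤ reach (+-mono-≤ lt (*-monoʳ-≤ reach (le & *-mono-≤ (<⇒≤ lt) (<⇒≤ lt)))))

    n₀≤threshold : n₀ ≤ threshold
    n₀≤threshold = m≤m+n n₀ _ & m≤m+n _ reach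

  -- The complement of a set witnessing non-robustness: at most `reach` vertices are lost and the
  -- surplus rises by at least one.
  descend : ∀ {n} (G : Graph n) k → ForbiddenFree q ρ m G → h n + k ≤ Graphs.E G full full →
    ∀ P → 1 ≤ # P → # P ≤ reach → Graphs.E G full full + h (n ∸ # P) < Graphs.E G (∁ P) (∁ P) + h n →
    ∃ λ n' → n' < n × n ≤ n' + reach × Σ (Graph n') λ G' → ForbiddenFree q ρ m G' × h n' + suc k ≤ Graphs.E G' full full
  descend {n} G k free dense P pos few lt = # (∁ P) , +-monoˡ-≤ (# (∁ P)) pos &= (#-∁ P) ,
      sym (+-comm (# (∁ P)) _ ∙ (#-∁ P)) =& +-monoʳ-≤ (# (∁ P)) few , induce G at ,
      ForbiddenFree-⊆ (at , (λ _ _ → at-inj) , λ _ _ → id) free ,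
      arith (subst (λ x → Graphs.E G full full + h x < Graphs.E G (∁ P) (∁ P) + h n) n∸ lt) dense & induced-E G (∁ P) M where
    M : Many (# (∁ P)) (λ v → ∁ P v ≡ true)
    M = pick (# (∁ P)) (∁ P) ≤-refl
    open Many M
    n∸ : n ∸ # P ≡ # (∁ P)
    n∸ = cong (_∸ # P) (sym (#-∁ P)) ∙ m+n∸m≡n (# P) _
    arith : ∀ {e h' e' hn k} → e + h' < e' + hn → hn + k ≤ e → h' + suc k ≤ e'
    arith {e} {h'} {e'} {hn} {k} h₁ h₂ = lin 0 (+-mono-≤ h₁ h₂) (lem e h' e' hn k) where
      lem : ∀ e h' e' hn k → h' + suc k + (e' + hn + e) + 0 ≡ e' + (suc (e + h') + (hn + k))
      lem = solve-∀

  E≤n² : ∀ {n} (G : Graph n) → Graphs.E G full full ≤ n * n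
  E≤n² {n} G = (Graphs.E-const G full full n λ v _ → #≤n (adj G v ∩ full)) &= cong (n *_) (#-full n)

  -- Strong induction on `n`. Along the descent `n + reach * surplus` does not decrease. The descent
  -- cannot end at a robust graph with `n ≥ n₀`, whose surplus is not positive, and for `n < n₀` the
  -- surplus would have to exceed `n * n`.
  no-excess : ∀ n (G : Graph n) k → ForbiddenFree q ρ m G → h n + suc k ≤ Graphs.E G full full → threshold ≤ n + reach * suc k + reach → ⊥
  no-excess = <-rec _ step where
    step : ∀ n → (∀ {n'} → n' < n → (G : Graph n') → ∀ k → ForbiddenFree q ρ m G → h n' + suc k ≤ Graphs.E G full full → threshold ≤ n' + reach * suc k + reach → ⊥) →
      (G : Graph n) → ∀ k → ForbiddenFree q ρ m G → h n + suc k ≤ Graphs.E G full full → threshold ≤ n + reach * suc k + reach → ⊥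
    step n rec G k free dense big = go (n <? n₀) where
      go : Dec (n < n₀) → ⊥
      go (yes lt) = small-⊥ lt ((m≤n+m (suc k) (h n) & dense) & E≤n² G) big
      go (no ge) = decide (robust? G h reach) where
        decide : Robust h reach G ⊎ (∃ λ P → 1 ≤ # P × # P ≤ reach × Graphs.E G full full + h (n ∸ # P) < Graphs.E G (∁ P) (∁ P) + h n) → ⊥
        decide (inl robust) = <-irrefl refl (((s≤s (m≤m+n (h n) k) &= sym (+-suc (h n) k)) & dense) & fst (robust-optimal G free (≮⇒≥ ge) robust))
        decide (inr (P , pos , few , lt)) = let (n' , n'< , n≤ , G' , free' , dense') = descend G (suc k) free dense P pos few lt in
          rec n'< G' (suc k) free' dense' (big & +-monoˡ-≤ reach (+-monoˡ-≤ (reach * suc k) n≤) &= lem n' reach k) where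
          lem : ∀ n' d k → n' + d + d * suc k + d ≡ n' + d * suc (suc k) + d
          lem = solve-∀

  -- At surplus zero a graph that is not robust would pass to a smaller graph with positive surplus,
  -- so equality forces robustness and hence the structure.
  optimal : ∀ {n} (G : Graph n) → threshold ≤ n → ForbiddenFree q ρ m G → Optimal h G (Ends G)
  optimal {n} G large free = ≮⇒≥ (λ lt → no-excess n G 0 free (+-comm (h n) 1 =& lt) (large & m≤m+n n _ & m≤m+n _ reach)) , λ tight →
      decide tight (robust? G h reach) where
    decide : h n ≤ Graphs.E G full full → Robust h reach G ⊎ (∃ λ P → 1 ≤ # P × # P ≤ reach × Graphs.E G full full + h (n ∸ # P) < Graphs.E G (∁ P) (∁ P) + h n) → Ends G
    decide tight (inl robust) = snd (robust-optimal G free (n₀≤threshold & large) robust) tight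
    decide tight (inr (P , pos , few , lt)) = ⊥-elim (let (n' , n'< , n≤ , G' , free' , dense') = descend G 0 free (+-identityʳ (h n) =& tight) P pos few lt in
      no-excess n' G' 0 free' dense' ((large & n≤) & +-monoˡ-≤ reach (m≤m+n n' _)))

-- The benchmark and the classification.

⊆-edges : ∀ {a b} {H : Graph a} {G : Graph b} → H ⊆ᴳ G → edgeCount H ≤ edgeCount G
⊆-edges {H = H} {G} (f , inj , pres) = *-cancelˡ-≤ 2 (sym (EdgeCount.E≡2edges H) =& ≤-trans
    ((∑-mono λ x → +-identityʳ _ =& row x &= sym (+-identityʳ _)) & ∑-inj f (inj _ _) (λ y → 𝟙 true * Graphs.d G y full)) (≤-reflexive (EdgeCount.E≡2edges G))) where
  row : ∀ x → Graphs.d H x full ≤ Graphs.d G (f x) full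
  row x = (#-∑ (adj H x ∩ full)) =& (∑-mono λ y → 𝟙-mono {adj H x y ∧ true} {adj G (f x) (f y) ∧ true} λ h → ∧-intro (pres x y (∧-elimˡ h)) refl) &
    ∑-inj f (inj _ _) (λ z → 𝟙 (adj G (f x) z ∧ true)) &= sym (#-∑ (adj G (f x) ∩ full))

≅⇒⊆ : ∀ {a b} {G : Graph a} {H : Graph b} → G ≅ H → G ⊆ᴳ H
≅⇒⊆ i = to , (λ x y e → sym (from-to x) ∙ cong from e ∙ from-to y) , λ u v h → preserves u v ∙ h
  where open _≅_ i

≅⇒⊇ : ∀ {a b} {G : Graph a} {H : Graph b} → G ≅ H → H ⊆ᴳ G
≅⇒⊇ {H = H} i = from , (λ x y e → sym (to-from x) ∙ cong to e ∙ to-from y) ,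
    λ u v h → sym (preserves (from u) (from v)) ∙ cong₂ (adj H) (to-from u) (to-from v) ∙ h
  where open _≅_ i

module Equivalence (q ρ m : ℕ) where
  private
    half : (2 + 2 * q) / 2 ≡ suc q
    half = cong (_/ 2) (sym (*-suc 2 q) ∙ *-comm 2 (suc q)) ∙ m*n/n≡m (suc q) 2

  module _ {n : ℕ} (G : Graph n) where
    private
      No₃ : ℕ → Set
      No₃ t = ¬ (((complete t ∪ᴳ complete (suc (2 * q)) ∪ᴳ edgeless m) ⊗ᴳ turan (m * suc ρ) (suc ρ)) ⊆ᴳ G)

    free⁺ : Free (forbidden (2 + 2 * q) (2 + ρ) m) G → ForbiddenFree q ρ m G
    free⁺ (n₁ ∷ n₂ ∷ n₃ ∷ []) = record { noF₁ = n₁ ; noF₂ = n₂ ; noF₃ = subst No₃ half n₃ }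

    free⁻ : ForbiddenFree q ρ m G → Free (forbidden (2 + 2 * q) (2 + ρ) m) G
    free⁻ f = ForbiddenFree.noF₁ f ∷ ForbiddenFree.noF₂ f ∷ subst No₃ (sym half) (ForbiddenFree.noF₃ f) ∷ []

-- What the descent requires of `h`: one-vertex growth for the minimum degree, block growth for
-- `Deletion`, and domination of both endgame bounds. `h-cases` says that a construction attains it.
record Benchmark (q ρ : ℕ) : Set where
  open Profile ρ
  field
    h       : ℕ → ℕ
    h-suc   : ∀ n → h n + 2 * (n ∸ n / suc (suc ρ)) ≤ h (suc n)
    h-block : ∀ n u → q ≤ n → h n + (2 * suc ρ * (2 * u) * n + suc (suc ρ) * suc ρ * (2 * u * (2 * u)) + 2 * q * (2 * u)) ≤ h (n + suc (suc ρ) * (2 * u))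
    apex≤h  : ∀ n → profile q 0 n ≤ h n
    pair≤h  : suc (suc ρ) ≡ 2 * q → ∀ n → profile 0 1 n ≤ h n
    h-cases : ∀ n → h n ≡ profile q 0 n ⊎ (suc (suc ρ) ≡ 2 * q × h n ≡ profile 0 1 n)

module Benchmarks (q ρ : ℕ) where
  open Profile ρ

  private
    r : ℕ
    r = suc (suc ρ)

    gain : ℕ → ℕ → ℕ
    gain t n = 2 * suc ρ * t * n + r * suc ρ * (t * t) + 2 * q * t

    profile-gain : ∀ p σ → 2 * q ≤ 2 * p + r * σ → ∀ N τ {t} → τ * suc σ ≡ t → profile p σ (p + N) + gain t (p + N) ≤ profile p σ (p + N + r * t)
    profile-gain p σ le N τ {t} refl = +-monoʳ-≤ (profile p σ (p + N)) (+-monoʳ-≤ (2 * suc ρ * t * (p + N) + r * suc ρ * (t * t))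
      (*-comm (2 * q) t =& *-monoʳ-≤ t le)) &= sym (profile-block p σ N τ)

    apex-gain : ∀ n u → q ≤ n → profile q 0 n + gain (2 * u) n ≤ profile q 0 (n + r * (2 * u))
    apex-gain n u le = subst (λ n → profile q 0 n + gain (2 * u) n ≤ profile q 0 (n + r * (2 * u))) (m+[n∸m]≡n le)
      (profile-gain q 0 (m≤m+n (2 * q) _) (n ∸ q) (2 * u) (*-identityʳ (2 * u)))

    pair-gain : r ≡ 2 * q → ∀ n u → profile 0 1 n + gain (2 * u) n ≤ profile 0 1 (n + r * (2 * u))
    pair-gain e n u = profile-gain 0 1 (≤-reflexive (sym e ∙ sym (*-identityʳ r))) n u (*-comm u 2)

    ⊔-step : ∀ {a b a' b'} x → a + x ≤ a' → b + x ≤ b' → (a ⊔ b) + x ≤ a' ⊔ b'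
    ⊔-step {a} {b} x h h' = +-distribʳ-⊔ x a b =& ⊔-mono-≤ h h'

  -- For `r = 2 * q` both profiles gain at least the same amount per block, so their maximum
  -- satisfies the block inequality as well; otherwise the apex profile stands alone.
  benchmark : Benchmark q ρ
  benchmark = go (r ≟ℕ 2 * q) where
    go : Dec (r ≡ 2 * q) → Benchmark q ρ
    go (no ne) = record
      { h = profile q 0 ; h-suc = profile-suc q 0 ; h-block = apex-gain ; apex≤h = λ _ → ≤-refl ; pair≤h = λ e → ⊥-elim (ne e) ; h-cases = λ _ → inl refl }
    go (yes e) = record
      { h = λ n → profile q 0 n ⊔ profile 0 1 n
      ; h-suc = λ n → ⊔-step {profile q 0 n} {profile 0 1 n} (2 * (n ∸ n / r)) (profile-suc q 0 n) (profile-suc 0 1 n)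
      ; h-block = λ n u le → ⊔-step {profile q 0 n} {profile 0 1 n} (gain (2 * u) n) (apex-gain n u le) (pair-gain e n u)
      ; apex≤h = λ n → m≤m⊔n _ _ ; pair≤h = λ _ n → m≤n⊔m _ _
      ; h-cases = λ n → [ inl , (λ h → inr (e , h)) ]′ (⊔-sel (profile q 0 n) (profile 0 1 n)) }

module Extremal (q ρ m : ℕ) (1≤q : 1 ≤ q) (r≤2q : suc (suc ρ) ≤ 2 * q) (ℓ<m : 3 + 2 * q ≤ m) where
  open Benchmark (Benchmarks.benchmark q ρ)
  open Equivalence q ρ m
  open Chain q ρ m 1≤q r≤2q h h-suc h-block apex≤h pair≤h using (threshold; optimal; Ends)
  open Profile ρ

  private
    r : ℕ
    r = suc (suc ρ)

    𝓕 : Family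
    𝓕 = forbidden (2 + 2 * q) (2 + ρ) m

    q<m : suc q ≤ m
    q<m = s≤s (m≤m+n q _ & n≤1+n _ & n≤1+n _) & ℓ<m

    r<m : r < m
    r<m = s≤s (r≤2q & n≤1+n _ & n≤1+n _) & ℓ<m

    beats : ∀ {n} (G : Graph n) → IsExtremal 𝓕 G → ∀ {k} → k ≡ n → (H : Graph k) → ForbiddenFree q ρ m H → edgeCount H ≤ edgeCount G
    beats _ (_ , best) refl H free = best H (free⁻ H free)

  N₀ : ℕ
  N₀ = q + threshold

  module _ {n : ℕ} (large : N₀ ≤ n) where
    private
      q≤n : q ≤ n
      q≤n = m≤m+n q _ & large

      large' : threshold ≤ n
      large' = m≤n+m _ q & large

      split : q + (n ∸ q) ≡ n
      split = m+[n∸m]≡n q≤n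

    module _ (G : Graph n) (ext : IsExtremal 𝓕 G) where
      private
        -- An extremal graph has at least as many edges as whichever construction attains `h n`,
        -- both constructions being free of the family.
        h≤ : h n ≤ Graphs.E G full full
        h≤ = go (h-cases n) &= sym (EdgeCount.E≡2edges G) where
          go : h n ≡ profile q 0 n ⊎ (r ≡ 2 * q × h n ≡ profile 0 1 n) → h n ≤ 2 * edgeCount G
          go (inl e) = (e ∙ cong (profile q 0) (sym split)) =& CliqueJoinTuran.edges≥ q ρ (n ∸ q) &
            *-monoʳ-≤ 2 (beats G ext split (CliqueJoinTuran.graph q ρ (n ∸ q)) (CliqueJoinTuran.free q ρ (n ∸ q) 1≤q q<m))
          go (inr (_ , e)) = e =& MatchedTuran.edges≥ ρ n & *-monoʳ-≤ 2 (beats G ext refl (MatchedTuran.graph ρ n) (MatchedTuran.free ρ n 1≤q q<m r<m))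

      ends : Ends G
      ends = snd (optimal G large' (free⁺ G (fst ext))) h≤

      apex-iso : ApexStructure q ρ G → G ≅ CliqueJoinTuran.graph q ρ (n ∸ q)
      apex-iso S = subst (λ N → G ≅ CliqueJoinTuran.graph q ρ N) N≡ (ApexIso.iso q ρ base G cls apexes sizes independent
          (beats G ext q+N (CliqueJoinTuran.graph q ρ (# (∁ (isN ∘ cls)))) (CliqueJoinTuran.free q ρ _ 1≤q q<m))) where
        open ApexStructure S
        q+N : q + # (∁ (isN ∘ cls)) ≡ n
        q+N = cong (_+ # (∁ (isN ∘ cls))) (sym apexes) ∙ (#-∁ (isN ∘ cls))
        N≡ : # (∁ (isN ∘ cls)) ≡ n ∸ q
        N≡ = sym (m+n∸m≡n q _) ∙ cong (_∸ q) q+N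

      pair-iso : PairStructure ρ G → InGnr r G
      pair-iso S = tabulate P.sizes , length-tabulate P.sizes , P.total , close , P.iso (beats G ext P.total (Kplus (tabulate P.sizes)) (Kplus-free 1≤q q<m r<m P.sizes)) where
        open PairStructure S
        module P = PairIso G cls matching
        close : ∀ {x y} → x ∈ tabulate P.sizes → y ∈ tabulate P.sizes → x ≤ y + 2
        close x∈ y∈ = let (i , e) = ∈-tabulate⁻ {f = P.sizes} x∈ ; (j , e') = ∈-tabulate⁻ {f = P.sizes} y∈ in
          e =& snd (sizes i) & +-monoˡ-≤ 2 (fst (sizes j) &= sym e')

    -- Without competition from the matched construction `h n` is the apex profile, which bounds
    -- every free graph and is attained by this one.
    turan-extremal : r ≢ 2 * q → (G : Graph n) → G ≅ CliqueJoinTuran.graph q ρ (n ∸ q) → IsExtremal 𝓕 G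
    turan-extremal r≢2q G i = free⁻ G (ForbiddenFree-⊆ (≅⇒⊆ {G = G} i) (CliqueJoinTuran.free q ρ (n ∸ q) 1≤q q<m)) , λ H free →
      *-cancelˡ-≤ {edgeCount H} {edgeCount G} 2 (sym (EdgeCount.E≡2edges H) =& fst (optimal H large' (free⁺ H free)) &
        h-apex (h-cases n) =& CliqueJoinTuran.edges≥ q ρ (n ∸ q) & *-monoʳ-≤ 2 (⊆-edges {H = CliqueJoinTuran.graph q ρ (n ∸ q)} {G} (≅⇒⊇ i))) where
      h-apex : h n ≡ profile q 0 n ⊎ (r ≡ 2 * q × h n ≡ profile 0 1 n) → h n ≡ profile q 0 (q + (n ∸ q))
      h-apex (inl e) = e ∙ cong (profile q 0) (sym split)
      h-apex (inr (e , _)) = ⊥-elim (r≢2q e)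

    classification : (r ≤ 2 * q ∸ 1 → (G : Graph n) →
        (IsExtremal 𝓕 G → G ≅ CliqueJoinTuran.graph q ρ (n ∸ q)) × (G ≅ CliqueJoinTuran.graph q ρ (n ∸ q) → IsExtremal 𝓕 G)) ×
      (r ≡ 2 * q → (G : Graph n) → IsExtremal 𝓕 G → (G ≅ CliqueJoinTuran.graph q ρ (n ∸ q)) ⊎ InGnr r G)
    classification = (λ r< G → (λ ext → only-apex r< G ext (ends G ext)) , turan-extremal (strict r<) G) , λ _ G ext → both G ext (ends G ext) where
      strict : r ≤ 2 * q ∸ 1 → r ≢ 2 * q
      strict r< e = <-irrefl e (s≤s r< &= m+[n∸m]≡n {1} (1≤q & m≤m+n q _))
      only-apex : r ≤ 2 * q ∸ 1 → ∀ G → IsExtremal 𝓕 G → Ends G → G ≅ CliqueJoinTuran.graph q ρ (n ∸ q)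
      only-apex r< G ext (inl S) = apex-iso G ext S
      only-apex r< G ext (inr (e , _)) = ⊥-elim (strict r< e)
      both : ∀ G → IsExtremal 𝓕 G → Ends G → (G ≅ CliqueJoinTuran.graph q ρ (n ∸ q)) ⊎ InGnr r G
      both G ext (inl S) = inl (apex-iso G ext S)
      both G ext (inr (_ , S)) = inr (pair-iso G ext S)

theorem1p5 : (ℓ r m : ℕ) → ℓ % 2 ≡ 0 → 4 ≤ ℓ → 2 ≤ r → r ≤ ℓ ∸ 2 → ℓ + 1 ≤ m →
    Σ ℕ λ N → (n : ℕ) → N ≤ n →
      (r ≤ ℓ ∸ 3 → (G : Graph n) →
        (IsExtremal (forbidden ℓ r m) G → G ≅ cliqueJoinTuran ((ℓ ∸ 2) / 2) n r) ×
        (G ≅ cliqueJoinTuran ((ℓ ∸ 2) / 2) n r → IsExtremal (forbidden ℓ r m) G))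
      ×
      (r ≡ ℓ ∸ 2 → (G : Graph n) → IsExtremal (forbidden ℓ r m) G →
        (G ≅ cliqueJoinTuran (r / 2) n r) ⊎ InGnr r G)
theorem1p5 ℓ (suc (suc ρ)) m even 4≤ℓ (s≤s (s≤s _)) r≤ ℓ<m = reduce (ℓ / 2) (m≡m%n+[m/n]*n ℓ 2 ∙ cong (_+ ℓ / 2 * 2) even) 4≤ℓ r≤ ℓ<m where
  Statement : ℕ → Set
  Statement ℓ = Σ ℕ λ N → (n : ℕ) → N ≤ n →
      (suc (suc ρ) ≤ ℓ ∸ 3 → (G : Graph n) →
        (IsExtremal (forbidden ℓ (2 + ρ) m) G → G ≅ cliqueJoinTuran ((ℓ ∸ 2) / 2) n (2 + ρ)) ×
        (G ≅ cliqueJoinTuran ((ℓ ∸ 2) / 2) n (2 + ρ) → IsExtremal (forbidden ℓ (2 + ρ) m) G))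
      ×
      (suc (suc ρ) ≡ ℓ ∸ 2 → (G : Graph n) → IsExtremal (forbidden ℓ (2 + ρ) m) G →
        (G ≅ cliqueJoinTuran (suc (suc ρ) / 2) n (2 + ρ)) ⊎ InGnr (2 + ρ) G)
  solved : ∀ q → 1 ≤ q → suc (suc ρ) ≤ 2 * q → 3 + 2 * q ≤ m → Statement (2 + 2 * q)
  solved q 1≤q r≤2q ℓ<m = Extremal.N₀ q ρ m 1≤q r≤2q ℓ<m , λ n large → adapt n (Extremal.classification q ρ m 1≤q r≤2q ℓ<m large) where
    half : (2 * q) / 2 ≡ q
    half = cong (_/ 2) (*-comm 2 q) ∙ m*n/n≡m q 2
    adapt : ∀ n → _ → _
    adapt n (part₁ , part₂) = (λ r< G → subst (λ a → (IsExtremal (forbidden (2 + 2 * q) (2 + ρ) m) G → G ≅ cliqueJoinTuran a n (2 + ρ)) ×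
          (G ≅ cliqueJoinTuran a n (2 + ρ) → IsExtremal (forbidden (2 + 2 * q) (2 + ρ) m) G)) (sym half) (part₁ r< G)) ,
      λ e G ext → subst (λ a → (G ≅ cliqueJoinTuran a n (2 + ρ)) ⊎ InGnr (2 + ρ) G) (sym (cong (_/ 2) e ∙ half)) (part₂ e G ext)
  reduce : ∀ k {ℓ} → ℓ ≡ k * 2 → 4 ≤ ℓ → suc (suc ρ) ≤ ℓ ∸ 2 → ℓ + 1 ≤ m → Statement ℓ
  reduce zero          refl () _ _
  reduce (suc zero)    refl (s≤s (s≤s ())) _ _
  -- Here `ℓ = (k + 2) * 2 = 2 + 2 * suc k`, so `q` is `suc k`.
  reduce (suc (suc k)) e    _ r≤ ℓ<m = go (suc k) (s≤s z≤n) (e ∙ cong (2 +_) (*-comm (suc k) 2)) r≤ ℓ<m where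
    go : ∀ q → 1 ≤ q → ∀ {ℓ} → ℓ ≡ 2 + 2 * q → suc (suc ρ) ≤ ℓ ∸ 2 → ℓ + 1 ≤ m → Statement ℓ
    go q 1≤q refl r≤ ℓ<m = solved q 1≤q r≤ (+-comm 1 (2 + 2 * q) =& ℓ<m)
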